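{- Let $p\ge 3$, $q\ge 3$ and $r\ge 2$ be integers. The graph $d(p,q,r)$ is determined by its signless Laplacian permanental polynomial; that is, for every graph $H$, if $\pi(Q(H);x)=\pi(Q(d(p,q,r));x)$ then $H$ is isomorphic to $d(p,q,r)$.
   Context: All graphs are finite, simple and undirected (not necessarily connected). For a graph $G$ with vertices $v_1,\dots,v_n$, let $A(G)$ be its $(0,1)$-adjacency matrix, $D(G)=\mathrm{diag}(d(v_1),\dots,d(v_n))$ the diagonal matrix of vertex degrees, and $Q(G)=D(G)+A(G)$ the signless Laplacian matrix. The permanent of an $n\times n$ matrix $X=(x_{ij})$ is $\mathrm{per}(X)=\sum_{\sigma}\prod_{i=1}^n x_{i\sigma(i)}$, the sum being over all permutations $\sigma$ of $\{1,\dots,n\}$. The signless Laplacian permanental polynomial of $G$ is $\pi(Q(G);x)=\mathrm{per}(xI-Q(G))$, where $I$ is the $n\times n$ identity matrix. $C_n$ and $P_n$ denote the cycle and the path on $n$ vertices. The graph $d(p,q,r)$ is obtained from vertex-disjoint copies of the cycles $C_p$ ($p\ge 3$), $C_q$ ($q\ge 3$) and the path $P_r$ by identifying one end vertex of $P_r$ with a vertex of $C_p$ and the other (different) end vertex of $P_r$ with a vertex of $C_q$. -}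

module Defs where

open import Algebra.Bundles using (RawRing)
import Algebra.Definitions.RawMonoid as RawMonoidDefs
open import Data.Fin.Base using (Fin; zero; suc; toℕ; fromℕ; punchIn; splitAt; _↑ʳ_)
import Data.Fin.Permutation as Perm
open import Data.Fin.Permutation using (Permutation; Permutation′; _⟨$⟩ʳ_; insert)
open import Data.Fin.Properties using (_≟_; punchIn-injective)
open import Data.Integer.Base as ℤ using (ℤ; 0ℤ; 1ℤ)
open import Data.List.Base
  using (List; []; _∷_; map; foldr; filter; length; allFin; cartesianProductWith)
import Data.List.Membership.Propositional.Properties as ∈
import Data.List.Relation.Unary.All as All
import Data.List.Relation.Unary.All.Properties as All
open import Data.List.Relation.Unary.AllPairs as AllPairs using (AllPairs; []; _∷_)
import Data.List.Relation.Unary.AllPairs.Properties as AllPairs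
open import Data.List.Relation.Unary.All using ([]; _∷_)
open import Data.List.Relation.Unary.Any using (Any; here)
open import Data.List.Relation.Unary.Any.Properties using (cartesianProductWith⁺)
open import Data.List.Relation.Unary.Unique.Propositional using (Unique)
open import Data.List.Relation.Unary.Unique.Propositional.Properties using (allFin⁺)
open import Data.Nat.Base using (ℕ; zero; suc; pred; _+_; _≤_; s≤s)
import Data.Nat.Properties as ℕ
open import Data.Product.Base using (_×_; _,_; Σ-syntax)
open import Data.Sum.Base using (_⊎_; inj₁; inj₂; swap)
open import Function.Base using (_∘_)
open import Function.Bundles using (_⇔_)
open import Level using (0ℓ)
open import Relation.Binary.Core using (Rel)
open import Relation.Binary.Definitions using (Decidable; Symmetric)
open import Relation.Binary.PropositionalEquality.Core using (_≡_; _≢_; refl; sym; trans; cong)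
import Relation.Binary.PropositionalEquality.Properties as ≡
open import Relation.Nullary.Decidable using (yes; no; _×-dec_; _⊎-dec_; ¬?)
open import Relation.Nullary.Negation using (¬_)

------------------------------------------------------------------------
-- Graphs

-- A finite simple undirected graph, its n vertices labelled by Fin n.
record Graph (n : ℕ) : Set₁ where
  field
    _~_    : Rel (Fin n) 0ℓ
    _~?_   : Decidable _~_
    ~-sym  : Symmetric _~_
    ~-irr  : ∀ {i} → ¬ (i ~ i)

infix 4 _≅_

_≅_ : ∀ {m n} → Graph m → Graph n → Set
_≅_ {m} {n} G H =
  Σ[ f ∈ Permutation m n ] (∀ i j → (i G.~ j) ⇔ ((f ⟨$⟩ʳ i) H.~ (f ⟨$⟩ʳ j)))
  where
  module G = Graph G
  module H = Graph H

-- The simple graph whose edges are the pairs of distinct vertices related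
-- by R in at least one direction.
fromRel : ∀ {n} {R : Rel (Fin n) 0ℓ} → Decidable R → Graph n
fromRel {R = R} R? = record
  { _~_   = λ i j → i ≢ j × (R i j ⊎ R j i)
  ; _~?_  = λ i j → ¬? (i ≟ j) ×-dec (R? i j ⊎-dec R? j i)
  ; ~-sym = λ (i≢j , r) → i≢j ∘ sym , swap r
  ; ~-irr = λ (i≢i , _) → i≢i refl
  }

-- P n: vertices 0, …, n-1 in order along the path.
P : ∀ n → Graph n
P n = fromRel (λ i j → toℕ j ℕ.≟ suc (toℕ i))

-- C n: the path P n with its two ends joined (a cycle when n ≥ 3).
C : ∀ n → Graph n
C n = fromRel λ i j →
  (toℕ j ℕ.≟ suc (toℕ i)) ⊎-dec ((toℕ j ℕ.≟ 0) ×-dec (suc (toℕ i) ℕ.≟ n))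

-- The disjoint union of G and K with vertex u of G identified with vertex
-- zero of K.  The first m vertices are those of G (so u also plays the role
-- of zero in K); the last n are the vertices suc _ of K.
identify : ∀ {m n} → Graph m → Fin m → Graph (suc n) → Graph (m + n)
identify {m} {n} G u K = record
  { _~_   = λ x y → splitAt m x ∼ splitAt m y
  ; _~?_  = λ x y → splitAt m x ∼? splitAt m y
  ; ~-sym = λ {x} {y} → ∼-sym (splitAt m x) (splitAt m y)
  ; ~-irr = λ {x} → ∼-irr (splitAt m x)
  }
  where
  module G = Graph G
  module K = Graph K

  _∼_ : Rel (Fin m ⊎ Fin n) 0ℓ
  inj₁ i ∼ inj₁ j = i G.~ j
  inj₁ i ∼ inj₂ l = i ≡ u × (zero K.~ suc l)
  inj₂ k ∼ inj₁ j = j ≡ u × (suc k K.~ zero)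
  inj₂ k ∼ inj₂ l = suc k K.~ suc l

  _∼?_ : Decidable _∼_
  inj₁ i ∼? inj₁ j = i G.~? j
  inj₁ i ∼? inj₂ l = (i ≟ u) ×-dec (zero K.~? suc l)
  inj₂ k ∼? inj₁ j = (j ≟ u) ×-dec (suc k K.~? zero)
  inj₂ k ∼? inj₂ l = suc k K.~? suc l

  ∼-sym : ∀ x y → x ∼ y → y ∼ x
  ∼-sym (inj₁ _) (inj₁ _) e       = G.~-sym e
  ∼-sym (inj₁ _) (inj₂ _) (p , e) = p , K.~-sym e
  ∼-sym (inj₂ _) (inj₁ _) (p , e) = p , K.~-sym e
  ∼-sym (inj₂ _) (inj₂ _) e       = K.~-sym e

  ∼-irr : ∀ x → ¬ (x ∼ x)
  ∼-irr (inj₁ _) = G.~-irr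
  ∼-irr (inj₂ _) = K.~-irr

-- With p = suc p′ and r = suc (suc r′), the first identification has vertex
-- set Fin (p + suc r′), in which the other end of the path P r is the last
-- vertex p ↑ʳ fromℕ r′; that vertex is then identified with one of C q.
d : ∀ p q r → 3 ≤ p → 3 ≤ q → 2 ≤ r → Graph (p + pred r + pred q)
d p@(suc _) q@(suc _) r@(suc (suc r′)) (s≤s _) (s≤s _) (s≤s (s≤s _)) =
  identify (identify (C p) zero (P r)) (p ↑ʳ fromℕ r′) (C q)

------------------------------------------------------------------------
-- Permanents

Matrix : Set → ℕ → Set
Matrix A n = Fin n → Fin n → A

-- All permutations of Fin n: those of Fin (suc n) are obtained by choosing
-- the image j of zero and a permutation of the remaining elements.
permutations : ∀ n → List (Permutation′ n)
permutations zero    = Perm.id ∷ []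
permutations (suc n) =
  cartesianProductWith (insert zero) (allFin (suc n)) (permutations n)

permutations-complete : ∀ {n} (σ : Permutation′ n) → Any (σ Perm.≈_) (permutations n)
permutations-complete {zero}  σ = here λ ()
permutations-complete {suc n} σ =
  cartesianProductWith⁺ (insert zero) extend
    (∈.∈-allFin (σ ⟨$⟩ʳ zero)) (permutations-complete (Perm.remove zero σ))
  where
  extend : ∀ {j τ} → σ ⟨$⟩ʳ zero ≡ j → Perm.remove zero σ Perm.≈ τ →
           σ Perm.≈ insert zero j τ
  extend refl eq zero    = refl
  extend refl eq (suc i) =
    trans (Perm.punchIn-permute σ zero i) (cong (punchIn (σ ⟨$⟩ʳ zero)) (eq i))

permutations-distinct : ∀ n →
  AllPairs (λ σ τ → ¬ (σ Perm.≈ τ)) (permutations n)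
permutations-distinct zero    = [] ∷ []
permutations-distinct (suc n) = go (allFin⁺ (suc n))
  where
  _#_ : Rel (Permutation′ (suc n)) 0ℓ
  σ # τ = ¬ (σ Perm.≈ τ)

  go : ∀ {js} → Unique js →
       AllPairs _#_ (cartesianProductWith (insert zero) js (permutations n))
  go []                    = []
  go {j ∷ js} (j∉js ∷ js!) = AllPairs.++⁺
    (AllPairs.map⁺ (AllPairs.map
      (λ σ#τ eq → σ#τ (λ i → punchIn-injective j _ _ (eq (suc i))))
      (permutations-distinct n)))
    (go js!)
    (All.map⁺ (All.universal (λ σ →
      All.cartesianProductWith⁺ (≡.setoid _) (≡.setoid _) (insert zero) js (permutations n)
        (λ {k} k∈js _ eq → All.lookup j∉js k∈js (eq zero))) (permutations n)))

module _ (R : RawRing 0ℓ 0ℓ) where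
  open RawRing R
    using (0#; *-rawMonoid)
    renaming (_+_ to _⊕_; Carrier to A)

  -- The library's sum in a monoid, here the multiplicative one.
  ∏ : ∀ {n} → (Fin n → A) → A
  ∏ = RawMonoidDefs.sum *-rawMonoid

  per : ∀ {n} → Matrix A n → A
  per {n} M =
    foldr (λ σ s → ∏ (λ i → M i (σ ⟨$⟩ʳ i)) ⊕ s) 0# (permutations n)

------------------------------------------------------------------------
-- The polynomial ring ℤ[x]

-- Coefficients in order of increasing degree; trailing zeros are allowed,
-- hence the coefficientwise equality _≈ₚ_.
Poly : Set
Poly = List ℤ

coeff : Poly → ℕ → ℤ
coeff []      _       = 0ℤ
coeff (a ∷ _) zero    = a
coeff (_ ∷ f) (suc k) = coeff f k

infix  4 _≈ₚ_
infixl 6 _+ₚ_ _-ₚ_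
infixl 7 _*ₚ_
infix  8 -ₚ_

_≈ₚ_ : Rel Poly 0ℓ
f ≈ₚ g = ∀ k → coeff f k ≡ coeff g k

const : ℤ → Poly
const a = a ∷ []

x : Poly
x = 0ℤ ∷ 1ℤ ∷ []

_+ₚ_ : Poly → Poly → Poly
[]      +ₚ g       = g
f       +ₚ []      = f
(a ∷ f) +ₚ (b ∷ g) = (a ℤ.+ b) ∷ (f +ₚ g)

-ₚ_ : Poly → Poly
-ₚ_ = map (λ a → ℤ.- a)

_-ₚ_ : Poly → Poly → Poly
f -ₚ g = f +ₚ (-ₚ g)

_*ₚ_ : Poly → Poly → Poly
[]      *ₚ g = []
(a ∷ f) *ₚ g = map (a ℤ.*_) g +ₚ (0ℤ ∷ (f *ₚ g))

ℤ[x] : RawRing 0ℓ 0ℓ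
ℤ[x] = record
  { Carrier = Poly
  ; _≈_     = _≈ₚ_
  ; _+_     = _+ₚ_
  ; _*_     = _*ₚ_
  ; -_      = -ₚ_
  ; 0#      = []
  ; 1#      = const 1ℤ
  }

------------------------------------------------------------------------
-- The signless Laplacian and its permanental polynomial

diag : ∀ {n} → (Fin n → ℤ) → Matrix ℤ n
diag a i j with i ≟ j
... | yes _ = a i
... | no  _ = 0ℤ

module _ {n} (G : Graph n) where
  open Graph G

  degree : Fin n → ℕ
  degree i = length (filter (i ~?_) (allFin n))

  A : Matrix ℤ n
  A i j with i ~? j
  ... | yes _ = 1ℤ
  ... | no  _ = 0ℤ

  D : Matrix ℤ n
  D = diag (λ i → ℤ.+ degree i)

  Q : Matrix ℤ n
  Q i j = D i j ℤ.+ A i j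

I : ∀ {n} → Matrix ℤ n
I = diag (λ _ → 1ℤ)

-- The permanental polynomial per (xI - M).
π : ∀ {n} → Matrix ℤ n → Poly
π M = per ℤ[x] (λ i j → x *ₚ const (I i j) -ₚ const (M i j))

{-# OPTIONS --safe #-}

-- Let w = −s².  At x = 2 + s − 1/s, with every row multiplied by −s, the matrix xI − Q has the entry
-- 1 + w at a vertex of degree two and s at an edge, so permanents of paths and cycles have closed forms
-- in powers of s and w.  Modulo s³ the permanent depends only on the number of vertices, Σ (deg − 2)
-- and Σ (deg − 2)²; hence a graph H with the polynomial of d(p,q,r) has exactly two vertices of
-- degree three, and all its other vertices have degree two.  So H consists of disjoint cycles together
-- with either two cycles joined by a path or three paths with common ends.  Its permanent is a power
-- series in s whose first term of interest is governed by the shortest cycle; the comparison of the next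
-- two or three coefficients, and of their parities, rules out the three paths as well as any further
-- cycle, and identifies the lengths one after another.
module Submission where

open import Algebra.Bundles using (RawRing)
open import Algebra.Structures using (IsCommutativeSemiring)
import Data.Integer.Properties as ℤ
open import Data.Integer.Tactic.RingSolver using (solve-∀)
open import Data.List.Membership.Propositional using (_∈_; _∉_)
open import Data.List.Relation.Unary.Any using (here; there)
open import Data.Nat.Base using (ℕ; _≤_)
import Data.Nat.Properties as ℕ
open import Data.Nat.Tactic.RingSolver using () renaming (solve-∀ to ℕ-solve-∀)
open import Data.Product.Base using (_,_; _×_; proj₁; proj₂; ∃; ∃₂)
open import Data.Sum.Base as Sum using (_⊎_; inj₁; inj₂)
open import Defs using (Graph)
open import Level using (0ℓ)
open import Relation.Binary.PropositionalEquality hiding (J)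
open import Relation.Nullary.Decidable using (Dec; no; yes)
open import Relation.Nullary.Negation using (contradiction; ¬_)

module ListPermanent {A : Set} {_⊕_ _⊛_ : A → A → A} {0# 1# : A}
          (isCSR : IsCommutativeSemiring _≡_ _⊕_ _⊛_ 0# 1#) where

  open import Algebra.Bundles using (CommutativeSemiring)
  open import Data.List.Base using (List; []; _∷_; map; length)
  open import Data.List.Relation.Binary.Permutation.Propositional using (_↭_; ↭-sym; prep; swap; refl) renaming (trans to ↭-step)
  open import Data.List.Relation.Binary.Permutation.Propositional.Properties using (¬x∷xs↭[])
  open import Data.List.Relation.Unary.All using (All; []; _∷_)
  open import Data.Nat.Base as ℕ using (ℕ; suc; s≤s)

  private
    csr : CommutativeSemiring 0ℓ 0ℓ
    csr = record { isCommutativeSemiring = isCSR }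

  open import Algebra.Solver.Ring.NaturalCoefficients.Default csr using (solve; _:+_; _:*_; _:=_)
  open CommutativeSemiring csr using (_+_; _*_; +-identityˡ; +-identityʳ; zeroʳ; zeroˡ; distribˡ)

  private
    +-congˡ : ∀ {x y z : A} → y ≡ z → x + y ≡ x + z
    +-congˡ {x} = cong (x +_)

  module _ {V : Set} where

    -- The sum of f c cs′ over the ways to remove an entry c from cs, leaving cs′.
    Σpick : (V → List V → A) → List V → A
    Σpick f []       = 0#
    Σpick f (c ∷ cs) = f c cs + Σpick (λ d ds → f d (c ∷ ds)) cs

    Σpick-cong : ∀ {f g} cs → (∀ d ds → length cs ≡ suc (length ds) → f d ds ≡ g d ds) →
                 Σpick f cs ≡ Σpick g cs
    Σpick-cong []       eq = refl
    Σpick-cong (c ∷ cs) eq =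
      cong₂ _+_ (eq c cs refl) (Σpick-cong cs λ d ds l → eq d (c ∷ ds) (cong suc l))

    Σpick-↭ : ∀ {f cs ds} → (∀ d {es es′} → es ↭ es′ → f d es ≡ f d es′) →
              cs ↭ ds → Σpick f cs ≡ Σpick f ds
    Σpick-↭ f-↭ refl        = refl
    Σpick-↭ f-↭ (prep c p)  =
      cong₂ _+_ (f-↭ c p) (Σpick-↭ (λ d q → f-↭ d (prep c q)) p)
    Σpick-↭ {f} {c ∷ c′ ∷ cs} {_ ∷ _ ∷ ds} f-↭ (swap c c′ p) = begin
      f c (c′ ∷ cs) + (f c′ (c ∷ cs) + Σpick (λ d es → f d (c ∷ c′ ∷ es)) cs)
        ≡⟨ cong₂ _+_ (f-↭ c (prep c′ p)) (cong₂ _+_ (f-↭ c′ (prep c p))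
             (trans (Σpick-↭ (λ d q → f-↭ d (prep c (prep c′ q))) p)
                    (Σpick-cong ds λ d es _ → f-↭ d (swap c c′ refl)))) ⟩
      f c (c′ ∷ ds) + (f c′ (c ∷ ds) + Σpick (λ d es → f d (c′ ∷ c ∷ es)) ds)
        ≡⟨ swapˡ _ _ _ ⟩
      f c′ (c ∷ ds) + (f c (c′ ∷ ds) + Σpick (λ d es → f d (c′ ∷ c ∷ es)) ds) ∎
      where
      open ≡-Reasoning
      swapˡ : ∀ x y z → x + (y + z) ≡ y + (x + z)
      swapˡ = solve 3 (λ x y z → x :+ (y :+ z) := y :+ (x :+ z)) refl
    Σpick-↭ f-↭ (↭-step p q) = trans (Σpick-↭ f-↭ p) (Σpick-↭ f-↭ q)

    Σpick-0 : ∀ cs → Σpick (λ _ _ → 0#) cs ≡ 0#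
    Σpick-0 []       = refl
    Σpick-0 (c ∷ cs) = trans (+-identityˡ _) (Σpick-0 cs)

    Σpick-+ : ∀ f g cs → Σpick (λ d ds → f d ds + g d ds) cs ≡ Σpick f cs + Σpick g cs
    Σpick-+ f g []       = sym (+-identityˡ 0#)
    Σpick-+ f g (c ∷ cs) = begin
      f c cs + g c cs + Σpick (λ d ds → f d (c ∷ ds) + g d (c ∷ ds)) cs
        ≡⟨ cong (f c cs + g c cs +_) (Σpick-+ _ _ cs) ⟩
      f c cs + g c cs + (Σpick (λ d ds → f d (c ∷ ds)) cs + Σpick (λ d ds → g d (c ∷ ds)) cs)
        ≡⟨ interchange (f c cs) (g c cs) _ _ ⟩
      Σpick f (c ∷ cs) + Σpick g (c ∷ cs) ∎
      where
      open ≡-Reasoning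
      interchange : ∀ x y z t → x + y + (z + t) ≡ x + z + (y + t)
      interchange = solve 4 (λ x y z t → x :+ y :+ (z :+ t) := x :+ z :+ (y :+ t)) refl

    *-Σpick : ∀ k f cs → k * Σpick f cs ≡ Σpick (λ d ds → k * f d ds) cs
    *-Σpick k f []       = zeroʳ k
    *-Σpick k f (c ∷ cs) =
      trans (distribˡ k (f c cs) _) (cong (k * f c cs +_) (*-Σpick k _ cs))

    Σpick-swap : ∀ (f : V → List V → V → List V → A) cs ds →
      Σpick (λ c cs′ → Σpick (f c cs′) ds) cs ≡ Σpick (λ d ds′ → Σpick (λ c cs′ → f c cs′ d ds′) cs) ds
    Σpick-swap f []       ds = sym (Σpick-0 ds)
    Σpick-swap f (c ∷ cs) ds =
      trans (cong (Σpick (f c cs) ds +_) (Σpick-swap (λ e es → f e (c ∷ es)) cs ds))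
            (sym (Σpick-+ _ _ ds))

  -- The permanent of the submatrix with the given rows and columns.
  opaque
    perm : ∀ {V W : Set} → (V → W → A) → List V → List W → A
    perm M []       []      = 1#
    perm M []       (_ ∷ _) = 0#
    perm M (r ∷ rs) cs      = Σpick (λ c cs′ → M r c * perm M rs cs′) cs

    perm-map : ∀ {V W V′ W′ : Set} (M : V′ → W′ → A) (f : V → V′) (g : W → W′) rs cs →
               perm (λ i j → M (f i) (g j)) rs cs ≡ perm M (map f rs) (map g cs)
    perm-map M f g []       []       = refl
    perm-map M f g []       (_ ∷ _)  = refl
    perm-map {V} {W} {V′} {W′} M f g (r ∷ rs) cs = go (perm-map M f g rs) cs
      where
      go : ∀ {h : List W → A} {h′ : List W′ → A} → (∀ ds → h ds ≡ h′ (map g ds)) → ∀ cs →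
           Σpick (λ c cs′ → M (f r) (g c) * h cs′) cs ≡ Σpick (λ c cs′ → M (f r) c * h′ cs′) (map g cs)
      go eq []       = refl
      go eq (c ∷ cs) = cong₂ _+_ (cong (M (f r) (g c) *_) (eq cs)) (go (λ ds → eq (c ∷ ds)) cs)

    perm-[] : ∀ {V W : Set} (M : V → W → A) → perm M [] [] ≡ 1#
    perm-[] M = refl

    perm-∷ : ∀ {V W : Set} (M : V → W → A) r rs cs →
             perm M (r ∷ rs) cs ≡ Σpick (λ c cs′ → M r c * perm M rs cs′) cs
    perm-∷ M r rs cs = refl

  module _ {V : Set} (M : V → V → A) where

    opaque
      unfolding perm

      perm-↭ʳ : ∀ rs {cs ds} → cs ↭ ds → perm M rs cs ≡ perm M rs ds
      perm-↭ʳ []       {[]}    {[]}    p = refl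
      perm-↭ʳ []       {_ ∷ _} {_ ∷ _} p = refl
      perm-↭ʳ []       {[]}    {_ ∷ _} p with () ← ¬x∷xs↭[] (↭-sym p)
      perm-↭ʳ []       {_ ∷ _} {[]}    p with () ← ¬x∷xs↭[] p
      perm-↭ʳ (r ∷ rs) p = Σpick-↭ (λ d q → cong (M r d *_) (perm-↭ʳ rs q)) p

  module Symmetric {V : Set} (M : V → V → A) (M-sym : ∀ i j → M i j ≡ M j i) where

    private
      P = perm M

    _⊥_ : V → List V → Set
    x ⊥ C = All (λ c → M x c ≡ 0#) C

    opaque
      unfolding perm

      perm-transpose : ∀ rs cs → P rs cs ≡ P cs rs
      perm-transpose rs cs = go _ rs cs ℕ.≤-refl
        where
        open ≡-Reasoning
        go : ∀ n rs cs → length rs ℕ.+ length cs ℕ.≤ n → P rs cs ≡ P cs rs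
        go n       []       []       _       = refl
        go n       []       (c ∷ cs) _       = refl
        go n       (r ∷ rs) []       _       = refl
        go (suc n) (r ∷ rs) (c ∷ cs) (s≤s h) = cong₂ _+_
          (cong₂ _*_ (M-sym r c) (go n rs cs bound₀))
          (begin
            Σpick (λ c′ ds → M r c′ * P rs (c ∷ ds)) cs
              ≡⟨ Σpick-cong cs (λ c′ ds l → trans (cong (M r c′ *_) (go n rs (c ∷ ds) (bound₁ ds l)))
                   (*-Σpick (M r c′) _ rs)) ⟩
            Σpick (λ c′ ds → Σpick (λ r′ es → M r c′ * (M c r′ * P ds es)) rs) cs
              ≡⟨ Σpick-swap _ cs rs ⟩
            Σpick (λ r′ es → Σpick (λ c′ ds → M r c′ * (M c r′ * P ds es)) cs) rs
              ≡⟨ Σpick-cong rs (λ r′ es l → trans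
                   (Σpick-cong cs λ c′ ds l′ → trans (exchange (M r c′) (M c r′) _)
                     (cong (λ z → M c r′ * (M r c′ * z)) (sym (go n es ds (bound₂ es ds l l′)))))
                   (trans (sym (*-Σpick (M c r′) _ cs)) (cong (M c r′ *_) (go n (r ∷ es) cs (bound₃ es l))))) ⟩
            Σpick (λ r′ es → M c r′ * P cs (r ∷ es)) rs ∎)
          where
          exchange : ∀ x y z → x * (y * z) ≡ y * (x * z)
          exchange = solve 3 (λ x y z → x :* (y :* z) := y :* (x :* z)) refl
          bound₀ : length rs ℕ.+ length cs ℕ.≤ n
          bound₀ = ℕ.≤-trans (ℕ.+-monoʳ-≤ (length rs) (ℕ.n≤1+n (length cs))) h
          bound₁ : ∀ (ds : List V) → length cs ≡ suc (length ds) → length rs ℕ.+ suc (length ds) ℕ.≤ n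
          bound₁ ds l = subst (λ k → length rs ℕ.+ k ℕ.≤ n) l bound₀
          bound₃ : ∀ (es : List V) → length rs ≡ suc (length es) → suc (length es) ℕ.+ length cs ℕ.≤ n
          bound₃ es l = subst (λ k → k ℕ.+ length cs ℕ.≤ n) l bound₀
          bound₂ : ∀ (es ds : List V) → length rs ≡ suc (length es) → length cs ≡ suc (length ds) →
                   length es ℕ.+ length ds ℕ.≤ n
          bound₂ es ds l l′ = ℕ.≤-trans (ℕ.+-mono-≤ (ℕ.n≤1+n _) (ℕ.n≤1+n _))
            (subst (λ k → suc (length es) ℕ.+ k ℕ.≤ n) l′ (bound₃ es l))

      perm-↭ : ∀ {rs rs′ cs cs′} → rs ↭ rs′ → cs ↭ cs′ → P rs cs ≡ P rs′ cs′
      perm-↭ {rs} {rs′} {cs} {cs′} p q = begin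
        P rs cs   ≡⟨ perm-↭ʳ M rs q ⟩
        P rs cs′  ≡⟨ perm-transpose rs cs′ ⟩
        P cs′ rs  ≡⟨ perm-↭ʳ M cs′ p ⟩
        P cs′ rs′ ≡⟨ perm-transpose cs′ rs′ ⟩
        P rs′ cs′ ∎
        where open ≡-Reasoning

      private
        Σpick-⊥ : ∀ {x C} → x ⊥ C → (f : List V → A) → Σpick (λ c ds → M x c * f ds) C ≡ 0#
        Σpick-⊥ []                 f = refl
        Σpick-⊥ {x} {c ∷ C} (e ∷ z) f rewrite e | zeroˡ (f C) =
          (trans (+-identityˡ _) (Σpick-⊥ z (λ ds → f (c ∷ ds))))

      perm-row₁ : ∀ {x} R a {C} → x ⊥ C → P (x ∷ R) (a ∷ C) ≡ M x a * P R C
      perm-row₁ R a z = trans (+-congˡ (Σpick-⊥ z (λ ds → P R (a ∷ ds)))) (+-identityʳ _)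

      perm-row₂ : ∀ {x} R a b {C} → x ⊥ C → P (x ∷ R) (a ∷ b ∷ C) ≡ M x a * P R (b ∷ C) + M x b * P R (a ∷ C)
      perm-row₂ R a b z = +-congˡ
        (trans (+-congˡ (Σpick-⊥ z (λ ds → P R (a ∷ b ∷ ds)))) (+-identityʳ _))

      perm-col₁ : ∀ {x} a R {C} → x ⊥ R → P (a ∷ R) (x ∷ C) ≡ M x a * P R C
      perm-col₁ {x} a R {C} z = trans (perm-transpose (a ∷ R) (x ∷ C))
        (trans (perm-row₁ C a z) (cong (M x a *_) (perm-transpose C R)))

      perm-leaf : ∀ {x} a {R C} → x ⊥ R → x ⊥ C →
        P (x ∷ a ∷ R) (x ∷ a ∷ C) ≡ M x x * P (a ∷ R) (a ∷ C) + M x a * (M x a * P R C)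
      perm-leaf {x} a {R} {C} zR zC = trans (perm-row₂ (a ∷ R) x a zC)
        (cong (λ k → M x x * P (a ∷ R) (a ∷ C) + M x a * k) (perm-col₁ a R zR))

      perm-row₃ : ∀ {x} R a b c {C} → x ⊥ C → P (x ∷ R) (a ∷ b ∷ c ∷ C) ≡
        M x a * P R (b ∷ c ∷ C) + (M x b * P R (a ∷ c ∷ C) + M x c * P R (a ∷ b ∷ C))
      perm-row₃ R a b c z = +-congˡ (+-congˡ
        (trans (+-congˡ (Σpick-⊥ z (λ ds → P R (a ∷ b ∷ c ∷ ds)))) (+-identityʳ _)))

      perm-col₂ : ∀ {x} a b R {C} → x ⊥ R →
        P (a ∷ b ∷ R) (x ∷ C) ≡ M x a * P (b ∷ R) C + M x b * P (a ∷ R) C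
      perm-col₂ {x} a b R {C} z = trans (perm-transpose (a ∷ b ∷ R) (x ∷ C))
        (trans (perm-row₂ C a b z) (cong₂ (λ u v → M x a * u + M x b * v)
          (perm-transpose C (b ∷ R)) (perm-transpose C (a ∷ R))))

module ChainExpansion {A : Set} {_⊕_ _⊛_ : A → A → A} {0# 1# : A}
          (isCSR : IsCommutativeSemiring _≡_ _⊕_ _⊛_ 0# 1#)
          (d s : A) {V : Set} (M : V → V → A) (M-sym : ∀ i j → M i j ≡ M j i) where

  open import Algebra.Bundles using (CommutativeSemiring)
  open import Data.List.Base using (List; []; _∷_; _++_; length)
  open import Data.List.Relation.Binary.Permutation.Propositional using (_↭_; ↭-sym; ↭-trans; prep; swap; refl)
  open import Data.List.Relation.Binary.Permutation.Propositional.Properties using (shift)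
  open import Data.List.Relation.Unary.All using ([]; _∷_)
  open import Data.Nat.Base using (ℕ; zero; suc)
  open ListPermanent isCSR

  private
    csr : CommutativeSemiring 0ℓ 0ℓ
    csr = record { isCommutativeSemiring = isCSR }

  open import Algebra.Solver.Ring.NaturalCoefficients.Default csr using (solve; _:+_; _:*_; _:=_; con)
  open CommutativeSemiring csr using (_+_; _*_; +-identityʳ; distribˡ)
  open Symmetric M M-sym

  private
    P = perm M

  α β γ τ : ℕ → A
  α zero    = d
  α (suc k) = d * α k + β k
  β zero    = s * s
  β (suc k) = s * (s * α k)
  γ zero    = 0#
  γ (suc k) = s * (s * β k)
  τ zero    = s * s
  τ (suc k) = s * τ k

  β-step : ∀ k → d * β k + γ k ≡ β (suc k)
  β-step zero    = trans (+-identityʳ _) (solve 2 (λ d s → d :* (s :* s) := s :* (s :* d)) refl d s)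
  β-step (suc k) = solve 4 (λ d s a b → d :* (s :* (s :* a)) :+ s :* (s :* b) := s :* (s :* (d :* a :+ b)))
                     refl d s (α k) (β k)

  -- Chain b a (x₀ ∷ … ∷ xₖ) Or Oc: a path a, x₀, …, xₖ, b whose interior vertices
  -- have no neighbours in the lists Or and Oc.
  data Chain (b : V) : V → List V → List V → List V → Set where
    chain-end  : ∀ {a x Or Oc} → M x x ≡ d → M x a ≡ s → M x b ≡ s → x ⊥ Or → x ⊥ Oc →
                  Chain b a (x ∷ []) Or Oc
    chain-cons : ∀ {a x y xs Or Oc} → M x x ≡ d → M x a ≡ s → M x b ≡ 0# → x ⊥ Or → x ⊥ Oc →
                  Chain b x (y ∷ xs) (a ∷ Or) (a ∷ Oc) → Chain b a (x ∷ y ∷ xs) Or Oc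

  pred-length : List V → ℕ
  pred-length []       = 0
  pred-length (_ ∷ xs) = length xs

  private
    cong₃ : ∀ {B : Set} (f : B → B → B → B) {x x′ y y′ z z′} → x ≡ x′ → y ≡ y′ → z ≡ z′ → f x y z ≡ f x′ y′ z′
    cong₃ f refl refl refl = refl

    front : ∀ {a x : V} xs {O} → a ∷ x ∷ xs ++ O ↭ x ∷ xs ++ a ∷ O
    front {a} {x} xs {O} = ↭-sym (shift a (x ∷ xs) O)

    front₂ : ∀ {a b x : V} xs {O} → a ∷ b ∷ x ∷ xs ++ O ↭ x ∷ b ∷ xs ++ a ∷ O
    front₂ {a} {b} {x} xs {O} = ↭-trans (↭-sym (shift a (b ∷ x ∷ xs) O)) (swap b x refl)

  -- The suffixes record which of the end vertices a and b occur among the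
  -- rows and among the columns.
  perm-chain-a-a : ∀ {a b xs Or Oc} → Chain b a xs Or Oc → let k = pred-length xs in
    P (a ∷ xs ++ Or) (a ∷ xs ++ Oc) ≡ α k * P (a ∷ Or) (a ∷ Oc) + β k * P Or Oc
  perm-chain-a-a {a} {b} {x ∷ []} {Or} {Oc} (chain-end xx xa _ zr zc) = begin
    P (a ∷ x ∷ Or) (a ∷ x ∷ Oc)  ≡⟨ perm-↭ (swap a x refl) (swap a x refl) ⟩
    P (x ∷ a ∷ Or) (x ∷ a ∷ Oc)  ≡⟨ perm-leaf a zr zc ⟩
    M x x * P (a ∷ Or) (a ∷ Oc) + M x a * (M x a * P Or Oc)
      ≡⟨ cong₂ (λ u v → u * P (a ∷ Or) (a ∷ Oc) + v * (v * P Or Oc)) xx xa ⟩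
    d * P (a ∷ Or) (a ∷ Oc) + s * (s * P Or Oc)
      ≡⟨ solve 4 (λ d s p q → d :* p :+ s :* (s :* q) := d :* p :+ (s :* s) :* q) refl d s _ _ ⟩
    d * P (a ∷ Or) (a ∷ Oc) + (s * s) * P Or Oc ∎
    where open ≡-Reasoning
  perm-chain-a-a {a} {b} {x ∷ ys@(_ ∷ xs)} {Or} {Oc} (chain-cons xx xa _ zr zc ch) = begin
    P (a ∷ x ∷ ys ++ Or) (a ∷ x ∷ ys ++ Oc)      ≡⟨ perm-↭ (front ys) (front ys) ⟩
    P (x ∷ ys ++ a ∷ Or) (x ∷ ys ++ a ∷ Oc)      ≡⟨ perm-chain-a-a ch ⟩
    α k * P (x ∷ a ∷ Or) (x ∷ a ∷ Oc) + β k * P (a ∷ Or) (a ∷ Oc)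
      ≡⟨ cong (λ z → α k * z + β k * P (a ∷ Or) (a ∷ Oc)) (trans (perm-leaf a zr zc)
           (cong₂ (λ u v → u * P (a ∷ Or) (a ∷ Oc) + v * (v * P Or Oc)) xx xa)) ⟩
    α k * (d * P (a ∷ Or) (a ∷ Oc) + s * (s * P Or Oc)) + β k * P (a ∷ Or) (a ∷ Oc)
      ≡⟨ solve 6 (λ d s a b p q → a :* (d :* p :+ s :* (s :* q)) :+ b :* p
                               := (d :* a :+ b) :* p :+ (s :* (s :* a)) :* q) refl d s (α k) (β k) _ _ ⟩
    α (suc k) * P (a ∷ Or) (a ∷ Oc) + β (suc k) * P Or Oc ∎
    where
    open ≡-Reasoning
    k = length xs

  perm-chain-a-ab : ∀ {a b xs Or Oc} → Chain b a xs Or Oc → let k = pred-length xs in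
    P (a ∷ xs ++ Or) (a ∷ b ∷ xs ++ Oc) ≡
    α k * P (a ∷ Or) (a ∷ b ∷ Oc) + β k * P Or (b ∷ Oc) + τ k * P Or (a ∷ Oc)
  perm-chain-a-ab {a} {b} {x ∷ []} {Or} {Oc} (chain-end xx xa xb zr zc) = begin
    P (a ∷ x ∷ Or) (a ∷ b ∷ x ∷ Oc)
      ≡⟨ perm-↭ (swap a x refl) (shift x (a ∷ b ∷ []) Oc) ⟩
    P (x ∷ a ∷ Or) (x ∷ a ∷ b ∷ Oc)
      ≡⟨ perm-row₃ (a ∷ Or) x a b zc ⟩
    M x x * P (a ∷ Or) (a ∷ b ∷ Oc) + (M x a * P (a ∷ Or) (x ∷ b ∷ Oc) + M x b * P (a ∷ Or) (x ∷ a ∷ Oc))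
      ≡⟨ cong₂ (λ u v → M x x * P (a ∷ Or) (a ∷ b ∷ Oc) + (M x a * u + M x b * v))
           (perm-col₁ a Or zr) (perm-col₁ a Or zr) ⟩
    M x x * P (a ∷ Or) (a ∷ b ∷ Oc) + (M x a * (M x a * P Or (b ∷ Oc)) + M x b * (M x a * P Or (a ∷ Oc)))
      ≡⟨ substitute xx xa xb ⟩
    d * P (a ∷ Or) (a ∷ b ∷ Oc) + (s * (s * P Or (b ∷ Oc)) + s * (s * P Or (a ∷ Oc)))
      ≡⟨ solve 5 (λ d s p q r → d :* p :+ (s :* (s :* q) :+ s :* (s :* r))
                             := d :* p :+ (s :* s) :* q :+ (s :* s) :* r) refl d s _ _ _ ⟩
    d * P (a ∷ Or) (a ∷ b ∷ Oc) + (s * s) * P Or (b ∷ Oc) + (s * s) * P Or (a ∷ Oc) ∎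
    where
    open ≡-Reasoning
    substitute : ∀ {u v w p q r} → u ≡ d → v ≡ s → w ≡ s →
      u * p + (v * (v * q) + w * (v * r)) ≡ d * p + (s * (s * q) + s * (s * r))
    substitute refl refl refl = refl
  perm-chain-a-ab {a} {b} {x ∷ ys@(_ ∷ xs)} {Or} {Oc} (chain-cons xx xa xb zr zc ch) = begin
    P (a ∷ x ∷ ys ++ Or) (a ∷ b ∷ x ∷ ys ++ Oc)
      ≡⟨ perm-↭ (front ys) (front₂ ys) ⟩
    P (x ∷ ys ++ a ∷ Or) (x ∷ b ∷ ys ++ a ∷ Oc)
      ≡⟨ perm-chain-a-ab ch ⟩
    α k * P (x ∷ a ∷ Or) (x ∷ b ∷ a ∷ Oc) + β k * P (a ∷ Or) (b ∷ a ∷ Oc) + τ k * P (a ∷ Or) (x ∷ a ∷ Oc)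
      ≡⟨ cong₃ (λ p q r → α k * p + β k * q + τ k * r)
           (trans (perm-↭ refl (prep x (swap b a refl))) (perm-leaf a zr (xb ∷ zc)))
           (perm-↭ refl (swap b a refl))
           (perm-col₁ a Or zr) ⟩
    α k * (M x x * P (a ∷ Or) (a ∷ b ∷ Oc) + M x a * (M x a * P Or (b ∷ Oc)))
      + β k * P (a ∷ Or) (a ∷ b ∷ Oc) + τ k * (M x a * P Or (a ∷ Oc))
      ≡⟨ substitute xx xa ⟩
    α k * (d * P (a ∷ Or) (a ∷ b ∷ Oc) + s * (s * P Or (b ∷ Oc)))
      + β k * P (a ∷ Or) (a ∷ b ∷ Oc) + τ k * (s * P Or (a ∷ Oc))
      ≡⟨ solve 8 (λ d s a b t p q r → a :* (d :* p :+ s :* (s :* q)) :+ b :* p :+ t :* (s :* r)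
           := (d :* a :+ b) :* p :+ (s :* (s :* a)) :* q :+ (s :* t) :* r)
           refl d s (α k) (β k) (τ k) _ _ _ ⟩
    α (suc k) * P (a ∷ Or) (a ∷ b ∷ Oc) + β (suc k) * P Or (b ∷ Oc) + τ (suc k) * P Or (a ∷ Oc) ∎
    where
    open ≡-Reasoning
    k = length xs
    substitute : ∀ {u v p q r t A B} → u ≡ d → v ≡ s →
      A * (u * p + v * (v * q)) + B + t * (v * r) ≡ A * (d * p + s * (s * q)) + B + t * (s * r)
    substitute refl refl = refl

  perm-chain-ab-ab : ∀ {a b xs Or Oc} → Chain b a xs Or Oc → let k = pred-length xs in
    P (a ∷ b ∷ xs ++ Or) (a ∷ b ∷ xs ++ Oc) ≡
    α k * P (a ∷ b ∷ Or) (a ∷ b ∷ Oc) + β k * (P (a ∷ Or) (a ∷ Oc) + P (b ∷ Or) (b ∷ Oc))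
      + γ k * P Or Oc + τ k * (P (a ∷ Or) (b ∷ Oc) + P (b ∷ Or) (a ∷ Oc))
  perm-chain-ab-ab {a} {b} {x ∷ []} {Or} {Oc} (chain-end xx xa xb zr zc) = begin
    P (a ∷ b ∷ x ∷ Or) (a ∷ b ∷ x ∷ Oc)
      ≡⟨ perm-↭ (shift x (a ∷ b ∷ []) Or) (shift x (a ∷ b ∷ []) Oc) ⟩
    P (x ∷ a ∷ b ∷ Or) (x ∷ a ∷ b ∷ Oc)
      ≡⟨ perm-row₃ (a ∷ b ∷ Or) x a b zc ⟩
    M x x * P (a ∷ b ∷ Or) (a ∷ b ∷ Oc)
      + (M x a * P (a ∷ b ∷ Or) (x ∷ b ∷ Oc) + M x b * P (a ∷ b ∷ Or) (x ∷ a ∷ Oc))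
      ≡⟨ cong₂ (λ u v → M x x * P (a ∷ b ∷ Or) (a ∷ b ∷ Oc) + (M x a * u + M x b * v))
           (perm-col₂ a b Or zr) (perm-col₂ a b Or zr) ⟩
    M x x * P (a ∷ b ∷ Or) (a ∷ b ∷ Oc)
      + (M x a * (M x a * P (b ∷ Or) (b ∷ Oc) + M x b * P (a ∷ Or) (b ∷ Oc))
       + M x b * (M x a * P (b ∷ Or) (a ∷ Oc) + M x b * P (a ∷ Or) (a ∷ Oc)))
      ≡⟨ substitute xx xa xb ⟩
    d * P (a ∷ b ∷ Or) (a ∷ b ∷ Oc)
      + (s * (s * P (b ∷ Or) (b ∷ Oc) + s * P (a ∷ Or) (b ∷ Oc))
       + s * (s * P (b ∷ Or) (a ∷ Oc) + s * P (a ∷ Or) (a ∷ Oc)))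
      ≡⟨ solve 8 (λ d s p q r t u z → d :* p :+ (s :* (s :* q :+ s :* r) :+ s :* (s :* t :+ s :* u))
           := d :* p :+ (s :* s) :* (u :+ q) :+ con 0 :* z :+ (s :* s) :* (r :+ t))
           refl d s _ _ _ _ _ _ ⟩
    _ ∎
    where
    open ≡-Reasoning
    substitute : ∀ {u v w p q r t z} → u ≡ d → v ≡ s → w ≡ s →
      u * p + (v * (v * q + w * r) + w * (v * t + w * z)) ≡ d * p + (s * (s * q + s * r) + s * (s * t + s * z))
    substitute refl refl refl = refl
  perm-chain-ab-ab {a} {b} {x ∷ ys@(_ ∷ xs)} {Or} {Oc} (chain-cons xx xa xb zr zc ch) = begin
    P (a ∷ b ∷ x ∷ ys ++ Or) (a ∷ b ∷ x ∷ ys ++ Oc)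
      ≡⟨ perm-↭ (front₂ ys) (front₂ ys) ⟩
    P (x ∷ b ∷ ys ++ a ∷ Or) (x ∷ b ∷ ys ++ a ∷ Oc)
      ≡⟨ perm-chain-ab-ab ch ⟩
    α k * P (x ∷ b ∷ a ∷ Or) (x ∷ b ∷ a ∷ Oc)
      + β k * (P (x ∷ a ∷ Or) (x ∷ a ∷ Oc) + P (b ∷ a ∷ Or) (b ∷ a ∷ Oc))
      + γ k * P (a ∷ Or) (a ∷ Oc)
      + τ k * (P (x ∷ a ∷ Or) (b ∷ a ∷ Oc) + P (b ∷ a ∷ Or) (x ∷ a ∷ Oc))
      ≡⟨ cong₂ _+_ (cong (_+ γ k * P (a ∷ Or) (a ∷ Oc)) (cong₃ (λ p q r → α k * p + β k * (q + r))
           (trans (perm-↭ (prep x (swap b a refl)) (prep x (swap b a refl)))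
             (trans (perm-leaf a (xb ∷ zr) (xb ∷ zc)) (substitute xx xa)))
           (trans (perm-leaf a zr zc) (substitute xx xa))
           (perm-↭ (swap b a refl) (swap b a refl))))
         (cong₂ (λ p q → τ k * (p + q))
           (trans (perm-↭ refl (swap b a refl))
             (trans (perm-row₁ (a ∷ Or) a (xb ∷ zc)) (cong (_* P (a ∷ Or) (b ∷ Oc)) xa)))
           (trans (perm-↭ (swap b a refl) refl)
             (trans (perm-col₁ a (b ∷ Or) (xb ∷ zr)) (cong (_* P (b ∷ Or) (a ∷ Oc)) xa)))) ⟩
    α k * (d * P (a ∷ b ∷ Or) (a ∷ b ∷ Oc) + s * (s * P (b ∷ Or) (b ∷ Oc)))
      + β k * ((d * P (a ∷ Or) (a ∷ Oc) + s * (s * P Or Oc)) + P (a ∷ b ∷ Or) (a ∷ b ∷ Oc))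
      + γ k * P (a ∷ Or) (a ∷ Oc)
      + τ k * (s * P (a ∷ Or) (b ∷ Oc) + s * P (b ∷ Or) (a ∷ Oc))
      ≡⟨ solve 12 (λ d s A B G T p q r t u v →
           A :* (d :* p :+ s :* (s :* q)) :+ B :* ((d :* r :+ s :* (s :* t)) :+ p) :+ G :* r :+ T :* (s :* u :+ s :* v)
           := (d :* A :+ B) :* p :+ ((d :* B :+ G) :* r :+ (s :* (s :* A)) :* q) :+ (s :* (s :* B)) :* t
              :+ (s :* T) :* (u :+ v))
           refl d s (α k) (β k) (γ k) (τ k) _ _ _ _ _ _ ⟩
    α (suc k) * P (a ∷ b ∷ Or) (a ∷ b ∷ Oc)
      + ((d * β k + γ k) * P (a ∷ Or) (a ∷ Oc) + β (suc k) * P (b ∷ Or) (b ∷ Oc))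
      + γ (suc k) * P Or Oc + τ (suc k) * (P (a ∷ Or) (b ∷ Oc) + P (b ∷ Or) (a ∷ Oc))
      ≡⟨ cong (λ z → α (suc k) * P (a ∷ b ∷ Or) (a ∷ b ∷ Oc) + z + γ (suc k) * P Or Oc
                + τ (suc k) * (P (a ∷ Or) (b ∷ Oc) + P (b ∷ Or) (a ∷ Oc)))
           (trans (cong (λ z → z * P (a ∷ Or) (a ∷ Oc) + β (suc k) * P (b ∷ Or) (b ∷ Oc)) (β-step k))
                  (sym (distribˡ (β (suc k)) _ _))) ⟩
    _ ∎
    where
    open ≡-Reasoning
    k = length xs
    substitute : ∀ {u v p q} → u ≡ d → v ≡ s → u * p + v * (v * q) ≡ d * p + s * (s * q)
    substitute refl refl = refl

  Chain-weaken : ∀ {a b xs Or Oc Or′ Oc′} → (∀ {x} → x ⊥ Or → x ⊥ Or′) → (∀ {x} → x ⊥ Oc → x ⊥ Oc′) →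
                 Chain b a xs Or Oc → Chain b a xs Or′ Oc′
  Chain-weaken f g (chain-end xx xa xb zr zc)  = (chain-end xx xa xb (f zr) (g zc))
  Chain-weaken f g (chain-cons xx xa xb zr zc ch) =
    chain-cons xx xa xb (f zr) (g zc) (Chain-weaken (λ { (z ∷ zs) → z ∷ f zs }) (λ { (z ∷ zs) → z ∷ g zs }) ch)

  private
    drop₁ : ∀ {x a O} → x ⊥ (a ∷ O) → x ⊥ O
    drop₁ (_ ∷ z) = z

  perm-chain-∅-∅ : ∀ {a b xs O} → Chain b a xs O O → let k = pred-length xs in
    P (xs ++ O) (xs ++ O) ≡ α k * P O O
  perm-chain-∅-∅ {a} {b} {x ∷ []} {O} (chain-end xx xa xb z _) =
    trans (perm-row₁ O x z) (cong (_* P O O) xx)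
  perm-chain-∅-∅ {a} {b} {x ∷ ys@(_ ∷ xs)} {O} (chain-cons xx xa xb z _ ch) = begin
    P (x ∷ ys ++ O) (x ∷ ys ++ O)   ≡⟨ perm-chain-a-a (Chain-weaken drop₁ drop₁ ch) ⟩
    α k * P (x ∷ O) (x ∷ O) + β k * P O O
      ≡⟨ cong (λ p → α k * p + β k * P O O) (trans (perm-row₁ O x z) (cong (_* P O O) xx)) ⟩
    α k * (d * P O O) + β k * P O O
      ≡⟨ solve 4 (λ d a b p → a :* (d :* p) :+ b :* p := (d :* a :+ b) :* p) refl d (α k) (β k) _ ⟩
    α (suc k) * P O O ∎
    where
    open ≡-Reasoning
    k = length xs

  perm-chain-b-b : ∀ {a b xs O} → Chain b a xs O O → let k = pred-length xs in
    P (b ∷ xs ++ O) (b ∷ xs ++ O) ≡ α k * P (b ∷ O) (b ∷ O) + β k * P O O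
  perm-chain-b-b {a} {b} {x ∷ []} {O} (chain-end xx xa xb z z′) = perm-chain-a-a (chain-end xx xb xa z z′)
  perm-chain-b-b {a} {b} {x ∷ ys@(_ ∷ xs)} {O} (chain-cons xx xa xb z _ ch) = begin
    P (b ∷ x ∷ ys ++ O) (b ∷ x ∷ ys ++ O)
      ≡⟨ perm-↭ (swap b x refl) (swap b x refl) ⟩
    P (x ∷ b ∷ ys ++ O) (x ∷ b ∷ ys ++ O)
      ≡⟨ perm-chain-ab-ab (Chain-weaken drop₁ drop₁ ch) ⟩
    α k * P (x ∷ b ∷ O) (x ∷ b ∷ O) + β k * (P (x ∷ O) (x ∷ O) + P (b ∷ O) (b ∷ O))
      + γ k * P O O + τ k * (P (x ∷ O) (b ∷ O) + P (b ∷ O) (x ∷ O))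
      ≡⟨ cong₂ _+_ (cong₂ (λ p q → α k * p + β k * (q + P (b ∷ O) (b ∷ O)) + γ k * P O O)
           (trans (perm-row₁ (b ∷ O) x (xb ∷ z)) (cong (_* P (b ∷ O) (b ∷ O)) xx))
           (trans (perm-row₁ O x z) (cong (_* P O O) xx)))
         (cong₂ (λ p q → τ k * (p + q))
           (trans (perm-row₁ O b z) (cong (_* P O O) xb))
           (trans (perm-col₁ b O z) (cong (_* P O O) xb))) ⟩
    α k * (d * P (b ∷ O) (b ∷ O)) + β k * (d * P O O + P (b ∷ O) (b ∷ O))
      + γ k * P O O + τ k * (0# * P O O + 0# * P O O)
      ≡⟨ solve 7 (λ d A B G T p q → A :* (d :* p) :+ B :* (d :* q :+ p) :+ G :* q :+ T :* (con 0 :* q :+ con 0 :* q)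
           := (d :* A :+ B) :* p :+ (d :* B :+ G) :* q) refl d (α k) (β k) (γ k) (τ k) _ _ ⟩
    α (suc k) * P (b ∷ O) (b ∷ O) + (d * β k + γ k) * P O O
      ≡⟨ cong (λ z → α (suc k) * P (b ∷ O) (b ∷ O) + z * P O O) (β-step k) ⟩
    α (suc k) * P (b ∷ O) (b ∷ O) + β (suc k) * P O O ∎
    where
    open ≡-Reasoning
    k = length xs

  perm-chain-a-b : ∀ {a b xs O} → Chain b a xs O O → let k = pred-length xs in
    P (a ∷ xs ++ O) (b ∷ xs ++ O) ≡ α k * P (a ∷ O) (b ∷ O) + τ k * P O O
  perm-chain-a-b {a} {b} {x ∷ []} {O} (chain-end xx xa xb z _) = begin
    P (a ∷ x ∷ O) (b ∷ x ∷ O)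
      ≡⟨ perm-↭ (swap a x refl) (swap b x refl) ⟩
    P (x ∷ a ∷ O) (x ∷ b ∷ O)
      ≡⟨ perm-row₂ (a ∷ O) x b z ⟩
    M x x * P (a ∷ O) (b ∷ O) + M x b * P (a ∷ O) (x ∷ O)
      ≡⟨ cong₃ (λ u v w → u * P (a ∷ O) (b ∷ O) + v * w) xx xb
           (trans (perm-col₁ a O z) (cong (_* P O O) xa)) ⟩
    d * P (a ∷ O) (b ∷ O) + s * (s * P O O)
      ≡⟨ solve 4 (λ d s p q → d :* p :+ s :* (s :* q) := d :* p :+ (s :* s) :* q) refl d s _ _ ⟩
    d * P (a ∷ O) (b ∷ O) + (s * s) * P O O ∎
    where open ≡-Reasoning
  perm-chain-a-b {a} {b} {x ∷ ys@(_ ∷ xs)} {O} (chain-cons xx xa xb z _ ch) = begin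
    P (a ∷ x ∷ ys ++ O) (b ∷ x ∷ ys ++ O)
      ≡⟨ perm-↭ (front ys) (swap b x refl) ⟩
    P (x ∷ ys ++ a ∷ O) (x ∷ b ∷ ys ++ O)
      ≡⟨ perm-chain-a-ab (Chain-weaken (λ z → z) drop₁ ch) ⟩
    α k * P (x ∷ a ∷ O) (x ∷ b ∷ O) + β k * P (a ∷ O) (b ∷ O) + τ k * P (a ∷ O) (x ∷ O)
      ≡⟨ cong₂ (λ p q → α k * p + β k * P (a ∷ O) (b ∷ O) + τ k * q)
           (trans (perm-row₁ (a ∷ O) x (xb ∷ z)) (cong (_* P (a ∷ O) (b ∷ O)) xx))
           (trans (perm-col₁ a O z) (cong (_* P O O) xa)) ⟩
    α k * (d * P (a ∷ O) (b ∷ O)) + β k * P (a ∷ O) (b ∷ O) + τ k * (s * P O O)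
      ≡⟨ solve 7 (λ d s A B T p q → A :* (d :* p) :+ B :* p :+ T :* (s :* q)
           := (d :* A :+ B) :* p :+ (s :* T) :* q) refl d s (α k) (β k) (τ k) _ _ ⟩
    α (suc k) * P (a ∷ O) (b ∷ O) + τ (suc k) * P O O ∎
    where
    open ≡-Reasoning
    k = length xs

  data Loop (u : V) : List V → List V → Set where
    loop : ∀ {x ys O} → M x x ≡ d → M x u ≡ s → x ⊥ O → Chain u x ys O O → Loop u (x ∷ ys) O

  -- ζ k is the weight of the two orientations of a closed walk together with the
  -- two ways to match its base point with a neighbour.
  ζ : ℕ → A
  ζ k = β k + β k + (τ k + τ k)

  perm-loop-u-u : ∀ {u xs O} → Loop u xs O → let k = pred-length xs in
    P (u ∷ xs ++ O) (u ∷ xs ++ O) ≡ α k * P (u ∷ O) (u ∷ O) + ζ k * P O O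
  perm-loop-u-u {u} {x ∷ _} {O} (loop {ys = ys@(_ ∷ xs)} xx xu z ch) = begin
    P (u ∷ x ∷ ys ++ O) (u ∷ x ∷ ys ++ O)
      ≡⟨ perm-↭ (swap u x refl) (swap u x refl) ⟩
    P (x ∷ u ∷ ys ++ O) (x ∷ u ∷ ys ++ O)
      ≡⟨ perm-chain-ab-ab ch ⟩
    α k * P (x ∷ u ∷ O) (x ∷ u ∷ O) + β k * (P (x ∷ O) (x ∷ O) + P (u ∷ O) (u ∷ O))
      + γ k * P O O + τ k * (P (x ∷ O) (u ∷ O) + P (u ∷ O) (x ∷ O))
      ≡⟨ cong₂ _+_ (cong₂ (λ p q → α k * p + β k * (q + P (u ∷ O) (u ∷ O)) + γ k * P O O)
           (trans (perm-leaf u z z) (cong₂ (λ v w → v * P (u ∷ O) (u ∷ O) + w * (w * P O O)) xx xu))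
           (trans (perm-row₁ O x z) (cong (_* P O O) xx)))
         (cong₂ (λ p q → τ k * (p + q))
           (trans (perm-row₁ O u z) (cong (_* P O O) xu))
           (trans (perm-col₁ u O z) (cong (_* P O O) xu))) ⟩
    α k * (d * P (u ∷ O) (u ∷ O) + s * (s * P O O)) + β k * (d * P O O + P (u ∷ O) (u ∷ O))
      + γ k * P O O + τ k * (s * P O O + s * P O O)
      ≡⟨ solve 8 (λ d s A B G T p q →
           A :* (d :* p :+ s :* (s :* q)) :+ B :* (d :* q :+ p) :+ G :* q :+ T :* (s :* q :+ s :* q)
           := (d :* A :+ B) :* p :+ (s :* (s :* A) :+ (d :* B :+ G) :+ (s :* T :+ s :* T)) :* q)
           refl d s (α k) (β k) (γ k) (τ k) _ _ ⟩
    α (suc k) * P (u ∷ O) (u ∷ O) + (β (suc k) + (d * β k + γ k) + (τ (suc k) + τ (suc k))) * P O O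
      ≡⟨ cong (λ z → α (suc k) * P (u ∷ O) (u ∷ O) + (β (suc k) + z + (τ (suc k) + τ (suc k))) * P O O) (β-step k) ⟩
    α (suc k) * P (u ∷ O) (u ∷ O) + ζ (suc k) * P O O ∎
    where
    open ≡-Reasoning
    k = length xs

  perm-cycle : ∀ {x xs O} → M x x ≡ d → x ⊥ O → Loop x xs O → let k = pred-length xs in
    P (x ∷ xs ++ O) (x ∷ xs ++ O) ≡ (d * α k + ζ k) * P O O
  perm-cycle {x} {xs} {O} xx z l = begin
    P (x ∷ xs ++ O) (x ∷ xs ++ O)               ≡⟨ perm-loop-u-u l ⟩
    α k * P (x ∷ O) (x ∷ O) + ζ k * P O O
      ≡⟨ cong (λ p → α k * p + ζ k * P O O) (trans (perm-row₁ O x z) (cong (_* P O O) xx)) ⟩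
    α k * (d * P O O) + ζ k * P O O
      ≡⟨ solve 4 (λ d a z p → a :* (d :* p) :+ z :* p := (d :* a :+ z) :* p) refl d (α k) (ζ k) _ ⟩
    (d * α k + ζ k) * P O O ∎
    where
    open ≡-Reasoning
    k = pred-length xs

module PermanentOfList (R : RawRing 0ℓ 0ℓ)
          (isCSR : IsCommutativeSemiring _≡_ (RawRing._+_ R) (RawRing._*_ R) (RawRing.0# R) (RawRing.1# R)) where

  open import Algebra.Bundles using (CommutativeSemiring)
  open import Data.Fin.Base using (Fin; zero; suc; punchIn)
  open import Data.Fin.Permutation using (Permutation′; _⟨$⟩ʳ_; insert)
  open import Data.List.Base using (List; []; _∷_; _++_; map; foldr; tabulate; allFin; cartesianProductWith)
  open import Data.List.Properties using (map-tabulate)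
  open import Data.Nat.Base using (zero; suc)
  open import Function.Base using (_∘_; id)
  open import Defs using (permutations; Matrix; per; ∏)
  open ListPermanent isCSR

  private
    csr : CommutativeSemiring 0ℓ 0ℓ
    csr = record { isCommutativeSemiring = isCSR }

  open CommutativeSemiring csr using (_+_; _*_; 0#; 1#; +-identityʳ; +-identityˡ; zeroʳ; distribˡ; +-assoc) renaming (Carrier to A)

  private
    Σper : ∀ {n} → Matrix A n → List (Permutation′ n) → A
    Σper M = foldr (λ σ s → ∏ R (λ i → M i (σ ⟨$⟩ʳ i)) + s) 0#

    minor : ∀ {n} → Matrix A (suc n) → Fin (suc n) → Matrix A n
    minor M j i k = M (suc i) (punchIn j k)

    Σper-++ : ∀ {n} (M : Matrix A n) σs τs → Σper M (σs ++ τs) ≡ Σper M σs + Σper M τs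
    Σper-++ M []       τs = sym (+-identityˡ _)
    Σper-++ M (σ ∷ σs) τs = trans (cong (_ +_) (Σper-++ M σs τs)) (sym (+-assoc _ _ _))

    Σper-insert : ∀ {n} (M : Matrix A (suc n)) j σs →
                  Σper M (map (insert zero j) σs) ≡ M zero j * Σper (minor M j) σs
    Σper-insert M j []       = sym (zeroʳ _)
    Σper-insert M j (σ ∷ σs) = trans (cong (_ +_) (Σper-insert M j σs)) (sym (distribˡ _ _ _))

    Σlist : ∀ {V : Set} → (V → A) → List V → A
    Σlist f = foldr (λ v s → f v + s) 0#

    Σper-product : ∀ {n} (M : Matrix A (suc n)) js σs →
      Σper M (cartesianProductWith (insert zero) js σs) ≡ Σlist (λ j → M zero j * Σper (minor M j) σs) js
    Σper-product M []       σs = refl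
    Σper-product M (j ∷ js) σs = trans (Σper-++ M (map (insert zero j) σs) _)
      (cong₂ _+_ (Σper-insert M j σs) (Σper-product M js σs))

    Σlist-tabulate : ∀ {V : Set} {n} (f : V → A) (g : Fin n → V) →
                     Σlist f (tabulate g) ≡ Σlist (f ∘ g) (allFin n)
    Σlist-tabulate {n = zero}  f g = refl
    Σlist-tabulate {n = suc n} f g = cong (_ +_)
      (trans (Σlist-tabulate f (g ∘ suc)) (sym (Σlist-tabulate (f ∘ g) suc)))

    Σpick-tabulate : ∀ {V : Set} {n} f (g : Fin (suc n) → V) → Σpick f (tabulate g) ≡
                     Σlist (λ j → f (g j) (tabulate (g ∘ punchIn j))) (allFin (suc n))
    Σpick-tabulate {n = zero}  f g = refl
    Σpick-tabulate {n = suc n} f g = cong (_ +_)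
      (trans (Σpick-tabulate (λ d ds → f d (g zero ∷ ds)) (g ∘ suc))
             (sym (Σlist-tabulate (λ j → f (g j) (tabulate (g ∘ punchIn j))) suc)))

    Σlist-cong : ∀ {V : Set} {f g : V → A} → (∀ v → f v ≡ g v) → ∀ vs → Σlist f vs ≡ Σlist g vs
    Σlist-cong eq []       = refl
    Σlist-cong eq (v ∷ vs) = cong₂ _+_ (eq v) (Σlist-cong eq vs)

  per≡perm : ∀ {n} (M : Matrix A n) → per R M ≡ perm M (allFin n) (allFin n)
  per≡perm {zero}  M = trans (+-identityʳ 1#) (sym (perm-[] M))
  per≡perm {suc n} M = begin
    Σper M (cartesianProductWith (insert zero) (allFin (suc n)) (permutations n))
      ≡⟨ Σper-product M (allFin (suc n)) (permutations n) ⟩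
    Σlist (λ j → M zero j * per R (minor M j)) (allFin (suc n))
      ≡⟨ Σlist-cong (λ j → cong (M zero j *_) (trans (per≡perm (minor M j))
           (trans (perm-map M suc (punchIn j) (allFin n) (allFin n))
             (cong₂ (perm M) (map-tabulate id suc) (map-tabulate id (punchIn j))))))
           (allFin (suc n)) ⟩
    Σlist (λ j → M zero j * perm M (tabulate suc) (tabulate (punchIn j))) (allFin (suc n))
      ≡⟨ Σpick-tabulate (λ c cs → M zero c * perm M (tabulate suc) cs) id ⟨
    Σpick (λ c cs → M zero c * perm M (tabulate suc) cs) (allFin (suc n))
      ≡⟨ perm-∷ M zero (tabulate suc) (allFin (suc n)) ⟨
    perm M (allFin (suc n)) (allFin (suc n)) ∎
    where open ≡-Reasoning

module HomogeneousEvaluation where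

  open import Data.Fin.Base using (Fin; zero; suc)
  open import Data.Fin.Permutation using (Permutation′; _⟨$⟩ʳ_)
  open import Data.Integer.Base as ℤ using (ℤ; 0ℤ; 1ℤ; _+_; _*_; _-_; -_)
  open import Data.List.Base using (List; []; _∷_; map; length; foldr)
  open import Data.List.Properties using (length-map)
  open import Data.Nat.Base as ℕ using (ℕ; zero; suc; z≤n; s≤s; _≤_)
  open import Function.Base using (_∘_)
  open import Defs

  ℤ-raw = ℤ.+-*-rawRing

  private
    homEval-+-eq : ∀ a b w u p q → (a + b) * w + u * (p + q) ≡ a * w + u * p + (b * w + u * q)
    homEval-+-eq = solve-∀

    homEval-scale-eq : ∀ k a w u p → k * a * w + u * (k * p) ≡ k * (a * w + u * p)
    homEval-scale-eq = solve-∀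

    homEval-suc-eq : ∀ a v u → a * (v * 1ℤ) + u * 0ℤ ≡ v * a
    homEval-suc-eq = solve-∀

    homEval-suc-eq₁ : ∀ a v w u p → a * (v * w) + u * (v * p) ≡ v * (a * w + u * p)
    homEval-suc-eq₁ = solve-∀

    homEval-*-eq : ∀ a w p u q → a * (w * p) + u * (q * p) ≡ (a * w + u * q) * p
    homEval-*-eq = solve-∀

  module _ (u v : ℤ) where

    -- Σₖ≤ₙ fₖ uᵏ vⁿ⁻ᵏ
    homEval : ℕ → Poly → ℤ
    homEval n       []      = 0ℤ
    homEval zero    (a ∷ f) = a
    homEval (suc n) (a ∷ f) = a * v ℤ.^ suc n + u * homEval n f

    private
      coeffEval : ℕ → (ℕ → ℤ) → ℤ
      coeffEval zero    c = c 0
      coeffEval (suc n) c = c 0 * v ℤ.^ suc n + u * coeffEval n (c ∘ suc)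

      coeffEval-0 : ∀ n → coeffEval n (λ _ → 0ℤ) ≡ 0ℤ
      coeffEval-0 zero    = refl
      coeffEval-0 (suc n) = cong₂ _+_ (ℤ.*-zeroˡ (v ℤ.^ suc n)) (trans (cong (u *_) (coeffEval-0 n)) (ℤ.*-zeroʳ u))

      homEval-coeff : ∀ n f → homEval n f ≡ coeffEval n (coeff f)
      homEval-coeff n       []      = sym (coeffEval-0 n)
      homEval-coeff zero    (a ∷ f) = refl
      homEval-coeff (suc n) (a ∷ f) = cong (λ z → a * v ℤ.^ suc n + u * z) (homEval-coeff n f)

      coeffEval-cong : ∀ n {c c′} → (∀ k → c k ≡ c′ k) → coeffEval n c ≡ coeffEval n c′
      coeffEval-cong zero    eq = eq 0
      coeffEval-cong (suc n) eq = cong₂ (λ y z → y * v ℤ.^ suc n + u * z) (eq 0) (coeffEval-cong n (eq ∘ suc))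

    homEval-≈ : ∀ n {f g} → f ≈ₚ g → homEval n f ≡ homEval n g
    homEval-≈ n {f} {g} eq =
      trans (homEval-coeff n f) (trans (coeffEval-cong n eq) (sym (homEval-coeff n g)))

    homEval-+ : ∀ n f g → homEval n (f +ₚ g) ≡ homEval n f + homEval n g
    homEval-+ n       []      g       = sym (ℤ.+-identityˡ _)
    homEval-+ n       (a ∷ f) []      = sym (ℤ.+-identityʳ _)
    homEval-+ zero    (a ∷ f) (b ∷ g) = refl
    homEval-+ (suc n) (a ∷ f) (b ∷ g) =
      trans (cong (λ z → (a + b) * v ℤ.^ suc n + u * z) (homEval-+ n f g))
            (homEval-+-eq a b (v ℤ.^ suc n) u (homEval n f) (homEval n g))

    homEval-scale : ∀ n k f → homEval n (map (k *_) f) ≡ k * homEval n f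
    homEval-scale n       k []      = sym (ℤ.*-zeroʳ k)
    homEval-scale zero    k (a ∷ f) = refl
    homEval-scale (suc n) k (a ∷ f) =
      trans (cong (λ z → k * a * v ℤ.^ suc n + u * z) (homEval-scale n k f))
            (homEval-scale-eq k a (v ℤ.^ suc n) u (homEval n f))

    homEval-0∷ : ∀ n f → homEval (suc n) (0ℤ ∷ f) ≡ u * homEval n f
    homEval-0∷ n f = trans (cong (_+ u * homEval n f) (ℤ.*-zeroˡ (v ℤ.^ suc n))) (ℤ.+-identityˡ _)

    homEval-suc : ∀ n f → length f ≤ suc n → homEval (suc n) f ≡ v * homEval n f
    homEval-suc n       []           l             = sym (ℤ.*-zeroʳ v)
    homEval-suc zero    (a ∷ [])     l             = homEval-suc-eq a v u
    homEval-suc zero    (a ∷ _ ∷ _)  (s≤s ())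
    homEval-suc (suc n) (a ∷ f)      (s≤s l)       =
      trans (cong (λ z → a * v ℤ.^ suc (suc n) + u * z) (homEval-suc n f l))
            (homEval-suc-eq₁ a v (v ℤ.^ suc n) u (homEval n f))

    homEval-lift : ∀ k n f → length f ≤ suc n → homEval (k ℕ.+ n) f ≡ v ℤ.^ k * homEval n f
    homEval-lift zero    n f l = sym (ℤ.*-identityˡ _)
    homEval-lift (suc k) n f l = begin
      homEval (suc (k ℕ.+ n)) f    ≡⟨ homEval-suc (k ℕ.+ n) f (ℕ.≤-trans l (s≤s (ℕ.m≤n+m n k))) ⟩
      v * homEval (k ℕ.+ n) f      ≡⟨ cong (v *_) (homEval-lift k n f l) ⟩
      v * (v ℤ.^ k * homEval n f)  ≡⟨ ℤ.*-assoc v (v ℤ.^ k) _ ⟨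
      v * v ℤ.^ k * homEval n f    ∎
      where open ≡-Reasoning

    homEval-* : ∀ m n f g → length f ≤ suc m → length g ≤ suc n →
                homEval (m ℕ.+ n) (f *ₚ g) ≡ homEval m f * homEval n g
    homEval-* m       n []          g _        l′ = sym (ℤ.*-zeroˡ (homEval n g))
    homEval-* zero    n (a ∷ [])    g _        l′ = begin
      homEval n (map (a *_) g +ₚ (0ℤ ∷ []))             ≡⟨ homEval-+ n (map (a *_) g) (0ℤ ∷ []) ⟩
      homEval n (map (a *_) g) + homEval n (0ℤ ∷ [])    ≡⟨ cong₂ _+_ (homEval-scale n a g) (zero-const n) ⟩
      a * homEval n g + 0ℤ                              ≡⟨ ℤ.+-identityʳ _ ⟩
      a * homEval n g ∎
      where
      open ≡-Reasoning
      zero-const : ∀ n → homEval n (0ℤ ∷ []) ≡ 0ℤ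
      zero-const zero    = refl
      zero-const (suc n) = trans (homEval-0∷ n []) (ℤ.*-zeroʳ u)
    homEval-* zero    n (a ∷ _ ∷ _) g (s≤s ()) l′
    homEval-* (suc m) n (a ∷ f)     g (s≤s l)  l′ = begin
      homEval (suc m ℕ.+ n) (map (a *_) g +ₚ (0ℤ ∷ (f *ₚ g)))
        ≡⟨ homEval-+ (suc m ℕ.+ n) (map (a *_) g) (0ℤ ∷ (f *ₚ g)) ⟩
      homEval (suc m ℕ.+ n) (map (a *_) g) + homEval (suc m ℕ.+ n) (0ℤ ∷ (f *ₚ g))
        ≡⟨ cong₂ _+_ (trans (homEval-scale (suc m ℕ.+ n) a g) (cong (a *_) (homEval-lift (suc m) n g l′)))
                     (trans (homEval-0∷ (m ℕ.+ n) (f *ₚ g)) (cong (u *_) (homEval-* m n f g l l′))) ⟩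
      a * (v ℤ.^ suc m * homEval n g) + u * (homEval m f * homEval n g)
        ≡⟨ homEval-*-eq a (v ℤ.^ suc m) (homEval n g) u (homEval m f) ⟩
      (a * v ℤ.^ suc m + u * homEval m f) * homEval n g ∎
      where
      open ≡-Reasoning

  length-+ₚ : ∀ {n} f g → length f ≤ n → length g ≤ n → length (f +ₚ g) ≤ n
  length-+ₚ []      g       l       l′       = l′
  length-+ₚ (a ∷ f) []      l       l′       = l
  length-+ₚ (a ∷ f) (b ∷ g) (s≤s l) (s≤s l′) = s≤s (length-+ₚ f g l l′)

  length-*ₚ : ∀ m n f g → length f ≤ suc m → length g ≤ suc n → length (f *ₚ g) ≤ suc (m ℕ.+ n)
  length-*ₚ m       n []          g _        l′ = z≤n
  length-*ₚ zero    n (a ∷ [])    g _        l′ =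
    length-+ₚ (map (a *_) g) (0ℤ ∷ []) (subst (_≤ suc n) (sym (length-map (a *_) g)) l′) (s≤s z≤n)
  length-*ₚ zero    n (a ∷ _ ∷ _) g (s≤s ()) l′
  length-*ₚ (suc m) n (a ∷ f)     g (s≤s l)  l′ = length-+ₚ (map (a *_) g) (0ℤ ∷ (f *ₚ g))
    (subst (_≤ suc (suc m ℕ.+ n)) (sym (length-map (a *_) g)) (ℕ.≤-trans l′ (s≤s (ℕ.m≤n+m n (suc m)))))
    (s≤s (length-*ₚ m n f g l l′))

  private
    homEval-entry-eq : ∀ a b u v → (0ℤ * a + 0ℤ + - b) * (v * 1ℤ) + u * (1ℤ * a + 0ℤ) ≡ u * a - v * b
    homEval-entry-eq = solve-∀

    module _ {n} (M : Matrix ℤ n) (u v : ℤ) where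

      entry : Fin n → Fin n → Poly
      entry i j = x *ₚ const (I i j) -ₚ const (M i j)

      value : Fin n → Fin n → ℤ
      value i j = u * I i j - v * M i j

      homEval-entry : ∀ i j → homEval u v 1 (entry i j) ≡ value i j
      homEval-entry i j = homEval-entry-eq (I i j) (M i j) u v

      ∏-entry : ∀ {k} (f g : Fin k → Fin n) →
        length (∏ ℤ[x] (λ i → entry (f i) (g i))) ≤ suc k ×
        homEval u v k (∏ ℤ[x] (λ i → entry (f i) (g i))) ≡ ∏ ℤ-raw (λ i → value (f i) (g i))
      ∏-entry {zero}  f g = s≤s z≤n , refl
      ∏-entry {suc k} f g with l , eq ← ∏-entry (f ∘ suc) (g ∘ suc) =
        length-*ₚ 1 k (entry (f zero) (g zero)) (∏ ℤ[x] (λ i → entry (f (suc i)) (g (suc i)))) (s≤s (s≤s z≤n)) l ,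
        trans (homEval-* u v 1 k (entry (f zero) (g zero)) (∏ ℤ[x] (λ i → entry (f (suc i)) (g (suc i)))) (s≤s (s≤s z≤n)) l)
              (cong₂ _*_ (homEval-entry (f zero) (g zero)) eq)

      Σentry : List (Permutation′ n) → Poly
      Σentry = foldr (λ σ s → ∏ ℤ[x] (λ i → entry i (σ ⟨$⟩ʳ i)) +ₚ s) []

      homEval-Σ : ∀ σs → length (Σentry σs) ≤ suc n ×
        homEval u v n (Σentry σs) ≡ foldr (λ σ s → ∏ ℤ-raw (λ i → value i (σ ⟨$⟩ʳ i)) + s) 0ℤ σs
      homEval-Σ []       = z≤n , refl
      homEval-Σ (σ ∷ σs) with l , eq ← homEval-Σ σs | l′ , eq′ ← ∏-entry (λ i → i) (σ ⟨$⟩ʳ_) =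
        length-+ₚ p (Σentry σs) l′ l ,
        trans (homEval-+ u v n p (Σentry σs)) (cong₂ _+_ eq′ eq)
        where
        p = ∏ ℤ[x] (λ i → entry i (σ ⟨$⟩ʳ i))

  length-π : ∀ {n} (M : Matrix ℤ n) → length (π M) ≤ suc n
  length-π {n} M = proj₁ (homEval-Σ M 0ℤ 0ℤ (permutations n))

  homEval-π : ∀ {n} (M : Matrix ℤ n) u v →
              homEval u v n (π M) ≡ per ℤ-raw (λ i j → u * I i j - v * M i j)
  homEval-π {n} M u v = proj₂ (homEval-Σ M u v (permutations n))

  coeff-long : ∀ f {k} → length f ≤ k → coeff f k ≡ 0ℤ
  coeff-long []      l       = refl
  coeff-long (a ∷ f) (s≤s l) = coeff-long f l

  private
    coeff-homEval-eq : ∀ a p → a * 0ℤ + 1ℤ * p ≡ p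
    coeff-homEval-eq = solve-∀

  coeff-homEval : ∀ n f → homEval 1ℤ 0ℤ n f ≡ coeff f n
  coeff-homEval n       []      = refl
  coeff-homEval zero    (a ∷ f) = refl
  coeff-homEval (suc n) (a ∷ f) = trans (coeff-homEval-eq a (homEval 1ℤ 0ℤ n f)) (coeff-homEval n f)

module Windows where

  open import Data.Integer.Base as ℤ using (ℤ; 0ℤ; 1ℤ; +_; _+_; _*_; _-_; -_; ∣_∣; _^_)
  open import Data.List.Base using (List; []; _∷_)
  open import Data.List.Relation.Unary.All using (All; []; _∷_)
  open import Data.Nat.Base as ℕ using (ℕ; zero; suc; _≤_; _∸_)
  open import Data.Vec.Base using (Vec; []; _∷_; zipWith; map; replicate)
  import Data.Vec.Relation.Unary.All as V

  eval : ∀ {w} → Vec ℤ w → ℤ → ℤ → ℤ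
  eval []       s z = z
  eval (c ∷ cs) s z = c + s * eval cs s z

  -- f s = sᴹ (c₀ + c₁ s + … ) up to a multiple of sᴹ⁺ʷ: since the cᵢ do not depend on
  -- the integer s, they behave like the coefficients of a power series.
  record Win {w} (M : ℕ) (cs : Vec ℤ w) (f : ℤ → ℤ) : Set where
    constructor win
    field at : ∀ s → ∃ λ z → f s ≡ s ^ M * eval cs s z
  open Win

  Hi : ℕ → (ℤ → ℤ) → Set
  Hi M f = Win M [] f

  win-ext : ∀ {w M} {cs : Vec ℤ w} {f g} → (∀ s → f s ≡ g s) → Win M cs f → Win M cs g
  win-ext eq (win h) = win λ s → proj₁ (h s) , trans (sym (eq s)) (proj₂ (h s))

  win-cs : ∀ {w M} {cs ds : Vec ℤ w} {f} → cs ≡ ds → Win M cs f → Win M ds f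
  win-cs refl h = h

  win-forget : ∀ {M} {a b c e} {f} → Win M (a ∷ b ∷ c ∷ e ∷ []) f → Win M (a ∷ b ∷ c ∷ []) f
  win-forget {e = e} (win h) = win λ s → e + s * proj₁ (h s) , proj₂ (h s)

  win-head : ∀ {M w} {a} {as : Vec ℤ w} {f} → Win M (a ∷ as) f → Win M (a ∷ []) f
  win-head {as = as} (win h) = win λ s → eval as s (proj₁ (h s)) , proj₂ (h s)

  win⇒Hi : ∀ {w M} {cs : Vec ℤ w} {f} → Win M cs f → Hi M f
  win⇒Hi {cs = cs} (win h) = win λ s → eval cs s (proj₁ (h s)) , proj₂ (h s)

  private
    eval-+-eq : ∀ c d s p q → c + d + s * (p + q) ≡ c + s * p + (d + s * q)
    eval-+-eq = solve-∀

  eval-+ : ∀ {w} (cs ds : Vec ℤ w) s y z → eval (zipWith _+_ cs ds) s (y + z) ≡ eval cs s y + eval ds s z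
  eval-+ []       []       s y z = refl
  eval-+ (c ∷ cs) (d ∷ ds) s y z = trans (cong (λ t → c + d + s * t) (eval-+ cs ds s y z))
    (eval-+-eq c d s (eval cs s y) (eval ds s z))

  infixl 6 _⊞_
  _⊞_ : ∀ {w M} {cs ds : Vec ℤ w} {f g} → Win M cs f → Win M ds g → Win M (zipWith _+_ cs ds) (λ s → f s + g s)
  _⊞_ {M = M} {cs} {ds} (win h) (win k) = win λ s → let y , p = h s; z , q = k s in
    y + z , trans (cong₂ _+_ p q) (trans (sym (ℤ.*-distribˡ-+ (s ^ M) (eval cs s y) (eval ds s z)))
      (cong (s ^ M *_) (sym (eval-+ cs ds s y z))))

  private
    eval-scale-eq : ∀ k c s p → k * c + s * (k * p) ≡ k * (c + s * p)
    eval-scale-eq = solve-∀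

  eval-scale : ∀ {w} k (cs : Vec ℤ w) s z → eval (map (k *_) cs) s (k * z) ≡ k * eval cs s z
  eval-scale k []       s z = refl
  eval-scale k (c ∷ cs) s z = trans (cong (λ t → k * c + s * t) (eval-scale k cs s z)) (eval-scale-eq k c s (eval cs s z))

  infixr 7 _⊡_
  private
    aux-eq : ∀ k t u → k * (t * u) ≡ t * (k * u)
    aux-eq = solve-∀

  _⊡_ : ∀ {w M} {cs : Vec ℤ w} {f} k → Win M cs f → Win M (map (k *_) cs) (λ s → k * f s)
  _⊡_ {M = M} {cs} k (win h) = win λ s → let z , p = h s in
    k * z , trans (cong (k *_) p) (trans (aux-eq k (s ^ M) (eval cs s z)) (cong (s ^ M *_) (sym (eval-scale k cs s z))))

  private
    Hi-*-eq : ∀ a y b z → a * y * (b * z) ≡ a * b * (y * z)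
    Hi-*-eq = solve-∀

  Hi-* : ∀ {M N f g} → Hi M f → Hi N g → Hi (M ℕ.+ N) (λ s → f s * g s)
  Hi-* {M} {N} (win h) (win k) = win λ s → let y , p = h s; z , q = k s in
    y * z , trans (cong₂ _*_ p q) (trans (Hi-*-eq (s ^ M) y (s ^ N) z) (cong (_* (y * z)) (sym (ℤ.^-distribˡ-+-* s M N))))

  Hi-0 : ∀ f → Hi 0 f
  Hi-0 f = win λ s → f s , sym (ℤ.*-identityˡ _)

  Hi-pow : ∀ n → Hi n (_^ n)
  Hi-pow n = win λ s → 1ℤ , sym (ℤ.*-identityʳ _)

  Hi-*ˡ : ∀ {M g} (f : ℤ → ℤ) → Hi M g → Hi M (λ s → f s * g s)
  Hi-*ˡ {g = g} f h = Hi-* {f = f} {g = g} (Hi-0 f) h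

  Hi-*ʳ : ∀ {M f} (g : ℤ → ℤ) → Hi M f → Hi M (λ s → f s * g s)
  Hi-*ʳ {M} g (win h) = win λ s → proj₁ (h s) * g s ,
    trans (cong (_* g s) (proj₂ (h s))) (ℤ.*-assoc (s ^ M) (proj₁ (h s)) (g s))

  Hi-≤ : ∀ {M N f} → N ≤ M → Hi M f → Hi N f
  Hi-≤ {M} {N} {f} N≤M (win h) = win λ s → let z , p = h s in
    s ^ (M ∸ N) * z ,
    trans p (trans (cong (λ k → s ^ k * z) (sym (ℕ.m+[n∸m]≡n N≤M)))
      (trans (cong (_* z) (ℤ.^-distribˡ-+-* s N (M ∸ N))) (ℤ.*-assoc (s ^ N) _ z)))

  eval-0 : ∀ w s z → eval (replicate w 0ℤ) s z ≡ s ^ w * z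
  eval-0 zero    s z = sym (ℤ.*-identityˡ z)
  eval-0 (suc w) s z = trans (ℤ.+-identityˡ _) (trans (cong (s *_) (eval-0 w s z)) (sym (ℤ.*-assoc s (s ^ w) z)))

  Hi⇒win : ∀ w {M N f} → M ℕ.+ w ≤ N → Hi N f → Win M (replicate w 0ℤ) f
  Hi⇒win w {M} le h with win k ← Hi-≤ le h = win λ s → let z , p = k s in
    z , trans p (trans (cong (_* z) (ℤ.^-distribˡ-+-* s M w))
      (trans (ℤ.*-assoc (s ^ M) (s ^ w) z) (cong (s ^ M *_) (sym (eval-0 w s z)))))

  private
    neg-shape : ∀ x y → x + y + - y ≡ x
    neg-shape = solve-∀

    small-multiple : ∀ c z → c + (+ suc ∣ c ∣) * z ≡ 0ℤ → c ≡ 0ℤ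
    small-multiple c z eq = go ∣ z ∣ refl
      where
      neg : ∀ x y → x + y ≡ 0ℤ → x ≡ - y
      neg x y e = trans (sym (neg-shape x y)) (trans (cong (_+ - y) e) (ℤ.+-identityˡ (- y)))
      abs : ∣ c ∣ ≡ suc ∣ c ∣ ℕ.* ∣ z ∣
      abs = trans (cong ∣_∣ (neg c ((+ suc ∣ c ∣) * z) eq))
        (trans (ℤ.∣-i∣≡∣i∣ ((+ suc ∣ c ∣) * z)) (ℤ.abs-* (+ suc ∣ c ∣) z))
      go : ∀ k → ∣ z ∣ ≡ k → c ≡ 0ℤ
      go zero    e = ℤ.∣i∣≡0⇒i≡0 (trans abs (trans (cong (suc ∣ c ∣ ℕ.*_) e) (ℕ.*-zeroʳ (suc ∣ c ∣))))
      go (suc k) e = contradiction (ℕ.≤-trans (ℕ.m≤m*n (suc ∣ c ∣) (suc k))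
        (ℕ.≤-reflexive (sym (trans abs (cong (suc ∣ c ∣ ℕ.*_) e))))) (ℕ.<-irrefl refl)

    ^-nonzero : ∀ k M {y} → (+ suc k) ^ M * y ≡ 0ℤ → y ≡ 0ℤ
    ^-nonzero k zero    eq = trans (sym (ℤ.*-identityˡ _)) eq
    ^-nonzero k (suc M) {y} eq with ℤ.i*j≡0⇒i≡0∨j≡0 (+ suc k) (trans (sym (ℤ.*-assoc (+ suc k) ((+ suc k) ^ M) y)) eq)
    ... | inj₂ eq′ = ^-nonzero k M eq′

    win-zero-shift : ∀ s t u → t * (0ℤ + s * u) ≡ s * t * u
    win-zero-shift = solve-∀

  win-zero : ∀ {w M} {cs : Vec ℤ w} {f} → (∀ s → f s ≡ 0ℤ) → Win M cs f → V.All (_≡ 0ℤ) cs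
  win-zero {cs = []}     eq h = V.[]
  win-zero {M = M} {cs = c ∷ cs} {f} eq (win h) = c≡0 V.∷ win-zero {M = suc M} eq (win λ s → let z , p = h s in
    z , trans p (trans (cong (λ c → s ^ M * (c + s * eval cs s z)) c≡0) (win-zero-shift s (s ^ M) (eval cs s z))))
    where
    c≡0 : c ≡ 0ℤ
    c≡0 = let s = + suc ∣ c ∣; z , p = h s in
      small-multiple c (eval cs s z) (^-nonzero ∣ c ∣ M (trans (sym p) (eq s)))

  δ : ℕ → ℕ → ℕ
  δ zero    zero    = 1
  δ zero    (suc _) = 0
  δ (suc _) zero    = 0
  δ (suc i) (suc j) = δ i j

  win-pow : ∀ {M n} → M ≤ n → let k = n ∸ M in
            Win M (+ δ k 0 ∷ + δ k 1 ∷ + δ k 2 ∷ + δ k 3 ∷ []) (_^ n)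
  win-pow {M} {n} M≤n = win λ s → let z , p = go s (n ∸ M) in
    z , trans (cong (s ^_) (sym (ℕ.m+[n∸m]≡n M≤n)))
          (trans (ℤ.^-distribˡ-+-* s M (n ∸ M)) (cong (s ^ M *_) p))
    where
    go : ∀ s k → ∃ λ z → s ^ k ≡ eval (+ δ k 0 ∷ + δ k 1 ∷ + δ k 2 ∷ + δ k 3 ∷ []) s z
    go s 0 = 0ℤ , eq s
      where eq : ∀ s → 1ℤ ≡ 1ℤ + s * (0ℤ + s * (0ℤ + s * (0ℤ + s * 0ℤ)))
            eq = solve-∀
    go s 1 = 0ℤ , eq s
      where eq : ∀ s → s * 1ℤ ≡ 0ℤ + s * (1ℤ + s * (0ℤ + s * (0ℤ + s * 0ℤ)))
            eq = solve-∀
    go s 2 = 0ℤ , eq s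
      where eq : ∀ s → s * (s * 1ℤ) ≡ 0ℤ + s * (0ℤ + s * (1ℤ + s * (0ℤ + s * 0ℤ)))
            eq = solve-∀
    go s 3 = 0ℤ , eq s
      where eq : ∀ s → s * (s * (s * 1ℤ)) ≡ 0ℤ + s * (0ℤ + s * (0ℤ + s * (1ℤ + s * 0ℤ)))
            eq = solve-∀
    go s (suc (suc (suc (suc k)))) = s ^ k , eq s (s ^ k)
      where eq : ∀ s t → s * (s * (s * (s * t))) ≡ 0ℤ + s * (0ℤ + s * (0ℤ + s * (0ℤ + s * t)))
            eq = solve-∀

  Σpow : List ℕ → ℤ → ℤ
  Σpow []       s = 0ℤ
  Σpow (n ∷ ns) s = s ^ n + Σpow ns s

  count : ℕ → List ℕ → ℕ → ℕ
  count M []       j = 0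
  count M (n ∷ ns) j = δ (n ∸ M) j ℕ.+ count M ns j

  counts : ℕ → List ℕ → Vec ℤ 4
  counts M ns = + count M ns 0 ∷ + count M ns 1 ∷ + count M ns 2 ∷ + count M ns 3 ∷ []

  win-Σpow : ∀ {M ns} → All (M ≤_) ns → Win M (counts M ns) (Σpow ns)
  win-Σpow {M} []     = Hi⇒win 4 ℕ.≤-refl (win λ s → 0ℤ , sym (ℤ.*-zeroʳ (s ^ (M ℕ.+ 4))))
  win-Σpow (le ∷ les) = win-pow le ⊞ win-Σpow les

  private
    win-quadratic-eq : ∀ s z t a b n₀ n₁ n₂ n₃ →
      (1ℤ + a * s + b * (s * s)) * (t * (n₀ + s * (n₁ + s * (n₂ + s * (n₃ + s * z))))) ≡
      t * (n₀ + s * (a * n₀ + n₁ + s * (b * n₀ + a * n₁ + n₂ + s * (b * n₁ + a * n₂ + n₃ + s *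
      ((1ℤ + a * s + b * (s * s)) * z + (b * n₂ + a * n₃) + s * (b * n₃))))))
    win-quadratic-eq = solve-∀

  win-quadratic : ∀ {M} a b {n₀ n₁ n₂ n₃} {f : ℤ → ℤ} → Win M (n₀ ∷ n₁ ∷ n₂ ∷ n₃ ∷ []) f →
    Win M (n₀ ∷ a * n₀ + n₁ ∷ b * n₀ + a * n₁ + n₂ ∷ b * n₁ + a * n₂ + n₃ ∷ []) (λ s → (1ℤ + a * s + b * (s * s)) * f s)
  win-quadratic {M} a b {n₀} {n₁} {n₂} {n₃} (win h) = win λ s → let z , p = h s in
    (1ℤ + a * s + b * (s * s)) * z + (b * n₂ + a * n₃) + s * (b * n₃) ,
    trans (cong ((1ℤ + a * s + b * (s * s)) *_) p) (win-quadratic-eq s z (s ^ M) a b n₀ n₁ n₂ n₃)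

  private
    coefficients : ∀ {a b c a′ b′ c′ n : ℤ} → a ≡ a′ → b ≡ b′ → c ≡ c′ →
      _≡_ {A = Vec ℤ 4} (n ∷ a ∷ b ∷ c ∷ []) (n ∷ a′ ∷ b′ ∷ c′ ∷ [])
    coefficients refl refl refl = refl

    win-D-eq₁ : ∀ n₀ n₁ → 1ℤ * n₀ + (0ℤ * n₀ + n₁) ≡ n₀ + n₁
    win-D-eq₁ = solve-∀

    win-D-eq₂ : ∀ n₀ n₁ n₂ → + 2 * n₀ + 1ℤ * (0ℤ * n₀ + n₁) + (1ℤ * n₀ + 0ℤ * n₁ + n₂) ≡ + 3 * n₀ + n₁ + n₂
    win-D-eq₂ = solve-∀

    win-D-eq₃ : ∀ n₀ n₁ n₂ n₃ → + 2 * (0ℤ * n₀ + n₁) + 1ℤ * (1ℤ * n₀ + 0ℤ * n₁ + n₂) + (1ℤ * n₁ + 0ℤ * n₂ + n₃) ≡ n₀ + + 3 * n₁ + n₂ + n₃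
    win-D-eq₃ = solve-∀

    win-D-eq : ∀ s f → (1ℤ + 1ℤ * s + + 2 * (s * s)) * ((1ℤ + 0ℤ * s + 1ℤ * (s * s)) * f) ≡ (1ℤ + s + + 2 * (s * s)) * (1ℤ + s * s) * f
    win-D-eq = solve-∀

    win-T-eq₁ : ∀ n₀ n₁ → 0ℤ * n₀ + (0ℤ * n₀ + n₁) ≡ n₁
    win-T-eq₁ = solve-∀

    win-T-eq₂ : ∀ n₀ n₁ n₂ → 1ℤ * n₀ + 0ℤ * (0ℤ * n₀ + n₁) + (1ℤ * n₀ + 0ℤ * n₁ + n₂) ≡ + 2 * n₀ + n₂
    win-T-eq₂ = solve-∀

    win-T-eq₃ : ∀ n₀ n₁ n₂ n₃ → 1ℤ * (0ℤ * n₀ + n₁) + 0ℤ * (1ℤ * n₀ + 0ℤ * n₁ + n₂) + (1ℤ * n₁ + 0ℤ * n₂ + n₃) ≡ + 2 * n₁ + n₃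
    win-T-eq₃ = solve-∀

    win-T-eq : ∀ s f → (1ℤ + 0ℤ * s + 1ℤ * (s * s)) * ((1ℤ + 0ℤ * s + 1ℤ * (s * s)) * f) ≡ (1ℤ + s * s) * (1ℤ + s * s) * f
    win-T-eq = solve-∀

    win-K-eq₁ : ∀ n₀ n₁ → 1ℤ * n₀ + (1ℤ * n₀ + n₁) ≡ + 2 * n₀ + n₁
    win-K-eq₁ = solve-∀

    win-K-eq₂ : ∀ n₀ n₁ n₂ → + 2 * n₀ + 1ℤ * (1ℤ * n₀ + n₁) + (+ 2 * n₀ + 1ℤ * n₁ + n₂) ≡ + 5 * n₀ + + 2 * n₁ + n₂
    win-K-eq₂ = solve-∀

    win-K-eq₃ : ∀ n₀ n₁ n₂ n₃ → + 2 * (1ℤ * n₀ + n₁) + 1ℤ * (+ 2 * n₀ + 1ℤ * n₁ + n₂) + (+ 2 * n₁ + 1ℤ * n₂ + n₃) ≡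
      + 4 * n₀ + + 5 * n₁ + + 2 * n₂ + n₃
    win-K-eq₃ = solve-∀

    win-K-eq : ∀ s f → (1ℤ + 1ℤ * s + + 2 * (s * s)) * ((1ℤ + 1ℤ * s + + 2 * (s * s)) * f) ≡
      (1ℤ + s + + 2 * (s * s)) * (1ℤ + s + + 2 * (s * s)) * f
    win-K-eq = solve-∀

    win-P-eq : ∀ s f → (1ℤ + + 2 * s + 1ℤ * (s * s)) * f ≡ (1ℤ + s) * (1ℤ + s) * f
    win-P-eq = solve-∀

    win-U-eq : ∀ s z y κ t n₀ n₁ n₂ n₃ →
      1ℤ * (1ℤ + s * (+ 2 + s * (κ + s * y))) * (t * (n₀ + s * (n₁ + s * (n₂ + s * (n₃ + s * z))))) ≡
      t * (n₀ + s * (+ 2 * n₀ + n₁ + s * (κ * n₀ + + 2 * n₁ + n₂ + s *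
       (y * (n₀ + s * (n₁ + s * (n₂ + s * (n₃ + s * z)))) + (n₃ + s * z) * (1ℤ + + 2 * s + κ * (s * s))
        + (κ * n₁ + + 2 * n₂) + s * (κ * n₂)))))
    win-U-eq = solve-∀

  module _ {M : ℕ} {n₀ n₁ n₂ n₃ : ℤ} {f : ℤ → ℤ} (h : Win M (n₀ ∷ n₁ ∷ n₂ ∷ n₃ ∷ []) f) where

    win-D : Win M (n₀ ∷ n₀ + n₁ ∷ + 3 * n₀ + n₁ + n₂ ∷ n₀ + + 3 * n₁ + n₂ + n₃ ∷ [])
                (λ s → (1ℤ + s + + 2 * (s * s)) * (1ℤ + s * s) * f s)
    win-D = win-cs (coefficients (win-D-eq₁ n₀ n₁) (win-D-eq₂ n₀ n₁ n₂) (win-D-eq₃ n₀ n₁ n₂ n₃))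
      (win-ext (λ s → win-D-eq s (f s)) (win-quadratic 1ℤ (+ 2) (win-quadratic 0ℤ 1ℤ h)))

    win-T : Win M (n₀ ∷ n₁ ∷ + 2 * n₀ + n₂ ∷ + 2 * n₁ + n₃ ∷ [])
                (λ s → (1ℤ + s * s) * (1ℤ + s * s) * f s)
    win-T = win-cs (coefficients (win-T-eq₁ n₀ n₁) (win-T-eq₂ n₀ n₁ n₂) (win-T-eq₃ n₀ n₁ n₂ n₃))
      (win-ext (λ s → win-T-eq s (f s)) (win-quadratic 0ℤ 1ℤ (win-quadratic 0ℤ 1ℤ h)))

    win-K : Win M (n₀ ∷ + 2 * n₀ + n₁ ∷ + 5 * n₀ + + 2 * n₁ + n₂ ∷ + 4 * n₀ + + 5 * n₁ + + 2 * n₂ + n₃ ∷ [])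
                (λ s → (1ℤ + s + + 2 * (s * s)) * (1ℤ + s + + 2 * (s * s)) * f s)
    win-K = win-cs (coefficients (win-K-eq₁ n₀ n₁) (win-K-eq₂ n₀ n₁ n₂) (win-K-eq₃ n₀ n₁ n₂ n₃))
      (win-ext (λ s → win-K-eq s (f s)) (win-quadratic 1ℤ (+ 2) (win-quadratic 1ℤ (+ 2) h)))

    win-P : Win M (n₀ ∷ + 2 * n₀ + n₁ ∷ n₀ + + 2 * n₁ + n₂ ∷ n₁ + + 2 * n₂ + n₃ ∷ [])
                (λ s → (1ℤ + s) * (1ℤ + s) * f s)
    win-P = win-cs (coefficients refl (cong (λ t → t + + 2 * n₁ + n₂) (ℤ.*-identityˡ n₀)) (cong (λ t → t + + 2 * n₂ + n₃) (ℤ.*-identityˡ n₁)))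
      (win-ext (λ s → win-P-eq s (f s)) (win-quadratic (+ 2) 1ℤ h))

    -- Multiplication by a function with a known initial segment 1 + 2 s + κ s².
    win-U : ∀ {κ g} → Win 0 (1ℤ ∷ + 2 ∷ κ ∷ []) g →
            Win M (n₀ ∷ + 2 * n₀ + n₁ ∷ κ * n₀ + + 2 * n₁ + n₂ ∷ []) (λ s → g s * f s)
    win-U {κ} {g} k = win λ s → let z , p = at h s; y , q = at k s in
      (y * (n₀ + s * (n₁ + s * (n₂ + s * (n₃ + s * z)))) + (n₃ + s * z) * (1ℤ + + 2 * s + κ * (s * s))
        + (κ * n₁ + + 2 * n₂) + s * (κ * n₂)) ,
      trans (cong₂ _*_ q p) (win-U-eq s z y κ (s ^ M) n₀ n₁ n₂ n₃)

module ShapeFunctions where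

  open import Data.Integer.Base as ℤ using (ℤ; 0ℤ; 1ℤ; +_; _+_; _*_; _-_; -_; _^_)
  open import Data.List.Base using (List; []; _∷_)
  open import Data.List.Relation.Unary.All using (All; []; _∷_)
  open import Data.Nat.Base as ℕ using (ℕ; zero; suc; z≤n; s≤s; _≤_)
  open import Data.Vec.Base using ([]; _∷_)
  open Windows

  x₀ y₀ : ℤ → ℤ
  x₀ s = 1ℤ + s + + 2 * (s * s)
  y₀ s = s + s * s

  W : ℕ → ℤ → ℤ
  W n s = (- (s * s)) ^ n

  X Y : ℕ → ℤ → ℤ
  X p s = x₀ s + + 2 * ((1ℤ + s * s) * s ^ p) + W p s * (1ℤ - s)
  Y p s = y₀ s + + 2 * ((1ℤ + s * s) * s ^ p) + W p s * (+ 2 - s + s * s)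

  -- Up to the substitution in WalkPermanent.M, (1 + s²)³ per (xI − Q) is dumbbell p q e s for two cycles
  -- joined by a path with e edges, and θ a b c s for three paths with a, b, c edges and common ends;
  -- the factors in cycles are per (xI − Q) itself.
  dumbbell : ℕ → ℕ → ℕ → ℤ → ℤ
  dumbbell p q e s = X p s * X q s - W e s * (Y p s * Y q s)

  θ : ℕ → ℕ → ℕ → ℤ → ℤ
  θ a b c s = x₀ s * x₀ s - y₀ s * y₀ s * (W a s + W b s + W c s)
    + (1ℤ - s) * (1ℤ - s) * (W a s * W b s + W a s * W c s + W b s * W c s)
    - (+ 2 - s + s * s) * (+ 2 - s + s * s) * (W a s * W b s * W c s)
    + + 2 * ((1ℤ + s * s) * (1ℤ + s * s) * (s ^ (a ℕ.+ b) * (1ℤ - W c s) + s ^ (a ℕ.+ c) * (1ℤ - W b s)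
                                            + s ^ (b ℕ.+ c) * (1ℤ - W a s)))

  cycles : List ℕ → ℤ → ℤ
  cycles []       s = 1ℤ
  cycles (k ∷ ks) s = (1ℤ + + 2 * s ^ k + W k s) * cycles ks s

  sg : ℕ → ℤ
  sg zero    = 1ℤ
  sg (suc n) = - sg n

  private
    W-sg-eq : ∀ s g t → - (s * s) * (g * t) ≡ - g * (s * (s * t))
    W-sg-eq = solve-∀

  W-sg : ∀ n s → W n s ≡ sg n * s ^ (n ℕ.+ n)
  W-sg zero    s = refl
  W-sg (suc n) s rewrite ℕ.+-suc n n = trans (cong (- (s * s) *_) (W-sg n s)) (W-sg-eq s (sg n) (s ^ (n ℕ.+ n)))

  Hi-W : ∀ n → Hi (n ℕ.+ n) (W n)
  Hi-W n = win-ext (λ s → sym (W-sg n s)) (Hi-*ˡ (λ _ → sg n) (Hi-pow (n ℕ.+ n)))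

  infixl 6 _⊕_
  _⊕_ : ∀ {M f g} → Hi M f → Hi M g → Hi M (λ s → f s + g s)
  _⊕_ = _⊞_

  neg : ∀ {M f} → Hi M f → Hi M (λ s → - f s)
  neg {f = f} h = win-ext (λ s → ℤ.-1*i≡-i (f s)) (- 1ℤ ⊡ h)

  double : ∀ {M p} → M ≤ p → M ℕ.+ M ≤ p ℕ.+ p
  double le = ℕ.+-mono-≤ le le

  X-expand : ∀ {M} p → M ≤ p → ∃ λ R → Hi (M ℕ.+ M) R ×
             (∀ s → X p s ≡ x₀ s + + 2 * ((1ℤ + s * s) * s ^ p) + R s)
  X-expand p le = (λ s → W p s * (1ℤ - s)) , Hi-*ʳ (λ s → 1ℤ - s) (Hi-≤ (double le) (Hi-W p)) , λ s → refl

  private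
    Hi-X-eq : ∀ x u v → u + v ≡ x + u + v - x
    Hi-X-eq = solve-∀

  Hi-X : ∀ {M} p → M ≤ p → Hi M (λ s → X p s - x₀ s)
  Hi-X {M} p le = win-ext (λ s → Hi-X-eq (x₀ s) (+ 2 * ((1ℤ + s * s) * s ^ p)) (W p s * (1ℤ - s)))
    (Hi-*ˡ (λ _ → + 2) (Hi-*ˡ (λ s → 1ℤ + s * s) (Hi-≤ le (Hi-pow p)))
     ⊕ Hi-*ʳ (λ s → 1ℤ - s) (Hi-≤ (ℕ.≤-trans le (ℕ.m≤m+n p p)) (Hi-W p)))

  private
    Hi-Y-eq : ∀ x u v → u + v ≡ x + u + v - x
    Hi-Y-eq = solve-∀

  Hi-Y : ∀ {M} p → M ≤ p → Hi M (λ s → Y p s - y₀ s)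
  Hi-Y {M} p le = win-ext (λ s → Hi-Y-eq (y₀ s) (+ 2 * ((1ℤ + s * s) * s ^ p)) (W p s * (+ 2 - s + s * s)))
    (Hi-*ˡ (λ _ → + 2) (Hi-*ˡ (λ s → 1ℤ + s * s) (Hi-≤ le (Hi-pow p)))
     ⊕ Hi-*ʳ (λ s → + 2 - s + s * s) (Hi-≤ (ℕ.≤-trans le (ℕ.m≤m+n p p)) (Hi-W p)))

  private
    XX-expand-poly : ∀ x t u v r r′ → (x + + 2 * (t * u) + r) * (x + + 2 * (t * v) + r′) ≡
           x * x + + 2 * (x * t * (u + (v + 0ℤ))) +
           (x * r + x * r′ + ((x + + 2 * (t * u) + r) - x) * ((x + + 2 * (t * v) + r′) - x))
    XX-expand-poly = solve-∀

  XX-expand : ∀ {M} p q → M ≤ p → M ≤ q → ∃ λ R → Hi (M ℕ.+ M) R ×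
    (∀ s → X p s * X q s ≡ x₀ s * x₀ s + + 2 * (x₀ s * (1ℤ + s * s) * Σpow (p ∷ q ∷ []) s) + R s)
  XX-expand {M} p q lp lq with Rp , hp , ep ← X-expand p lp | Rq , hq , eq ← X-expand q lq =
    (λ s → x₀ s * Rp s + x₀ s * Rq s + (X p s - x₀ s) * (X q s - x₀ s)) ,
    Hi-*ˡ x₀ hp ⊕ Hi-*ˡ x₀ hq ⊕ Hi-* (Hi-X p lp) (Hi-X q lq) ,
    λ s → shape (x₀ s) (1ℤ + s * s) (s ^ p) (s ^ q) (Rp s) (Rq s) (ep s) (eq s)
    where
    shape : ∀ x t u v r r′ {a b} → a ≡ x + + 2 * (t * u) + r → b ≡ x + + 2 * (t * v) + r′ →
            a * b ≡ x * x + + 2 * (x * t * (u + (v + 0ℤ))) + (x * r + x * r′ + (a - x) * (b - x))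
    shape x t u v r r′ refl refl = XX-expand-poly x t u v r r′

  private
    cycles-expand-poly : ∀ u w S r → (1ℤ + + 2 * u + w) * (1ℤ + + 2 * S + r) ≡
           1ℤ + + 2 * (u + S) + (r + w + (+ 2 * u + w) * (+ 2 * S + r))
    cycles-expand-poly = solve-∀

  cycles-expand : ∀ {M} ks → All (M ≤_) ks → ∃ λ R → Hi (M ℕ.+ M) R ×
    (∀ s → cycles ks s ≡ 1ℤ + + 2 * Σpow ks s + R s)
  cycles-expand {M} []       []         = (λ s → 0ℤ) , win (λ s → 0ℤ , sym (ℤ.*-zeroʳ (s ^ (M ℕ.+ M)))) , λ s → refl
  cycles-expand {M} (k ∷ ks) (le ∷ les) with R , h , eq ← cycles-expand ks les =
    (λ s → R s + W k s + (+ 2 * s ^ k + W k s) * (+ 2 * Σpow ks s + R s)) ,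
    h ⊕ hW ⊕ Hi-* (Hi-*ˡ (λ _ → + 2) (Hi-≤ le (Hi-pow k)) ⊕ Hi-≤ (ℕ.m≤m+n M M) hW)
                  (Hi-*ˡ (λ _ → + 2) (win⇒Hi (win-Σpow les)) ⊕ Hi-≤ (ℕ.m≤m+n M M) h) ,
    λ s → trans (cong ((1ℤ + + 2 * s ^ k + W k s) *_) (eq s)) (cycles-expand-poly (s ^ k) (W k s) (Σpow ks s) (R s))
    where
    hW : Hi (M ℕ.+ M) (W k)
    hW = Hi-≤ (double le) (Hi-W k)

  θ-pairs : ℕ → ℕ → ℕ → List ℕ
  θ-pairs a b c = a ℕ.+ b ∷ a ℕ.+ c ∷ b ℕ.+ c ∷ []

  private
    θ-expand-four : ∀ a b c → a ℕ.+ b ℕ.+ (a ℕ.+ c) ≡ b ℕ.+ c ℕ.+ (a ℕ.+ a)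
    θ-expand-four = ℕ-solve-∀

    θ-expand-poly : ∀ x y k l t A B C u v w →
      x - y * (A + B + C) + k * (A * B + A * C + B * C) - l * (A * B * C)
        + + 2 * (t * (u * (1ℤ - C) + v * (1ℤ - B) + w * (1ℤ - A))) ≡
      x + + 2 * (t * (u + (v + (w + 0ℤ)))) - y * (A + B + C)
        + (k * (A * B + A * C + B * C) + - (l * (A * B * C)) + - ((+ 2 * t) * (u * C + v * B + w * A)))
    θ-expand-poly = solve-∀

  θ-expand : ∀ {M} a b c → a ≤ b → b ≤ c → M ≤ a ℕ.+ b → ∃ λ R → Hi (M ℕ.+ M) R ×
    (∀ s → θ a b c s ≡ x₀ s * x₀ s + + 2 * ((1ℤ + s * s) * (1ℤ + s * s) * Σpow (θ-pairs a b c) s)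
                       - y₀ s * y₀ s * (W a s + W b s + W c s) + R s)
  θ-expand {M} a b c a≤b b≤c le =
    (λ s → (1ℤ - s) * (1ℤ - s) * (W a s * W b s + W a s * W c s + W b s * W c s)
         + - ((+ 2 - s + s * s) * (+ 2 - s + s * s) * (W a s * W b s * W c s))
         + - ((+ 2 * ((1ℤ + s * s) * (1ℤ + s * s))) *
              (s ^ (a ℕ.+ b) * W c s + s ^ (a ℕ.+ c) * W b s + s ^ (b ℕ.+ c) * W a s))) ,
    Hi-*ˡ (λ s → (1ℤ - s) * (1ℤ - s)) (hab ⊕ hac ⊕ hbc)
      ⊕ neg (Hi-*ˡ (λ s → (+ 2 - s + s * s) * (+ 2 - s + s * s)) (Hi-*ʳ (W c) hab))
      ⊕ neg (Hi-*ˡ (λ s → + 2 * ((1ℤ + s * s) * (1ℤ + s * s))) (h₁ ⊕ h₂ ⊕ h₃)) ,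
    λ s → θ-expand-poly (x₀ s * x₀ s) (y₀ s * y₀ s) ((1ℤ - s) * (1ℤ - s)) ((+ 2 - s + s * s) * (+ 2 - s + s * s))
               ((1ℤ + s * s) * (1ℤ + s * s)) (W a s) (W b s) (W c s) (s ^ (a ℕ.+ b)) (s ^ (a ℕ.+ c)) (s ^ (b ℕ.+ c))
    where
    a≤c = ℕ.≤-trans a≤b b≤c
    bound : ∀ {m n} → a ℕ.+ b ≤ m → a ℕ.+ b ≤ n → M ℕ.+ M ≤ m ℕ.+ n
    bound p q = ℕ.+-mono-≤ (ℕ.≤-trans le p) (ℕ.≤-trans le q)
    regroup : ∀ x y → x ℕ.+ x ℕ.+ (y ℕ.+ y) ≡ x ℕ.+ y ℕ.+ (x ℕ.+ y)
    regroup x y = trans (ℕ.+-assoc x x (y ℕ.+ y)) (trans (cong (x ℕ.+_) (trans (sym (ℕ.+-assoc x y y))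
      (trans (cong (ℕ._+ y) (ℕ.+-comm x y)) (ℕ.+-assoc y x y)))) (sym (ℕ.+-assoc x y (x ℕ.+ y))))
    pair : ∀ {m n} → a ℕ.+ b ≤ m ℕ.+ n → Hi (M ℕ.+ M) (λ s → W m s * W n s)
    pair {m} {n} l = Hi-≤ (subst (M ℕ.+ M ≤_) (sym (regroup m n)) (bound l l)) (Hi-* (Hi-W m) (Hi-W n))
    ab≤ac = ℕ.+-monoʳ-≤ a b≤c
    ab≤bc = ℕ.+-mono-≤ a≤b b≤c
    hab = pair {a} {b} ℕ.≤-refl
    hac = pair {a} {c} ab≤ac
    hbc = pair {b} {c} ab≤bc
    h₁ = Hi-≤ (bound ℕ.≤-refl (ℕ.+-mono-≤ a≤c b≤c)) (Hi-* (Hi-pow (a ℕ.+ b)) (Hi-W c))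
    h₂ = Hi-≤ (bound ab≤ac (ℕ.+-monoˡ-≤ b a≤b)) (Hi-* (Hi-pow (a ℕ.+ c)) (Hi-W b))
    h₃ = Hi-≤ (subst (M ℕ.+ M ≤_) (θ-expand-four a b c) (bound ℕ.≤-refl ab≤ac)) (Hi-* (Hi-pow (b ℕ.+ c)) (Hi-W a))

  private
    win-T′-poly′ : ∀ s t n₀ n₁ n₂ n₃ z →
      (1ℤ + s * s) * (t * (n₀ + s * (n₁ + s * (n₂ + s * (n₃ + s * z))))) ≡
      t * (n₀ + s * (n₁ + s * (n₀ + n₂ + s * (n₁ + n₃ + s * (n₂ + z + s * n₃ + s * s * z)))))
    win-T′-poly′ = solve-∀

    Y-unit-neg1 : ∀ s → - s ≡ s * 1ℤ * - 1ℤ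
    Y-unit-neg1 = solve-∀

    Y-unit-base : ∀ s → 1ℤ + s ≡ 1ℤ * (1ℤ + s * (1ℤ + s * (0ℤ + s * 0ℤ)))
    Y-unit-base = solve-∀

    Y-unit-tidy : ∀ d → 0ℤ + + 2 * d + 0ℤ ≡ + 2 * d
    Y-unit-tidy = solve-∀

    Y-unit-shape : ∀ s t w → s + s * s + + 2 * ((1ℤ + s * s) * (s * (s * (s * t)))) + - (s * s) * w * (+ 2 - s + s * s) ≡
            s * (1ℤ + s + + 2 * ((1ℤ + s * s) * (s * (s * t))) + - s * (w * (+ 2 - s + s * s)))
    Y-unit-shape = solve-∀

    Y-unit : ∀ p → 3 ≤ p → ∃ λ V → ∃ λ κ → Win 0 (1ℤ ∷ 1ℤ ∷ κ ∷ []) V × (∀ s → Y p s ≡ s * V s)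
    Y-unit 1 (s≤s ())
    Y-unit 2 (s≤s (s≤s ()))
    Y-unit (suc (suc (suc p))) _ =
      (λ s → 1ℤ + s + + 2 * ((1ℤ + s * s) * (s * (s * s ^ p)))
             + - s * (W (suc (suc p)) s * (+ 2 - s + s * s))) ,
      + 2 * + δ p 0 ,
      win-cs (cong (λ k → 1ℤ ∷ 1ℤ ∷ k ∷ []) (Y-unit-tidy (+ δ p 0)))
        (win {M = 0} {cs = 1ℤ ∷ 1ℤ ∷ 0ℤ ∷ []} (λ s → 0ℤ , Y-unit-base s)
         ⊞ + 2 ⊡ win-forget (win-T′ (win-pow {0} {suc (suc p)} z≤n))
         ⊞ Hi⇒win 3 big (Hi-* (Hi-≤ (s≤s z≤n) (win {M = 1} {cs = []} (λ s → - 1ℤ , Y-unit-neg1 s)))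
                            (Hi-*ʳ (λ s → + 2 - s + s * s) (Hi-W (suc (suc p)))))) ,
      λ s → Y-unit-shape s (s ^ p) (W (suc (suc p)) s)
      where
      big : 3 ≤ 1 ℕ.+ (suc (suc p) ℕ.+ suc (suc p))
      big = s≤s (s≤s (s≤s z≤n))
      win-T′ : ∀ {M n₀ n₁ n₂ n₃ f} → Win M (n₀ ∷ n₁ ∷ n₂ ∷ n₃ ∷ []) f →
        Win M (n₀ ∷ n₁ ∷ n₀ + n₂ ∷ n₁ + n₃ ∷ []) (λ s → (1ℤ + s * s) * f s)
      win-T′ {M} {n₀} {n₁} {n₂} {n₃} h = win λ s → let z , e = Win.at h s in
        n₂ + z + s * n₃ + s * s * z , trans (cong ((1ℤ + s * s) *_) e) (win-T′-poly′ s (s ^ M) n₀ n₁ n₂ n₃ z)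

    YY-unit-regroup : ∀ s u v → s * u * (s * v) ≡ s * s * (u * v)
    YY-unit-regroup = solve-∀

    YY-unit-poly : ∀ s k l y z → 1ℤ * (1ℤ + s * (1ℤ + s * (k + s * y))) * (1ℤ * (1ℤ + s * (1ℤ + s * (l + s * z)))) ≡
      1ℤ * (1ℤ + s * (+ 2 + s * (k + l + 1ℤ + s *
        (k + l + (y + z) + s * (k * l) + s * (y + z) + s * s * (k * z + l * y) + s * s * s * (y * z)))))
    YY-unit-poly = solve-∀

  YY-unit : ∀ p q → 3 ≤ p → 3 ≤ q → ∃ λ U → ∃ λ κ →
    Win 0 (1ℤ ∷ + 2 ∷ κ ∷ []) U × (∀ s → Y p s * Y q s ≡ s * s * U s)
  YY-unit p q lp lq with Vp , κp , hp , ep ← Y-unit p lp | Vq , κq , hq , eq ← Y-unit q lq =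
    (λ s → Vp s * Vq s) , κp + κq + 1ℤ , (win λ s → let y , f = Win.at hp s; z , g = Win.at hq s in
      (κp + κq + (y + z) + s * (κp * κq) + s * (y + z) + s * s * (κp * z + κq * y) + s * s * s * (y * z)) ,
      trans (cong₂ _*_ f g) (YY-unit-poly s κp κq y z)) ,
    λ s → trans (cong₂ _*_ (ep s) (eq s)) (YY-unit-regroup s (Vp s) (Vq s))

module CoefficientEquations where

  open import Data.Empty using (⊥-elim)
  open import Data.Integer.Base as ℤ using (ℤ; 0ℤ; 1ℤ; +_; -[1+_]; _+_; _*_; _-_; -_; ∣_∣; _^_)
  open import Data.List.Base using (List; []; _∷_)
  open import Data.List.Relation.Unary.All using (All; []; _∷_)
  open import Data.Nat.Base as ℕ using (ℕ; zero; suc; z≤n; s≤s; _≤_; _∸_)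
  open import Data.Vec.Base using (Vec; []; _∷_; zipWith; map; replicate)
  import Data.Vec.Relation.Unary.All as V
  open import Function.Base using (_$_)
  open Windows
  open ShapeFunctions

  Unit : ℤ → Set
  Unit g = g ≡ 1ℤ ⊎ g ≡ - 1ℤ

  sg-unit : ∀ n → Unit (sg n)
  sg-unit zero    = inj₁ refl
  sg-unit (suc n) with sg-unit n
  ... | inj₁ e = inj₂ (cong -_ e)
  ... | inj₂ e = inj₁ (cong -_ e)

  neg-unit : ∀ {g} → Unit g → Unit (- 1ℤ * g)
  neg-unit (inj₁ refl) = inj₂ refl
  neg-unit (inj₂ refl) = inj₁ refl

  private
    even≢odd-shape : ∀ y x → + 2 * (y - x) ≡ + 2 * y - + 2 * x
    even≢odd-shape = solve-∀

    even≢odd-shape′ : ∀ x g → + 2 * x + g - + 2 * x ≡ g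
    even≢odd-shape′ = solve-∀

  even≢odd : ∀ x y {g} → Unit g → + 2 * x + g ≢ + 2 * y
  even≢odd x y {g} u eq = two≢1 ∣ y - x ∣ (trans (sym (ℤ.abs-* (+ 2) (y - x)))
    (trans (cong ∣_∣ (trans (even≢odd-shape y x) (trans (cong (_- + 2 * x) (sym eq)) (even≢odd-shape′ x g)))) (abs-unit u)))
    where
    abs-unit : ∀ {g} → Unit g → ∣ g ∣ ≡ 1
    abs-unit (inj₁ refl) = refl
    abs-unit (inj₂ refl) = refl
    two≢1 : ∀ n → 2 ℕ.* n ≢ 1
    two≢1 (suc n) e with () ← trans (sym (ℕ.+-suc n (n ℕ.+ 0))) (ℕ.suc-injective e)

  private
    path-window-shape : ∀ ε g u s t → ε * g * (u * (s * (s * t))) ≡ ε * (g * t * (s * s * u))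
    path-window-shape = solve-∀

  -- The contribution of a connecting path with n edges.
  path-window : ∀ {M} (ε : ℤ) n {Z U : ℤ → ℤ} {κ} → (∀ s → Z s ≡ s * s * U s) → Win 0 (1ℤ ∷ + 2 ∷ κ ∷ []) U →
    M ≤ 2 ℕ.+ (n ℕ.+ n) → let j = 2 ℕ.+ (n ℕ.+ n) ∸ M; g = ε * sg n in
    Win M (g * + δ j 0 ∷ g * (+ 2 * + δ j 0 + + δ j 1) ∷ g * (κ * + δ j 0 + + 2 * + δ j 1 + + δ j 2) ∷ [])
          (λ s → ε * (W n s * Z s))
  path-window ε n {Z} {U} eq hU le = win-ext
    (λ s → trans (path-window-shape ε (sg n) (U s) s (s ^ (n ℕ.+ n))) (cong₂ (λ w z → ε * (w * z)) (sym (W-sg n s)) (sym (eq s))))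
    ((ε * sg n) ⊡ win-U (win-pow le) hU)

  Hi-path : ∀ ε n (Z : ℤ → ℤ) → Hi 2 Z → Hi (2 ℕ.+ (n ℕ.+ n)) (λ s → ε * (W n s * Z s))
  Hi-path ε n Z h = Hi-*ˡ (λ _ → ε) (subst (λ k → Hi k (λ s → W n s * Z s)) (ℕ.+-comm (n ℕ.+ n) 2) (Hi-* (Hi-W n) h))

  private
    y₀²-unit-eq : ∀ s → (s + s * s) * (s + s * s) ≡ s * s * ((1ℤ + s) * (1ℤ + s))
    y₀²-unit-eq = solve-∀

  y₀²-unit : ∀ s → y₀ s * y₀ s ≡ s * s * ((1ℤ + s) * (1ℤ + s))
  y₀²-unit = y₀²-unit-eq

  private
    win-1+s²-eq : ∀ s → (1ℤ + s) * (1ℤ + s) ≡ 1ℤ * (1ℤ + s * (+ 2 + s * (1ℤ + s * 0ℤ)))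
    win-1+s²-eq = solve-∀

  win-1+s² : Win 0 (1ℤ ∷ + 2 ∷ 1ℤ ∷ []) (λ s → (1ℤ + s) * (1ℤ + s))
  win-1+s² = win λ s → 0ℤ , win-1+s²-eq s

  private
    Hi-y₀²-eq : ∀ s → (s + s * s) * (s + s * s) ≡ s * (s * 1ℤ) * ((1ℤ + s) * (1ℤ + s))
    Hi-y₀²-eq = solve-∀

  Hi-y₀² : Hi 2 (λ s → y₀ s * y₀ s)
  Hi-y₀² = win λ s → (1ℤ + s) * (1ℤ + s) , Hi-y₀²-eq s

  -- The comparison of the coefficients at M, M+1 and M+2: here D, τ and k come from
  -- the two sides, and π from the connecting paths.
  record Equations (D₀ D₁ D₂ τ₀ τ₁ τ₂ k₀ k₁ k₂ : ℕ) (π₀ π₁ π₂ : ℤ) : Set where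
    field
      eq₀ : + 2 * + D₀ + π₀ ≡ + 2 * + (τ₀ ℕ.+ k₀)
      eq₁ : + 2 * + D₁ + π₁ ≡ + 2 * + (τ₁ ℕ.+ (k₀ ℕ.+ k₀ ℕ.+ k₁))
      eq₂ : + 2 * + D₂ + π₂ ≡ + 2 * (+ (τ₂ ℕ.+ (k₀ ℕ.+ k₀ ℕ.+ k₀ ℕ.+ (k₁ ℕ.+ k₁) ℕ.+ k₂)) + π₀)

  record Equationsℕ (D₀ D₁ D₂ τ₀ τ₁ τ₂ k₀ k₁ k₂ : ℕ) : Set where
    constructor eqsℕ
    field
      eq₀ : D₀ ≡ τ₀ ℕ.+ k₀
      eq₁ : D₁ ≡ τ₁ ℕ.+ (k₀ ℕ.+ k₀ ℕ.+ k₁)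
      eq₂ : D₂ ≡ τ₂ ℕ.+ (k₀ ℕ.+ k₀ ℕ.+ k₀ ℕ.+ (k₁ ℕ.+ k₁) ℕ.+ k₂)

  halve : ∀ {m n} → + 2 * + m ≡ + 2 * + n → m ≡ n
  halve {m} {n} e = ℤ.+-injective (ℤ.*-cancelˡ-≡ (+ 2) (+ m) (+ n) e)

  toℕ : ∀ {D₀ D₁ D₂ τ₀ τ₁ τ₂ k₀ k₁ k₂ π₀ π₁ π₂} → Equations D₀ D₁ D₂ τ₀ τ₁ τ₂ k₀ k₁ k₂ π₀ π₁ π₂ →
        π₀ ≡ 0ℤ → π₁ ≡ 0ℤ → π₂ ≡ 0ℤ → Equationsℕ D₀ D₁ D₂ τ₀ τ₁ τ₂ k₀ k₁ k₂
  toℕ {D₀} {D₁} {D₂} {τ₀} {τ₁} {τ₂} {k₀} {k₁} {k₂} E refl refl refl = eqsℕ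
    (halve (trans (sym (ℤ.+-identityʳ (+ 2 * + D₀))) eq₀))
    (halve (trans (sym (ℤ.+-identityʳ (+ 2 * + D₁))) eq₁))
    (halve (trans (sym (ℤ.+-identityʳ (+ 2 * + D₂))) (trans eq₂ (cong (λ t → + 2 * t) (ℤ.+-identityʳ (+ (τ₂ ℕ.+ (k₀ ℕ.+ k₀ ℕ.+ k₀ ℕ.+ (k₁ ℕ.+ k₁) ℕ.+ k₂))))))))
    where open Equations E

  private
    paths-far-eq : ∀ x g h → x + g ≡ x + (g * 1ℤ + h * 0ℤ)
    paths-far-eq = solve-∀

    paths-far-eq₁ : ∀ x g h → x + h ≡ x + (g * 0ℤ + h * 1ℤ)
    paths-far-eq₁ = solve-∀

    paths-far-eq₂ : ∀ x g h → x + g ≡ x + (g * (+ 2 * 0ℤ + 1ℤ) + h * (+ 2 * 0ℤ + 0ℤ))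
    paths-far-eq₂ = solve-∀

    paths-far-eq₃ : ∀ x g h → x + h ≡ x + (g * (+ 2 * 0ℤ + 0ℤ) + h * (+ 2 * 0ℤ + 1ℤ))
    paths-far-eq₃ = solve-∀

    paths-far-eq₄ : ∀ x g h k l → x + g ≡ x + (g * (k * 0ℤ + + 2 * 0ℤ + 1ℤ) + h * (l * 0ℤ + + 2 * 0ℤ + 0ℤ))
    paths-far-eq₄ = solve-∀

    paths-far-eq₅ : ∀ x g h k l → x + h ≡ x + (g * (k * 0ℤ + + 2 * 0ℤ + 0ℤ) + h * (l * 0ℤ + + 2 * 0ℤ + 1ℤ))
    paths-far-eq₅ = solve-∀

  module _ {D₀ D₁ D₂ τ₀ τ₁ τ₂ k₀ k₁ k₂ : ℕ} {g h κ κ′ : ℤ} (ug : Unit g) (uh : Unit h) where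

    private
      rhs₂ : ℕ → ℕ → ℤ
      rhs₂ j i = + (τ₂ ℕ.+ (k₀ ℕ.+ k₀ ℕ.+ k₀ ℕ.+ (k₁ ℕ.+ k₁) ℕ.+ k₂)) + (g * + δ j 0 + h * + δ i 0)

    -- Two different paths have different orders, so the first one to appear would
    -- make a coefficient odd.
    paths-far : ∀ j i → j ≢ i →
      Equations D₀ D₁ D₂ τ₀ τ₁ τ₂ k₀ k₁ k₂
        (g * + δ j 0 + h * + δ i 0)
        (g * (+ 2 * + δ j 0 + + δ j 1) + h * (+ 2 * + δ i 0 + + δ i 1))
        (g * (κ * + δ j 0 + + 2 * + δ j 1 + + δ j 2) + h * (κ′ * + δ i 0 + + 2 * + δ i 1 + + δ i 2)) →
      3 ≤ j × 3 ≤ i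
    paths-far 0 0 j≢i E = contradiction refl j≢i
    paths-far 0 (suc i) j≢i E = ⊥-elim (even≢odd (+ D₀) (+ (τ₀ ℕ.+ k₀)) ug (trans (paths-far-eq (+ 2 * + D₀) g h) (Equations.eq₀ E)))
    paths-far (suc j) 0 j≢i E = ⊥-elim (even≢odd (+ D₀) (+ (τ₀ ℕ.+ k₀)) uh (trans (paths-far-eq₁ (+ 2 * + D₀) g h) (Equations.eq₀ E)))
    paths-far 1 1 j≢i E = contradiction refl j≢i
    paths-far 1 (suc (suc i)) j≢i E = ⊥-elim (even≢odd (+ D₁) (+ (τ₁ ℕ.+ (k₀ ℕ.+ k₀ ℕ.+ k₁))) ug (trans (paths-far-eq₂ (+ 2 * + D₁) g h) (Equations.eq₁ E)))
    paths-far (suc (suc j)) 1 j≢i E = ⊥-elim (even≢odd (+ D₁) (+ (τ₁ ℕ.+ (k₀ ℕ.+ k₀ ℕ.+ k₁))) uh (trans (paths-far-eq₃ (+ 2 * + D₁) g h) (Equations.eq₁ E)))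
    paths-far 2 2 j≢i E = contradiction refl j≢i
    paths-far 2 (suc (suc (suc i))) j≢i E =
      ⊥-elim (even≢odd (+ D₂) (rhs₂ 2 (suc (suc (suc i)))) ug (trans (paths-far-eq₄ (+ 2 * + D₂) g h κ κ′) (Equations.eq₂ E)))
    paths-far (suc (suc (suc j))) 2 j≢i E =
      ⊥-elim (even≢odd (+ D₂) (rhs₂ (suc (suc (suc j))) 2) uh (trans (paths-far-eq₅ (+ 2 * + D₂) g h κ κ′) (Equations.eq₂ E)))
    paths-far (suc (suc (suc j))) (suc (suc (suc i))) j≢i E = s≤s (s≤s (s≤s z≤n)) , s≤s (s≤s (s≤s z≤n))

  θ-balance dumbbell-balance : List ℕ → List ℕ → List ℕ → ℤ → ℤ → ℤ
  θ-balance ds ts ks s r = + 2 * (x₀ s * (1ℤ + s * s) * Σpow ds s) +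
    (-[1+ 1 ] * ((1ℤ + s * s) * (1ℤ + s * s) * Σpow ts s) + (-[1+ 1 ] * (x₀ s * x₀ s * Σpow ks s) + r))
  dumbbell-balance ds ds′ ks s r = + 2 * (x₀ s * (1ℤ + s * s) * Σpow ds s) +
    (-[1+ 1 ] * (x₀ s * (1ℤ + s * s) * Σpow ds′ s) + (-[1+ 1 ] * (x₀ s * x₀ s * Σpow ks s) + r))

  private
    θ-coefficients-dbl : ∀ x y z → x + (+ 2 * y + z) ≡ x + (y + y + z)
    θ-coefficients-dbl = solve-∀

    θ-coefficients-left : ∀ d₀ d₁ d₂ → d₀ + d₁ + d₂ ≡ + 3 * d₀ + d₁ + d₂ - + 2 * d₀
    θ-coefficients-left = solve-∀

    θ-coefficients-right : ∀ t₀ t₂ k₀ k₁ k₂ p → + 2 * t₀ + t₂ + (+ 5 * k₀ + + 2 * k₁ + k₂) - + 2 * (t₀ + k₀) + p ≡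
      t₂ + (k₀ + k₀ + k₀ + (k₁ + k₁) + k₂) + p
    θ-coefficients-right = solve-∀

    θ-coefficient₃-left : ∀ d₀ d₁ d₂ d₃ → d₀ + (d₁ + d₁ + d₁) + d₂ + d₃ ≡ d₀ + + 3 * d₁ + d₂ + d₃
    θ-coefficient₃-left = solve-∀

    θ-coefficient₃-right : ∀ t₁ t₃ k₀ k₁ k₂ k₃ → + 2 * t₁ + t₃ + (+ 4 * k₀ + + 5 * k₁ + + 2 * k₂ + k₃) ≡
      t₁ + t₁ + t₃ + (k₀ + k₀ + k₀ + k₀ + (k₁ + k₁ + k₁ + k₁ + k₁) + (k₂ + k₂) + k₃)
    θ-coefficient₃-right = solve-∀

    dumbbell-coefficients-dbl : ∀ x y z → x + (+ 2 * y + z) ≡ x + (y + y + z)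
    dumbbell-coefficients-dbl = solve-∀

    dumbbell-coefficients-left : ∀ d₀ d₁ d₂ → d₀ + d₁ + d₂ ≡ + 3 * d₀ + d₁ + d₂ - + 2 * d₀
    dumbbell-coefficients-left = solve-∀

    dumbbell-coefficients-right : ∀ t₀ t₁ t₂ k₀ k₁ k₂ p → + 3 * t₀ + t₁ + t₂ + (+ 5 * k₀ + + 2 * k₁ + k₂) - + 2 * (t₀ + k₀) + p ≡
      t₀ + t₁ + t₂ + (k₀ + k₀ + k₀ + (k₁ + k₁) + k₂) + p
    dumbbell-coefficients-right = solve-∀

    eliminate-left : ∀ x₀ x₂ π₀ π₂ → + 2 * (x₂ - + 2 * x₀) + π₂ ≡ (+ 2 * x₂ + π₂) - + 2 * (+ 2 * x₀ + π₀) + + 2 * π₀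
    eliminate-left = solve-∀

    eliminate-right : ∀ u v π₀ → + 2 * u - + 2 * (+ 2 * v) + + 2 * π₀ ≡ + 2 * (u - + 2 * v + π₀)
    eliminate-right = solve-∀

    cleared : ∀ x t k π → x + (-[1+ 1 ] * t + (-[1+ 1 ] * k + (π + 0ℤ))) ≡ 0ℤ → x + π ≡ + 2 * (t + k)
    cleared x t k π e = trans (shape x t k π) (trans (cong (λ z → z + + 2 * (t + k)) e) (ℤ.+-identityˡ (+ 2 * (t + k))))
      where
      shape : ∀ x t k π → x + π ≡ x + (-[1+ 1 ] * t + (-[1+ 1 ] * k + (π + 0ℤ))) + + 2 * (t + k)
      shape = solve-∀

    eliminate : ∀ x₀ x₂ t₀ t₂ k₀ k₂ π₀ π₂ → + 2 * x₀ + π₀ ≡ + 2 * (t₀ + k₀) → + 2 * x₂ + π₂ ≡ + 2 * (t₂ + k₂) →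
      + 2 * (x₂ - + 2 * x₀) + π₂ ≡ + 2 * (t₂ + k₂ - + 2 * (t₀ + k₀) + π₀)
    eliminate x₀ x₂ t₀ t₂ k₀ k₂ π₀ π₂ e₀ e₂ = begin
      + 2 * (x₂ - + 2 * x₀) + π₂
        ≡⟨ eliminate-left x₀ x₂ π₀ π₂ ⟩
      (+ 2 * x₂ + π₂) - + 2 * (+ 2 * x₀ + π₀) + + 2 * π₀
        ≡⟨ cong₂ (λ u v → u - + 2 * v + + 2 * π₀) e₂ e₀ ⟩
      + 2 * (t₂ + k₂) - + 2 * (+ 2 * (t₀ + k₀)) + + 2 * π₀
        ≡⟨ eliminate-right (t₂ + k₂) (t₀ + k₀) π₀ ⟩
      + 2 * (t₂ + k₂ - + 2 * (t₀ + k₀) + π₀) ∎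
      where
      open ≡-Reasoning

    three : ∀ {a b c} → V.All (_≡ 0ℤ) (a ∷ b ∷ c ∷ []) → a ≡ 0ℤ × b ≡ 0ℤ × c ≡ 0ℤ
    three (p V.∷ q V.∷ r V.∷ V.[]) = p , q , r

    fourth : ∀ {a b c d} → V.All (_≡ 0ℤ) (a ∷ b ∷ c ∷ d ∷ []) → d ≡ 0ℤ
    fourth (_ V.∷ _ V.∷ _ V.∷ p V.∷ V.[]) = p

    assemble : ∀ {w M} {cs₁ cs₂ cs₃ cs₄ : Vec ℤ w} {f₁ f₂ f₃ f₄ f₅ : ℤ → ℤ} →
      Win M cs₁ f₁ → Win M cs₂ f₂ → Win M cs₃ f₃ → Win M cs₄ f₄ → Hi (M ℕ.+ w) f₅ →
      (∀ s → + 2 * f₁ s + (-[1+ 1 ] * f₂ s + (-[1+ 1 ] * f₃ s + (f₄ s + f₅ s))) ≡ 0ℤ) →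
      V.All (_≡ 0ℤ) (zipWith _+_ (map (+ 2 *_) cs₁) (zipWith _+_ (map (-[1+ 1 ] *_) cs₂)
        (zipWith _+_ (map (-[1+ 1 ] *_) cs₃) (zipWith _+_ cs₄ (replicate w 0ℤ)))))
    assemble {w} {f₁ = f₁} {f₂} {f₃} {f₄} {f₅} h₁ h₂ h₃ h₄ h₅ eq = win-zero eq g₁
      where
      g₄ = _⊞_ {f = f₄} {g = f₅} h₄ (Hi⇒win w ℕ.≤-refl h₅)
      g₃ = _⊞_ {f = λ s → -[1+ 1 ] * f₃ s} {g = λ s → f₄ s + f₅ s} (_⊡_ {f = f₃} -[1+ 1 ] h₃) g₄
      g₂ = _⊞_ {f = λ s → -[1+ 1 ] * f₂ s} {g = λ s → -[1+ 1 ] * f₃ s + (f₄ s + f₅ s)} (_⊡_ {f = f₂} -[1+ 1 ] h₂) g₃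
      g₁ = _⊞_ {f = λ s → + 2 * f₁ s} {g = λ s → -[1+ 1 ] * f₂ s + (-[1+ 1 ] * f₃ s + (f₄ s + f₅ s))}
               (_⊡_ {f = f₁} (+ 2) h₁) g₂

    module _ {M : ℕ} {d₀ d₁ d₂ d₃ t₀ t₁ t₂ t₃ k₀ k₁ k₂ k₃ : ℤ} {S T K P R : ℤ → ℤ}
             (hS : Win M (d₀ ∷ d₁ ∷ d₂ ∷ d₃ ∷ []) S) (hT : Win M (t₀ ∷ t₁ ∷ t₂ ∷ t₃ ∷ []) T)
             (hK : Win M (k₀ ∷ k₁ ∷ k₂ ∷ k₃ ∷ []) K) where

      θ-coefficients : ∀ {π₀ π₁ π₂} → Win M (π₀ ∷ π₁ ∷ π₂ ∷ []) P → Hi (M ℕ.+ 3) R →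
        (∀ s → + 2 * ((1ℤ + s + + 2 * (s * s)) * (1ℤ + s * s) * S s) + (-[1+ 1 ] * ((1ℤ + s * s) * (1ℤ + s * s) * T s) +
          (-[1+ 1 ] * ((1ℤ + s + + 2 * (s * s)) * (1ℤ + s + + 2 * (s * s)) * K s) + (P s + R s))) ≡ 0ℤ) →
        + 2 * d₀ + π₀ ≡ + 2 * (t₀ + k₀) ×
        + 2 * (d₀ + d₁) + π₁ ≡ + 2 * (t₁ + (k₀ + k₀ + k₁)) ×
        + 2 * (d₀ + d₁ + d₂) + π₂ ≡ + 2 * (t₂ + (k₀ + k₀ + k₀ + (k₁ + k₁) + k₂) + π₀)
      θ-coefficients {π₀} {π₁} {π₂} hP hR eq =
        let e₀ , e₁ , e₂ = three $ assemble (win-forget (win-D hS)) (win-forget (win-T hT)) (win-forget (win-K hK)) hP hR eq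
            f₀ = cleared (+ 2 * d₀) t₀ k₀ π₀ e₀ in
        f₀ ,
        trans (cleared (+ 2 * (d₀ + d₁)) t₁ (+ 2 * k₀ + k₁) π₁ e₁) (cong (λ z → + 2 * z) (θ-coefficients-dbl t₁ k₀ k₁)) ,
        trans (cong (λ z → + 2 * z + π₂) (θ-coefficients-left d₀ d₁ d₂))
          (trans (eliminate d₀ (+ 3 * d₀ + d₁ + d₂) t₀ (+ 2 * t₀ + t₂) k₀ (+ 5 * k₀ + + 2 * k₁ + k₂) π₀ π₂ f₀ (cleared (+ 2 * (+ 3 * d₀ + d₁ + d₂)) (+ 2 * t₀ + t₂) (+ 5 * k₀ + + 2 * k₁ + k₂) π₂ e₂))
                 (cong (λ z → + 2 * z) (θ-coefficients-right t₀ t₂ k₀ k₁ k₂ π₀)))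

      θ-coefficient₃ : ∀ {π₀ π₁ π₂ π₃} → Win M (π₀ ∷ π₁ ∷ π₂ ∷ π₃ ∷ []) P → Hi (M ℕ.+ 4) R →
        (∀ s → + 2 * ((1ℤ + s + + 2 * (s * s)) * (1ℤ + s * s) * S s) + (-[1+ 1 ] * ((1ℤ + s * s) * (1ℤ + s * s) * T s) +
          (-[1+ 1 ] * ((1ℤ + s + + 2 * (s * s)) * (1ℤ + s + + 2 * (s * s)) * K s) + (P s + R s))) ≡ 0ℤ) →
        + 2 * (d₀ + (d₁ + d₁ + d₁) + d₂ + d₃) + π₃ ≡
        + 2 * (t₁ + t₁ + t₃ + (k₀ + k₀ + k₀ + k₀ + (k₁ + k₁ + k₁ + k₁ + k₁) + (k₂ + k₂) + k₃))
      θ-coefficient₃ {π₃ = π₃} hP hR eq =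
        let e₃ = fourth $ assemble (win-D hS) (win-T hT) (win-K hK) hP hR eq in
        trans (cong (λ z → + 2 * z + π₃) (θ-coefficient₃-left d₀ d₁ d₂ d₃))
          (trans (cleared (+ 2 * (d₀ + + 3 * d₁ + d₂ + d₃)) (+ 2 * t₁ + t₃) (+ 4 * k₀ + + 5 * k₁ + + 2 * k₂ + k₃) π₃ e₃)
                 (cong (λ z → + 2 * z) (θ-coefficient₃-right t₁ t₃ k₀ k₁ k₂ k₃)))

      dumbbell-coefficients : ∀ {π₀ π₁ π₂} → Win M (π₀ ∷ π₁ ∷ π₂ ∷ []) P → Hi (M ℕ.+ 3) R →
        (∀ s → + 2 * ((1ℤ + s + + 2 * (s * s)) * (1ℤ + s * s) * S s) +
          (-[1+ 1 ] * ((1ℤ + s + + 2 * (s * s)) * (1ℤ + s * s) * T s) +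
          (-[1+ 1 ] * ((1ℤ + s + + 2 * (s * s)) * (1ℤ + s + + 2 * (s * s)) * K s) + (P s + R s))) ≡ 0ℤ) →
        + 2 * d₀ + π₀ ≡ + 2 * (t₀ + k₀) ×
        + 2 * (d₀ + d₁) + π₁ ≡ + 2 * (t₀ + t₁ + (k₀ + k₀ + k₁)) ×
        + 2 * (d₀ + d₁ + d₂) + π₂ ≡ + 2 * (t₀ + t₁ + t₂ + (k₀ + k₀ + k₀ + (k₁ + k₁) + k₂) + π₀)
      dumbbell-coefficients {π₀} {π₁} {π₂} hP hR eq =
        let e₀ , e₁ , e₂ = three $ assemble (win-forget (win-D hS)) (win-forget (win-D hT)) (win-forget (win-K hK)) hP hR eq
            f₀ = cleared (+ 2 * d₀) t₀ k₀ π₀ e₀ in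
        f₀ ,
        trans (cleared (+ 2 * (d₀ + d₁)) (t₀ + t₁) (+ 2 * k₀ + k₁) π₁ e₁) (cong (λ z → + 2 * z) (dumbbell-coefficients-dbl (t₀ + t₁) k₀ k₁)) ,
        trans (cong (λ z → + 2 * z + π₂) (dumbbell-coefficients-left d₀ d₁ d₂))
          (trans (eliminate d₀ (+ 3 * d₀ + d₁ + d₂) t₀ (+ 3 * t₀ + t₁ + t₂) k₀ (+ 5 * k₀ + + 2 * k₁ + k₂) π₀ π₂ f₀ (cleared (+ 2 * (+ 3 * d₀ + d₁ + d₂)) (+ 3 * t₀ + t₁ + t₂) (+ 5 * k₀ + + 2 * k₁ + k₂) π₂ e₂))
                 (cong (λ z → + 2 * z) (dumbbell-coefficients-right t₀ t₁ t₂ k₀ k₁ k₂ π₀)))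

  module _ {M : ℕ} {ds ts ks : List ℕ} (ds≥ : All (M ≤_) ds) (ts≥ : All (M ≤_) ts) (ks≥ : All (M ≤_) ks)
           {Path R : ℤ → ℤ} where

    private
      d = count M ds
      t = count M ts
      k = count M ks

    θ-equations : ∀ {π₀ π₁ π₂} → Win M (π₀ ∷ π₁ ∷ π₂ ∷ []) Path → Hi (M ℕ.+ 3) R →
      (∀ s → θ-balance ds ts ks s (Path s + R s) ≡ 0ℤ) →
      Equations (d 0) (d 0 ℕ.+ d 1) (d 0 ℕ.+ d 1 ℕ.+ d 2) (t 0) (t 1) (t 2) (k 0) (k 1) (k 2) π₀ π₁ π₂
    θ-equations hP hR eq =
      let e₀ , e₁ , e₂ = θ-coefficients (win-Σpow ds≥) (win-Σpow ts≥) (win-Σpow ks≥) hP hR eq in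
      record { eq₀ = e₀ ; eq₁ = e₁ ; eq₂ = e₂ }

    θ-equation₃ : ∀ {π₀ π₁ π₂ π₃} → Win M (π₀ ∷ π₁ ∷ π₂ ∷ π₃ ∷ []) Path → Hi (M ℕ.+ 4) R →
      (∀ s → θ-balance ds ts ks s (Path s + R s) ≡ 0ℤ) →
      + 2 * + (d 0 ℕ.+ (d 1 ℕ.+ d 1 ℕ.+ d 1) ℕ.+ d 2 ℕ.+ d 3) + π₃ ≡
      + 2 * + (t 1 ℕ.+ t 1 ℕ.+ t 3 ℕ.+ (k 0 ℕ.+ k 0 ℕ.+ k 0 ℕ.+ k 0 ℕ.+ (k 1 ℕ.+ k 1 ℕ.+ k 1 ℕ.+ k 1 ℕ.+ k 1) ℕ.+ (k 2 ℕ.+ k 2) ℕ.+ k 3))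
    θ-equation₃ = θ-coefficient₃ (win-Σpow ds≥) (win-Σpow ts≥) (win-Σpow ks≥)

    dumbbell-equations : ∀ {π₀ π₁ π₂} → Win M (π₀ ∷ π₁ ∷ π₂ ∷ []) Path → Hi (M ℕ.+ 3) R →
      (∀ s → dumbbell-balance ds ts ks s (Path s + R s) ≡ 0ℤ) →
      Equations (d 0) (d 0 ℕ.+ d 1) (d 0 ℕ.+ d 1 ℕ.+ d 2) (t 0) (t 0 ℕ.+ t 1) (t 0 ℕ.+ t 1 ℕ.+ t 2)
                (k 0) (k 1) (k 2) π₀ π₁ π₂
    dumbbell-equations hP hR eq =
      let e₀ , e₁ , e₂ = dumbbell-coefficients (win-Σpow ds≥) (win-Σpow ts≥) (win-Σpow ks≥) hP hR eq in
      record { eq₀ = e₀ ; eq₁ = e₁ ; eq₂ = e₂ }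

  θ-path : ℕ → ℕ → ℕ → ℕ → ℕ → ℕ → ℤ → ℤ
  θ-path p q e a b c s = - 1ℤ * (W e s * (Y p s * Y q s)) +
    (1ℤ * (W a s * (y₀ s * y₀ s)) + (1ℤ * (W b s * (y₀ s * y₀ s)) + 1ℤ * (W c s * (y₀ s * y₀ s))))

  private
    θ-core-difference : ∀ x t y A B C r → t + - (y * A + y * B + y * C) + r ≡ x + t - y * (A + B + C) + r - x
    θ-core-difference = solve-∀

    θ-core-eq : ∀ x y → y ≡ x - (x - y)
    θ-core-eq = solve-∀

  θ-core : ∀ {p q e a b c ks} M w → w ≤ M → w ≤ 4 → 1 ≤ a → a ≤ b → b ≤ c → M ≤ p → M ≤ q → M ≤ a ℕ.+ b → All (M ≤_) ks →
    (∀ s → dumbbell p q e s ≡ θ a b c s * cycles ks s) →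
    ∃ λ R → Hi (M ℕ.+ w) R ×
    (∀ s → θ-balance (p ∷ q ∷ []) (θ-pairs a b c) ks s (θ-path p q e a b c s + R s) ≡ 0ℤ)
  θ-core {p} {q} {e} {a} {b} {c} {ks} M w w≤M w≤4 1≤a a≤b b≤c M≤p M≤q M≤ab ks≥ H
    = let R₁ , h₁ , e₁ = XX-expand p q M≤p M≤q; R₂ , h₂ , e₂ = θ-expand a b c a≤b b≤c M≤ab; R₃ , h₃ , e₃ = cycles-expand ks ks≥ in
    (λ s → R₁ s + - R₂ s + - (x₀ s * x₀ s * R₃ s) + - ((θ a b c s - x₀ s * x₀ s) * (+ 2 * Σpow ks s + R₃ s))) ,
    Hi-≤ 2M h₁ ⊕ neg (Hi-≤ 2M h₂) ⊕ neg (Hi-*ˡ (λ s → x₀ s * x₀ s) (Hi-≤ 2M h₃))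
      ⊕ neg (subst (λ n → Hi n (λ s → (θ a b c s - x₀ s * x₀ s) * (+ 2 * Σpow ks s + R₃ s))) (ℕ.+-comm w M)
          (Hi-* hθ (Hi-*ˡ (λ _ → + 2) (win⇒Hi (win-Σpow ks≥)) ⊕ Hi-≤ (ℕ.m≤m+n M M) h₃))) ,
    λ s → shape (x₀ s * x₀ s) (x₀ s * (1ℤ + s * s) * Σpow (p ∷ q ∷ []) s)
      ((1ℤ + s * s) * (1ℤ + s * s) * Σpow (θ-pairs a b c) s) (Σpow ks s) (y₀ s * y₀ s) (W a s) (W b s) (W c s)
      (R₁ s) (R₂ s) (R₃ s) (W e s * (Y p s * Y q s)) (e₁ s) (e₂ s) (e₃ s) (H s)
    where
    2M : M ℕ.+ w ≤ M ℕ.+ M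
    2M = ℕ.+-monoʳ-≤ M w≤M
    a≤c = ℕ.≤-trans a≤b b≤c
    hw : ∀ n → a ≤ n → Hi w (λ s → y₀ s * y₀ s * W n s)
    hw n le = Hi-≤ (ℕ.≤-trans w≤4 (ℕ.+-monoʳ-≤ 2 (ℕ.+-mono-≤ (ℕ.≤-trans 1≤a le) (ℕ.≤-trans 1≤a le)))) (Hi-* Hi-y₀² (Hi-W n))
    hθ : Hi w (λ s → θ a b c s - x₀ s * x₀ s)
    hθ = let R₂ , h₂ , e₂ = θ-expand a b c a≤b b≤c M≤ab in win-ext
      (λ s → trans (θ-core-difference (x₀ s * x₀ s) (+ 2 * ((1ℤ + s * s) * (1ℤ + s * s) * Σpow (θ-pairs a b c) s)) (y₀ s * y₀ s)
                     (W a s) (W b s) (W c s) (R₂ s)) (cong (_- x₀ s * x₀ s) (sym (e₂ s))))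
      (Hi-*ˡ (λ _ → + 2) (Hi-*ˡ (λ s → (1ℤ + s * s) * (1ℤ + s * s)) (Hi-≤ w≤M (win⇒Hi (win-Σpow ts≥))))
        ⊕ neg (hw a ℕ.≤-refl ⊕ hw b a≤b ⊕ hw c a≤c) ⊕ Hi-≤ (ℕ.≤-trans w≤M (ℕ.m≤m+n M M)) h₂)
      where
      ts≥ : All (M ≤_) (θ-pairs a b c)
      ts≥ = M≤ab ∷ ℕ.≤-trans M≤ab (ℕ.+-monoʳ-≤ a b≤c) ∷ ℕ.≤-trans M≤ab (ℕ.+-mono-≤ a≤b b≤c) ∷ []
    poly : ∀ xx u v S yy A B C r₁ r₂ r₃ →
      + 2 * u + (-[1+ 1 ] * v + (-[1+ 1 ] * (xx * S) +
        (- 1ℤ * (xx + + 2 * u + r₁ - (xx + + 2 * v - yy * (A + B + C) + r₂) * (1ℤ + + 2 * S + r₃))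
          + (1ℤ * (A * yy) + (1ℤ * (B * yy) + 1ℤ * (C * yy)))
         + (r₁ + - r₂ + - (xx * r₃) + - ((xx + + 2 * v - yy * (A + B + C) + r₂ - xx) * (+ 2 * S + r₃)))))) ≡ 0ℤ
    poly = solve-∀
    isolate : ∀ x y z → x - y ≡ z → y ≡ x - z
    isolate x y z refl = θ-core-eq x y
    shape : ∀ xx u v S yy A B C r₁ r₂ r₃ E {P T K} →
      P ≡ xx + + 2 * u + r₁ → T ≡ xx + + 2 * v - yy * (A + B + C) + r₂ → K ≡ 1ℤ + + 2 * S + r₃ → P - E ≡ T * K →
      + 2 * u + (-[1+ 1 ] * v + (-[1+ 1 ] * (xx * S) +
        (- 1ℤ * E + (1ℤ * (A * yy) + (1ℤ * (B * yy) + 1ℤ * (C * yy)))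
         + (r₁ + - r₂ + - (xx * r₃) + - ((T - xx) * (+ 2 * S + r₃)))))) ≡ 0ℤ
    shape xx u v S yy A B C r₁ r₂ r₃ E refl refl refl h
      rewrite isolate (xx + + 2 * u + r₁) E _ h = poly xx u v S yy A B C r₁ r₂ r₃

module ThetaEquations where

  open import Data.Integer.Base as ℤ using (ℤ; 0ℤ; 1ℤ; +_; _+_; _*_; _-_; -_; _^_)
  open import Data.List.Base using (List; []; _∷_; _++_)
  open import Data.Nat.ListAction using (sum)
  open import Data.List.Relation.Unary.All as All using (All; []; _∷_)
  import Data.List.Relation.Unary.All.Properties as All
  open import Data.Nat.Base as ℕ using (ℕ; zero; suc; z≤n; s≤s; _≤_; _<_; _∸_; _⊓_)
  open import Data.Vec.Base using ([]; _∷_)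
  open Windows
  open ShapeFunctions
  open CoefficientEquations

  least : ∀ n ns → ∃ λ M → All (M ≤_) (n ∷ ns) × 1 ≤ count M (n ∷ ns) 0
  least n []        = n , ℕ.≤-refl ∷ [] , subst (λ k → 1 ≤ δ k 0 ℕ.+ 0) (sym (ℕ.n∸n≡0 n)) (s≤s z≤n)
  least n (n′ ∷ ns) with M , le , c ← least n′ ns | ℕ.≤-total n M
  ... | inj₁ n≤M = n , ℕ.≤-refl ∷ All.map (ℕ.≤-trans n≤M) le ,
                   subst (λ k → 1 ≤ δ k 0 ℕ.+ count n (n′ ∷ ns) 0) (sym (ℕ.n∸n≡0 n)) (s≤s z≤n)
  ... | inj₂ M≤n = M , M≤n ∷ le , ℕ.≤-trans c (ℕ.m≤n+m _ (δ (n ∸ M) 0))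

  count-++ : ∀ M ms ns j → count M (ms ++ ns) j ≡ count M ms j ℕ.+ count M ns j
  count-++ M []       ns j = refl
  count-++ M (m ∷ ms) ns j = trans (cong (δ (m ∸ M) j ℕ.+_) (count-++ M ms ns j)) (sym (ℕ.+-assoc (δ (m ∸ M) j) _ _))

  δ-offset : ∀ {n M k} j → n ≡ M ℕ.+ k → δ (n ∸ M) j ≡ δ k j
  δ-offset {M = M} {k} j refl = cong (λ i → δ i j) (ℕ.m+n∸m≡n M k)

  δ-Σ≤1 : ∀ k → δ k 0 ℕ.+ δ k 1 ℕ.+ δ k 2 ≤ 1
  δ-Σ≤1 0                   = s≤s z≤n
  δ-Σ≤1 1                   = s≤s z≤n
  δ-Σ≤1 2                   = s≤s z≤n
  δ-Σ≤1 (suc (suc (suc k))) = z≤n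

  private
    count₂-regroup : ∀ x y z u v w → x ℕ.+ y ℕ.+ z ℕ.+ (u ℕ.+ v ℕ.+ w) ≡
              x ℕ.+ (u ℕ.+ 0) ℕ.+ (y ℕ.+ (v ℕ.+ 0)) ℕ.+ (z ℕ.+ (w ℕ.+ 0))
    count₂-regroup = ℕ-solve-∀

  count₂ : ∀ M p q → let d = count M (p ∷ q ∷ []) in d 0 ℕ.+ d 1 ℕ.+ d 2 ≤ 2
  count₂ M p q = subst (_≤ 2) (count₂-regroup (δ (p ∸ M) 0) (δ (p ∸ M) 1) (δ (p ∸ M) 2) (δ (q ∸ M) 0) (δ (q ∸ M) 1) (δ (q ∸ M) 2))
    (ℕ.+-mono-≤ (δ-Σ≤1 (p ∸ M)) (δ-Σ≤1 (q ∸ M)))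

  δ₀≡0⇒< : ∀ {n M} → M ≤ n → δ (n ∸ M) 0 ≡ 0 → M < n
  δ₀≡0⇒< {n} {M} le eq = ℕ.≤∧≢⇒< le λ { refl → contradiction (trans (sym (cong (λ k → δ k 0) (ℕ.n∸n≡0 M))) eq) λ () }

  <⇒δ₀≡0 : ∀ {n M} → M < n → δ (n ∸ M) 0 ≡ 0
  <⇒δ₀≡0 {n} {M} lt with n ∸ M | ℕ.m<n⇒0<n∸m lt
  ... | suc k | _ = refl

  <⇒δ-suc : ∀ {n M} j → M < n → δ (n ∸ M) (suc j) ≡ δ (n ∸ suc M) j
  <⇒δ-suc {suc n} {M} j (s≤s le) = cong (λ k → δ k (suc j)) (ℕ.+-∸-assoc 1 le)

  none-at : ∀ {M ks} → All (M ≤_) ks → count M ks 0 ≡ 0 → All (suc M ≤_) ks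
  none-at []         eq = []
  none-at {M} {k ∷ ks} (le ∷ les) eq =
    δ₀≡0⇒< le (ℕ.m+n≡0⇒m≡0 _ eq) ∷ none-at les (ℕ.m+n≡0⇒n≡0 (δ (k ∸ M) 0) eq)

  none-above : ∀ {M ks} → All (suc M ≤_) ks → count M ks 0 ≡ 0
  none-above []         = refl
  none-above {M} (lt ∷ lts) rewrite <⇒δ₀≡0 lt = none-above lts

  count-suc : ∀ {M ks} j → All (suc M ≤_) ks → count M ks (suc j) ≡ count (suc M) ks j
  count-suc j []         = refl
  count-suc {M} j (lt ∷ lts) = cong₂ ℕ._+_ (<⇒δ-suc j lt) (count-suc j lts)

  private
    k≤Σ : ∀ {M k ks} → M ≤ k → M ≤ sum (k ∷ ks)
    k≤Σ {ks = ks} le = ℕ.≤-trans le (ℕ.m≤m+n _ (sum ks))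

  empty-or-large : ∀ {M} ks → All (M ≤_) ks → ks ≡ [] ⊎ M ≤ sum ks
  empty-or-large []       []         = inj₁ refl
  empty-or-large (k ∷ ks) (le ∷ les) = inj₂ (k≤Σ {ks = ks} le)

  private
    no-cycle-regroup : ∀ t k k₁ k₂ → t ℕ.+ (suc k ℕ.+ suc k ℕ.+ suc k ℕ.+ (k₁ ℕ.+ k₁) ℕ.+ k₂) ≡ 3 ℕ.+ (t ℕ.+ (k ℕ.+ k ℕ.+ k ℕ.+ (k₁ ℕ.+ k₁) ℕ.+ k₂))
    no-cycle-regroup = ℕ-solve-∀

  no-cycle : ∀ {D₀ D₁ D₂ τ₀ τ₁ τ₂ k₀ k₁ k₂} → D₂ ≤ 2 → Equationsℕ D₀ D₁ D₂ τ₀ τ₁ τ₂ k₀ k₁ k₂ → k₀ ≡ 0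
  no-cycle {k₀ = zero}  le E = refl
  no-cycle {D₂ = D₂} {τ₂ = τ₂} {suc k} {k₁} {k₂} le E = contradiction
    (ℕ.≤-trans (ℕ.m≤m+n 3 _) (ℕ.≤-trans (ℕ.≤-reflexive (sym (trans (Equationsℕ.eq₂ E) (no-cycle-regroup τ₂ k k₁ k₂)))) le)) λ { (s≤s (s≤s ())) }

  Hi-0ᶠ : ∀ M → Hi M (λ _ → 0ℤ)
  Hi-0ᶠ M = win λ s → 0ℤ , sym (ℤ.*-zeroʳ (s ^ M))

  private
    Hi-y₀-eq : ∀ s → s + s * s ≡ s * 1ℤ * (1ℤ + s)
    Hi-y₀-eq = solve-∀

  Hi-y₀ : Hi 1 y₀
  Hi-y₀ = win λ s → 1ℤ + s , Hi-y₀-eq s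

  private
    Hi-YY-shape : ∀ s u → s * (s * 1ℤ) * u ≡ s * s * u
    Hi-YY-shape = solve-∀

  Hi-YY : ∀ {p q} → 3 ≤ p → 3 ≤ q → Hi 2 (λ s → Y p s * Y q s)
  Hi-YY {p} {q} lp lq = let U , κ , h , eq = YY-unit p q lp lq in
    win-ext (λ s → trans (Hi-YY-shape s (proj₁ (YY-unit p q lp lq) s)) (sym (eq s))) (Hi-*ʳ U (Hi-pow 2))

  private
    Hi-ΔYY-eq′ : ∀ x y → x + (y - x) ≡ y
    Hi-ΔYY-eq′ = solve-∀

    Hi-ΔYY-eq : ∀ y u v → (u - y) * v + y * (v - y) ≡ u * v - y * y
    Hi-ΔYY-eq = solve-∀

  Hi-ΔYY : ∀ {M} p q → 1 ≤ M → M ≤ p → M ≤ q → Hi (suc M) (λ s → Y p s * Y q s - y₀ s * y₀ s)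
  Hi-ΔYY {M} p q 1≤M lp lq = win-ext (λ s → Hi-ΔYY-eq (y₀ s) (Y p s) (Y q s))
    (subst (λ k → Hi k (λ s → (Y p s - y₀ s) * Y q s)) (ℕ.+-comm M 1) (Hi-* (Hi-Y p lp) hY) ⊕ Hi-* Hi-y₀ (Hi-Y q lq))
    where
    hY : Hi 1 (Y q)
    hY = win-ext (λ s → Hi-ΔYY-eq′ (y₀ s) (Y q s)) (Hi-y₀ ⊕ Hi-≤ 1≤M (Hi-Y q lq))

  private
    ΔYY-order : ∀ M a → a ℕ.+ a ℕ.+ suc M ≡ M ℕ.+ suc (a ℕ.+ a)
    ΔYY-order = ℕ-solve-∀

    ΔYY-shape : ∀ w u y → - 1ℤ * (w * (u - y)) ≡ - 1ℤ * (w * u) + 1ℤ * (w * y)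
    ΔYY-shape = solve-∀

  module Theta {p q e a b c : ℕ} {ks : List ℕ} (3≤p : 3 ≤ p) (p≤q : p ≤ q) (1≤e : 1 ≤ e) (1≤a : 1 ≤ a)
               (a≤b : a ≤ b) (b≤c : b ≤ c) (3≤ab : 3 ≤ a ℕ.+ b) (3≤ks : All (3 ≤_) ks)
               (H : ∀ s → dumbbell p q e s ≡ θ a b c s * cycles ks s) where

    3≤q : 3 ≤ q
    3≤q = ℕ.≤-trans 3≤p p≤q

    record Bound (M : ℕ) : Set where
      field
        3≤M  : 3 ≤ M
        M≤p  : M ≤ p
        M≤ab : M ≤ a ℕ.+ b
        M≤ks : All (M ≤_) ks
      M≤q : M ≤ q
      M≤q = ℕ.≤-trans M≤p p≤q
      ds≥ : All (M ≤_) (p ∷ q ∷ [])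
      ds≥ = M≤p ∷ M≤q ∷ []
      ts≥ : All (M ≤_) (θ-pairs a b c)
      ts≥ = M≤ab ∷ ℕ.≤-trans M≤ab (ℕ.+-monoʳ-≤ a b≤c) ∷ ℕ.≤-trans M≤ab (ℕ.+-mono-≤ a≤b b≤c) ∷ []

    Eqs : ℕ → ℤ → ℤ → ℤ → Set
    Eqs M = let d = count M (p ∷ q ∷ []); t = count M (θ-pairs a b c); k = count M ks in
      Equations (d 0) (d 0 ℕ.+ d 1) (d 0 ℕ.+ d 1 ℕ.+ d 2) (t 0) (t 1) (t 2) (k 0) (k 1) (k 2)

    Eqsℕ : ℕ → Set
    Eqsℕ M = let d = count M (p ∷ q ∷ []); t = count M (θ-pairs a b c); k = count M ks in
      Equationsℕ (d 0) (d 0 ℕ.+ d 1) (d 0 ℕ.+ d 1 ℕ.+ d 2) (t 0) (t 1) (t 2) (k 0) (k 1) (k 2)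

    private
      path = θ-path p q e a b c

    equations : ∀ {M} → Bound M → ∀ {P ρ : ℤ → ℤ} → (∀ s → path s ≡ P s + ρ s) →
                ∀ {π₀ π₁ π₂} → Win M (π₀ ∷ π₁ ∷ π₂ ∷ []) P → Hi (M ℕ.+ 3) ρ → Eqs M π₀ π₁ π₂
    equations {M} B {P} {ρ} split hP hρ
      = let R , hR , eq = θ-core {p} {q} {e} {a} {b} {c} {ks} M 3 3≤M (s≤s (s≤s (s≤s z≤n))) 1≤a a≤b b≤c M≤p M≤q M≤ab M≤ks H in
        θ-equations ds≥ ts≥ M≤ks hP (hρ ⊕ hR) (λ s → subst (λ r → θ-balance (p ∷ q ∷ []) (θ-pairs a b c) ks s r ≡ 0ℤ)
          (trans (cong (_+ R s) (split s)) (ℤ.+-assoc (P s) (ρ s) (R s))) (eq s))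
      where open Bound B

    equationsℕ : ∀ {M} → Bound M → Hi (M ℕ.+ 3) path → Eqsℕ M
    equationsℕ {M} B h = toℕ (equations B {P = λ _ → 0ℤ} (λ s → sym (ℤ.+-identityˡ _)) (Hi⇒win 3 ℕ.≤-refl (Hi-0ᶠ (M ℕ.+ 3))) h) refl refl refl

    minimum : ∃ λ M → Bound M × 1 ≤ count M (p ∷ q ∷ []) 0 ℕ.+ (count M (θ-pairs a b c) 0 ℕ.+ count M ks 0)
    minimum = let M , le , attained = least p (q ∷ θ-pairs a b c ++ ks) in
      M , bound le attained , subst (1 ≤_) (trans (count-++ M (p ∷ q ∷ []) (θ-pairs a b c ++ ks) 0)
                                (cong (count M (p ∷ q ∷ []) 0 ℕ.+_) (count-++ M (θ-pairs a b c) ks 0))) attained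
      where
      lower : All (3 ≤_) (p ∷ q ∷ θ-pairs a b c ++ ks)
      lower = 3≤p ∷ 3≤q ∷ 3≤ab ∷ ℕ.≤-trans 3≤ab (ℕ.+-monoʳ-≤ a b≤c) ∷ ℕ.≤-trans 3≤ab (ℕ.+-mono-≤ a≤b b≤c) ∷ 3≤ks
      3≤least : ∀ {M} ns → All (3 ≤_) ns → 1 ≤ count M ns 0 → All (M ≤_) ns → 3 ≤ M
      3≤least {M} (n ∷ ns) (l ∷ ls) c (le ∷ les) with M ℕ.≟ n
      ... | yes refl = l
      ... | no  M≢n  = 3≤least ns ls (subst (λ k → 1 ≤ k ℕ.+ count M ns 0) (<⇒δ₀≡0 (ℕ.≤∧≢⇒< le M≢n)) c) les
      bound : ∀ {M} → All (M ≤_) (p ∷ q ∷ θ-pairs a b c ++ ks) → 1 ≤ count M (p ∷ q ∷ θ-pairs a b c ++ ks) 0 → Bound M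
      bound le attained = record
        { 3≤M  = 3≤least _ lower attained le
        ; M≤p  = All.head le
        ; M≤ab = All.head (All.tail (All.tail le))
        ; M≤ks = All.++⁻ʳ (p ∷ q ∷ θ-pairs a b c) le
        }

    -- If the equations hold without path terms at the least exponent M, then M
    -- is the length of the shortest cycle of the theta graph.
    theta-shortest : ∀ {M} → Bound M →
      1 ≤ count M (p ∷ q ∷ []) 0 ℕ.+ (count M (θ-pairs a b c) 0 ℕ.+ count M ks 0) → Eqsℕ M →
      count M ks 0 ≡ 0 × M ≡ a ℕ.+ b
    theta-shortest {M} B att E = k₀≡0 , ℕ.≤-antisym M≤ab (ℕ.≮⇒≥ λ M<ab → contradiction (subst (1 ≤_) (all-zero M<ab) att) λ ())
      where
      open Bound B
      k₀≡0 = no-cycle (count₂ M p q) E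
      t₀≡0 : M < a ℕ.+ b → count M (θ-pairs a b c) 0 ≡ 0
      t₀≡0 lt = none-above (lt ∷ ℕ.≤-trans lt (ℕ.+-monoʳ-≤ a b≤c) ∷ ℕ.≤-trans lt (ℕ.+-mono-≤ a≤b b≤c) ∷ [])
      all-zero : M < a ℕ.+ b → count M (p ∷ q ∷ []) 0 ℕ.+ (count M (θ-pairs a b c) 0 ℕ.+ count M ks 0) ≡ 0
      all-zero lt = cong₂ ℕ._+_ (trans (Equationsℕ.eq₀ E) (cong₂ ℕ._+_ (t₀≡0 lt) k₀≡0)) (cong₂ ℕ._+_ (t₀≡0 lt) k₀≡0)

    Eq₃ : ℕ → ℤ → Set
    Eq₃ M π₃ = let d = count M (p ∷ q ∷ []); t = count M (θ-pairs a b c); k = count M ks in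
      + 2 * + (d 0 ℕ.+ (d 1 ℕ.+ d 1 ℕ.+ d 1) ℕ.+ d 2 ℕ.+ d 3) + π₃ ≡
      + 2 * + (t 1 ℕ.+ t 1 ℕ.+ t 3 ℕ.+ (k 0 ℕ.+ k 0 ℕ.+ k 0 ℕ.+ k 0 ℕ.+ (k 1 ℕ.+ k 1 ℕ.+ k 1 ℕ.+ k 1 ℕ.+ k 1) ℕ.+ (k 2 ℕ.+ k 2) ℕ.+ k 3))

    equation₃ : ∀ {M} → Bound M → 4 ≤ M → ∀ {P ρ : ℤ → ℤ} → (∀ s → path s ≡ P s + ρ s) →
      ∀ {π₀ π₁ π₂ π₃} → Win M (π₀ ∷ π₁ ∷ π₂ ∷ π₃ ∷ []) P → Hi (M ℕ.+ 4) ρ → Eq₃ M π₃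
    equation₃ {M} B 4≤M {P} {ρ} split hP hρ
      = let R , hR , eq = θ-core {p} {q} {e} {a} {b} {c} {ks} M 4 4≤M ℕ.≤-refl 1≤a a≤b b≤c M≤p M≤q M≤ab M≤ks H in
        θ-equation₃ ds≥ ts≥ M≤ks hP (hρ ⊕ hR) (λ s → subst (λ r → θ-balance (p ∷ q ∷ []) (θ-pairs a b c) ks s r ≡ 0ℤ)
          (trans (cong (_+ R s) (split s)) (ℤ.+-assoc (P s) (ρ s) (R s))) (eq s))
      where open Bound B

    E-term : ℤ → ℤ
    E-term s = - 1ℤ * (W e s * (Y p s * Y q s))

    term : ℕ → ℤ → ℤ
    term n s = 1ℤ * (W n s * (y₀ s * y₀ s))

    Hi-E : Hi (2 ℕ.+ (e ℕ.+ e)) E-term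
    Hi-E = Hi-path (- 1ℤ) e (λ s → Y p s * Y q s) (Hi-YY 3≤p 3≤q)

    Hi-term : ∀ n → Hi (2 ℕ.+ (n ℕ.+ n)) (term n)
    Hi-term n = Hi-path 1ℤ n (λ s → y₀ s * y₀ s) Hi-y₀²

    win-E : ∀ {M} → M ≤ 2 ℕ.+ (e ℕ.+ e) → let j = 2 ℕ.+ (e ℕ.+ e) ∸ M; g = - 1ℤ * sg e in ∃ λ κ →
      Win M (g * + δ j 0 ∷ g * (+ 2 * + δ j 0 + + δ j 1) ∷ g * (κ * + δ j 0 + + 2 * + δ j 1 + + δ j 2) ∷ []) E-term
    win-E le = let U , κ , hU , eq = YY-unit p q 3≤p 3≤q in κ , path-window (- 1ℤ) e {U = U} eq hU le

    win-term : ∀ {M} n → M ≤ 2 ℕ.+ (n ℕ.+ n) → let j = 2 ℕ.+ (n ℕ.+ n) ∸ M; g = 1ℤ * sg n in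
      Win M (g * + δ j 0 ∷ g * (+ 2 * + δ j 0 + + δ j 1) ∷ g * (1ℤ * + δ j 0 + + 2 * + δ j 1 + + δ j 2) ∷ []) (term n)
    win-term n = path-window 1ℤ n {Z = λ s → y₀ s * y₀ s} {U = λ s → (1ℤ + s) * (1ℤ + s)} y₀²-unit win-1+s²

    module Scalene (a<b : a < b) where

      2b-far : ∀ {M} → M ≤ a ℕ.+ b → M ℕ.+ 3 ≤ 2 ℕ.+ (b ℕ.+ b)
      2b-far {M} le = ℕ.≤-trans (ℕ.≤-reflexive (ℕ.+-comm M 3)) (s≤s (s≤s (ℕ.≤-trans (s≤s le) (ℕ.+-monoˡ-≤ b a<b))))

      2c-far : ∀ {M} → M ≤ a ℕ.+ b → M ℕ.+ 3 ≤ 2 ℕ.+ (c ℕ.+ c)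
      2c-far le = ℕ.≤-trans (2b-far le) (ℕ.+-monoʳ-≤ 2 (ℕ.+-mono-≤ b≤c b≤c))

      far-or-equal : ∀ {M} → Bound M → e ≢ a → M ℕ.+ 3 ≤ 2 ℕ.+ (e ℕ.+ e) × M ℕ.+ 3 ≤ 2 ℕ.+ (a ℕ.+ a)
      far-or-equal {M} B e≢a = subst (λ m → m ℕ.+ 3 ≤ E × m ℕ.+ 3 ≤ A) M′≡M (M′-far-E , M′-far-A)
        where
        open Bound B
        E = 2 ℕ.+ (e ℕ.+ e)
        A = 2 ℕ.+ (a ℕ.+ a)
        M′ = M ⊓ (E ⊓ A)
        M′≤M : M′ ≤ M
        M′≤M = ℕ.m⊓n≤m M (E ⊓ A)
        M′≤E : M′ ≤ E
        M′≤E = ℕ.≤-trans (ℕ.m⊓n≤n M (E ⊓ A)) (ℕ.m⊓n≤m E A)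
        M′≤A : M′ ≤ A
        M′≤A = ℕ.≤-trans (ℕ.m⊓n≤n M (E ⊓ A)) (ℕ.m⊓n≤n E A)
        3≤2+ : ∀ {n} → 1 ≤ n → 3 ≤ 2 ℕ.+ (n ℕ.+ n)
        3≤2+ {n} l = s≤s (s≤s (ℕ.≤-trans l (ℕ.m≤m+n n n)))
        B′ : Bound M′
        B′ = record { 3≤M = ℕ.⊓-glb 3≤M (ℕ.⊓-glb (3≤2+ 1≤e) (3≤2+ 1≤a)) ; M≤p = ℕ.≤-trans M′≤M M≤p
                    ; M≤ab = ℕ.≤-trans M′≤M M≤ab ; M≤ks = All.map (ℕ.≤-trans M′≤M) M≤ks }
        j≢i : E ∸ M′ ≢ A ∸ M′
        j≢i eq = e≢a (double-injective (ℕ.suc-injective (ℕ.suc-injective (ℕ.∸-cancelʳ-≡ M′≤E M′≤A eq))))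
          where
          double-injective : ∀ {m n} → m ℕ.+ m ≡ n ℕ.+ n → m ≡ n
          double-injective {m} {n} h = ℕ.*-cancelˡ-≡ m n 2 (trans (cong (m ℕ.+_) (ℕ.+-identityʳ m)) (trans h (cong (n ℕ.+_) (sym (ℕ.+-identityʳ n)))))
        one-unit : ∀ {g} → Unit g → Unit (1ℤ * g)
        one-unit (inj₁ refl) = inj₁ refl
        one-unit (inj₂ refl) = inj₂ refl
        split : ∀ s → path s ≡ (E-term s + term a s) + (term b s + term c s)
        split s = sym (ℤ.+-assoc (E-term s) (term a s) (term b s + term c s))
        far : 3 ≤ E ∸ M′ × 3 ≤ A ∸ M′
        far = let κ , hE = win-E M′≤E in
          paths-far {κ = κ} {κ′ = 1ℤ} (neg-unit (sg-unit e)) (one-unit (sg-unit a)) (E ∸ M′) (A ∸ M′) j≢i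
            (equations B′ {P = λ s → E-term s + term a s} {ρ = λ s → term b s + term c s} split
              (hE ⊞ win-term a M′≤A)
              (Hi-≤ (2b-far (Bound.M≤ab B′)) (Hi-term b) ⊕ Hi-≤ (2c-far (Bound.M≤ab B′)) (Hi-term c)))
        up : ∀ {N} → M′ ≤ N → 3 ≤ N ∸ M′ → M′ ℕ.+ 3 ≤ N
        up le l = ℕ.≤-trans (ℕ.+-monoʳ-≤ M′ l) (ℕ.≤-reflexive (ℕ.m+[n∸m]≡n le))
        M′-far-E = up M′≤E (proj₁ far)
        M′-far-A = up M′≤A (proj₂ far)
        not : ∀ {N} → M′ ℕ.+ 3 ≤ N → M′ ≢ N
        not l eq = ℕ.m+1+n≰m M′ (subst (M′ ℕ.+ 3 ≤_) (sym eq) l)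
        M′≡M : M′ ≡ M
        M′≡M with ℕ.⊓-sel M (E ⊓ A) | ℕ.⊓-sel E A
        ... | inj₁ h | _       = h
        ... | inj₂ h | inj₁ h′ = contradiction (trans h h′) (not M′-far-E)
        ... | inj₂ h | inj₂ h′ = contradiction (trans h h′) (not M′-far-A)

      M = proj₁ minimum
      B = proj₁ (proj₂ minimum)
      attained = proj₂ (proj₂ minimum)

      e≡a : e ≡ a
      e≡a with e ℕ.≟ a
      ... | yes eq = eq
      ... | no e≢a = contradiction
        (ℕ.≤-trans (ℕ.≤-reflexive (ℕ.+-comm 3 (a ℕ.+ a))) (ℕ.≤-trans (ℕ.+-monoˡ-≤ 3 (ℕ.+-monoʳ-≤ a (ℕ.<⇒≤ a<b)))
          (subst (λ m → m ℕ.+ 3 ≤ 2 ℕ.+ (a ℕ.+ a)) M≡ab farA))) ℕ.1+n≰n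
        where
        farE = proj₁ (far-or-equal B e≢a)
        farA = proj₂ (far-or-equal B e≢a)
        M≡ab = proj₂ (theta-shortest B attained (equationsℕ B (Hi-≤ farE Hi-E ⊕ (Hi-≤ farA (Hi-term a)
          ⊕ (Hi-≤ (2b-far (Bound.M≤ab B)) (Hi-term b) ⊕ Hi-≤ (2c-far (Bound.M≤ab B)) (Hi-term c))))))

      ΔYY : ∀ {M} → Bound M → Hi (M ℕ.+ suc (a ℕ.+ a)) (λ s → E-term s + term a s)
      ΔYY {M} Bd = win-ext (λ s → trans (ΔYY-shape (W a s) (Y p s * Y q s) (y₀ s * y₀ s))
          (cong (λ n → - 1ℤ * (W n s * (Y p s * Y q s)) + term a s) (sym e≡a)))
        (subst (λ n → Hi n (λ s → - 1ℤ * (W a s * (Y p s * Y q s - y₀ s * y₀ s)))) (ΔYY-order M a)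
          (Hi-*ˡ (λ _ → - 1ℤ) (Hi-* (Hi-W a) (Hi-ΔYY p q (ℕ.≤-trans (s≤s z≤n) 3≤M) M≤p M≤q))))
        where
        open Bound Bd

      eqs : Eqsℕ M
      eqs = equationsℕ B (win-ext (λ s → ℤ.+-assoc (E-term s) (term a s) (term b s + term c s))
        (Hi-≤ (ℕ.+-monoʳ-≤ M (s≤s (ℕ.+-mono-≤ 1≤a 1≤a))) (ΔYY B)
         ⊕ (Hi-≤ (2b-far (Bound.M≤ab B)) (Hi-term b) ⊕ Hi-≤ (2c-far (Bound.M≤ab B)) (Hi-term c))))

      M≡ab : M ≡ a ℕ.+ b
      M≡ab = proj₂ (theta-shortest B attained eqs)

      k₀≡0 : count M ks 0 ≡ 0
      k₀≡0 = proj₁ (theta-shortest B attained eqs)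

module OffsetCases where

  open import Data.Empty using (⊥; ⊥-elim)
  open import Data.Nat.Base
  open Windows using (δ)
  open CoefficientEquations using (Equationsℕ; eqsℕ)

  d# : ℕ → ℕ → ℕ → ℕ
  d# p q j = δ p j + (δ q j + 0)

  t# : ℕ → ℕ → ℕ → ℕ
  t# γ ω j = δ 0 j + (δ γ j + (δ ω j + 0))

  private
    scalene-shape : ∀ t k₁ k₂ → t + (suc k₁ + suc k₁ + k₂) ≡ suc (suc (t + (k₁ + k₁ + k₂)))
    scalene-shape = ℕ-solve-∀

    scalene-shape₁ : ∀ a β → suc a + suc (suc a + suc β) ≡ suc a + suc a + suc (suc β)
    scalene-shape₁ = ℕ-solve-∀

    scalene-shape₁₁ : ∀ a β γ → suc a + suc a + 1 + (2 + β + γ) ≡ suc γ + (suc a + suc (suc a + suc β))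
    scalene-shape₁₁ = ℕ-solve-∀

    scalene-shape₂ : ∀ a q → suc a + suc a + 0 + suc q ≡ suc a + suc a + 1 + q
    scalene-shape₂ = ℕ-solve-∀

  -- Offsets p̂, q̂, γ, ω of the cycle lengths relative to a + b, where Σ is the
  -- total length of the cycle components.
  scalene : ∀ a β p q γ k₁ k₂ Σ → 1 ≤ a → p ≤ q → let ω = γ + suc β in
    Equationsℕ (d# p q 0) (d# p q 0 + d# p q 1) (d# p q 0 + d# p q 1 + d# p q 2)
               (t# γ ω 0) (t# γ ω 1) (t# γ ω 2) 0 k₁ k₂ →
    γ + Σ ≡ a + a + p + q → (Σ ≡ 0 × k₁ ≡ 0) ⊎ a + suc (a + suc β) ≤ Σ →
    p ≡ 0 × γ ≡ 1 × k₁ ≡ 0 × (∃ λ q′ → q ≡ 3 + q′) × ((β ≡ 0 × k₂ ≡ 0) ⊎ (1 ≤ β × k₂ ≡ 1))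
  scalene a β (suc p) (suc q) γ k₁ k₂ Σ 1≤a p≤q (eqsℕ () _ _) total large
  scalene (suc a) β zero q zero k₁ k₂ Σ 1≤a p≤q (eqsℕ e₀ _ _) total large = ⊥-elim (absurd large)
    where
    q≡0 : ∀ q → 1 + (δ q 0 + 0) ≡ 2 + (δ (suc β) 0 + 0) + 0 → q ≡ 0
    q≡0 zero e = refl
    Σ≡2a : Σ ≡ suc a + suc a
    Σ≡2a = trans total (trans (cong (λ k → suc a + suc a + 0 + k) (q≡0 q e₀)) (trans (ℕ.+-identityʳ _) (ℕ.+-identityʳ _)))
    absurd : _ → ⊥
    absurd (inj₁ (Σ≡0 , _)) with () ← trans (sym Σ≡0) Σ≡2a
    absurd (inj₂ l) = ℕ.m+1+n≰m (suc a + suc a) (subst (_≤ suc a + suc a) (scalene-shape₁ a β) (subst (_ ≤_) Σ≡2a l))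
  scalene (suc a) β zero zero (suc γ) k₁ k₂ Σ 1≤a p≤q (eqsℕ () _ _) total large
  scalene (suc a) β zero (suc q) (suc γ) k₁ k₂ Σ 1≤a p≤q (eqsℕ _ e₁ e₂) total (inj₁ (refl , refl)) =
    ⊥-elim (γ≡0 γ (trans e₁ (ℕ.+-identityʳ _)) total)
    where
    γ≡0 : ∀ γ → 1 + (δ (suc q) 1 + 0) ≡ δ γ 0 + (δ (γ + suc β) 0 + 0) → suc γ + 0 ≡ suc a + suc a + 0 + suc q → ⊥
    γ≡0 zero    e t with () ← trans t (trans (cong (_+ suc q) (ℕ.+-identityʳ (suc a + suc a))) (ℕ.+-suc (suc a + suc a) q))
    γ≡0 (suc γ) () t
  scalene (suc a) β zero (suc q) (suc γ) k₁ k₂ Σ 1≤a p≤q E total (inj₂ large) = go (large-q q q≥) E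
    where
    q≥ : 2 + β + γ ≤ q
    q≥ = ℕ.+-cancelˡ-≤ (suc a + suc a + 1) _ _ (begin
      suc a + suc a + 1 + (2 + β + γ)          ≡⟨ scalene-shape₁₁ a β γ ⟩
      suc γ + (suc a + suc (suc a + suc β))    ≤⟨ ℕ.+-monoʳ-≤ (suc γ) large ⟩
      suc γ + Σ                                ≡⟨ total ⟩
      suc a + suc a + 0 + suc q                ≡⟨ scalene-shape₂ a q ⟩
      suc a + suc a + 1 + q                    ∎)
      where
      open ℕ.≤-Reasoning
    large-q : ∀ q → 2 + β + γ ≤ q → ∃ λ q′ → q ≡ 2 + q′
    large-q (suc (suc q)) _ = q , refl
    large-q 1 (s≤s ())
    go : ∀ {q} → (∃ λ q′ → q ≡ 2 + q′) → let ω = suc γ + suc β in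
      Equationsℕ (d# 0 (suc q) 0) (d# 0 (suc q) 0 + d# 0 (suc q) 1) (d# 0 (suc q) 0 + d# 0 (suc q) 1 + d# 0 (suc q) 2)
                 (t# (suc γ) ω 0) (t# (suc γ) ω 1) (t# (suc γ) ω 2) 0 k₁ k₂ →
      0 ≡ 0 × suc γ ≡ 1 × k₁ ≡ 0 × (∃ λ q′ → suc q ≡ 3 + q′) × ((β ≡ 0 × k₂ ≡ 0) ⊎ (1 ≤ β × k₂ ≡ 1))
    go (q′ , refl) (eqsℕ _ e₁ e₂) = cases γ k₁ β k₂ e₁ e₂
      where
      cases : ∀ γ k₁ β k₂ → 1 ≡ δ γ 0 + (δ (γ + suc β) 0 + 0) + k₁ →
        1 ≡ δ γ 1 + (δ (γ + suc β) 1 + 0) + (k₁ + k₁ + k₂) →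
        0 ≡ 0 × suc γ ≡ 1 × k₁ ≡ 0 × (∃ λ q″ → suc (suc (suc q′)) ≡ 3 + q″) × ((β ≡ 0 × k₂ ≡ 0) ⊎ (1 ≤ β × k₂ ≡ 1))
      cases γ (suc k₁) β k₂ f₁ f₂ = contradiction
        (trans f₂ (scalene-shape (δ γ 1 + (δ (γ + suc β) 1 + 0)) k₁ k₂)) λ ()
      cases zero    zero zero    zero f₁ f₂ = refl , refl , refl , (q′ , refl) , inj₁ (refl , refl)
      cases zero    zero (suc β) k₂   f₁ f₂ = refl , refl , refl , (q′ , refl) , inj₂ (s≤s z≤n , sym f₂)
      cases (suc γ) zero β       k₂   () f₂

  -- For a = b the two equal paths contribute ε = ± 1 to the coefficient at 2a + 2 and ± 2 to the
  -- next one.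
  isosceles⁺ : ∀ p q γ k₀ k₁ k₂ k₃ → p ≤ q → 1 ≤ γ →
    d# p q 0 ≡ t# γ γ 0 + k₀ → d# p q 0 + d# p q 1 ≡ t# γ γ 1 + (k₀ + k₀ + k₁) →
    d# p q 0 + d# p q 1 + d# p q 2 + 1 ≡ t# γ γ 2 + (k₀ + k₀ + k₀ + (k₁ + k₁) + k₂) →
    d# p q 0 + (d# p q 1 + d# p q 1 + d# p q 1) + d# p q 2 + d# p q 3 + 2 ≡
      t# γ γ 1 + t# γ γ 1 + t# γ γ 3 + (k₀ + k₀ + k₀ + k₀ + (k₁ + k₁ + k₁ + k₁ + k₁) + (k₂ + k₂) + k₃) →
    p ≡ 0 × q ≡ 0 × k₀ ≡ 1
  isosceles⁺ (suc p) (suc q) (suc γ) k₀ k₁ k₂ k₃ le 1≤γ () e₁ e₂ e₃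
  isosceles⁺ 0 0 (suc γ) k₀ k₁ k₂ k₃ le 1≤γ refl e₁ e₂ e₃ = refl , refl , refl
  isosceles⁺ 0 1 1 k₀ 0 k₂ k₃ le 1≤γ refl e₁ refl ()
  isosceles⁺ 0 (suc (suc q)) 1 k₀ k₁ k₂ k₃ le 1≤γ refl () e₂ e₃
  isosceles⁺ 0 1 2 k₀ k₁ k₂ k₃ le 1≤γ refl refl () e₃
  isosceles⁺ 0 2 2 k₀ k₁ k₂ k₃ le 1≤γ refl refl () e₃
  isosceles⁺ 0 (suc (suc (suc q))) 2 k₀ k₁ k₂ k₃ le 1≤γ refl refl () e₃
  isosceles⁺ 0 1 (suc (suc (suc γ))) k₀ k₁ k₂ k₃ le 1≤γ refl refl () e₃
  isosceles⁺ 0 2 3 k₀ k₁ k₂ k₃ le 1≤γ refl refl refl ()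
  isosceles⁺ 0 2 (suc (suc (suc (suc γ)))) k₀ k₁ k₂ k₃ le 1≤γ refl refl refl ()
  isosceles⁺ 0 3 3 k₀ k₁ k₂ k₃ le 1≤γ refl refl refl ()
  isosceles⁺ 0 3 (suc (suc (suc (suc γ)))) k₀ k₁ k₂ k₃ le 1≤γ refl refl refl ()
  isosceles⁺ 0 (suc (suc (suc (suc q)))) 3 k₀ k₁ k₂ k₃ le 1≤γ refl refl refl ()
  isosceles⁺ 0 (suc (suc (suc (suc q)))) (suc (suc (suc (suc γ)))) k₀ k₁ k₂ k₃ le 1≤γ refl refl refl ()

  isosceles⁻ : ∀ p q γ k₀ k₁ k₂ k₃ → p ≤ q → 1 ≤ γ →
    d# p q 0 ≡ t# γ γ 0 + k₀ → d# p q 0 + d# p q 1 ≡ t# γ γ 1 + (k₀ + k₀ + k₁) →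
    d# p q 0 + d# p q 1 + d# p q 2 ≡ 1 + (t# γ γ 2 + (k₀ + k₀ + k₀ + (k₁ + k₁) + k₂)) →
    d# p q 0 + (d# p q 1 + d# p q 1 + d# p q 1) + d# p q 2 + d# p q 3 ≡
      2 + (t# γ γ 1 + t# γ γ 1 + t# γ γ 3 + (k₀ + k₀ + k₀ + k₀ + (k₁ + k₁ + k₁ + k₁ + k₁) + (k₂ + k₂) + k₃)) → ⊥
  isosceles⁻ (suc p) (suc q) (suc γ) k₀ k₁ k₂ k₃ le 1≤γ () e₁ e₂ e₃
  isosceles⁻ 0 0 1 k₀ k₁ k₂ k₃ le 1≤γ refl () e₂ e₃
  isosceles⁻ 0 0 2 k₀ k₁ k₂ k₃ le 1≤γ refl refl () e₃
  isosceles⁻ 0 0 (suc (suc (suc γ))) k₀ k₁ k₂ k₃ le 1≤γ refl refl () e₃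
  isosceles⁻ 0 1 1 k₀ 0 k₂ k₃ le 1≤γ refl e₁ refl ()
  isosceles⁻ 0 (suc (suc q)) 1 k₀ k₁ k₂ k₃ le 1≤γ refl () e₂ e₃
  isosceles⁻ 0 1 2 k₀ k₁ k₂ k₃ le 1≤γ refl refl () e₃
  isosceles⁻ 0 2 2 k₀ k₁ k₂ k₃ le 1≤γ refl refl () e₃
  isosceles⁻ 0 (suc (suc (suc q))) 2 k₀ k₁ k₂ k₃ le 1≤γ refl refl () e₃
  isosceles⁻ 0 1 (suc (suc (suc γ))) k₀ k₁ k₂ k₃ le 1≤γ refl refl () e₃
  isosceles⁻ 0 2 (suc (suc (suc γ))) k₀ k₁ k₂ k₃ le 1≤γ refl refl () e₃
  isosceles⁻ 0 (suc (suc (suc q))) (suc (suc (suc γ))) k₀ k₁ k₂ k₃ le 1≤γ refl refl () e₃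

  scalene-order₃ : ∀ x q β k₃ → x ≤ 1 → let q̂ = 3 + q in
    x + (d# 0 q̂ 0 + (d# 0 q̂ 1 + d# 0 q̂ 1 + d# 0 q̂ 1) + d# 0 q̂ 2 + d# 0 q̂ 3) ≡
    t# 1 (1 + suc β) 1 + t# 1 (1 + suc β) 1 + t# 1 (1 + suc β) 3 + (0 + 0 + (1 + 1) + k₃) → ⊥
  scalene-order₃ 0 0 0 k₃ x≤1 ()
  scalene-order₃ 0 0 1 k₃ x≤1 ()
  scalene-order₃ 0 0 (suc (suc β)) k₃ x≤1 ()
  scalene-order₃ 0 (suc q) 0 k₃ x≤1 ()
  scalene-order₃ 0 (suc q) 1 k₃ x≤1 ()
  scalene-order₃ 0 (suc q) (suc (suc β)) k₃ x≤1 ()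
  scalene-order₃ 1 0 0 k₃ x≤1 ()
  scalene-order₃ 1 0 1 k₃ x≤1 ()
  scalene-order₃ 1 0 (suc (suc β)) k₃ x≤1 ()
  scalene-order₃ 1 (suc q) 0 k₃ x≤1 ()
  scalene-order₃ 1 (suc q) 1 k₃ x≤1 ()
  scalene-order₃ 1 (suc q) (suc (suc β)) k₃ x≤1 ()
  scalene-order₃ (suc (suc x)) q β k₃ (s≤s ()) e

  scalene-finish : ∀ {p q q′ γ β k₀ k₁ k₂ t₁ t₃} x k₃ → p ≡ 0 → q ≡ 3 + q′ → γ ≡ 1 → k₀ ≡ 0 → k₁ ≡ 0 → k₂ ≡ 1 →
    t₁ ≡ t# γ (γ + suc β) 1 → t₃ ≡ t# γ (γ + suc β) 3 → x ≤ 1 →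
    x + (d# p q 0 + (d# p q 1 + d# p q 1 + d# p q 1) + d# p q 2 + d# p q 3) ≡
    t₁ + t₁ + t₃ + (k₀ + k₀ + k₀ + k₀ + (k₁ + k₁ + k₁ + k₁ + k₁) + (k₂ + k₂) + k₃) → ⊥
  scalene-finish {q′ = q′} {β = β} x k₃ refl refl refl refl refl refl refl refl x≤1 h = scalene-order₃ x q′ β k₃ x≤1 h

  leading-count : ∀ {p q q′} → p ≡ 0 → q ≡ 3 + q′ → d# p q 0 ≡ 1
  leading-count refl refl = refl

module ScaleneTheta where

  open import Data.Empty using (⊥)
  open import Data.Integer.Base as ℤ using (ℤ; 0ℤ; 1ℤ; +_; _+_; _*_; _-_; -_; _^_)
  open import Data.List.Base using (List; []; _∷_)
  open import Data.List.Relation.Unary.All using (All; []; _∷_)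
  open import Data.Nat.Base as ℕ using (ℕ; suc; z≤n; s≤s; _≤_; _<_; _∸_)
  open import Data.Nat.ListAction using (sum)
  open import Data.Vec.Base using ([]; _∷_)
  import Data.Vec.Relation.Unary.All as V
  open Windows
  open ShapeFunctions
  open CoefficientEquations
  open ThetaEquations
  open OffsetCases

  private
    win-term₄-shape : ∀ s g t → 1ℤ * g * ((1ℤ + s) * (1ℤ + s) * (s * (s * t))) ≡ 1ℤ * (g * t * ((s + s * s) * (s + s * s)))
    win-term₄-shape = solve-∀

  win-term₄ : ∀ {M} n → M ≤ 2 ℕ.+ (n ℕ.+ n) → let j = 2 ℕ.+ (n ℕ.+ n) ∸ M in
    Win M (1ℤ * sg n * + δ j 0 ∷ 1ℤ * sg n * (+ 2 * + δ j 0 + + δ j 1) ∷ 1ℤ * sg n * (+ δ j 0 + + 2 * + δ j 1 + + δ j 2)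
           ∷ 1ℤ * sg n * (+ δ j 1 + + 2 * + δ j 2 + + δ j 3) ∷ []) (λ s → 1ℤ * (W n s * (y₀ s * y₀ s)))
  win-term₄ {M} n le = win-ext
    (λ s → trans (win-term₄-shape s (sg n) (s ^ (n ℕ.+ n))) (cong (λ w → 1ℤ * (w * (y₀ s * y₀ s))) (sym (W-sg n s))))
    (_⊡_ {f = λ s → (1ℤ + s) * (1ℤ + s) * s ^ (2 ℕ.+ (n ℕ.+ n))} (1ℤ * sg n) (win-P (win-pow le)))

  private
    ΔYY-window-shape : ∀ s t n u → + 2 * (s * s * (s + s * s) * (1ℤ + s * s)) * (t * (n + s * u)) ≡
      t * (0ℤ + s * (0ℤ + s * (0ℤ + s * (+ 2 * n + s * (+ 2 * u * ((1ℤ + s) * (1ℤ + s * s)) + + 2 * n * (1ℤ + s + s * s))))))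
    ΔYY-window-shape = solve-∀

    ΔYY-window-sum-shape : ∀ s t u v y a b →
      + 2 * (s * s * y * t) * (u + (v + 0ℤ)) + s * s * (y * a + y * b + (y + + 2 * (t * u) + a - y) * (y + + 2 * (t * v) + b - y)) ≡
      s * s * ((y + + 2 * (t * u) + a) * (y + + 2 * (t * v) + b) - y * y)
    ΔYY-window-sum-shape = solve-∀

  ΔYY-window : ∀ {M p q} → 4 ≤ M → M ≤ p → M ≤ q →
    Win M (0ℤ ∷ 0ℤ ∷ 0ℤ ∷ + 2 * + count M (p ∷ q ∷ []) 0 ∷ []) (λ s → s * s * (Y p s * Y q s - y₀ s * y₀ s))
  ΔYY-window {M} {p} {q} 4≤M lp lq = win-ext (λ s → ΔYY-window-sum-shape s (1ℤ + s * s) (s ^ p) (s ^ q) (y₀ s) (V p s) (V q s))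
    (win-cs (cong (λ t → 0ℤ ∷ 0ℤ ∷ 0ℤ ∷ t ∷ []) (ℤ.+-identityʳ (+ 2 * + count M (p ∷ q ∷ []) 0)))
      (_⊞_ {f = λ s → (+ 2 * (s * s * y₀ s * (1ℤ + s * s)) * Σpow (p ∷ q ∷ []) s)} {g = R} lead
        (Hi⇒win 4 (ℕ.+-monoʳ-≤ M 4≤M) hR)))
    where
    V : ℕ → ℤ → ℤ
    V p s = W p s * (+ 2 - s + s * s)
    R : ℤ → ℤ
    R s = s * s * (y₀ s * V p s + y₀ s * V q s + (Y p s - y₀ s) * (Y q s - y₀ s))
    hV : ∀ n → M ≤ n → Hi (M ℕ.+ M) (V n)
    hV n le = Hi-*ʳ (λ s → + 2 - s + s * s) (Hi-≤ (double le) (Hi-W n))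
    hR : Hi (M ℕ.+ M) R
    hR = Hi-*ˡ (λ s → s * s) (Hi-*ˡ y₀ (hV p lp) ⊕ Hi-*ˡ y₀ (hV q lq) ⊕ Hi-* (Hi-Y p lp) (Hi-Y q lq))
    lead : Win M (0ℤ ∷ 0ℤ ∷ 0ℤ ∷ + 2 * + count M (p ∷ q ∷ []) 0 ∷ [])
                 (λ s → + 2 * (s * s * y₀ s * (1ℤ + s * s)) * Σpow (p ∷ q ∷ []) s)
    lead = win λ s → let z , h = Win.at (win-Σpow (lp ∷ lq ∷ [])) s
                         n₀ = + count M (p ∷ q ∷ []) 0
                         u = + count M (p ∷ q ∷ []) 1 + s * (+ count M (p ∷ q ∷ []) 2 + s * (+ count M (p ∷ q ∷ []) 3 + s * z)) in
      + 2 * u * ((1ℤ + s) * (1ℤ + s * s)) + + 2 * n₀ * (1ℤ + s + s * s) ,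
      trans (cong (+ 2 * (s * s * y₀ s * (1ℤ + s * s)) *_) h) (ΔYY-window-shape s (s ^ M) n₀ u)

  private
    small-case-shape₁ : ∀ s w → (1ℤ + s + + 2 * (s * s)) * (1ℤ + s + + 2 * (s * s)) - 1ℤ - (s + s * s) * (s + s * s) * w ≡
      s * 1ℤ * (+ 2 + + 5 * s + + 4 * (s * s) + + 4 * (s * s * s) + (- (s * (1ℤ + s) * (1ℤ + s) * w)))
    small-case-shape₁ = solve-∀

    small-case-shape : ∀ s t w r → ((1ℤ + s + + 2 * (s * s)) * (1ℤ + s + + 2 * (s * s)) - 1ℤ - (s + s * s) * (s + s * s) * w) + + 2 * t + r ≡
      (1ℤ + s + + 2 * (s * s)) * (1ℤ + s + + 2 * (s * s)) + + 2 * t - (s + s * s) * (s + s * s) * w + r - 1ℤ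
    small-case-shape = solve-∀

    small-case-poly : ∀ x x′ x″ t y y′ y″ θ Σ r →
      x″ * x + t * (y″ * y) - θ + (- + 2 * Σ + (x * (x′ - x″) + t * (y * (y′ - y″)) + - (θ * r) + - (+ 2 * ((θ - 1ℤ) * Σ)))) ≡
      x * x′ - (- t) * 1ℤ * (y * y′) - θ * (1ℤ + + 2 * Σ + r)
    small-case-poly = solve-∀

    small-case-shape₂ : ∀ s →
      (1ℤ + s + + 2 * (s * s)) * ((1ℤ + s + + 2 * (s * s)) + + 2 * ((1ℤ + s * s) * (s * (s * (s * 1ℤ)))) + ((- (s * s)) * ((- (s * s)) * ((- (s * s)) * 1ℤ))) * (1ℤ - s))
      + s * s * ((s + s * s) * ((s + s * s) + + 2 * ((1ℤ + s * s) * (s * (s * (s * 1ℤ)))) + ((- (s * s)) * ((- (s * s)) * ((- (s * s)) * 1ℤ))) * (+ 2 - s + s * s)))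
      - ((1ℤ + s + + 2 * (s * s)) * (1ℤ + s + + 2 * (s * s)) - (s + s * s) * (s + s * s) * (((- (s * s)) * 1ℤ) + ((- (s * s)) * ((- (s * s)) * 1ℤ)) + ((- (s * s)) * ((- (s * s)) * ((- (s * s)) * 1ℤ))))
      + (1ℤ - s) * (1ℤ - s) * (((- (s * s)) * 1ℤ) * ((- (s * s)) * ((- (s * s)) * 1ℤ)) + ((- (s * s)) * 1ℤ) * ((- (s * s)) * ((- (s * s)) * ((- (s * s)) * 1ℤ))) + ((- (s * s)) * ((- (s * s)) * 1ℤ)) * ((- (s * s)) * ((- (s * s)) * ((- (s * s)) * 1ℤ))))
      - (+ 2 - s + s * s) * (+ 2 - s + s * s) * (((- (s * s)) * 1ℤ) * ((- (s * s)) * ((- (s * s)) * 1ℤ)) * ((- (s * s)) * ((- (s * s)) * ((- (s * s)) * 1ℤ))))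
      + + 2 * ((1ℤ + s * s) * (1ℤ + s * s) * ((s * (s * (s * 1ℤ))) * (1ℤ - ((- (s * s)) * ((- (s * s)) * ((- (s * s)) * 1ℤ)))) + (s * (s * (s * (s * 1ℤ)))) * (1ℤ - ((- (s * s)) * ((- (s * s)) * 1ℤ)))
      + (s * (s * (s * (s * (s * 1ℤ))))) * (1ℤ - ((- (s * s)) * 1ℤ)))))
      ≡ (s * (s * (s * (s * (s * (s * 1ℤ)))))) * (1ℤ + s * (- + 2 + s * (1ℤ + s * (- + 6 + s * (+ 2 + s * (- + 8 + s * (+ 6 + s * (- + 6 + s * (+ 5 + s * (- + 2 + s))))))))))
    small-case-shape₂ = solve-∀

    small-case-shape₃ : ∀ k → + 2 * k ≡ 1ℤ - (1ℤ + (- + 2 * k + 0ℤ))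
    small-case-shape₃ = solve-∀

  small-case : ∀ {q ks} → 7 ≤ q → All (6 ≤_) ks → (∀ s → dumbbell 3 q 1 s ≡ θ 1 2 3 s * cycles ks s) → ⊥
  small-case {q} {ks} 7≤q 6≤ks H = even≢odd 0ℤ (+ count 6 ks 0) {1ℤ} (inj₁ refl) (sym (move (+ count 6 ks 0) (V.head zeros)))
    where
    exp = cycles-expand ks 6≤ks
    R₃ = proj₁ exp
    F : ℤ → ℤ
    F s = x₀ s * X 3 s + s * s * (y₀ s * Y 3 s) - θ 1 2 3 s
    hF : Win 6 (1ℤ ∷ []) F
    hF = win λ s → - + 2 + s * (1ℤ + s * (- + 6 + s * (+ 2 + s * (- + 8 + s * (+ 6 + s * (- + 6 + s * (+ 5 + s * (- + 2 + s)))))))) , small-case-shape₂ s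
    rest : ℤ → ℤ
    rest s = X 3 s * (X q s - x₀ s) + s * s * (Y 3 s * (Y q s - y₀ s)) + - (θ 1 2 3 s * R₃ s) + - (+ 2 * ((θ 1 2 3 s - 1ℤ) * Σpow ks s))
    hrest : Hi 7 rest
    hrest = Hi-*ˡ (X 3) (Hi-X q 7≤q) ⊕ Hi-*ˡ (λ s → s * s) (Hi-*ˡ (Y 3) (Hi-Y q 7≤q))
      ⊕ neg (Hi-*ˡ (θ 1 2 3) (Hi-≤ (ℕ.m≤m+n 7 5) (proj₁ (proj₂ exp))))
      ⊕ neg (Hi-*ˡ (λ _ → + 2) (Hi-* hθ (win⇒Hi (win-Σpow 6≤ks))))
      where
      hθ : Hi 1 (λ s → θ 1 2 3 s - 1ℤ)
      hθ = let R , h , eq = θ-expand {3} 1 2 3 (s≤s z≤n) (s≤s (s≤s z≤n)) ℕ.≤-refl in win-ext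
        (λ s → trans (small-case-shape s ((1ℤ + s * s) * (1ℤ + s * s) * Σpow (θ-pairs 1 2 3) s) (W 1 s + W 2 s + W 3 s) (R s)) (cong (λ z → z - 1ℤ) (sym (eq s))))
        (win {M = 1} {cs = []} (λ s → + 2 + + 5 * s + + 4 * (s * s) + + 4 * (s * s * s) + (- (s * (1ℤ + s) * (1ℤ + s) * (W 1 s + W 2 s + W 3 s))) , small-case-shape₁ s (W 1 s + W 2 s + W 3 s))
         ⊕ Hi-*ˡ (λ _ → + 2) (Hi-*ˡ (λ s → (1ℤ + s * s) * (1ℤ + s * s)) (Hi-≤ (s≤s z≤n) (win⇒Hi (win-Σpow {3} {θ-pairs 1 2 3} (ℕ.≤-refl ∷ s≤s (s≤s (s≤s z≤n)) ∷ s≤s (s≤s (s≤s z≤n)) ∷ [])))))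
         ⊕ Hi-≤ (s≤s z≤n) h)
    zeros : V.All (_≡ 0ℤ) (1ℤ + (- + 2 * + count 6 ks 0 + 0ℤ) ∷ [])
    zeros = win-zero (λ s → shape (X 3 s) (X q s) (x₀ s) (s * s) (Y 3 s) (Y q s) (y₀ s) (θ 1 2 3 s) (Σpow ks s) (R₃ s)
                               (trans (H s) (cong (θ 1 2 3 s *_) (proj₂ (proj₂ exp) s))))
      (_⊞_ {f = F} {g = λ s → - + 2 * Σpow ks s + rest s} hF
        (_⊞_ {f = λ s → - + 2 * Σpow ks s} {g = rest} (_⊡_ {f = Σpow ks} (- + 2) (win-head (win-Σpow 6≤ks))) (Hi⇒win 1 ℕ.≤-refl hrest)))
      where
      shape : ∀ x x′ x″ t y y′ y″ θ Σ r → x * x′ - (- t) * 1ℤ * (y * y′) ≡ θ * (1ℤ + + 2 * Σ + r) →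
        x″ * x + t * (y″ * y) - θ + (- + 2 * Σ + (x * (x′ - x″) + t * (y * (y′ - y″)) + - (θ * r) + - (+ 2 * ((θ - 1ℤ) * Σ)))) ≡ 0ℤ
      shape x x′ x″ t y y′ y″ θ Σ r h = trans (small-case-poly x x′ x″ t y y′ y″ θ Σ r) (trans (cong (λ z → z - θ * (1ℤ + + 2 * Σ + r)) h) (ℤ.+-inverseʳ (θ * (1ℤ + + 2 * Σ + r))))
    move : ∀ k → 1ℤ + (- + 2 * k + 0ℤ) ≡ 0ℤ → + 2 * k ≡ + 2 * 0ℤ + 1ℤ
    move k e = trans (small-case-shape₃ k) (trans (cong (λ z → 1ℤ - z) e) refl)

  private
    split-shape : ∀ s u y → - 1ℤ * (- (s * s) * 1ℤ * u) + 1ℤ * (- (s * s) * 1ℤ * y) ≡ s * s * (u - y)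
    split-shape = solve-∀

    t-count-shape : ∀ b γ → b ℕ.+ (b ℕ.+ γ) ≡ b ℕ.+ b ℕ.+ γ
    t-count-shape = ℕ-solve-∀

    t-count-shape₂ : ∀ a b β γ → suc a ℕ.+ β ℕ.+ b ℕ.+ γ ≡ a ℕ.+ b ℕ.+ (γ ℕ.+ suc β)
    t-count-shape₂ = ℕ-solve-∀

    total′-shape : ∀ a b γ k → a ℕ.+ b ℕ.+ b ℕ.+ (γ ℕ.+ k) ≡ a ℕ.+ b ℕ.+ (b ℕ.+ γ) ℕ.+ k
    total′-shape = ℕ-solve-∀

    total′-shape₂ : ∀ a b p q → a ℕ.+ b ℕ.+ p ℕ.+ (a ℕ.+ b ℕ.+ q) ℕ.+ a ≡ a ℕ.+ b ℕ.+ b ℕ.+ (a ℕ.+ a ℕ.+ p ℕ.+ q)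
    total′-shape₂ = ℕ-solve-∀

    large-shape : ∀ a β → suc (a ℕ.+ (suc a ℕ.+ β)) ≡ a ℕ.+ suc (a ℕ.+ suc β)
    large-shape = ℕ-solve-∀

    bb-shape : ∀ a b β → 2 ℕ.+ (suc a ℕ.+ β ℕ.+ b) ≡ a ℕ.+ b ℕ.+ (3 ℕ.+ β)
    bb-shape = ℕ-solve-∀

    M≥-shape : ∀ a β → 2 ℕ.+ a ℕ.+ a ℕ.+ β ≡ suc (a ℕ.+ (suc a ℕ.+ β))
    M≥-shape = ℕ-solve-∀

    4≤M-shape : ∀ a β → suc (a ℕ.+ a ℕ.+ suc β) ≡ 2 ℕ.+ a ℕ.+ a ℕ.+ β
    4≤M-shape = ℕ-solve-∀

    a≥2-case-swap : ∀ x y z → x + (y + z) ≡ y + (x + z)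
    a≥2-case-swap = solve-∀

  small-case′ : ∀ {p q e a b c ks} → 7 ≤ q → All (6 ≤_) ks → p ≡ 3 → e ≡ 1 → a ≡ 1 → b ≡ 2 → c ≡ 3 →
    (∀ s → dumbbell p q e s ≡ θ a b c s * cycles ks s) → ⊥
  small-case′ {q = q} {ks = ks} 7≤q 6≤ks refl refl refl refl refl = small-case {q} {ks} 7≤q 6≤ks

  module _ {p q e a b c : ℕ} {ks : List ℕ} (3≤p : 3 ≤ p) (p≤q : p ≤ q) (1≤e : 1 ≤ e) (1≤a : 1 ≤ a)
           (a≤b : a ≤ b) (b≤c : b ≤ c) (3≤ab : 3 ≤ a ℕ.+ b) (3≤ks : All (3 ≤_) ks)
           (H : ∀ s → dumbbell p q e s ≡ θ a b c s * cycles ks s)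
           (total : a ℕ.+ b ℕ.+ c ℕ.+ sum ks ≡ p ℕ.+ q ℕ.+ e) (a<b : a < b) where

    private
      module T = Theta {p} {q} {e} {a} {b} {c} {ks} 3≤p p≤q 1≤e 1≤a a≤b b≤c 3≤ab 3≤ks H
      module S = T.Scalene a<b
      open T using (E-term; term)

    module AtMinimum {M : ℕ} (B : T.Bound M) (e≡a : e ≡ a) (M≡ab : M ≡ a ℕ.+ b) (k₀≡0 : count M ks 0 ≡ 0)
                     (eqs : T.Eqsℕ M) where
     private
      open T.Bound B
      γ = c ∸ b
      β = b ∸ suc a
      p̂ = p ∸ M
      q̂ = q ∸ M
      k = count M ks
      c≡ : b ℕ.+ γ ≡ c
      c≡ = ℕ.m+[n∸m]≡n b≤c
      b≡ : suc a ℕ.+ β ≡ b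
      b≡ = ℕ.m+[n∸m]≡n a<b
      t-count : ∀ j → count M (θ-pairs a b c) j ≡ t# γ (γ ℕ.+ suc β) j
      t-count j = cong₂ ℕ._+_ (δ-offset {M = M} {k = 0} j (trans (sym M≡ab) (sym (ℕ.+-identityʳ M))))
        (cong₂ ℕ._+_ (δ-offset {M = M} {k = γ} j (trans (cong (a ℕ.+_) (sym c≡)) (trans (sym (ℕ.+-assoc a b γ)) (cong (ℕ._+ γ) (sym M≡ab)))))
          (cong (ℕ._+ 0) (δ-offset {M = M} {k = γ ℕ.+ suc β} j (trans (cong (b ℕ.+_) (sym c≡)) (trans (t-count-shape b γ) (trans (cong (λ n → n ℕ.+ b ℕ.+ γ) (sym b≡))
            (trans (t-count-shape₂ a b β γ) (cong (ℕ._+ (γ ℕ.+ suc β)) (sym M≡ab)))))))))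
      ω = γ ℕ.+ suc β
      eqs′ : Equationsℕ (d# p̂ q̂ 0) (d# p̂ q̂ 0 ℕ.+ d# p̂ q̂ 1) (d# p̂ q̂ 0 ℕ.+ d# p̂ q̂ 1 ℕ.+ d# p̂ q̂ 2)
                        (t# γ ω 0) (t# γ ω 1) (t# γ ω 2) 0 (k 1) (k 2)
      eqs′ = eqsℕ
        (trans (Equationsℕ.eq₀ eqs) (cong₂ ℕ._+_ (t-count 0) k₀≡0))
        (trans (Equationsℕ.eq₁ eqs) (cong₂ (λ t k₀ → t ℕ.+ (k₀ ℕ.+ k₀ ℕ.+ k 1)) (t-count 1) k₀≡0))
        (trans (Equationsℕ.eq₂ eqs) (cong₂ (λ t k₀ → t ℕ.+ (k₀ ℕ.+ k₀ ℕ.+ k₀ ℕ.+ (k 1 ℕ.+ k 1) ℕ.+ k 2)) (t-count 2) k₀≡0))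
      total′ : γ ℕ.+ sum ks ≡ a ℕ.+ a ℕ.+ p̂ ℕ.+ q̂
      total′ = ℕ.+-cancelˡ-≡ (a ℕ.+ b ℕ.+ b) _ _ (begin
        a ℕ.+ b ℕ.+ b ℕ.+ (γ ℕ.+ sum ks)                     ≡⟨ total′-shape a b γ (sum ks) ⟩
        a ℕ.+ b ℕ.+ (b ℕ.+ γ) ℕ.+ sum ks                     ≡⟨ cong (λ n → a ℕ.+ b ℕ.+ n ℕ.+ sum ks) c≡ ⟩
        a ℕ.+ b ℕ.+ c ℕ.+ sum ks                            ≡⟨ total ⟩
        p ℕ.+ q ℕ.+ e                                      ≡⟨ cong₂ (λ u v → u ℕ.+ v ℕ.+ e) (offset M≤p) (offset M≤q) ⟩
        a ℕ.+ b ℕ.+ p̂ ℕ.+ (a ℕ.+ b ℕ.+ q̂) ℕ.+ e              ≡⟨ cong (λ n → a ℕ.+ b ℕ.+ p̂ ℕ.+ (a ℕ.+ b ℕ.+ q̂) ℕ.+ n) e≡a ⟩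
        a ℕ.+ b ℕ.+ p̂ ℕ.+ (a ℕ.+ b ℕ.+ q̂) ℕ.+ a              ≡⟨ total′-shape₂ a b p̂ q̂ ⟩
        a ℕ.+ b ℕ.+ b ℕ.+ (a ℕ.+ a ℕ.+ p̂ ℕ.+ q̂)              ∎)
        where
        open ≡-Reasoning
        offset : ∀ {n} → M ≤ n → n ≡ a ℕ.+ b ℕ.+ (n ∸ M)
        offset {n} le = trans (sym (ℕ.m+[n∸m]≡n le)) (cong (ℕ._+ (n ∸ M)) M≡ab)
      M<ks : All (suc M ≤_) ks
      M<ks = none-at M≤ks k₀≡0
      large : (sum ks ≡ 0 × k 1 ≡ 0) ⊎ a ℕ.+ suc (a ℕ.+ suc β) ≤ sum ks
      large = Sum.map (λ eq → cong sum eq , cong (λ ks → count M ks 1) eq)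
        (subst (_≤ sum ks) (trans (cong suc (trans M≡ab (cong (a ℕ.+_) (sym b≡)))) (large-shape a β))) (empty-or-large ks M<ks)
      result = scalene a β p̂ q̂ γ (k 1) (k 2) (sum ks) 1≤a (ℕ.∸-monoˡ-≤ M p≤q) eqs′ total′ large
      p̂≡0 = proj₁ result
      γ≡1 = proj₁ (proj₂ result)
      k₁≡0 = proj₁ (proj₂ (proj₂ result))
      q′ = proj₁ (proj₁ (proj₂ (proj₂ (proj₂ result))))
      q̂≡ = proj₂ (proj₁ (proj₂ (proj₂ (proj₂ result))))

      tail-far : ∀ n {N} → N ≤ 2 ℕ.+ (n ℕ.+ n) → Hi N (term n)
      tail-far n le = Hi-≤ le (T.Hi-term n)

      bb : 2 ℕ.+ (b ℕ.+ b) ≡ M ℕ.+ (3 ℕ.+ β)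
      bb = trans (cong (λ n → 2 ℕ.+ (n ℕ.+ b)) (sym b≡)) (trans (bb-shape a b β) (cong (ℕ._+ (3 ℕ.+ β)) (sym M≡ab)))
      cc : M ℕ.+ (4 ℕ.+ β) ≤ 2 ℕ.+ (c ℕ.+ c)
      cc = ℕ.≤-trans (ℕ.≤-reflexive (ℕ.+-suc M (3 ℕ.+ β))) (ℕ.≤-trans (s≤s (ℕ.≤-reflexive (sym bb)))
        (s≤s (s≤s (subst (suc (b ℕ.+ b) ≤_) refl (ℕ.+-mono-<-≤ b<c b≤c)))))
        where
        b<c : b < c
        b<c = subst (suc b ≤_) c≡ (subst (λ g → suc b ≤ b ℕ.+ g) (sym γ≡1) (ℕ.≤-reflexive (ℕ.+-comm 1 b)))

      M≥ : 2 ℕ.+ a ℕ.+ a ℕ.+ β ≤ suc M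
      M≥ = ℕ.≤-reflexive (trans (M≥-shape a β) (cong suc (trans (cong (a ℕ.+_) b≡) (sym M≡ab))))

      reassoc : ∀ s → θ-path p q e a b c s ≡ (E-term s + term a s) + (term b s + term c s)
      reassoc s = sym (ℤ.+-assoc (E-term s) (term a s) (term b s + term c s))

      drop : ∀ {x y} → + 2 * + x + 0ℤ ≡ + 2 * + y → x ≡ y
      drop {x} e = halve (trans (sym (ℤ.+-identityʳ (+ 2 * + x))) e)

      Y# : ℕ → ℕ → ℕ → ℕ → ℕ → ℕ → ℕ
      Y# t₁ t₃ k₀ k₁ k₂ k₃ = t₁ ℕ.+ t₁ ℕ.+ t₃ ℕ.+ (k₀ ℕ.+ k₀ ℕ.+ k₀ ℕ.+ k₀ ℕ.+ (k₁ ℕ.+ k₁ ℕ.+ k₁ ℕ.+ k₁ ℕ.+ k₁) ℕ.+ (k₂ ℕ.+ k₂) ℕ.+ k₃)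

      finish : ∀ x → x ≤ 1 → k 2 ≡ 1 →
        x ℕ.+ (d# p̂ q̂ 0 ℕ.+ (d# p̂ q̂ 1 ℕ.+ d# p̂ q̂ 1 ℕ.+ d# p̂ q̂ 1) ℕ.+ d# p̂ q̂ 2 ℕ.+ d# p̂ q̂ 3) ≡
        Y# (count M (θ-pairs a b c) 1) (count M (θ-pairs a b c) 3) (k 0) (k 1) (k 2) (k 3) → ⊥
      finish x x≤1 k₂≡1 = scalene-finish x (k 3) p̂≡0 q̂≡ γ≡1 k₀≡0 k₁≡0 k₂≡1 (t-count 1) (t-count 3) x≤1

      4≤M : 4 ≤ a ℕ.+ a ℕ.+ suc β → 4 ≤ M
      4≤M l = ℕ.≤-pred (ℕ.≤-trans (s≤s l) (ℕ.≤-trans (ℕ.≤-reflexive (4≤M-shape a β)) M≥))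

      a≥2-case : 2 ≤ a → ∀ {P ρ : ℤ → ℤ} → (∀ s → term b s + term c s ≡ P s + ρ s) →
        ∀ {π₀ π₁ π₂ π₃} → Win M (π₀ ∷ π₁ ∷ π₂ ∷ π₃ ∷ []) P → Hi (M ℕ.+ 4) ρ → T.Eq₃ M π₃
      a≥2-case 2≤a {P} {ρ} split hP hρ = T.equation₃ B (4≤M (ℕ.≤-trans (ℕ.+-mono-≤ 2≤a 2≤a) (ℕ.m≤m+n (a ℕ.+ a) (suc β))))
        {P = P} {ρ = λ s → (E-term s + term a s) + ρ s}
        (λ s → trans (reassoc s) (trans (cong (λ z → (E-term s + term a s) + z) (split s)) (a≥2-case-swap (E-term s + term a s) (P s) (ρ s))))
        hP (Hi-≤ (ℕ.+-monoʳ-≤ M (s≤s (ℕ.≤-trans (s≤s (s≤s (s≤s z≤n))) (ℕ.+-mono-≤ 2≤a 2≤a)))) (S.ΔYY B) ⊕ hρ)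

      hc : Hi (M ℕ.+ 4) (term c)
      hc = tail-far c (ℕ.≤-trans (ℕ.+-monoʳ-≤ M (ℕ.m≤m+n 4 β)) cc)

      hb : 1 ≤ β → Hi (M ℕ.+ 4) (term b)
      hb 1≤β = tail-far b (ℕ.≤-trans (ℕ.+-monoʳ-≤ M (ℕ.+-monoʳ-≤ 3 1≤β)) (ℕ.≤-reflexive (sym bb)))

      d₀≡1 : count M (p ∷ q ∷ []) 0 ≡ 1
      d₀≡1 = leading-count p̂≡0 q̂≡

      case-2-β : 2 ≤ a → 1 ≤ β → k 2 ≡ 1 → ⊥
      case-2-β 2≤a 1≤β k₂≡1 = finish 0 z≤n k₂≡1 (drop (a≥2-case 2≤a {P = λ _ → 0ℤ} (λ s → sym (ℤ.+-identityˡ (term b s + term c s)))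
        (Hi⇒win 4 ℕ.≤-refl (Hi-0ᶠ (M ℕ.+ 4))) (hb 1≤β ⊕ hc)))

      case-2-0 : 2 ≤ a → β ≡ 0 → ⊥
      case-2-0 2≤a β≡0 = even≢odd (+ Dsum) (+ Ysum) (parity (sg-unit b) j≡3)
        (a≥2-case 2≤a {P = term b} {ρ = term c} (λ s → refl) (win-term₄ b le) hc)
        where
        t = count M (θ-pairs a b c)
        Dsum = d# p̂ q̂ 0 ℕ.+ (d# p̂ q̂ 1 ℕ.+ d# p̂ q̂ 1 ℕ.+ d# p̂ q̂ 1) ℕ.+ d# p̂ q̂ 2 ℕ.+ d# p̂ q̂ 3
        Ysum = Y# (t 1) (t 3) (k 0) (k 1) (k 2) (k 3)
        le : M ≤ 2 ℕ.+ (b ℕ.+ b)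
        le = ℕ.≤-trans (ℕ.m≤m+n M (3 ℕ.+ β)) (ℕ.≤-reflexive (sym bb))
        j≡3 : 2 ℕ.+ (b ℕ.+ b) ∸ M ≡ 3
        j≡3 = trans (cong (_∸ M) bb) (trans (ℕ.m+n∸m≡n M (3 ℕ.+ β)) (cong (3 ℕ.+_) β≡0))
        parity : ∀ {g j} → Unit g → j ≡ 3 → Unit (1ℤ * g * (+ δ j 1 + + 2 * + δ j 2 + + δ j 3))
        parity (inj₁ refl) refl = inj₁ refl
        parity (inj₂ refl) refl = inj₂ refl

      case-1-β : a ≡ 1 → 1 ≤ β → k 2 ≡ 1 → ⊥
      case-1-β a≡1 1≤β k₂≡1 = finish 1 ℕ.≤-refl k₂≡1 (trans (cong (ℕ._+ Dsum) (sym d₀≡1)) (trans (ℕ.+-comm (count M (p ∷ q ∷ []) 0) Dsum)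
        (halve (trans (ℤ.*-distribˡ-+ (+ 2) (+ Dsum) (+ count M (p ∷ q ∷ []) 0))
          (T.equation₃ B four {P = λ s → s * s * (Y p s * Y q s - y₀ s * y₀ s)} {ρ = λ s → term b s + term c s} split
            (ΔYY-window four M≤p M≤q) (hb 1≤β ⊕ hc))))))
        where
        Dsum = d# p̂ q̂ 0 ℕ.+ (d# p̂ q̂ 1 ℕ.+ d# p̂ q̂ 1 ℕ.+ d# p̂ q̂ 1) ℕ.+ d# p̂ q̂ 2 ℕ.+ d# p̂ q̂ 3
        four : 4 ≤ M
        four = 4≤M (ℕ.+-mono-≤ (ℕ.+-mono-≤ 1≤a 1≤a) (s≤s 1≤β))
        split : ∀ s → θ-path p q e a b c s ≡ s * s * (Y p s * Y q s - y₀ s * y₀ s) + (term b s + term c s)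
        split s = trans (reassoc s) (cong (_+ (term b s + term c s)) (trans
          (cong₂ (λ m n → - 1ℤ * (W m s * (Y p s * Y q s)) + 1ℤ * (W n s * (y₀ s * y₀ s))) (trans e≡a a≡1) a≡1)
          (split-shape s (Y p s * Y q s) (y₀ s * y₀ s))))

      case-1-0 : a ≡ 1 → β ≡ 0 → k 2 ≡ 0 → ⊥
      case-1-0 a≡1 β≡0 k₂≡0 = small-case′ 7≤q 6≤ks p≡3 (trans e≡a a≡1) a≡1 b≡2 c≡3 H
        where
        b≡2 : b ≡ 2
        b≡2 = trans (sym b≡) (cong₂ (λ m n → suc m ℕ.+ n) a≡1 β≡0)
        c≡3 : c ≡ 3
        c≡3 = trans (sym c≡) (cong₂ ℕ._+_ b≡2 γ≡1)
        M≡3 : M ≡ 3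
        M≡3 = trans M≡ab (cong₂ ℕ._+_ a≡1 b≡2)
        p≡3 : p ≡ 3
        p≡3 = trans (sym (ℕ.m+[n∸m]≡n M≤p)) (cong₂ ℕ._+_ M≡3 p̂≡0)
        M+2<ks : All (3 ℕ.+ M ≤_) ks
        M+2<ks = none-at M+1<ks (trans (sym (count-suc 0 M+1<ks)) (trans (sym (count-suc 1 M<ks)) k₂≡0))
          where
          M+1<ks : All (2 ℕ.+ M ≤_) ks
          M+1<ks = none-at M<ks (trans (sym (count-suc 0 M<ks)) k₁≡0)
        6≤ks : All (6 ≤_) ks
        6≤ks = subst (λ m → All (3 ℕ.+ m ≤_) ks) M≡3 M+2<ks
        7≤q : 7 ≤ q
        7≤q = go (empty-or-large ks 6≤ks)
          where
          5≤q̂ : 6 ≤ sum ks → 5 ≤ q̂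
          5≤q̂ le = ℕ.≤-pred (ℕ.≤-pred (ℕ.≤-trans (s≤s le) (ℕ.≤-reflexive
            (trans (cong (ℕ._+ sum ks) (sym γ≡1)) (trans total′ (cong₂ (λ m n → m ℕ.+ m ℕ.+ n ℕ.+ q̂) a≡1 p̂≡0))))))
          go : ks ≡ [] ⊎ 6 ≤ sum ks → 7 ≤ q
          go (inj₁ eq) = contradiction (trans (sym (cong₂ ℕ._+_ γ≡1 (cong sum eq)))
                          (trans total′ (cong₂ (λ m n → m ℕ.+ m ℕ.+ p̂ ℕ.+ n) a≡1 q̂≡))) (one≢ p̂ q′)
            where
            one≢ : ∀ x y → 1 ≢ 1 ℕ.+ 1 ℕ.+ x ℕ.+ (3 ℕ.+ y)
            one≢ x y ()
          go (inj₂ le) = ℕ.≤-trans (ℕ.≤-trans (ℕ.m≤n+m 7 1) (ℕ.+-monoʳ-≤ 3 (5≤q̂ le))) (ℕ.≤-reflexive (trans (cong (ℕ._+ q̂) (sym M≡3)) (ℕ.m+[n∸m]≡n M≤q)))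

     at-minimum-impossible : ⊥
     at-minimum-impossible = by-cases (a ℕ.≟ 1) (proj₂ (proj₂ (proj₂ (proj₂ result))))
      where
      by-cases : Dec (a ≡ 1) → (β ≡ 0 × k 2 ≡ 0) ⊎ (1 ≤ β × k 2 ≡ 1) → ⊥
      by-cases (no a≢1)  (inj₂ (1≤β , k₂≡1)) = case-2-β (ℕ.≤∧≢⇒< 1≤a (λ h → a≢1 (sym h))) 1≤β k₂≡1
      by-cases (yes a≡1) (inj₂ (1≤β , k₂≡1)) = case-1-β a≡1 1≤β k₂≡1
      by-cases (no a≢1)  (inj₁ (β≡0 , _))    = case-2-0 (ℕ.≤∧≢⇒< 1≤a (λ h → a≢1 (sym h))) β≡0
      by-cases (yes a≡1) (inj₁ (β≡0 , k₂≡0)) = case-1-0 a≡1 β≡0 k₂≡0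

    scalene-impossible : ⊥
    scalene-impossible = AtMinimum.at-minimum-impossible S.B S.e≡a S.M≡ab S.k₀≡0 S.eqs

module AntipodalTheta where

  open import Data.Empty using (⊥)
  open import Data.Integer.Base as ℤ using (ℤ; 0ℤ; 1ℤ; +_; _+_; _*_; _-_; -_; _^_)
  open import Data.List.Base using ([]; _∷_)
  open import Data.List.Relation.Unary.All as All using (All; []; _∷_)
  open import Data.Nat.Base as ℕ using (ℕ; z≤n; s≤s; _≤_; _<_; _∸_)
  open import Data.Nat.ListAction using (sum)
  open import Data.Vec.Base using ([]; _∷_)
  import Data.Vec.Relation.Unary.All as V
  open Windows
  open ShapeFunctions
  open CoefficientEquations
  open ThetaEquations
  open OffsetCases

  private
    remove-cycle-swapˡ : ∀ x y z → x * (y * z) ≡ y * (x * z)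
    remove-cycle-swapˡ = solve-∀

    remove-cycle-shape : ∀ k m n → k ℕ.+ (m ℕ.+ n) ≡ m ℕ.+ (k ℕ.+ n)
    remove-cycle-shape = ℕ-solve-∀

  remove-cycle : ∀ {M} ks → All (M ≤_) ks → 1 ≤ count M ks 0 → ∃ λ ks′ →
    (∀ s → cycles ks s ≡ (1ℤ + + 2 * s ^ M + W M s) * cycles ks′ s) ×
    sum ks ≡ M ℕ.+ sum ks′ × (∀ {m} → All (m ≤_) ks → All (m ≤_) ks′)
  remove-cycle {M} (k ∷ ks) (le ∷ les) c = go (k ℕ.≟ M)
    where
    go : Dec (k ≡ M) → ∃ λ ks′ → (∀ s → cycles (k ∷ ks) s ≡ (1ℤ + + 2 * s ^ M + W M s) * cycles ks′ s) ×
      sum (k ∷ ks) ≡ M ℕ.+ sum ks′ × (∀ {m} → All (m ≤_) (k ∷ ks) → All (m ≤_) ks′)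
    go (yes refl) = ks , (λ s → refl) , refl , λ { (_ ∷ hs) → hs }
    go (no k≢M) = let
        ks′ , eq , Σeq , sub = remove-cycle ks les (subst (λ n → 1 ≤ n ℕ.+ count M ks 0) (<⇒δ₀≡0 (ℕ.≤∧≢⇒< le (λ h → k≢M (sym h)))) c) in
      k ∷ ks′ ,
      (λ s → trans (cong ((1ℤ + + 2 * s ^ k + W k s) *_) (eq s)) (remove-cycle-swapˡ (1ℤ + + 2 * s ^ k + W k s) (1ℤ + + 2 * s ^ M + W M s) (cycles ks′ s))) ,
      trans (cong (k ℕ.+_) Σeq) (remove-cycle-shape k M (sum ks′)) ,
      λ { (h ∷ hs) → h ∷ sub hs }

  private
    antipodal-impossible-shape′ : ∀ s a → s * (+ 2 + + 5 * s + + 4 * (s * s) + + 4 * (s * s * s)) + a * ((+ 2 * (1ℤ + s * s) + a * (1ℤ - s)) *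
      ((1ℤ + s + + 2 * (s * s)) + ((1ℤ + s + + 2 * (s * s)) + + 2 * ((1ℤ + s * s) * a) + a * a * (1ℤ - s)))) ≡
      ((1ℤ + s + + 2 * (s * s)) + + 2 * ((1ℤ + s * s) * a) + a * a * (1ℤ - s)) * ((1ℤ + s + + 2 * (s * s)) + + 2 * ((1ℤ + s * s) * a) + a * a * (1ℤ - s)) - 1ℤ
    antipodal-impossible-shape′ = solve-∀

    antipodal-impossible-square : ∀ s A →
      ((1ℤ + s + + 2 * (s * s)) * (1ℤ + s + + 2 * (s * s)) - + 2 * ((s + s * s) * (s + s * s) * A) + (1ℤ - s) * (1ℤ - s) * (A * A)
        + + 2 * ((1ℤ + s * s) * (1ℤ + s * s) * A)) * ((1ℤ + A) * (1ℤ + A)) ≡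
      ((1ℤ + s + + 2 * (s * s)) + + 2 * ((1ℤ + s * s) * A) + A * A * (1ℤ - s)) * ((1ℤ + s + + 2 * (s * s)) + + 2 * ((1ℤ + s * s) * A) + A * A * (1ℤ - s))
    antipodal-impossible-square = solve-∀

    antipodal-impossible-split : ∀ k x y u v A C t →
      x - + 2 * (y * A) + u * (A * A) + + 2 * (k * A) + C * (- y + + 2 * (u * A) - v * (A * A) - + 2 * (k * A)) + + 4 * (t * (k * (1ℤ - A))) ≡
      x - y * (A + A + C) + u * (A * A + A * C + A * C) - v * (A * A * C) + + 2 * (k * (A * (1ℤ - C) + t * (1ℤ - A) + t * (1ℤ - A)))
    antipodal-impossible-split = solve-∀

    antipodal-impossible-binomial : ∀ A K → (1ℤ + A) * (1ℤ + A) * K ≡ (1ℤ + + 2 * A + A * A) * K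
    antipodal-impossible-binomial = solve-∀

    antipodal-impossible-linear : ∀ Σ t C E R q Θ Ψ k B →
      + 2 * Σ + (+ 4 * t + (+ 2 * ((Θ * q - 1ℤ) * Σ) + Θ * q * R + + 4 * (t * (k * (B * q) * (1ℤ + + 2 * Σ + R) - 1ℤ))
        + C * (Ψ * (q * (1ℤ + + 2 * Σ + R))) + E)) ≡
      (Θ + C * Ψ + + 4 * (t * (k * B))) * (q * (1ℤ + + 2 * Σ + R)) - (Θ * q - E)
    antipodal-impossible-linear = solve-∀

    antipodal-impossible-poly : ∀ Σ t A C E R s →
      + 2 * Σ + (+ 4 * t + (+ 2 * ((((1ℤ + s + + 2 * (s * s)) + + 2 * ((1ℤ + s * s) * A) + A * A * (1ℤ - s)) * ((1ℤ + s + + 2 * (s * s)) + + 2 * ((1ℤ + s * s) * A) + A * A * (1ℤ - s)) - 1ℤ) * Σ)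
      + ((1ℤ + s + + 2 * (s * s)) + + 2 * ((1ℤ + s * s) * A) + A * A * (1ℤ - s)) * ((1ℤ + s + + 2 * (s * s)) + + 2 * ((1ℤ + s * s) * A) + A * A * (1ℤ - s)) * R
      + + 4 * (t * ((1ℤ + s * s) * (1ℤ + s * s) * ((1ℤ - A) * ((1ℤ + A) * (1ℤ + A))) * (1ℤ + + 2 * Σ + R) - 1ℤ))
      + C * ((- ((s + s * s) * (s + s * s)) + + 2 * ((1ℤ - s) * (1ℤ - s) * A) - (+ 2 - s + s * s) * (+ 2 - s + s * s) * (A * A)
          - + 2 * ((1ℤ + s * s) * (1ℤ + s * s) * A)) * ((1ℤ + A) * (1ℤ + A) * (1ℤ + + 2 * Σ + R))) + E)) ≡
      ((1ℤ + s + + 2 * (s * s)) * (1ℤ + s + + 2 * (s * s)) - (s + s * s) * (s + s * s) * (A + A + C)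
        + (1ℤ - s) * (1ℤ - s) * (A * A + A * C + A * C)
        - (+ 2 - s + s * s) * (+ 2 - s + s * s) * (A * A * C)
        + + 2 * ((1ℤ + s * s) * (1ℤ + s * s) * (A * (1ℤ - C) + t * (1ℤ - A) + t * (1ℤ - A)))) * ((1ℤ + + 2 * A + A * A) * (1ℤ + + 2 * Σ + R))
      - (((1ℤ + s + + 2 * (s * s)) + + 2 * ((1ℤ + s * s) * A) + A * A * (1ℤ - s)) * ((1ℤ + s + + 2 * (s * s)) + + 2 * ((1ℤ + s * s) * A) + A * A * (1ℤ - s)) - E)
    antipodal-impossible-poly Σ t A C E R s = trans
      (cong (λ Z → + 2 * Σ + (+ 4 * t + (+ 2 * ((Z - 1ℤ) * Σ) + Z * R + + 4 * (t * (k * (B * q) * (1ℤ + + 2 * Σ + R) - 1ℤ))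
        + C * (Ψ * (q * (1ℤ + + 2 * Σ + R))) + E))) (sym (antipodal-impossible-square s A)))
      (trans (antipodal-impossible-linear Σ t C E R q Θ Ψ k B)
        (cong₃ (λ x y z → x * y - (z - E))
          (antipodal-impossible-split k ((1ℤ + s + + 2 * (s * s)) * (1ℤ + s + + 2 * (s * s))) ((s + s * s) * (s + s * s)) ((1ℤ - s) * (1ℤ - s))
            ((+ 2 - s + s * s) * (+ 2 - s + s * s)) A C t)
          (antipodal-impossible-binomial A (1ℤ + + 2 * Σ + R)) (antipodal-impossible-square s A)))
      where
      cong₃ : ∀ (f : ℤ → ℤ → ℤ → ℤ) {x x′ y y′ z z′} → x ≡ x′ → y ≡ y′ → z ≡ z′ → f x y z ≡ f x′ y′ z′
      cong₃ f refl refl refl = refl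
      k = (1ℤ + s * s) * (1ℤ + s * s)
      B = 1ℤ - A
      q = (1ℤ + A) * (1ℤ + A)
      Θ = (1ℤ + s + + 2 * (s * s)) * (1ℤ + s + + 2 * (s * s)) - + 2 * ((s + s * s) * (s + s * s) * A) + (1ℤ - s) * (1ℤ - s) * (A * A)
        + + 2 * (k * A)
      Ψ = - ((s + s * s) * (s + s * s)) + + 2 * ((1ℤ - s) * (1ℤ - s) * A) - (+ 2 - s + s * s) * (+ 2 - s + s * s) * (A * A) - + 2 * (k * A)

    antipodal-impossible-shape : ∀ s → s ≡ s * 1ℤ * 1ℤ
    antipodal-impossible-shape = solve-∀

    antipodal-impossible-shape₁ : ∀ x y → + 2 * x + y ≡ 1ℤ + + 2 * x + y - 1ℤ
    antipodal-impossible-shape₁ = solve-∀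

    antipodal-impossible-shape₂ : ∀ s a k → s * ((+ 2 * s + s * s * s) * k) + a * ((1ℤ - a - a * a) * ((1ℤ + s * s) * (1ℤ + s * s)) * k) + (k - 1ℤ) ≡
      (1ℤ + s * s) * (1ℤ + s * s) * ((1ℤ - a) * ((1ℤ + a) * (1ℤ + a))) * k - 1ℤ
    antipodal-impossible-shape₂ = solve-∀

    antipodal-impossible-shape₃ : ∀ k d → + 2 * (k + (d + d)) ≡ + 2 * k + (+ 4 * d + 0ℤ)
    antipodal-impossible-shape₃ = solve-∀

  -- Two copies of C₂ₐ with a pendant path cover the same closed walks as C₂ₐ with two
  -- antipodal pendant paths together with C₂ₐ, so this case is only settled by the length of the
  -- connecting path.
  antipodal-impossible : ∀ {a c e ks} → 1 ≤ a → a < c → c ≤ e → sg a ≡ 1ℤ → All (1 ≤_) ks →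
    (∀ s → dumbbell (a ℕ.+ a) (a ℕ.+ a) e s ≡ θ a a c s * ((1ℤ + + 2 * s ^ (a ℕ.+ a) + W (a ℕ.+ a) s) * cycles ks s)) → ⊥
  antipodal-impossible {a} {c} {e} {ks} 1≤a a<c c≤e sg≡1 1≤ks H = absurd (δ (a ℕ.+ c ∸ N) 0) (count N ks 0) att eq₀
    where
    least′ = least (a ℕ.+ c) ks
    N = proj₁ least′
    N≤ : All (N ≤_) (a ℕ.+ c ∷ ks)
    N≤ = proj₁ (proj₂ least′)
    N≤ac = All.head N≤
    N≤ks = All.tail N≤
    att : 1 ≤ δ (a ℕ.+ c ∸ N) 0 ℕ.+ count N ks 0
    att = proj₂ (proj₂ least′)
    exp = cycles-expand ks N≤ks
    R = proj₁ exp
    exp₁ = cycles-expand ks 1≤ks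
    A : ℤ → ℤ
    A = W a
    A≡ : ∀ s → s ^ (a ℕ.+ a) ≡ A s
    A≡ s = sym (trans (W-sg a s) (trans (cong (_* s ^ (a ℕ.+ a)) sg≡1) (ℤ.*-identityˡ (s ^ (a ℕ.+ a)))))
    AA≡ : ∀ s → W (a ℕ.+ a) s ≡ A s * A s
    AA≡ s = ℤ.^-distribˡ-+-* (- (s * s)) a a
    K = cycles ks
    X∞ : ℤ → ℤ
    X∞ s = x₀ s + + 2 * ((1ℤ + s * s) * A s) + A s * A s * (1ℤ - s)
    YY : ℤ → ℤ
    YY s = Y (a ℕ.+ a) s * Y (a ℕ.+ a) s
    Ψ : ℤ → ℤ
    Ψ s = - (y₀ s * y₀ s) + + 2 * ((1ℤ - s) * (1ℤ - s) * A s) - (+ 2 - s + s * s) * (+ 2 - s + s * s) * (A s * A s)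
          - + 2 * ((1ℤ + s * s) * (1ℤ + s * s) * A s)
    G : ℤ → ℤ
    G s = (1ℤ + s * s) * (1ℤ + s * s) * ((1ℤ - A s) * ((1ℤ + A s) * (1ℤ + A s)))
    rest : ℤ → ℤ
    rest s = + 2 * ((X∞ s * X∞ s - 1ℤ) * Σpow ks s) + X∞ s * X∞ s * R s
      + + 4 * (s ^ (a ℕ.+ c) * (G s * K s - 1ℤ)) + W c s * (Ψ s * ((1ℤ + A s) * (1ℤ + A s) * K s)) + W e s * YY s
    hA : Hi 1 A
    hA = Hi-≤ (ℕ.≤-trans 1≤a (ℕ.m≤m+n a a)) (Hi-W a)
    Hi-s : Hi 1 (λ s → s)
    Hi-s = win λ s → 1ℤ , antipodal-impossible-shape s
    hX : Hi 1 (λ s → X∞ s * X∞ s - 1ℤ)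
    hX = win-ext (λ s → shape s (A s)) (Hi-*ʳ (λ s → + 2 + + 5 * s + + 4 * (s * s) + + 4 * (s * s * s)) Hi-s
         ⊕ Hi-*ʳ (λ s → (+ 2 * (1ℤ + s * s) + A s * (1ℤ - s)) * (x₀ s + X∞ s)) hA)
      where
      shape : ∀ s a → let x = 1ℤ + s + + 2 * (s * s); X = x + + 2 * ((1ℤ + s * s) * a) + a * a * (1ℤ - s) in
        s * (+ 2 + + 5 * s + + 4 * (s * s) + + 4 * (s * s * s)) + a * ((+ 2 * (1ℤ + s * s) + a * (1ℤ - s)) * (x + X)) ≡ X * X - 1ℤ
      shape = antipodal-impossible-shape′
    hK : Hi 1 (λ s → K s - 1ℤ)
    hK = let R₁ , h , eq = exp₁ in win-ext (λ s → trans (antipodal-impossible-shape₁ (Σpow ks s) (R₁ s)) (cong (λ z → z - 1ℤ) (sym (eq s))))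
      (Hi-*ˡ (λ _ → + 2) (win⇒Hi (win-Σpow 1≤ks)) ⊕ Hi-≤ (s≤s z≤n) h)
    hGK : Hi 1 (λ s → G s * K s - 1ℤ)
    hGK = win-ext (λ s → antipodal-impossible-shape₂ s (A s) (K s)) (Hi-*ʳ (λ s → (+ 2 * s + s * s * s) * K s) Hi-s
      ⊕ Hi-*ʳ (λ s → (1ℤ - A s - A s * A s) * ((1ℤ + s * s) * (1ℤ + s * s)) * K s) hA ⊕ hK)
    up : ∀ {f g} → Hi N f → Hi 1 g → Hi (N ℕ.+ 1) (λ s → f s * g s)
    up = Hi-*
    N+1≤ : ∀ {n} → c ≤ n → N ℕ.+ 1 ≤ n ℕ.+ n
    N+1≤ {n} le = ℕ.≤-trans (ℕ.≤-reflexive (ℕ.+-comm N 1)) (ℕ.≤-trans (s≤s N≤ac) (ℕ.≤-trans (ℕ.+-monoˡ-≤ c a<c) (ℕ.+-mono-≤ le le)))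
    1≤N : 1 ≤ N
    1≤N = go (a ℕ.+ c ∷ ks) (ℕ.≤-trans 1≤a (ℕ.m≤m+n a c) ∷ 1≤ks) N≤ att
      where
      go : ∀ ns → All (1 ≤_) ns → All (N ≤_) ns → 1 ≤ count N ns 0 → 1 ≤ N
      go (n ∷ ns) (l ∷ ls) (m ∷ ms) c = by-cases (N ℕ.≟ n)
        where
        by-cases : Dec (N ≡ n) → 1 ≤ N
        by-cases (yes eq) = subst (1 ≤_) (sym eq) l
        by-cases (no ne)  = go ns ls ms (subst (λ k → 1 ≤ k ℕ.+ count N ns 0) (<⇒δ₀≡0 (ℕ.≤∧≢⇒< m ne)) c)
    hrest : Hi (N ℕ.+ 1) rest
    hrest = Hi-*ˡ (λ _ → + 2) (subst (λ n → Hi n (λ s → (X∞ s * X∞ s - 1ℤ) * Σpow ks s)) (ℕ.+-comm 1 N) (Hi-* hX (win⇒Hi (win-Σpow N≤ks))))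
      ⊕ Hi-*ˡ (λ s → X∞ s * X∞ s) (Hi-≤ (ℕ.+-monoʳ-≤ N 1≤N) (proj₁ (proj₂ exp)))
      ⊕ Hi-*ˡ (λ _ → + 4) (up (Hi-≤ N≤ac (Hi-pow (a ℕ.+ c))) hGK)
      ⊕ Hi-*ʳ (λ s → Ψ s * ((1ℤ + A s) * (1ℤ + A s) * K s)) (Hi-≤ (N+1≤ ℕ.≤-refl) (Hi-W c))
      ⊕ Hi-*ʳ YY (Hi-≤ (N+1≤ c≤e) (Hi-W e))
    identity : ∀ s → + 2 * Σpow ks s + (+ 4 * s ^ (a ℕ.+ c) + rest s) ≡ 0ℤ
    identity s = final (Σpow ks s) (s ^ (a ℕ.+ c)) (A s) (W c s) (W e s) (YY s) (K s) (R s) s (proj₂ (proj₂ exp) s)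
      (trans (cong₂ (λ u v → (x₀ s + + 2 * ((1ℤ + s * s) * u) + v * (1ℤ - s)) * (x₀ s + + 2 * ((1ℤ + s * s) * u) + v * (1ℤ - s)) - W e s * YY s) (sym (A≡ s)) (sym (AA≡ s)))
        (trans (H s) (cong₂ (λ u v → (θ₀ (A s) u (W c s) (s ^ (a ℕ.+ c)) s) * ((1ℤ + + 2 * u + v) * K s)) (A≡ s) (AA≡ s))))
      where
      θ₀ : ℤ → ℤ → ℤ → ℤ → ℤ → ℤ
      θ₀ A A′ C t s = x₀ s * x₀ s - y₀ s * y₀ s * (A + A + C)
        + (1ℤ - s) * (1ℤ - s) * (A * A + A * C + A * C)
        - (+ 2 - s + s * s) * (+ 2 - s + s * s) * (A * A * C)
        + + 2 * ((1ℤ + s * s) * (1ℤ + s * s) * (A′ * (1ℤ - C) + t * (1ℤ - A) + t * (1ℤ - A)))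
      final : ∀ Σ t A C E yy K R s → K ≡ 1ℤ + + 2 * Σ + R →
        ((1ℤ + s + + 2 * (s * s)) + + 2 * ((1ℤ + s * s) * A) + A * A * (1ℤ - s)) * ((1ℤ + s + + 2 * (s * s)) + + 2 * ((1ℤ + s * s) * A) + A * A * (1ℤ - s)) - E * yy
          ≡ θ₀ A A C t s * ((1ℤ + + 2 * A + A * A) * K) →
        + 2 * Σ + (+ 4 * t + (+ 2 * ((((1ℤ + s + + 2 * (s * s)) + + 2 * ((1ℤ + s * s) * A) + A * A * (1ℤ - s)) * ((1ℤ + s + + 2 * (s * s)) + + 2 * ((1ℤ + s * s) * A) + A * A * (1ℤ - s)) - 1ℤ) * Σ)
          + ((1ℤ + s + + 2 * (s * s)) + + 2 * ((1ℤ + s * s) * A) + A * A * (1ℤ - s)) * ((1ℤ + s + + 2 * (s * s)) + + 2 * ((1ℤ + s * s) * A) + A * A * (1ℤ - s)) * R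
          + + 4 * (t * ((1ℤ + s * s) * (1ℤ + s * s) * ((1ℤ - A) * ((1ℤ + A) * (1ℤ + A))) * K - 1ℤ))
          + C * ((- ((s + s * s) * (s + s * s)) + + 2 * ((1ℤ - s) * (1ℤ - s) * A) - (+ 2 - s + s * s) * (+ 2 - s + s * s) * (A * A)
              - + 2 * ((1ℤ + s * s) * (1ℤ + s * s) * A)) * ((1ℤ + A) * (1ℤ + A) * K)) + E * yy)) ≡ 0ℤ
      final Σ t A C E yy K R s refl h = trans (antipodal-impossible-poly Σ t A C (E * yy) R s) (trans (cong (λ z → θ₀ A A C t s * ((1ℤ + + 2 * A + A * A) * (1ℤ + + 2 * Σ + R)) - z) h) (ℤ.+-inverseʳ (θ₀ A A C t s * ((1ℤ + + 2 * A + A * A) * (1ℤ + + 2 * Σ + R)))))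
    zeros : V.All (_≡ 0ℤ) (+ 2 * + count N ks 0 + (+ 4 * + δ (a ℕ.+ c ∸ N) 0 + 0ℤ) ∷ [])
    zeros = win-zero identity
      (_⊞_ {f = λ s → + 2 * Σpow ks s} {g = λ s → + 4 * s ^ (a ℕ.+ c) + rest s}
        (_⊡_ {f = Σpow ks} (+ 2) (win-head (win-Σpow N≤ks)))
        (_⊞_ {f = λ s → + 4 * s ^ (a ℕ.+ c)} {g = rest}
          (_⊡_ {f = _^ (a ℕ.+ c)} (+ 4) (win-head (win-pow N≤ac))) (Hi⇒win 1 ℕ.≤-refl hrest)))
    eq₀ : count N ks 0 ℕ.+ (δ (a ℕ.+ c ∸ N) 0 ℕ.+ δ (a ℕ.+ c ∸ N) 0) ≡ 0
    eq₀ = halve (trans (antipodal-impossible-shape₃ (+ count N ks 0) (+ δ (a ℕ.+ c ∸ N) 0)) (V.head zeros))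
    absurd : ∀ d k → 1 ≤ d ℕ.+ k → k ℕ.+ (d ℕ.+ d) ≡ 0 → ⊥
    absurd d k l eq = contradiction (subst (1 ≤_) (cong₂ ℕ._+_ (ℕ.m+n≡0⇒m≡0 d (ℕ.m+n≡0⇒n≡0 k eq)) (ℕ.m+n≡0⇒m≡0 k eq)) l) λ ()

module ThetaComparison where

  open import Data.Empty using (⊥; ⊥-elim)
  open import Data.Integer.Base as ℤ using (ℤ; 0ℤ; 1ℤ; +_; _+_; _*_; _-_; -_; _^_)
  open import Data.List.Base using (List; []; _∷_)
  open import Data.List.Relation.Unary.All as All using (All; []; _∷_)
  open import Data.Nat.Base as ℕ using (ℕ; zero; suc; z≤n; s≤s; _≤_; _<_; _∸_)
  open import Data.Nat.ListAction using (sum)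
  open import Data.Vec.Base using (Vec; []; _∷_)
  open Windows
  open ShapeFunctions
  open CoefficientEquations
  open ThetaEquations
  open OffsetCases
  open ScaleneTheta
  open AntipodalTheta

  private
    path-beyond₁-eq : ∀ x g → x + g ≡ x + (g * 1ℤ + 0ℤ)
    path-beyond₁-eq = solve-∀

    path-beyond₁-eq₁ : ∀ x g → x + g ≡ x + (g * (+ 2 * 0ℤ + 1ℤ) + 0ℤ)
    path-beyond₁-eq₁ = solve-∀

    path-beyond₁-eq₀ : ∀ x g → + 2 * x ≡ + 2 * x + (g * 0ℤ + 0ℤ)
    path-beyond₁-eq₀ = solve-∀

    path-beyond₁-eq₁₁ : ∀ x g → + 2 * x ≡ + 2 * x + (g * (+ 2 * 0ℤ + 0ℤ) + 0ℤ)
    path-beyond₁-eq₁₁ = solve-∀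

    path-beyond₁-eq₂ : ∀ x g κ d n → + 2 * x + (g * d + n) ≡ + 2 * x + (g * (κ * 0ℤ + + 2 * 0ℤ + d) + n)
    path-beyond₁-eq₂ = solve-∀

    path-beyond₁-eq₃ : ∀ x g → + 2 * (x + (g * 0ℤ + 0ℤ)) ≡ + 2 * x
    path-beyond₁-eq₃ = solve-∀

    path-beyond₂-eq : ∀ x g h → + 2 * (x + h) + g ≡ + 2 * x + (g * 1ℤ + + 2 * h)
    path-beyond₂-eq = solve-∀

    path-beyond₂-eq₁ : ∀ x g h → + 2 * (x + h) ≡ + 2 * x + (g * 0ℤ + + 2 * h)
    path-beyond₂-eq₁ = solve-∀

  module _ {D₀ D₁ D₂ τ₀ τ₁ τ₂ k₀ k₁ k₂ : ℕ} {g κ n₂ : ℤ} (ug : Unit g) where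

    path-beyond₁ : ∀ j → Equations D₀ D₁ D₂ τ₀ τ₁ τ₂ k₀ k₁ k₂
      (g * + δ j 0 + 0ℤ) (g * (+ 2 * + δ j 0 + + δ j 1) + 0ℤ) (g * (κ * + δ j 0 + + 2 * + δ j 1 + + δ j 2) + n₂) →
      2 ≤ j × D₀ ≡ τ₀ ℕ.+ k₀ × D₁ ≡ τ₁ ℕ.+ (k₀ ℕ.+ k₀ ℕ.+ k₁) ×
      + 2 * + D₂ + (g * + δ j 2 + n₂) ≡ + 2 * + (τ₂ ℕ.+ (k₀ ℕ.+ k₀ ℕ.+ k₀ ℕ.+ (k₁ ℕ.+ k₁) ℕ.+ k₂))
    path-beyond₁ 0 E = ⊥-elim (even≢odd (+ D₀) (+ (τ₀ ℕ.+ k₀)) ug (trans (path-beyond₁-eq (+ 2 * + D₀) g) (Equations.eq₀ E)))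
    path-beyond₁ 1 E = ⊥-elim (even≢odd (+ D₁) (+ (τ₁ ℕ.+ (k₀ ℕ.+ k₀ ℕ.+ k₁))) ug (trans (path-beyond₁-eq₁ (+ 2 * + D₁) g) (Equations.eq₁ E)))
    path-beyond₁ (suc (suc j)) E = s≤s (s≤s z≤n) ,
      halve (trans (path-beyond₁-eq₀ (+ D₀) g) (Equations.eq₀ E)) ,
      halve (trans (path-beyond₁-eq₁₁ (+ D₁) g) (Equations.eq₁ E)) ,
      trans (path-beyond₁-eq₂ (+ D₂) g κ (+ δ (suc (suc j)) 2) n₂) (trans (Equations.eq₂ E) (path-beyond₁-eq₃ (+ (τ₂ ℕ.+ (k₀ ℕ.+ k₀ ℕ.+ k₀ ℕ.+ (k₁ ℕ.+ k₁) ℕ.+ k₂))) g))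

    path-beyond₂ : ∀ j h → n₂ ≡ + 2 * h → 2 ≤ j →
      + 2 * + D₂ + (g * + δ j 2 + n₂) ≡ + 2 * + (τ₂ ℕ.+ (k₀ ℕ.+ k₀ ℕ.+ k₀ ℕ.+ (k₁ ℕ.+ k₁) ℕ.+ k₂)) →
      3 ≤ j × + 2 * (+ D₂ + h) ≡ + 2 * + (τ₂ ℕ.+ (k₀ ℕ.+ k₀ ℕ.+ k₀ ℕ.+ (k₁ ℕ.+ k₁) ℕ.+ k₂))
    path-beyond₂ 0 h refl () E
    path-beyond₂ 1 h refl (s≤s ()) E
    path-beyond₂ 2 h refl le E = ⊥-elim (even≢odd (+ D₂ + h) (+ (τ₂ ℕ.+ (k₀ ℕ.+ k₀ ℕ.+ k₀ ℕ.+ (k₁ ℕ.+ k₁) ℕ.+ k₂))) ug (trans (path-beyond₂-eq (+ D₂) g h) E))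
    path-beyond₂ (suc (suc (suc j))) h refl le E = s≤s (s≤s (s≤s z≤n)) , trans (path-beyond₂-eq₁ (+ D₂) g h) E

  private
    win-late-z₁ : ∀ g → g * 0ℤ ≡ 0ℤ
    win-late-z₁ = solve-∀

    win-late-z₂ : ∀ g → g * (+ 2 * 0ℤ + 0ℤ) ≡ 0ℤ
    win-late-z₂ = solve-∀

    win-late-z₃ : ∀ g d → g * (1ℤ * 0ℤ + + 2 * 0ℤ + d) ≡ g * d
    win-late-z₃ = solve-∀

  win-late : ∀ {M} n → M ℕ.+ 2 ≤ 2 ℕ.+ (n ℕ.+ n) → ∃ λ i → 2 ℕ.+ (n ℕ.+ n) ≡ M ℕ.+ (2 ℕ.+ i) ×
    Win M (0ℤ ∷ 0ℤ ∷ 1ℤ * sg n * + δ i 0 ∷ []) (λ s → 1ℤ * (W n s * (y₀ s * y₀ s)))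
  win-late {M} n le = i , eq , win-cs (tidy _ j≡)
    (path-window 1ℤ n {Z = λ s → y₀ s * y₀ s} {U = λ s → (1ℤ + s) * (1ℤ + s)} y₀²-unit win-1+s² (ℕ.≤-trans (ℕ.m≤m+n M 2) le))
    where
    i = 2 ℕ.+ (n ℕ.+ n) ∸ (M ℕ.+ 2)
    eq : 2 ℕ.+ (n ℕ.+ n) ≡ M ℕ.+ (2 ℕ.+ i)
    eq = trans (sym (ℕ.m+[n∸m]≡n le)) (ℕ.+-assoc M 2 i)
    j≡ : 2 ℕ.+ (n ℕ.+ n) ∸ M ≡ 2 ℕ.+ i
    j≡ = trans (cong (_∸ M) eq) (ℕ.m+n∸m≡n M (2 ℕ.+ i))
    tidy : ∀ j {i} → j ≡ 2 ℕ.+ i → let g = 1ℤ * sg n in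
      _≡_ {A = Vec ℤ 3} (g * + δ j 0 ∷ g * (+ 2 * + δ j 0 + + δ j 1) ∷ g * (1ℤ * + δ j 0 + + 2 * + δ j 1 + + δ j 2) ∷ [])
      (0ℤ ∷ 0ℤ ∷ g * + δ i 0 ∷ [])
    tidy _ {i} refl = cong₃ (λ x y z → x ∷ y ∷ z ∷ []) (win-late-z₁ (1ℤ * sg n)) (win-late-z₂ (1ℤ * sg n)) (win-late-z₃ (1ℤ * sg n) (+ δ i 0))
      where
      cong₃ : ∀ (f : ℤ → ℤ → ℤ → Vec ℤ 3) {x x′ y y′ z z′} → x ≡ x′ → y ≡ y′ → z ≡ z′ → f x y z ≡ f x′ y′ z′
      cong₃ f refl refl refl = refl

  private
    n₂≡0-shape : ∀ g g′ → 1ℤ * g * 0ℤ + (1ℤ * g * 0ℤ + 1ℤ * g′ * 0ℤ) ≡ 0ℤ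
    n₂≡0-shape = solve-∀

    at-2a-shape : ∀ M i → M ℕ.+ (2 ℕ.+ i) ≡ 2 ℕ.+ M ℕ.+ i
    at-2a-shape = ℕ-solve-∀

    n₂≡-shape : ∀ g g′ → 1ℤ * g * 1ℤ + (1ℤ * g * 1ℤ + 1ℤ * g′ * 0ℤ) ≡ + 2 * g
    n₂≡-shape = solve-∀

    far-C-shape₁ : ∀ a → a ℕ.+ a ℕ.+ 4 ≡ 2 ℕ.+ (suc a ℕ.+ suc a)
    far-C-shape₁ = ℕ-solve-∀

    π₃≡-shape′ : ∀ g → 1ℤ * g * (0ℤ + + 2 * 1ℤ + 0ℤ) + 1ℤ * g * (0ℤ + + 2 * 1ℤ + 0ℤ) ≡ + 2 * g + + 2 * g
    π₃≡-shape′ = solve-∀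

    c≤e-shape : ∀ x c k → x ℕ.+ x ℕ.+ (c ℕ.+ k) ≡ x ℕ.+ c ℕ.+ (x ℕ.+ k)
    c≤e-shape = ℕ-solve-∀

    far-E-shape₁ : ∀ a → a ℕ.+ a ℕ.+ 4 ≡ 2 ℕ.+ (suc a ℕ.+ suc a)
    far-E-shape₁ = ℕ-solve-∀

    third-distrib : ∀ x g → + 2 * (x + + 2 * g) ≡ + 2 * x + (+ 2 * g + + 2 * g)
    third-distrib = solve-∀

    third-shape : ∀ x y z → x + (y + (y + z)) ≡ (y + y) + (x + z)
    third-shape = solve-∀

    minus-shape : ∀ m j → m ≡ j + (m + - j)
    minus-shape = solve-∀

  module _ {p q e a c : ℕ} {ks : List ℕ} (3≤p : 3 ≤ p) (p≤q : p ≤ q) (1≤e : 1 ≤ e) (2≤a : 2 ≤ a)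
           (a≤c : a ≤ c) (3≤aa : 3 ≤ a ℕ.+ a) (3≤ks : All (3 ≤_) ks)
           (H : ∀ s → dumbbell p q e s ≡ θ a a c s * cycles ks s)
           (total : a ℕ.+ a ℕ.+ c ℕ.+ sum ks ≡ p ℕ.+ q ℕ.+ e) where

    private
      1≤a : 1 ≤ a
      1≤a = ℕ.≤-trans (s≤s z≤n) 2≤a
      module T = Theta {p} {q} {e} {a} {a} {c} {ks} 3≤p p≤q 1≤e 1≤a ℕ.≤-refl a≤c 3≤aa 3≤ks H
      open T using (E-term; term; Bound)

    module Iso {M : ℕ} (B : Bound M)
               (att : 1 ≤ count M (p ∷ q ∷ []) 0 ℕ.+ (count M (θ-pairs a a c) 0 ℕ.+ count M ks 0)) where
      private
        d = count M (p ∷ q ∷ [])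
        t = count M (θ-pairs a a c)
        k = count M ks
        open Bound B
        E = 2 ℕ.+ (e ℕ.+ e)

        late : ∀ {M} n → M ≤ a ℕ.+ a → a ≤ n → M ℕ.+ 2 ≤ 2 ℕ.+ (n ℕ.+ n)
        late {M} n le l = ℕ.≤-trans (ℕ.≤-reflexive (ℕ.+-comm M 2)) (ℕ.+-monoʳ-≤ 2 (ℕ.≤-trans le (ℕ.+-mono-≤ l l)))

        first : ∀ {M} (B : Bound M) → M ≤ E → let d = count M (p ∷ q ∷ []); t = count M (θ-pairs a a c); k = count M ks
                                                  i = proj₁ (win-late {M} a (late a (Bound.M≤ab B) ℕ.≤-refl))
                                                  i′ = proj₁ (win-late {M} c (late c (Bound.M≤ab B) a≤c)) in
          2 ≤ E ∸ M × d 0 ≡ t 0 ℕ.+ k 0 × d 0 ℕ.+ d 1 ≡ t 1 ℕ.+ (k 0 ℕ.+ k 0 ℕ.+ k 1) ×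
          + 2 * + (d 0 ℕ.+ d 1 ℕ.+ d 2) + (- 1ℤ * sg e * + δ (E ∸ M) 2 + (1ℤ * sg a * + δ i 0 + (1ℤ * sg a * + δ i 0 + 1ℤ * sg c * + δ i′ 0))) ≡
          + 2 * + (t 2 ℕ.+ (k 0 ℕ.+ k 0 ℕ.+ k 0 ℕ.+ (k 1 ℕ.+ k 1) ℕ.+ k 2))
        first {M} B M≤E = let κ , hE = T.win-E M≤E
                              i , _ , hA = win-late {M} a (late a (Bound.M≤ab B) ℕ.≤-refl)
                              i′ , _ , hC = win-late {M} c (late c (Bound.M≤ab B) a≤c) in
          path-beyond₁ {κ = κ} (neg-unit (sg-unit e)) (E ∸ M)
            (T.equations B {P = θ-path p q e a a c} {ρ = λ _ → 0ℤ} (λ s → sym (ℤ.+-identityʳ (θ-path p q e a a c s)))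
              (hE ⊞ (hA ⊞ (hA ⊞ hC))) (Hi-0ᶠ (M ℕ.+ 3)))

      M+2≤E : M ℕ.+ 2 ≤ E
      M+2≤E = by-cases (ℕ.≤-total M E)
        where
        by-cases : M ≤ E ⊎ E ≤ M → M ℕ.+ 2 ≤ E
        by-cases (inj₁ M≤E) = ℕ.≤-trans (ℕ.+-monoʳ-≤ M (proj₁ (first B M≤E))) (ℕ.≤-reflexive (ℕ.m+[n∸m]≡n M≤E))
        by-cases (inj₂ E≤M) = contradiction (subst (2 ≤_) (ℕ.n∸n≡0 E) (proj₁ (first B′ ℕ.≤-refl))) λ ()
          where
          B′ : Bound E
          B′ = record { 3≤M = s≤s (s≤s (ℕ.≤-trans 1≤e (ℕ.m≤m+n e e))) ; M≤p = ℕ.≤-trans E≤M M≤p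
                      ; M≤ab = ℕ.≤-trans E≤M M≤ab ; M≤ks = All.map (ℕ.≤-trans E≤M) M≤ks }

      private
        M≤E = ℕ.≤-trans (ℕ.m≤m+n M 2) M+2≤E
        eqs = first B M≤E

      M≡2a : M ≡ a ℕ.+ a
      M≡2a = by-cases (M ℕ.≟ a ℕ.+ a)
        where
        by-cases : Dec (M ≡ a ℕ.+ a) → M ≡ a ℕ.+ a
        by-cases (yes eq) = eq
        by-cases (no ne) = proj₂ (T.theta-shortest B att (T.equationsℕ B
          (Hi-≤ far-E T.Hi-E ⊕ (Hi-≤ (far a ℕ.≤-refl) (T.Hi-term a) ⊕ (Hi-≤ (far a ℕ.≤-refl) (T.Hi-term a) ⊕ Hi-≤ (far c a≤c) (T.Hi-term c))))))
          where
          M<2a = ℕ.≤∧≢⇒< M≤ab ne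
          far : ∀ n → a ≤ n → M ℕ.+ 3 ≤ 2 ℕ.+ (n ℕ.+ n)
          far n le = ℕ.≤-trans (ℕ.≤-reflexive (ℕ.+-comm M 3)) (ℕ.+-monoʳ-≤ 2 (ℕ.≤-trans M<2a (ℕ.+-mono-≤ le le)))
          zero-at : ∀ {n i} → a ≤ n → 2 ℕ.+ (n ℕ.+ n) ≡ M ℕ.+ (2 ℕ.+ i) → δ i 0 ≡ 0
          zero-at {n} {zero}  le eq = contradiction (ℕ.≤-trans (far n le) (ℕ.≤-reflexive eq)) (λ l → ℕ.1+n≰n (ℕ.≤-trans (ℕ.≤-reflexive (sym (ℕ.+-suc M 2))) l))
          zero-at {n} {suc i} le eq = refl
          n₂≡0 : ∀ {g g′ x y} → x ≡ 0 → y ≡ 0 → 1ℤ * g * + x + (1ℤ * g * + x + 1ℤ * g′ * + y) ≡ + 2 * 0ℤ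
          n₂≡0 {g} {g′} refl refl = n₂≡0-shape g g′
          far-E : M ℕ.+ 3 ≤ E
          far-E = ℕ.≤-trans (ℕ.+-monoʳ-≤ M (proj₁ (path-beyond₂ {D₀ = 0} {D₁ = 0} {D₂ = d 0 ℕ.+ d 1 ℕ.+ d 2} {τ₀ = 0} {τ₁ = 0} {τ₂ = t 2} {k₀ = k 0} {k₁ = k 1} {k₂ = k 2} {κ = 0ℤ}
              (neg-unit (sg-unit e)) (E ∸ M) 0ℤ
              (n₂≡0 {sg a} {sg c} (zero-at ℕ.≤-refl (proj₁ (proj₂ (win-late {M} a (late a M≤ab ℕ.≤-refl))))) (zero-at a≤c (proj₁ (proj₂ (win-late {M} c (late c M≤ab a≤c))))))
              (proj₁ eqs) (proj₂ (proj₂ (proj₂ eqs)))))) (ℕ.≤-reflexive (ℕ.m+[n∸m]≡n M≤E))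

      private
        γ = c ∸ a
        t-count : ∀ j → t j ≡ t# γ γ j
        t-count j = cong₂ ℕ._+_ (δ-offset {M = M} {k = 0} j (trans (sym M≡2a) (sym (ℕ.+-identityʳ M))))
          (cong₂ ℕ._+_ off (cong (ℕ._+ 0) off))
          where
          off : δ (a ℕ.+ c ∸ M) j ≡ δ γ j
          off = δ-offset {M = M} {k = γ} j (trans (cong (a ℕ.+_) (sym (ℕ.m+[n∸m]≡n a≤c))) (trans (sym (ℕ.+-assoc a a γ)) (cong (ℕ._+ γ) (sym M≡2a))))

      1≤γ : 1 ≤ γ
      1≤γ = by-cases γ (λ j → t-count j) refl
        where
        by-cases : ∀ g → (∀ j → t j ≡ t# g g j) → γ ≡ g → 1 ≤ γ
        by-cases zero    tc eq = contradiction (ℕ.≤-trans (ℕ.≤-reflexive (sym (trans (proj₁ (proj₂ eqs)) (cong (ℕ._+ k 0) (tc 0)))))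
          (ℕ.≤-trans (ℕ.≤-trans (ℕ.m≤m+n (d 0) (d 1)) (ℕ.m≤m+n (d 0 ℕ.+ d 1) (d 2))) (count₂ M p q))) λ { (s≤s (s≤s ())) }
        by-cases (suc g) tc eq = subst (1 ≤_) (sym eq) (s≤s z≤n)

      private
        a<c : a < c
        a<c = ℕ.≤-trans (ℕ.≤-reflexive (ℕ.+-comm 1 a)) (ℕ.≤-trans (ℕ.+-monoʳ-≤ a 1≤γ) (ℕ.≤-reflexive (ℕ.m+[n∸m]≡n a≤c)))

        p̂ = p ∸ M
        q̂ = q ∸ M
        L₃ = d# p̂ q̂ 0 ℕ.+ (d# p̂ q̂ 1 ℕ.+ d# p̂ q̂ 1 ℕ.+ d# p̂ q̂ 1) ℕ.+ d# p̂ q̂ 2 ℕ.+ d# p̂ q̂ 3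
        R₂ = t# γ γ 2 ℕ.+ (k 0 ℕ.+ k 0 ℕ.+ k 0 ℕ.+ (k 1 ℕ.+ k 1) ℕ.+ k 2)
        R₃ = t# γ γ 1 ℕ.+ t# γ γ 1 ℕ.+ t# γ γ 3 ℕ.+ (k 0 ℕ.+ k 0 ℕ.+ k 0 ℕ.+ k 0 ℕ.+ (k 1 ℕ.+ k 1 ℕ.+ k 1 ℕ.+ k 1 ℕ.+ k 1) ℕ.+ (k 2 ℕ.+ k 2) ℕ.+ k 3)

        second : 3 ≤ E ∸ M × + 2 * (+ (d 0 ℕ.+ d 1 ℕ.+ d 2) + sg a) ≡ + 2 * + R₂
        second = let le , h = path-beyond₂ {D₀ = 0} {D₁ = 0} {D₂ = d 0 ℕ.+ d 1 ℕ.+ d 2} {τ₀ = 0} {τ₁ = 0} {τ₂ = t 2} {k₀ = k 0} {k₁ = k 1} {k₂ = k 2} {κ = 0ℤ}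
                                (neg-unit (sg-unit e)) (E ∸ M) (sg a)
                                (n₂≡ {sg a} {sg c} (at-2a (proj₁ (proj₂ (win-late {M} a (late a M≤ab ℕ.≤-refl)))))
                                     (beyond-2a (proj₁ (proj₂ (win-late {M} c (late c M≤ab a≤c))))))
                                (proj₁ eqs) (proj₂ (proj₂ (proj₂ eqs))) in
          le , trans h (cong (λ n → + 2 * + (n ℕ.+ (k 0 ℕ.+ k 0 ℕ.+ k 0 ℕ.+ (k 1 ℕ.+ k 1) ℕ.+ k 2))) (t-count 2))
          where
          at-2a : ∀ {i} → 2 ℕ.+ (a ℕ.+ a) ≡ M ℕ.+ (2 ℕ.+ i) → δ i 0 ≡ 1
          at-2a {i} eq = cong (λ n → δ n 0) (sym (ℕ.+-cancelˡ-≡ (2 ℕ.+ M) 0 i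
            (trans (ℕ.+-identityʳ (2 ℕ.+ M)) (trans (cong (2 ℕ.+_) M≡2a) (trans eq (at-2a-shape M i))))))
          beyond-2a : ∀ {i} → 2 ℕ.+ (c ℕ.+ c) ≡ M ℕ.+ (2 ℕ.+ i) → δ i 0 ≡ 0
          beyond-2a {zero}  eq = contradiction (ℕ.≤-trans (s≤s (s≤s (ℕ.+-mono-<-≤ a<c a≤c)))
            (ℕ.≤-reflexive (trans eq (trans (ℕ.+-comm M 2) (cong (2 ℕ.+_) M≡2a))))) ℕ.1+n≰n
          beyond-2a {suc i} eq = refl
          n₂≡ : ∀ {g g′ x y} → x ≡ 1 → y ≡ 0 → 1ℤ * g * + x + (1ℤ * g * + x + 1ℤ * g′ * + y) ≡ + 2 * g
          n₂≡ {g} {g′} refl refl = n₂≡-shape g g′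

        far-E : M ℕ.+ 4 ≤ E
        far-E = ℕ.≤-trans (ℕ.≤-reflexive (trans (cong (ℕ._+ 4) M≡2a) (far-E-shape₁ a))) (s≤s (s≤s (ℕ.+-mono-≤ a<e a<e)))
          where
          M+3≤E : M ℕ.+ 3 ≤ E
          M+3≤E = ℕ.≤-trans (ℕ.+-monoʳ-≤ M (proj₁ second)) (ℕ.≤-reflexive (ℕ.m+[n∸m]≡n M≤E))
          a<e : a < e
          a<e = ℕ.≰⇒> λ e≤a → ℕ.1+n≰n (ℕ.≤-trans (ℕ.≤-reflexive (trans (ℕ.+-comm 3 M) refl))
            (ℕ.≤-trans M+3≤E (ℕ.≤-trans (ℕ.+-monoʳ-≤ 2 (ℕ.+-mono-≤ e≤a e≤a)) (ℕ.≤-reflexive (cong (2 ℕ.+_) (sym M≡2a))))))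

        third : + 2 * (+ L₃ + + 2 * sg a) ≡ + 2 * + R₃
        third = trans (third-distrib (+ L₃) (sg a)) (trans (cong (λ z → + 2 * + L₃ + z) (sym (π₃≡ (sg a) j≡2)))
          (trans (T.equation₃ B 4≤M {P = λ s → term a s + term a s} {ρ = λ s → E-term s + term c s}
            (λ s → third-shape (E-term s) (term a s) (term c s)) (win-term₄ a le ⊞ win-term₄ a le)
            (Hi-≤ far-E T.Hi-E ⊕ Hi-≤ far-C (T.Hi-term c)))
            (cong₂ (λ x y → + 2 * + (x ℕ.+ x ℕ.+ y ℕ.+ (k 0 ℕ.+ k 0 ℕ.+ k 0 ℕ.+ k 0 ℕ.+ (k 1 ℕ.+ k 1 ℕ.+ k 1 ℕ.+ k 1 ℕ.+ k 1) ℕ.+ (k 2 ℕ.+ k 2) ℕ.+ k 3)))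
              (t-count 1) (t-count 3))))
          where
          4≤M : 4 ≤ M
          4≤M = ℕ.≤-trans (ℕ.+-mono-≤ 2≤a 2≤a) (ℕ.≤-reflexive (sym M≡2a))
          le : M ≤ 2 ℕ.+ (a ℕ.+ a)
          le = ℕ.≤-trans (ℕ.≤-reflexive M≡2a) (ℕ.m≤n+m (a ℕ.+ a) 2)
          j≡2 : 2 ℕ.+ (a ℕ.+ a) ∸ M ≡ 2
          j≡2 = trans (cong (2 ℕ.+ (a ℕ.+ a) ∸_) M≡2a) (ℕ.m+n∸n≡m 2 (a ℕ.+ a))
          far-C : M ℕ.+ 4 ≤ 2 ℕ.+ (c ℕ.+ c)
          far-C = ℕ.≤-trans (ℕ.≤-reflexive (trans (cong (ℕ._+ 4) M≡2a) (far-C-shape₁ a))) (s≤s (s≤s (ℕ.+-mono-≤ a<c a<c)))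
          π₃≡ : ∀ g {j} → j ≡ 2 → 1ℤ * g * (+ δ j 1 + + 2 * + δ j 2 + + δ j 3) + 1ℤ * g * (+ δ j 1 + + 2 * + δ j 2 + + δ j 3) ≡ + 2 * g + + 2 * g
          π₃≡ g refl = π₃≡-shape′ g

        zeroth : d# p̂ q̂ 0 ≡ t# γ γ 0 ℕ.+ k 0
        zeroth = trans (proj₁ (proj₂ eqs)) (cong (ℕ._+ k 0) (t-count 0))
        one : d# p̂ q̂ 0 ℕ.+ d# p̂ q̂ 1 ≡ t# γ γ 1 ℕ.+ (k 0 ℕ.+ k 0 ℕ.+ k 1)
        one = trans (proj₁ (proj₂ (proj₂ eqs))) (cong (ℕ._+ (k 0 ℕ.+ k 0 ℕ.+ k 1)) (t-count 1))

        minus : ∀ {m n g} j → g ≡ - + j → + 2 * (+ m + g) ≡ + 2 * + n → m ≡ j ℕ.+ n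
        minus {m} {n} j refl h = ℤ.+-injective (trans (minus-shape (+ m) (+ j)) (trans (cong (λ z → + j + z)
          (ℤ.*-cancelˡ-≡ (+ 2) (+ m + - + j) (+ n) h)) refl))

        plus : ∀ {m n g} j → g ≡ + j → + 2 * (+ m + g) ≡ + 2 * + n → m ℕ.+ j ≡ n
        plus j refl h = halve h

        antipodal : sg a ≡ 1ℤ → p̂ ≡ 0 × q̂ ≡ 0 × k 0 ≡ 1 → ⊥
        antipodal sg≡1 (p̂≡0 , q̂≡0 , k₀≡1) = antipodal-impossible {a} {c} {e} {ks′} 1≤a a<c c≤e sg≡1
            (All.map (ℕ.≤-trans (s≤s z≤n)) (sub 3≤ks)) H′
          where
          rc = remove-cycle {M} ks M≤ks (subst (1 ≤_) (sym k₀≡1) ℕ.≤-refl)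
          ks′ = proj₁ rc
          sub : ∀ {m} → All (m ≤_) ks → All (m ≤_) ks′
          sub = proj₂ (proj₂ (proj₂ rc))
          p≡ : p ≡ a ℕ.+ a
          p≡ = trans (sym (ℕ.m+[n∸m]≡n M≤p)) (trans (cong (M ℕ.+_) p̂≡0) (trans (ℕ.+-identityʳ M) M≡2a))
          q≡ : q ≡ a ℕ.+ a
          q≡ = trans (sym (ℕ.m+[n∸m]≡n M≤q)) (trans (cong (M ℕ.+_) q̂≡0) (trans (ℕ.+-identityʳ M) M≡2a))
          c≤e : c ≤ e
          c≤e = ℕ.≤-trans (ℕ.m≤m+n c (sum ks′)) (ℕ.≤-reflexive (ℕ.+-cancelˡ-≡ (a ℕ.+ a ℕ.+ (a ℕ.+ a)) _ _ (begin
            a ℕ.+ a ℕ.+ (a ℕ.+ a) ℕ.+ (c ℕ.+ sum ks′)      ≡⟨ c≤e-shape (a ℕ.+ a) c (sum ks′) ⟩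
            a ℕ.+ a ℕ.+ c ℕ.+ (a ℕ.+ a ℕ.+ sum ks′)        ≡⟨ cong (λ n → a ℕ.+ a ℕ.+ c ℕ.+ (n ℕ.+ sum ks′)) (sym M≡2a) ⟩
            a ℕ.+ a ℕ.+ c ℕ.+ (M ℕ.+ sum ks′)             ≡⟨ cong (a ℕ.+ a ℕ.+ c ℕ.+_) (sym (proj₁ (proj₂ (proj₂ rc)))) ⟩
            a ℕ.+ a ℕ.+ c ℕ.+ sum ks                     ≡⟨ total ⟩
            p ℕ.+ q ℕ.+ e                               ≡⟨ cong₂ (λ m n → m ℕ.+ n ℕ.+ e) p≡ q≡ ⟩
            a ℕ.+ a ℕ.+ (a ℕ.+ a) ℕ.+ e                   ∎)))
            where
            open ≡-Reasoning
          H′ : ∀ s → dumbbell (a ℕ.+ a) (a ℕ.+ a) e s ≡ θ a a c s * ((1ℤ + + 2 * s ^ (a ℕ.+ a) + W (a ℕ.+ a) s) * cycles ks′ s)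
          H′ s = trans (cong₂ (λ m n → dumbbell m n e s) (sym p≡) (sym q≡)) (trans (H s) (cong (θ a a c s *_)
            (trans (proj₁ (proj₂ rc) s) (cong (λ n → (1ℤ + + 2 * s ^ n + W n s) * cycles ks′ s) M≡2a))))

      isosceles-impossible : ⊥
      isosceles-impossible = by-sign (sg-unit a)
        where
        by-sign : Unit (sg a) → ⊥
        by-sign (inj₁ eq) = antipodal eq (isosceles⁺ p̂ q̂ γ (k 0) (k 1) (k 2) (k 3) (ℕ.∸-monoˡ-≤ M p≤q) 1≤γ zeroth one
          (plus 1 eq (proj₂ second)) (plus 2 (cong (λ z → + 2 * z) eq) third))
        by-sign (inj₂ eq) = isosceles⁻ p̂ q̂ γ (k 0) (k 1) (k 2) (k 3) (ℕ.∸-monoˡ-≤ M p≤q) 1≤γ zeroth one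
          (minus 1 eq (proj₂ second)) (minus 2 (cong (λ z → + 2 * z) eq) third)

    isosceles-theta-impossible : ⊥
    isosceles-theta-impossible = Iso.isosceles-impossible (proj₁ (proj₂ T.minimum)) (proj₂ (proj₂ T.minimum))

  theta-impossible : ∀ {p q e a b c ks} → 3 ≤ p → p ≤ q → 1 ≤ e → 1 ≤ a → a ≤ b → b ≤ c → 3 ≤ a ℕ.+ b → All (3 ≤_) ks →
    (∀ s → dumbbell p q e s ≡ θ a b c s * cycles ks s) → a ℕ.+ b ℕ.+ c ℕ.+ sum ks ≡ p ℕ.+ q ℕ.+ e → ⊥
  theta-impossible {p} {q} {e} {a} {b} {c} {ks} 3≤p p≤q 1≤e 1≤a a≤b b≤c 3≤ab 3≤ks H total = by-cases (a ℕ.≟ b)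
    where
    by-cases : Dec (a ≡ b) → ⊥
    by-cases (no a≢b)  = scalene-impossible 3≤p p≤q 1≤e 1≤a a≤b b≤c 3≤ab 3≤ks H total (ℕ.≤∧≢⇒< a≤b a≢b)
    by-cases (yes a≡b) = isosceles-theta-impossible 3≤p p≤q 1≤e (ℕ.≰⇒> a≰1) (subst (_≤ c) (sym a≡b) b≤c)
      (subst (λ n → 3 ≤ a ℕ.+ n) (sym a≡b) 3≤ab) 3≤ks
      (subst (λ n → ∀ s → dumbbell p q e s ≡ θ a n c s * cycles ks s) (sym a≡b) H)
      (subst (λ n → a ℕ.+ n ℕ.+ c ℕ.+ sum ks ≡ p ℕ.+ q ℕ.+ e) (sym a≡b) total)
      where
      a≰1 : ¬ a ≤ 1
      a≰1 le = contradiction (ℕ.≤-trans 3≤ab (ℕ.+-mono-≤ le (subst (_≤ 1) a≡b le))) λ { (s≤s (s≤s ())) }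

module DumbbellComparison where

  open import Data.Integer.Base as ℤ using (ℤ; 0ℤ; 1ℤ; +_; -[1+_]; _+_; _*_; _-_; -_; _^_)
  open import Data.List.Base using (List; []; _∷_)
  open import Data.List.Relation.Unary.All as All using (All; []; _∷_)
  import Data.List.Relation.Unary.All.Properties as All
  open import Data.Nat.Base as ℕ using (ℕ; suc; z≤n; s≤s; _≤_; _<_; _∸_; _⊓_)
  open import Data.Nat.ListAction using (sum)
  open import Data.Vec.Base using ([]; _∷_)
  open Windows
  open ShapeFunctions
  open CoefficientEquations
  open ThetaEquations

  record SomeEquations (π₀ π₁ π₂ : ℤ) : Set where
    constructor some
    field
      {D₀ D₁ D₂ τ₀ τ₁ τ₂ k₀ k₁ k₂} : ℕ
      eqs : Equations D₀ D₁ D₂ τ₀ τ₁ τ₂ k₀ k₁ k₂ π₀ π₁ π₂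

  PathEquations : ℕ → ℕ → ℕ → ℤ → ℤ → Set
  PathEquations e e′ M κ κ′ = let j = 2 ℕ.+ (e ℕ.+ e) ∸ M; i = 2 ℕ.+ (e′ ℕ.+ e′) ∸ M; g = - 1ℤ * sg e; h = 1ℤ * sg e′ in
    SomeEquations (g * + δ j 0 + h * + δ i 0)
      (g * (+ 2 * + δ j 0 + + δ j 1) + h * (+ 2 * + δ i 0 + + δ i 1))
      (g * (κ * + δ j 0 + + 2 * + δ j 1 + + δ j 2) + h * (κ′ * + δ i 0 + + 2 * + δ i 1 + + δ i 2))

  far-paths : ∀ {e e′ M} → e ≢ e′ → 3 ≤ M → 1 ≤ e → 1 ≤ e′ →
    (∀ {M′} → 3 ≤ M′ → M′ ≤ M → M′ ≤ 2 ℕ.+ (e ℕ.+ e) → M′ ≤ 2 ℕ.+ (e′ ℕ.+ e′) → ∃ λ κ → ∃ λ κ′ → PathEquations e e′ M′ κ κ′) →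
    M ℕ.+ 3 ≤ 2 ℕ.+ (e ℕ.+ e) × M ℕ.+ 3 ≤ 2 ℕ.+ (e′ ℕ.+ e′)
  far-paths {e} {e′} {M} e≢e′ 3≤M 1≤e 1≤e′ equations =
    subst (λ m → m ℕ.+ 3 ≤ E × m ℕ.+ 3 ≤ A) (by-cases (ℕ.⊓-sel M (E ⊓ A)) (ℕ.⊓-sel E A)) (far-E , far-A)
    where
    E = 2 ℕ.+ (e ℕ.+ e)
    A = 2 ℕ.+ (e′ ℕ.+ e′)
    M′ = M ⊓ (E ⊓ A)
    M′≤M : M′ ≤ M
    M′≤M = ℕ.m⊓n≤m M (E ⊓ A)
    M′≤E : M′ ≤ E
    M′≤E = ℕ.≤-trans (ℕ.m⊓n≤n M (E ⊓ A)) (ℕ.m⊓n≤m E A)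
    M′≤A : M′ ≤ A
    M′≤A = ℕ.≤-trans (ℕ.m⊓n≤n M (E ⊓ A)) (ℕ.m⊓n≤n E A)
    3≤2+ : ∀ {n} → 1 ≤ n → 3 ≤ 2 ℕ.+ (n ℕ.+ n)
    3≤2+ {n} l = s≤s (s≤s (ℕ.≤-trans l (ℕ.m≤m+n n n)))
    j≢i : E ∸ M′ ≢ A ∸ M′
    j≢i eq = e≢e′ (double-injective (ℕ.suc-injective (ℕ.suc-injective (ℕ.∸-cancelʳ-≡ M′≤E M′≤A eq))))
      where
      double-injective : ∀ {m n} → m ℕ.+ m ≡ n ℕ.+ n → m ≡ n
      double-injective {m} {n} h = ℕ.*-cancelˡ-≡ m n 2 (trans (cong (m ℕ.+_) (ℕ.+-identityʳ m)) (trans h (cong (n ℕ.+_) (sym (ℕ.+-identityʳ n)))))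
    one-unit : ∀ {g} → Unit g → Unit (1ℤ * g)
    one-unit (inj₁ refl) = inj₁ refl
    one-unit (inj₂ refl) = inj₂ refl
    far : 3 ≤ E ∸ M′ × 3 ≤ A ∸ M′
    far = let κ , κ′ , some eqs = equations (ℕ.⊓-glb 3≤M (ℕ.⊓-glb (3≤2+ 1≤e) (3≤2+ 1≤e′))) M′≤M M′≤E M′≤A in
      paths-far {κ = κ} {κ′ = κ′} (neg-unit (sg-unit e)) (one-unit (sg-unit e′)) (E ∸ M′) (A ∸ M′) j≢i eqs
    up : ∀ {N} → M′ ≤ N → 3 ≤ N ∸ M′ → M′ ℕ.+ 3 ≤ N
    up le l = ℕ.≤-trans (ℕ.+-monoʳ-≤ M′ l) (ℕ.≤-reflexive (ℕ.m+[n∸m]≡n le))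
    far-E = up M′≤E (proj₁ far)
    far-A = up M′≤A (proj₂ far)
    not : ∀ {N} → M′ ℕ.+ 3 ≤ N → M′ ≢ N
    not l eq = ℕ.m+1+n≰m M′ (subst (M′ ℕ.+ 3 ≤_) (sym eq) l)
    by-cases : M′ ≡ M ⊎ M′ ≡ E ⊓ A → E ⊓ A ≡ E ⊎ E ⊓ A ≡ A → M′ ≡ M
    by-cases (inj₁ h) _         = h
    by-cases (inj₂ h) (inj₁ h′) = contradiction (trans h h′) (not far-E)
    by-cases (inj₂ h) (inj₂ h′) = contradiction (trans h h′) (not far-A)

  attained⇒≡ : ∀ {M n} ns → M ≤ n → All (n ≤_) ns → 1 ≤ count M (n ∷ ns) 0 → n ≡ M
  attained⇒≡ {M} {n} ns le ns≥ c = ℕ.≤-antisym (ℕ.≮⇒≥ λ lt →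
    contradiction (subst (1 ≤_) (none-above (lt ∷ All.map (ℕ.≤-trans lt) ns≥)) c) λ ()) le

  private
    cancel-shape : ∀ x S → x ≡ 1ℤ + S + x - (1ℤ + S)
    cancel-shape = solve-∀

    count₁-shape : ∀ x y z → x ℕ.+ y ℕ.+ z ≡ x ℕ.+ 0 ℕ.+ (y ℕ.+ 0) ℕ.+ (z ℕ.+ 0)
    count₁-shape = ℕ-solve-∀

    shape-poly : ∀ P x t u v r r′ → P * (x + + 2 * (t * u) + r) - P * (x + + 2 * (t * v) + r′) ≡
      + 2 * (x * t * (u + 0ℤ)) - + 2 * (x * t * (v + 0ℤ)) + (x * (r + - r′) + (P - x) * ((x + + 2 * (t * u) + r - x) + - (x + + 2 * (t * v) + r′ - x)))
    shape-poly = solve-∀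

    hPath-shape : ∀ u y v → u - y + - (v - y) ≡ u - v
    hPath-shape = solve-∀

    q≡-shape : ∀ q e k → q ℕ.+ e ℕ.+ k ≡ q ℕ.+ k ℕ.+ e
    q≡-shape = ℕ-solve-∀

    ces-shape : ∀ a u y v → a * (u - y + - (v - y)) ≡ a * u - a * v
    ces-shape = solve-∀

    Hi-XX-shape : ∀ u v x → (u - x) * v + x * (v - x) ≡ u * v - x * x
    Hi-XX-shape = solve-∀

    Hi-F′-shape : ∀ u x w → u - x + - 1ℤ * w ≡ u - w - x
    Hi-F′-shape = solve-∀

    isolate-eq : ∀ x y → y ≡ x - (x - y)
    isolate-eq = solve-∀

    balance₁-shape : ∀ x u v r r′ → x + u + r - (x + v + r′) ≡ u - v + (r + - r′)
    balance₁-shape = solve-∀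

    balance₃-shape : ∀ d → 0ℤ ≡ + 2 * (d * 0ℤ) - + 2 * (d * 0ℤ) + 0ℤ
    balance₃-shape = solve-∀

    equal-Path-order : ∀ N → N ℕ.+ 3 ≡ 2 ℕ.+ suc N
    equal-Path-order = ℕ-solve-∀

    equal-Path-shape : ∀ w u v → - 1ℤ * (w * (u - v)) ≡ - 1ℤ * (w * u) + 1ℤ * (w * v)
    equal-Path-shape = solve-∀

    Hi-Yp-shape : ∀ x y → x + (y - x) ≡ y
    Hi-Yp-shape = solve-∀

    total′-shape : ∀ p q e k → p ℕ.+ q ℕ.+ e ℕ.+ k ≡ p ℕ.+ (q ℕ.+ e ℕ.+ k)
    total′-shape = ℕ-solve-∀

  module _ {p q e p′ q′ e′ : ℕ} {ks : List ℕ} (3≤p : 3 ≤ p) (p≤q : p ≤ q) (1≤e : 1 ≤ e)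
           (3≤p′ : 3 ≤ p′) (p′≤q′ : p′ ≤ q′) (1≤e′ : 1 ≤ e′) (3≤ks : All (3 ≤_) ks)
           (H : ∀ s → dumbbell p q e s ≡ dumbbell p′ q′ e′ s * cycles ks s) where

    private
      3≤q = ℕ.≤-trans 3≤p p≤q
      3≤q′ = ℕ.≤-trans 3≤p′ p′≤q′

      Path : ℤ → ℤ
      Path s = - 1ℤ * (W e s * (Y p s * Y q s)) + 1ℤ * (W e′ s * (Y p′ s * Y q′ s))

      F′ : ℤ → ℤ
      F′ = dumbbell p′ q′ e′

      Hi-XX : ∀ {m n} → 3 ≤ m → 3 ≤ n → Hi 3 (λ s → X m s * X n s - x₀ s * x₀ s)
      Hi-XX {m} {n} lm ln = win-ext (λ s → Hi-XX-shape (X m s) (X n s) (x₀ s)) (Hi-*ʳ (X n) (Hi-X m lm) ⊕ Hi-*ˡ x₀ (Hi-X n ln))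

      Hi-F′ : Hi 3 (λ s → F′ s - x₀ s * x₀ s)
      Hi-F′ = win-ext (λ s → Hi-F′-shape (X p′ s * X q′ s) (x₀ s * x₀ s) (W e′ s * (Y p′ s * Y q′ s)))
        (Hi-XX 3≤p′ 3≤q′ ⊕ Hi-≤ (s≤s (s≤s (ℕ.≤-trans 1≤e′ (ℕ.m≤m+n e′ e′)))) (Hi-path (- 1ℤ) e′ (λ s → Y p′ s * Y q′ s) (Hi-YY 3≤p′ 3≤q′)))

      cycle-rest : ∀ {M} → 3 ≤ M → All (M ≤_) ks → let R = proj₁ (cycles-expand ks 3≤ks) in
        Hi (M ℕ.+ 3) (λ s → - (x₀ s * x₀ s * R s) + - ((F′ s - x₀ s * x₀ s) * (+ 2 * Σpow ks s + R s)))
      cycle-rest {M} 3≤M les = neg (Hi-*ˡ (λ s → x₀ s * x₀ s) (Hi-≤ (ℕ.+-monoʳ-≤ M 3≤M) hR))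
        ⊕ neg (subst (λ n → Hi n (λ s → (F′ s - x₀ s * x₀ s) * (+ 2 * Σpow ks s + R s))) (ℕ.+-comm 3 M)
            (Hi-* Hi-F′ (Hi-*ˡ (λ _ → + 2) (win⇒Hi (win-Σpow les)) ⊕ Hi-≤ (ℕ.m≤m+n M M) hR)))
        where
        R = proj₁ (cycles-expand ks 3≤ks)
        hR : Hi (M ℕ.+ M) R
        hR = let R′ , h , eq = cycles-expand ks les in
          win-ext (λ s → cancel (+ 2 * Σpow ks s) (trans (sym (eq s)) (proj₂ (proj₂ (cycles-expand ks 3≤ks)) s))) h
          where
          cancel : ∀ {x y} S → 1ℤ + S + x ≡ 1ℤ + S + y → x ≡ y
          cancel {x} {y} S h = trans (cancel-shape x S) (trans (cong (λ z → z - (1ℤ + S)) h) (sym (cancel-shape y S)))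

      isolate : ∀ x y z → x - y ≡ z → y ≡ x - z
      isolate x y z refl = isolate-eq x y

      Balanced : ℕ → List ℕ → List ℕ → Set
      Balanced M ds ts = ∃ λ R → Hi (M ℕ.+ 3) R × (∀ s → dumbbell-balance ds ts ks s (Path s + R s) ≡ 0ℤ)

      combine : ∀ {M ds ts} → 3 ≤ M → All (M ≤_) ks → (R : ℤ → ℤ) → Hi (M ℕ.+ 3) R →
        (∀ s → X p s * X q s - X p′ s * X q′ s ≡ + 2 * (x₀ s * (1ℤ + s * s) * Σpow ds s) - + 2 * (x₀ s * (1ℤ + s * s) * Σpow ts s) + R s) →
        Balanced M ds ts
      combine {M} {ds} {ts} 3≤M les R hR eq =
        (λ s → R s + (- (x₀ s * x₀ s * R₃ s) + - ((F′ s - x₀ s * x₀ s) * (+ 2 * Σpow ks s + R₃ s)))) , hR ⊕ cycle-rest 3≤M les ,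
        λ s → final (X p s * X q s) (x₀ s * (1ℤ + s * s) * Σpow ds s) (x₀ s * (1ℤ + s * s) * Σpow ts s) (x₀ s * x₀ s) (Σpow ks s) (R s) (R₃ s)
          (X p′ s * X q′ s) (W e s * (Y p s * Y q s)) (W e′ s * (Y p′ s * Y q′ s)) (eq s) (proj₂ (proj₂ (cycles-expand ks 3≤ks)) s) (H s)
        where
        R₃ = proj₁ (cycles-expand ks 3≤ks)
        final : ∀ A u v xx S r r₃ B E E′ {K} → A - B ≡ + 2 * u - + 2 * v + r → K ≡ 1ℤ + + 2 * S + r₃ → A - E ≡ (B - E′) * K →
          + 2 * u + (-[1+ 1 ] * v + (-[1+ 1 ] * (xx * S) + (- 1ℤ * E + 1ℤ * E′ +
            (r + (- (xx * r₃) + - ((B - E′ - xx) * (+ 2 * S + r₃))))))) ≡ 0ℤ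
        final A u v xx S r r₃ B E E′ h refl h′ = trans (cong (λ E → + 2 * u + (-[1+ 1 ] * v + (-[1+ 1 ] * (xx * S) + (- 1ℤ * E + 1ℤ * E′ +
            (r + (- (xx * r₃) + - ((B - E′ - xx) * (+ 2 * S + r₃)))))))) (isolate A E ((B - E′) * (1ℤ + + 2 * S + r₃)) h′))
          (trans (poly u v xx S r r₃ A B E′) (trans (cong (λ z → + 2 * u - + 2 * v + r - z) h) (ℤ.+-inverseʳ (+ 2 * u - + 2 * v + r))))
          where
          poly : ∀ u v xx S r r₃ A B E′ → + 2 * u + (-[1+ 1 ] * v + (-[1+ 1 ] * (xx * S) + (- 1ℤ * (A - (B - E′) * (1ℤ + + 2 * S + r₃)) + 1ℤ * E′ +
            (r + (- (xx * r₃) + - ((B - E′ - xx) * (+ 2 * S + r₃))))))) ≡ + 2 * u - + 2 * v + r - (A - B)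
          poly = solve-∀

      balance₁ : ∀ {M} → 3 ≤ M → M ≤ p → M ≤ p′ → All (M ≤_) ks → Balanced M (p ∷ q ∷ []) (p′ ∷ q′ ∷ [])
      balance₁ {M} 3≤M lp lp′ les = let
          R₁ , h₁ , e₁ = XX-expand {M} p q lp (ℕ.≤-trans lp p≤q); R₂ , h₂ , e₂ = XX-expand {M} p′ q′ lp′ (ℕ.≤-trans lp′ p′≤q′) in
        combine {M} {p ∷ q ∷ []} {p′ ∷ q′ ∷ []} 3≤M les (λ s → R₁ s + - R₂ s) (Hi-≤ (ℕ.+-monoʳ-≤ M 3≤M) h₁ ⊕ neg (Hi-≤ (ℕ.+-monoʳ-≤ M 3≤M) h₂))
          λ s → trans (cong₂ _-_ (e₁ s) (e₂ s)) (balance₁-shape (x₀ s * x₀ s) (+ 2 * (x₀ s * (1ℤ + s * s) * Σpow (p ∷ q ∷ []) s))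
                                                     (+ 2 * (x₀ s * (1ℤ + s * s) * Σpow (p′ ∷ q′ ∷ []) s)) (R₁ s) (R₂ s))

      balance₂ : ∀ {M} → p ≡ p′ → 3 ≤ M → M ≤ q → M ≤ q′ → All (M ≤_) ks → Balanced M (q ∷ []) (q′ ∷ [])
      balance₂ {M} p≡p′ 3≤M lq lq′ les = let
          R₁ , h₁ , e₁ = X-expand {M} q lq; R₂ , h₂ , e₂ = X-expand {M} q′ lq′ in
        combine {M} {q ∷ []} {q′ ∷ []} 3≤M les (λ s → x₀ s * (R₁ s + - R₂ s) + (X p s - x₀ s) * ((X q s - x₀ s) + - (X q′ s - x₀ s)))
          (Hi-*ˡ x₀ (Hi-≤ (ℕ.+-monoʳ-≤ M 3≤M) h₁ ⊕ neg (Hi-≤ (ℕ.+-monoʳ-≤ M 3≤M) h₂))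
           ⊕ subst (λ n → Hi n (λ s → (X p s - x₀ s) * ((X q s - x₀ s) + - (X q′ s - x₀ s)))) (ℕ.+-comm 3 M)
               (Hi-* (Hi-X p 3≤p) (Hi-X q lq ⊕ neg (Hi-X q′ lq′))))
          λ s → trans (cong (λ n → X p s * X q s - X n s * X q′ s) (sym p≡p′))
            (shape (X p s) (x₀ s) (1ℤ + s * s) (s ^ q) (s ^ q′) (R₁ s) (R₂ s) (e₁ s) (e₂ s))
        where
        shape : ∀ P x t u v r r′ {A B} → A ≡ x + + 2 * (t * u) + r → B ≡ x + + 2 * (t * v) + r′ →
          P * A - P * B ≡ + 2 * (x * t * (u + 0ℤ)) - + 2 * (x * t * (v + 0ℤ)) + (x * (r + - r′) + (P - x) * ((A - x) + - (B - x)))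
        shape P x t u v r r′ refl refl = shape-poly P x t u v r r′

      balance₃ : ∀ {M} → p ≡ p′ → q ≡ q′ → 3 ≤ M → All (M ≤_) ks → Balanced M [] []
      balance₃ {M} p≡p′ q≡q′ 3≤M les = combine {M} {[]} {[]} 3≤M les (λ _ → 0ℤ) (Hi-0ᶠ (M ℕ.+ 3))
        λ s → trans (cong₂ (λ m n → X p s * X q s - X m s * X n s) (sym p≡p′) (sym q≡q′))
                (trans (ℤ.+-inverseʳ (X p s * X q s)) (balance₃-shape (x₀ s * (1ℤ + s * s))))

      path-equations : ∀ {M ds ts} → All (M ≤_) ds → All (M ≤_) ts → All (M ≤_) ks → Balanced M ds ts →
        M ≤ 2 ℕ.+ (e ℕ.+ e) → M ≤ 2 ℕ.+ (e′ ℕ.+ e′) → ∃ λ κ → ∃ λ κ′ → PathEquations e e′ M κ κ′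
      path-equations ds≥ ts≥ ks≥ (R , hR , eq) lE lE′ = let
          U , κ , hU , eqU = YY-unit p q 3≤p 3≤q; U′ , κ′ , hU′ , eqU′ = YY-unit p′ q′ 3≤p′ 3≤q′ in
        κ , κ′ , some (dumbbell-equations ds≥ ts≥ ks≥ {Path = Path} {R = R}
          (path-window (- 1ℤ) e {Z = λ s → Y p s * Y q s} {U = U} eqU hU lE ⊞ path-window 1ℤ e′ {Z = λ s → Y p′ s * Y q′ s} {U = U′} eqU′ hU′ lE′) hR eq)

      CountEquations : ℕ → List ℕ → List ℕ → Set
      CountEquations M ds ts = let d = count M ds; t = count M ts; k = count M ks in
        Equationsℕ (d 0) (d 0 ℕ.+ d 1) (d 0 ℕ.+ d 1 ℕ.+ d 2) (t 0) (t 0 ℕ.+ t 1) (t 0 ℕ.+ t 1 ℕ.+ t 2) (k 0) (k 1) (k 2)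

      count-equations : ∀ {M ds ts} → All (M ≤_) ds → All (M ≤_) ts → All (M ≤_) ks → Balanced M ds ts →
        Hi (M ℕ.+ 3) Path → CountEquations M ds ts
      count-equations {M} {ds} {ts} ds≥ ts≥ ks≥ (R , hR , eq) hP = toℕ (dumbbell-equations ds≥ ts≥ ks≥ {Path = λ _ → 0ℤ} {R = λ s → Path s + R s}
        (Hi⇒win 3 ℕ.≤-refl (Hi-0ᶠ (M ℕ.+ 3))) (hP ⊕ hR)
        (λ s → trans (cong (dumbbell-balance ds ts ks s) (ℤ.+-identityˡ (Path s + R s))) (eq s))) refl refl refl

      far-Path : ∀ {M} → M ℕ.+ 3 ≤ 2 ℕ.+ (e ℕ.+ e) × M ℕ.+ 3 ≤ 2 ℕ.+ (e′ ℕ.+ e′) → Hi (M ℕ.+ 3) Path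
      far-Path (l , l′) = Hi-≤ l (Hi-path (- 1ℤ) e (λ s → Y p s * Y q s) (Hi-YY 3≤p 3≤q))
                        ⊕ Hi-≤ l′ (Hi-path 1ℤ e′ (λ s → Y p′ s * Y q′ s) (Hi-YY 3≤p′ 3≤q′))

      equal-Path : ∀ {N} → e ≡ e′ → Hi (suc N) (λ s → Y p s * Y q s - Y p′ s * Y q′ s) → Hi (N ℕ.+ 3) Path
      equal-Path {N} e≡e′ h = win-ext (λ s → trans (equal-Path-shape (W e s) (Y p s * Y q s) (Y p′ s * Y q′ s))
          (cong (λ n → - 1ℤ * (W e s * (Y p s * Y q s)) + 1ℤ * (W n s * (Y p′ s * Y q′ s))) e≡e′))
        (Hi-≤ (ℕ.≤-trans (ℕ.≤-reflexive (equal-Path-order N)) (ℕ.+-monoˡ-≤ (suc N) (ℕ.+-mono-≤ 1≤e 1≤e)))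
          (Hi-*ˡ (λ _ → - 1ℤ) (Hi-* (Hi-W e) h)))

      3≤least : ∀ {M} ns → All (3 ≤_) ns → 1 ≤ count M ns 0 → All (M ≤_) ns → 3 ≤ M
      3≤least {M} (n ∷ ns) (l ∷ ls) c (le ∷ les) = by-cases (M ℕ.≟ n)
        where
        by-cases : Dec (M ≡ n) → 3 ≤ M
        by-cases (yes eq) = subst (3 ≤_) (sym eq) l
        by-cases (no M≢n) = 3≤least ns ls (subst (λ k → 1 ≤ k ℕ.+ count M ns 0) (<⇒δ₀≡0 (ℕ.≤∧≢⇒< le M≢n)) c) les

      p≡p′ : p ≡ p′
      p≡p′ = trans p≡M (sym p′≡M)
        where
        least′ = least p (q ∷ p′ ∷ q′ ∷ ks)
        M = proj₁ least′
        M≤ : All (M ≤_) (p ∷ q ∷ p′ ∷ q′ ∷ ks)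
        M≤ = proj₁ (proj₂ least′)
        lp = All.head M≤
        lq = All.head (All.tail M≤)
        lp′ = All.head (All.tail (All.tail M≤))
        lq′ = All.head (All.tail (All.tail (All.tail M≤)))
        les = All.tail (All.tail (All.tail (All.tail M≤)))
        3≤M = 3≤least _ (3≤p ∷ 3≤q ∷ 3≤p′ ∷ 3≤q′ ∷ 3≤ks) (proj₂ (proj₂ least′)) M≤
        hPath : Dec (e ≡ e′) → Hi (M ℕ.+ 3) Path
        hPath (yes e≡e′) = equal-Path e≡e′ (win-ext (λ s → hPath-shape (Y p s * Y q s) (y₀ s * y₀ s) (Y p′ s * Y q′ s))
          (Hi-ΔYY p q (ℕ.≤-trans (s≤s z≤n) 3≤M) lp lq ⊕ neg (Hi-ΔYY p′ q′ (ℕ.≤-trans (s≤s z≤n) 3≤M) lp′ lq′)))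
        hPath (no e≢e′) = far-Path (far-paths e≢e′ 3≤M 1≤e 1≤e′ λ {M′} 3≤M′ le lE lE′ → 
          path-equations (ℕ.≤-trans le lp ∷ ℕ.≤-trans le lq ∷ []) (ℕ.≤-trans le lp′ ∷ ℕ.≤-trans le lq′ ∷ []) (All.map (ℕ.≤-trans le) les)
            (balance₁ 3≤M′ (ℕ.≤-trans le lp) (ℕ.≤-trans le lp′) (All.map (ℕ.≤-trans le) les)) lE lE′)
        ces : CountEquations M (p ∷ q ∷ []) (p′ ∷ q′ ∷ [])
        ces = count-equations (lp ∷ lq ∷ []) (lp′ ∷ lq′ ∷ []) les (balance₁ 3≤M lp lp′ les) (hPath (e ℕ.≟ e′))
        k₀≡0 : count M ks 0 ≡ 0
        k₀≡0 = no-cycle (count₂ M p q) ces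
        d≡ : count M (p ∷ q ∷ []) 0 ≡ count M (p′ ∷ q′ ∷ []) 0
        d≡ = trans (Equationsℕ.eq₀ ces) (trans (cong (count M (p′ ∷ q′ ∷ []) 0 ℕ.+_) k₀≡0) (ℕ.+-identityʳ _))
        d≥1 : 1 ≤ count M (p ∷ q ∷ []) 0
        d≥1 = ℕ.≰⇒> λ le → contradiction (subst (1 ≤_)
          (trans (count-++ M (p ∷ q ∷ []) (p′ ∷ q′ ∷ ks) 0) (cong₂ ℕ._+_ (ℕ.n≤0⇒n≡0 le)
            (trans (count-++ M (p′ ∷ q′ ∷ []) ks 0) (cong₂ ℕ._+_ (trans (sym d≡) (ℕ.n≤0⇒n≡0 le)) k₀≡0)))) (proj₂ (proj₂ least′))) λ ()
        p≡M = attained⇒≡ (q ∷ []) lp (p≤q ∷ []) d≥1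
        p′≡M = attained⇒≡ (q′ ∷ []) lp′ (p′≤q′ ∷ []) (subst (1 ≤_) d≡ d≥1)

      Hi-Yp : Hi 1 (Y p)
      Hi-Yp = win-ext (λ s → Hi-Yp-shape (y₀ s) (Y p s)) (Hi-y₀ ⊕ Hi-X′)
        where
        Hi-X′ = Hi-≤ {M = 3} {N = 1} (s≤s z≤n) (Hi-Y p 3≤p)

    dumbbell-unique : p ℕ.+ q ℕ.+ e ≡ p′ ℕ.+ q′ ℕ.+ e′ ℕ.+ sum ks → ks ≡ [] × p ≡ p′ × q ≡ q′ × e ≡ e′
    dumbbell-unique total = by-cases (e ℕ.≟ e′)
      where
      total′ : q ℕ.+ e ≡ q′ ℕ.+ e′ ℕ.+ sum ks
      total′ = ℕ.+-cancelˡ-≡ p _ _ (trans (sym (ℕ.+-assoc p q e)) (trans total (trans (cong (λ n → n ℕ.+ q′ ℕ.+ e′ ℕ.+ sum ks) (sym p≡p′)) (total′-shape p q′ e′ (sum ks)))))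
      empty? : ∀ (l : List ℕ) → l ≡ [] ⊎ ∃ λ k → ∃ λ l′ → l ≡ k ∷ l′
      empty? []      = inj₁ refl
      empty? (k ∷ l) = inj₂ (k , l , refl)

      equal : e ≡ e′ → ks ≡ [] ⊎ (∃ λ k → ∃ λ l′ → ks ≡ k ∷ l′) → ks ≡ [] × p ≡ p′ × q ≡ q′ × e ≡ e′
      equal e≡e′ (inj₁ eq) = eq , p≡p′ , q≡ , e≡e′
        where
        q≡ : q ≡ q′
        q≡ = ℕ.+-cancelʳ-≡ e q q′ (trans total′ (trans (cong (λ l → q′ ℕ.+ e′ ℕ.+ sum l) eq) (trans (ℕ.+-identityʳ _) (cong (q′ ℕ.+_) (sym e≡e′)))))
      equal e≡e′ (inj₂ (k , l , eq)) = contradiction att (ℕ.<⇒≱ (s≤s (ℕ.≤-reflexive zero-count)))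
        where
        least′ = least q′ ks
        M = proj₁ least′
        lq′ = All.head (proj₁ (proj₂ least′))
        les = All.tail (proj₁ (proj₂ least′))
        att : 1 ≤ count M (q′ ∷ ks) 0
        att = proj₂ (proj₂ least′)
        3≤M = 3≤least _ (3≤q′ ∷ 3≤ks) att (proj₁ (proj₂ least′))
        q≡ : q ≡ q′ ℕ.+ sum ks
        q≡ = ℕ.+-cancelʳ-≡ e q (q′ ℕ.+ sum ks) (trans total′ (trans (cong (λ n → q′ ℕ.+ n ℕ.+ sum ks) (sym e≡e′)) (q≡-shape q′ e (sum ks))))
        1≤Σ : 1 ≤ sum ks
        1≤Σ = ℕ.≤-trans (s≤s z≤n) (ℕ.≤-trans (All.head (subst (All (3 ≤_)) eq 3≤ks)) (subst (λ m → k ≤ sum m) (sym eq) (ℕ.m≤m+n k (sum l))))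
        M<q : M < q
        M<q = ℕ.≤-trans (s≤s lq′) (ℕ.≤-trans (ℕ.≤-reflexive (ℕ.+-comm 1 q′)) (ℕ.≤-trans (ℕ.+-monoʳ-≤ q′ 1≤Σ) (ℕ.≤-reflexive (sym q≡))))
        lq = ℕ.<⇒≤ M<q
        ces : CountEquations M (q ∷ []) (q′ ∷ [])
        ces = count-equations (lq ∷ []) (lq′ ∷ []) les (balance₂ p≡p′ 3≤M lq lq′ les)
          (equal-Path e≡e′ (win-ext (λ s → trans (ces-shape (Y p s) (Y q s) (y₀ s) (Y q′ s)) (cong (λ n → Y p s * Y q s - Y n s * Y q′ s) p≡p′))
            (Hi-* Hi-Yp (Hi-Y q lq ⊕ neg (Hi-Y q′ lq′)))))
        zero-count : count M (q′ ∷ ks) 0 ≡ 0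
        zero-count = trans (cong (ℕ._+ count M ks 0) (sym (ℕ.+-identityʳ (δ (q′ ∸ M) 0)))) (trans (sym (Equationsℕ.eq₀ ces)) (none-above (M<q ∷ [])))

      different : e ≢ e′ → ks ≡ [] × p ≡ p′ × q ≡ q′ × e ≡ e′
      different e≢e′ = contradiction-by (empty? ks)
        where
        q≡q′ : q ≡ q′
        q≡q′ = trans (attained⇒≡ [] lq [] d≥1) (sym (attained⇒≡ [] lq′ [] (subst (1 ≤_) d≡ d≥1)))
          where
          least′ = least q (q′ ∷ ks)
          M = proj₁ least′
          lq = All.head (proj₁ (proj₂ least′))
          lq′ = All.head (All.tail (proj₁ (proj₂ least′)))
          les = All.tail (All.tail (proj₁ (proj₂ least′)))
          3≤M = 3≤least _ (3≤q ∷ 3≤q′ ∷ 3≤ks) (proj₂ (proj₂ least′)) (proj₁ (proj₂ least′))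
          ces : CountEquations M (q ∷ []) (q′ ∷ [])
          ces = count-equations (lq ∷ []) (lq′ ∷ []) les (balance₂ p≡p′ 3≤M lq lq′ les)
            (far-Path (far-paths e≢e′ 3≤M 1≤e 1≤e′ λ 3≤M′ le lE lE′ → 
              path-equations (ℕ.≤-trans le lq ∷ []) (ℕ.≤-trans le lq′ ∷ []) (All.map (ℕ.≤-trans le) les) (balance₂ p≡p′ 3≤M′ (ℕ.≤-trans le lq) (ℕ.≤-trans le lq′) (All.map (ℕ.≤-trans le) les)) lE lE′))
          count₁ : let d = count M (q ∷ []) in d 0 ℕ.+ d 1 ℕ.+ d 2 ≤ 2
          count₁ = subst (_≤ 2) (count₁-shape (δ (q ∸ M) 0) (δ (q ∸ M) 1) (δ (q ∸ M) 2)) (ℕ.≤-trans (δ-Σ≤1 (q ∸ M)) (s≤s z≤n))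
          k₀≡0 : count M ks 0 ≡ 0
          k₀≡0 = no-cycle count₁ ces
          d≡ : count M (q ∷ []) 0 ≡ count M (q′ ∷ []) 0
          d≡ = trans (Equationsℕ.eq₀ ces) (trans (cong (count M (q′ ∷ []) 0 ℕ.+_) k₀≡0) (ℕ.+-identityʳ _))
          d≥1 : 1 ≤ count M (q ∷ []) 0
          d≥1 = ℕ.≰⇒> λ le → contradiction (subst (1 ≤_)
            (trans (count-++ M (q ∷ []) (q′ ∷ ks) 0) (cong₂ ℕ._+_ (ℕ.n≤0⇒n≡0 le)
              (trans (count-++ M (q′ ∷ []) ks 0) (cong₂ ℕ._+_ (trans (sym d≡) (ℕ.n≤0⇒n≡0 le)) k₀≡0)))) (proj₂ (proj₂ least′))) λ ()

        contradiction-by : ks ≡ [] ⊎ (∃ λ k → ∃ λ l′ → ks ≡ k ∷ l′) → ks ≡ [] × p ≡ p′ × q ≡ q′ × e ≡ e′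
        contradiction-by (inj₁ eq) = contradiction (ℕ.+-cancelˡ-≡ q e e′
          (trans total′ (trans (cong (λ l → q′ ℕ.+ e′ ℕ.+ sum l) eq) (trans (ℕ.+-identityʳ _) (cong (ℕ._+ e′) (sym q≡q′)))))) e≢e′
        contradiction-by (inj₂ (k , l , eq)) = contradiction att (ℕ.<⇒≱ (s≤s (ℕ.≤-reflexive (sym (Equationsℕ.eq₀ ces)))))
          where
          least′ : ∃ λ M → All (M ≤_) ks × 1 ≤ count M ks 0
          least′ = subst (λ l → ∃ λ M → All (M ≤_) l × 1 ≤ count M l 0) (sym eq) (least k l)
          M = proj₁ least′
          les = proj₁ (proj₂ least′)
          att = proj₂ (proj₂ least′)
          3≤M = 3≤least _ 3≤ks att les
          ces : CountEquations M [] []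
          ces = count-equations [] [] les (balance₃ p≡p′ q≡q′ 3≤M les)
            (far-Path (far-paths e≢e′ 3≤M 1≤e 1≤e′ λ 3≤M′ le lE lE′ → 
              path-equations [] [] (All.map (ℕ.≤-trans le) les) (balance₃ p≡p′ q≡q′ 3≤M′ (All.map (ℕ.≤-trans le) les)) lE lE′))

      by-cases : Dec (e ≡ e′) → ks ≡ [] × p ≡ p′ × q ≡ q′ × e ≡ e′
      by-cases (yes e≡e′) = equal e≡e′ (empty? ks)
      by-cases (no e≢e′)  = different e≢e′

module Walks {n} (G : Graph n) where

  open import Defs using (degree)
  open import Data.Empty using (⊥)
  open import Data.Fin.Base using (Fin)
  open import Data.Fin.Properties using (_≟_)
  open import Data.List.Base using (List; []; _∷_; _++_; length; filter; allFin)
  open import Data.List.Properties using (filter-++; length-++; filter-accept; filter-reject)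
  open import Data.List.Membership.Propositional.Properties using (∈-filter⁺; ∈-filter⁻; ∈-allFin; ∈-∃++)
  open import Data.List.Membership.Propositional.Properties.WithK using (unique∧set⇒bag)
  open import Data.List.Relation.Binary.BagAndSetEquality using (∼bag⇒↭)
  open import Data.List.Relation.Binary.Permutation.Propositional using (_↭_; ↭-sym; ↭-trans; prep; swap; refl) renaming (trans to ↭-step)
  open import Data.List.Relation.Binary.Permutation.Propositional.Properties using (All-resp-↭; ∈-resp-↭; ↭-length; filter-↭; shift)
  open import Data.List.Relation.Unary.All as All using (All; []; _∷_)
  open import Data.List.Relation.Unary.AllPairs using ([]; _∷_)
  open import Data.List.Relation.Unary.Unique.Propositional using (Unique)
  open import Data.List.Relation.Unary.Unique.Propositional.Properties using (allFin⁺; filter⁺)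
  open import Data.Nat.Base as ℕ using (ℕ; zero; suc; _≤_; _+_)
  open import Function.Bundles using (mk⇔)

  open Graph G

  V : Set
  V = Fin n

  Unique-resp-↭ : ∀ {A : Set} {xs ys : List A} → xs ↭ ys → Unique xs → Unique ys
  Unique-resp-↭ refl         u                    = u
  Unique-resp-↭ (prep x p)   (x∉ ∷ u)             = All-resp-↭ p x∉ ∷ Unique-resp-↭ p u
  Unique-resp-↭ (swap x y p) ((x≢y ∷ x∉) ∷ y∉ ∷ u) =
    ((λ e → x≢y (sym e)) ∷ All-resp-↭ p y∉) ∷ All-resp-↭ p x∉ ∷ Unique-resp-↭ p u
  Unique-resp-↭ (↭-step p q) u                    = Unique-resp-↭ q (Unique-resp-↭ p u)

  unique-set-↭ : ∀ {A : Set} {xs ys : List A} → Unique xs → Unique ys →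
                 (∀ {z} → z ∈ xs → z ∈ ys) → (∀ {z} → z ∈ ys → z ∈ xs) → xs ↭ ys
  unique-set-↭ u u′ f g = ∼bag⇒↭ (unique∧set⇒bag u u′ (mk⇔ f g))

  ∈-∉-≢ : ∀ {A : Set} {x y : A} {xs} → x ∈ xs → y ∉ xs → x ≢ y
  ∈-∉-≢ x∈ y∉ refl = y∉ x∈

  unique-head : ∀ {A : Set} {x : A} {xs} → Unique (x ∷ xs) → x ∉ xs
  unique-head (x∉ ∷ _) x∈ = All.lookup x∉ x∈ refl

  unique-tail : ∀ {A : Set} {x : A} {xs} → Unique (x ∷ xs) → Unique xs
  unique-tail (_ ∷ u) = u

  pull : ∀ {A : Set} {x : A} {xs} → x ∈ xs → ∃ λ xs′ → x ∷ xs′ ↭ xs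
  pull {x = x} x∈ with ys , zs , refl ← ∈-∃++ x∈ = ys ++ zs , ↭-sym (shift x ys zs)

  deg : V → List V → ℕ
  deg u U = length (filter (u ~?_) U)

  deg-↭ : ∀ u {U W} → U ↭ W → deg u U ≡ deg u W
  deg-↭ u p = ↭-length (filter-↭ (u ~?_) p)

  deg-++ : ∀ u U W → deg u (U ++ W) ≡ deg u U + deg u W
  deg-++ u U W = trans (cong length (filter-++ (u ~?_) U W)) (length-++ (filter (u ~?_) U))

  deg-yes : ∀ {u x} U → u ~ x → deg u (x ∷ U) ≡ suc (deg u U)
  deg-yes {u} U u~x = cong length (filter-accept (u ~?_) {xs = U} u~x)

  deg-no : ∀ {u x} U → ¬ u ~ x → deg u (x ∷ U) ≡ deg u U
  deg-no {u} U u≁x = cong length (filter-reject (u ~?_) {xs = U} u≁x)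

  deg-0 : ∀ {u} U → deg u U ≡ 0 → ∀ {x} → x ∈ U → ¬ u ~ x
  deg-0 {u} U eq {x} x∈ u~x with filter (u ~?_) U | ∈-filter⁺ (u ~?_) x∈ u~x
  deg-0 U () x∈ u~x | _ ∷ _ | _

  deg-suc : ∀ {u k} U → deg u U ≡ suc k → ∃ λ x → x ∈ U × u ~ x
  deg-suc {u} U eq with filter (u ~?_) U in e
  deg-suc {u} U eq | x ∷ xs = x , ∈-filter⁻ (u ~?_) (subst (x ∈_) (sym e) (here refl))

  record Nbr2 (x a b : V) : Set where
    constructor nbr2
    field
      a≢b  : a ≢ b
      x~a  : x ~ a
      x~b  : x ~ b
      only : ∀ {y} → x ~ y → y ≡ a ⊎ y ≡ b

  degree≡2⇒Nbr2 : ∀ {x a} → degree G x ≡ 2 → x ~ a → ∃ λ b → Nbr2 x a b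
  degree≡2⇒Nbr2 {x} {a} eq x~a = go (filter (x ~?_) (allFin n)) refl eq
    where
    go : ∀ L → filter (x ~?_) (allFin n) ≡ L → length L ≡ 2 → ∃ λ b → Nbr2 x a b
    go (y ∷ z ∷ []) e refl = by-cases (two x~a)
      where
      nbr : ∀ {w} → w ∈ y ∷ z ∷ [] → x ~ w
      nbr w∈ = proj₂ (∈-filter⁻ (x ~?_) {xs = allFin n} (subst (_ ∈_) (sym e) w∈))
      two : ∀ {w} → x ~ w → w ≡ y ⊎ w ≡ z
      two x~w with subst (_ ∈_) e (∈-filter⁺ (x ~?_) (∈-allFin _) x~w)
      ... | here h         = inj₁ h
      ... | there (here h) = inj₂ h
      y≢z : y ≢ z
      y≢z = All.head (AllPairs-head (subst Unique e (filter⁺ (x ~?_) (allFin⁺ n))))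
        where
        AllPairs-head : ∀ {w ws} → Unique (w ∷ ws) → All (w ≢_) ws
        AllPairs-head (h ∷ _) = h
      by-cases : a ≡ y ⊎ a ≡ z → ∃ λ b → Nbr2 x a b
      by-cases (inj₁ refl) = z , nbr2 y≢z x~a (nbr (there (here refl))) two
      by-cases (inj₂ refl) = y , nbr2 (λ h → y≢z (sym h)) x~a (nbr (here refl)) λ h → swap⊎ (two h)
        where
        swap⊎ : ∀ {A B : Set} → A ⊎ B → B ⊎ A
        swap⊎ (inj₁ h) = inj₂ h
        swap⊎ (inj₂ h) = inj₁ h

  Nbr2⇒degree≡2 : ∀ {x a b} → Nbr2 x a b → degree G x ≡ 2
  Nbr2⇒degree≡2 {x} {a} {b} (nbr2 a≢b x~a x~b only) = ↭-length (unique-set-↭ (filter⁺ (x ~?_) (allFin⁺ n)) ((a≢b ∷ []) ∷ [] ∷ [])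
    (λ z∈ → to (only (proj₂ (∈-filter⁻ (x ~?_) {xs = allFin n} z∈))))
    λ { (here refl) → ∈-filter⁺ (x ~?_) (∈-allFin _) x~a ; (there (here refl)) → ∈-filter⁺ (x ~?_) (∈-allFin _) x~b })
    where
    to : ∀ {z} → z ≡ a ⊎ z ≡ b → z ∈ a ∷ b ∷ []
    to (inj₁ h) = here h
    to (inj₂ h) = there (here h)

  next : List V → V → V
  next []      b = b
  next (y ∷ _) b = y

  -- Seg b a xs: a, xs, b is a walk all of whose interior vertices have degree two and continue it
  -- without turning back.
  data Seg (b : V) : V → List V → Set where
    []  : ∀ {a} → a ~ b → Seg b a []
    _∷_ : ∀ {a x xs} → Nbr2 x a (next xs b) → Seg b x xs → Seg b a (x ∷ xs)

  seg-degree : ∀ {b a xs} → Seg b a xs → All (λ x → degree G x ≡ 2) xs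
  seg-degree ([] _)  = []
  seg-degree (h ∷ σ) = Nbr2⇒degree≡2 h ∷ seg-degree σ

  Closed : List V → List V → Set
  Closed B U = ∀ {z w} → z ∈ U → z ~ w → w ∈ U ⊎ w ∈ B

  record Trail (B U : List V) (a x : V) : Set where
    field
      {xs rest} : List V
      {end}     : V
      split     : x ∷ xs ++ rest ↭ U
      end∈      : end ∈ B
      seg       : Seg end a (x ∷ xs)
      closed    : Closed B rest

  trail : ∀ k B U {a x} → length U ≤ k → Unique U → All (λ z → degree G z ≡ 2) U → (∀ {z} → z ∈ B → z ∉ U) →
    a ∉ U → x ∈ U → x ~ a → (∀ {z w} → z ∈ U → z ~ w → w ∈ U ⊎ w ∈ B ⊎ (w ≡ a × z ≡ x)) → Trail B U a x
  trail zero    B []      len u d2 B∉ a∉ () x~a cl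
  trail (suc k) B U {a} {x} len u d2 B∉ a∉ x∈ x~a cl = from-other (degree≡2⇒Nbr2 (All.lookup d2 x∈) x~a)
    where
    U′ = proj₁ (pull x∈)
    p : x ∷ U′ ↭ U
    p = proj₂ (pull x∈)
    u′ : Unique (x ∷ U′)
    u′ = Unique-resp-↭ (↭-sym p) u
    x∉U′ = unique-head u′
    sub : ∀ {z} → z ∈ U′ → z ∈ U
    sub z∈ = ∈-resp-↭ p (there z∈)
    narrow : ∀ {w} → w ∈ U → w ≢ x → w ∈ U′
    narrow w∈ w≢x with ∈-resp-↭ (↭-sym p) w∈
    ... | here eq   = contradiction eq w≢x
    ... | there w∈′ = w∈′
    len′ : length U′ ≤ k
    len′ = ℕ.≤-pred (ℕ.≤-trans (ℕ.≤-reflexive (↭-length p)) len)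
    from-other : (∃ λ y → Nbr2 x a y) → Trail B U a x
    from-other (y , h@(nbr2 a≢y _ x~y only)) = by-cases (cl x∈ x~y)
      where
      back : ∀ {z} → z ∈ U′ → z ~ x → z ≡ y
      back z∈ z~x with only (~-sym z~x)
      ... | inj₁ refl = contradiction (sub z∈) a∉
      ... | inj₂ eq   = eq
      cl′ : ∀ {z w} → z ∈ U′ → z ~ w → w ∈ U′ ⊎ w ∈ B ⊎ (w ≡ x × z ≡ y)
      cl′ {z} {w} z∈ z~w with cl (sub z∈) z~w
      ... | inj₂ (inj₁ w∈)         = inj₂ (inj₁ w∈)
      ... | inj₂ (inj₂ (_ , refl)) = contradiction z∈ x∉U′
      ... | inj₁ w∈ with w ≟ x
      ...   | yes refl = inj₂ (inj₂ (refl , back z∈ z~w))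
      ...   | no w≢x   = inj₁ (narrow w∈ w≢x)
      stop : y ∈ B → Trail B U a x
      stop y∈ = record { xs = [] ; rest = U′ ; end = y ; split = p ; end∈ = y∈ ; seg = h ∷ [] x~y ; closed = closed }
        where
        closed : Closed B U′
        closed z∈ z~w with cl′ z∈ z~w
        ... | inj₁ w∈               = inj₁ w∈
        ... | inj₂ (inj₁ w∈)        = inj₂ w∈
        ... | inj₂ (inj₂ (_ , refl)) = contradiction (sub z∈) (B∉ y∈)
      by-cases : y ∈ U ⊎ y ∈ B ⊎ (y ≡ a × x ≡ x) → Trail B U a x
      by-cases (inj₂ (inj₁ y∈))       = stop y∈
      by-cases (inj₂ (inj₂ (y≡a , _))) = contradiction (sym y≡a) a≢y
      by-cases (inj₁ y∈) = record
        { xs = y ∷ T.xs ; rest = T.rest ; split = ↭-trans (prep x T.split) p ; end∈ = T.end∈ ; seg = h ∷ T.seg ; closed = T.closed }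
        where
        y≢x : y ≢ x
        y≢x refl = ~-irr x~y
        onward = trail k B U′ len′ (unique-tail u′) (All.tabulate λ z∈ → All.lookup d2 (sub z∈)) (λ b∈ z∈ → B∉ b∈ (sub z∈))
                   x∉U′ (narrow y∈ y≢x) (~-sym x~y) cl′
        module T = Trail onward

  same : V → V → ℕ
  same a b with a ≟ b
  ... | yes _ = 1
  ... | no  _ = 0

  same-refl : ∀ a → same a a ≡ 1
  same-refl a with a ≟ a
  ... | yes _ = refl
  ... | no ne = contradiction refl ne

  same-≢ : ∀ {a b} → a ≢ b → same a b ≡ 0
  same-≢ {a} {b} ne with a ≟ b
  ... | yes eq = contradiction eq ne
  ... | no _   = refl

  -- Only the two ends of a walk meet its end vertices.
  seg-deg : ∀ {b a x xs u} → Seg b a (x ∷ xs) → u ∉ x ∷ xs → deg u (x ∷ xs) ≡ same a u + same b u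
  seg-deg {b} {a} {x} {[]} {u} (nbr2 a≢b x~a x~b only ∷ _) u∉ with a ≟ u | b ≟ u
  ... | yes refl | yes refl = contradiction refl a≢b
  ... | yes refl | no _     = deg-yes [] (~-sym x~a)
  ... | no _     | yes refl = deg-yes [] (~-sym x~b)
  ... | no a≢u   | no b≢u   = deg-no [] λ u~x → neither (only (~-sym u~x))
    where
    neither : u ≡ a ⊎ u ≡ b → ⊥
    neither (inj₁ eq) = a≢u (sym eq)
    neither (inj₂ eq) = b≢u (sym eq)
  seg-deg {b} {a} {x} {y ∷ xs} {u} (nbr2 a≢y x~a x~y only ∷ σ) u∉ = first (a ≟ u)
    where
    later : deg u (y ∷ xs) ≡ same b u
    later = trans (seg-deg σ (λ u∈ → u∉ (there u∈))) (cong (_+ same b u) (same-≢ λ { refl → u∉ (here refl) }))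
    first : Dec (a ≡ u) → deg u (x ∷ y ∷ xs) ≡ same a u + same b u
    first (yes refl) = trans (deg-yes (y ∷ xs) (~-sym x~a)) (cong₂ _+_ (sym (same-refl a)) later)
    first (no a≢u)   = trans (deg-no (y ∷ xs) λ u~x → neither (only (~-sym u~x))) (cong₂ _+_ (sym (same-≢ a≢u)) later)
      where
      neither : u ≡ a ⊎ u ≡ y → ⊥
      neither (inj₁ eq) = a≢u (sym eq)
      neither (inj₂ eq) = u∉ (there (here eq))

module Classification {n} (G : Graph n) where

  open import Defs using (degree)
  open import Data.List.Base using (List; []; _∷_; _++_; length; allFin)
  open import Data.List.Properties using (++-assoc)
  open import Data.List.Membership.Propositional.Properties using (∈-++⁺ˡ; ∈-++⁺ʳ; ∈-++⁻; ∈-allFin)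
  open import Data.List.Relation.Binary.Permutation.Propositional using (_↭_; ↭-refl; ↭-sym; ↭-trans; prep; refl; ↭-reflexive)
  open import Data.List.Relation.Binary.Permutation.Propositional.Properties using (∈-resp-↭; ↭-length; shifts; ++⁺ˡ)
  open import Data.List.Relation.Unary.All as All using (All; []; _∷_)
  import Data.List.Relation.Unary.All.Properties as All
  open import Data.List.Relation.Unary.AllPairs using ([]; _∷_)
  open import Data.List.Relation.Unary.Unique.Propositional using (Unique)
  open import Data.List.Relation.Unary.Unique.Propositional.Properties using (allFin⁺)
  open import Data.Nat.Base as ℕ using (ℕ; suc; _≤_; s≤s; _+_)
  open Walks G
  open Graph G

  unique-++ʳ : ∀ {A : Set} (xs : List A) {ys} → Unique (xs ++ ys) → Unique ys
  unique-++ʳ []       u = u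
  unique-++ʳ (x ∷ xs) u = unique-++ʳ xs (unique-tail u)

  unique-++-disjoint : ∀ {A : Set} (xs : List A) {ys} → Unique (xs ++ ys) → ∀ {z} → z ∈ xs → z ∉ ys
  unique-++-disjoint (x ∷ xs) (x∉ ∷ u) (here refl) z∈ = All.lookup x∉ (∈-++⁺ʳ xs z∈) refl
  unique-++-disjoint (x ∷ xs) (_ ∷ u)  (there z∈)  z∈′ = unique-++-disjoint xs u z∈ z∈′

  flat : List (V × List V) → List V
  flat []              = []
  flat ((x , xs) ∷ cs) = x ∷ xs ++ flat cs

  Cycle : V × List V → Set
  Cycle (x , xs) = Seg x x xs × degree G x ≡ 2 × (∀ {c} → x ~ c → c ∈ xs)

  seg-nonempty : ∀ {a xs} → Seg a a xs → ∃₂ λ y ys → xs ≡ y ∷ ys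
  seg-nonempty ([] a~a)            = contradiction a~a ~-irr
  seg-nonempty (_∷_ {x = y} {xs} _ _) = y , xs , refl

  module _ (d2 : V → Set) (d2⇒ : ∀ {z} → d2 z → degree G z ≡ 2) where

    cycle-decomposition : ∀ k Pf R → length R ≤ k → allFin n ↭ Pf ++ R → All d2 R → Closed [] R →
      ∃ λ cs → R ↭ flat cs × All Cycle cs
    cycle-decomposition k       Pf []      len perm ds cl = [] , ↭-refl , []
    cycle-decomposition (suc k) Pf (x ∷ U) len perm (dx ∷ ds) cl =
        (x , y ∷ T.xs) ∷ proj₁ IH ,
        prep x (↭-trans (↭-sym T.split) (prep y (++⁺ˡ T.xs (proj₁ (proj₂ IH))))) ,
        (σ , d2⇒ dx , own) ∷ proj₂ (proj₂ IH)
      where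
      uR : Unique (x ∷ U)
      uR = unique-++ʳ Pf (Unique-resp-↭ perm (allFin⁺ n))
      x∉U = unique-head uR
      inside : ∀ {z w} → z ∈ x ∷ U → z ~ w → w ∈ x ∷ U
      inside z∈ z~w with cl z∈ z~w
      ... | inj₁ w∈ = w∈
      nbr : ∃ λ y → y ∈ allFin n × x ~ y
      nbr = deg-suc (allFin n) (d2⇒ dx)
      y = proj₁ nbr
      x~y = proj₂ (proj₂ nbr)
      y∈U : y ∈ U
      y∈U with inside (here refl) x~y
      ... | here eq  = contradiction (subst (x ~_) eq x~y) ~-irr
      ... | there y∈ = y∈
      cl′ : ∀ {z w} → z ∈ U → z ~ w → w ∈ U ⊎ w ∈ x ∷ [] ⊎ (w ≡ x × z ≡ y)
      cl′ z∈ z~w with inside (there z∈) z~w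
      ... | here eq  = inj₂ (inj₁ (here eq))
      ... | there w∈ = inj₁ w∈
      around = trail (length U) (x ∷ []) U ℕ.≤-refl (unique-tail uR) (All.map d2⇒ ds)
                 (λ { (here refl) → x∉U }) x∉U y∈U (~-sym x~y) cl′
      module T = Trail around
      σ : Seg x x (y ∷ T.xs)
      σ = subst (λ e → Seg e x (y ∷ T.xs)) (only T.end∈) T.seg
        where
        only : ∀ {e} → e ∈ x ∷ [] → e ≡ x
        only (here eq) = eq
      x∉ : x ∉ y ∷ T.xs
      x∉ x∈ = x∉U (∈-resp-↭ T.split (∈-++⁺ˡ {xs = y ∷ T.xs} x∈))
      no-more : deg x T.rest ≡ 0
      no-more = ℕ.n≤0⇒n≡0 (ℕ.+-cancelˡ-≤ 2 _ _ (ℕ.≤-trans (ℕ.m≤n+m (2 + deg x T.rest) (deg x Pf)) (ℕ.≤-reflexive (sym (begin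
        2                                              ≡⟨ sym (d2⇒ dx) ⟩
        deg x (allFin n)                               ≡⟨ deg-↭ x perm ⟩
        deg x (Pf ++ x ∷ U)                            ≡⟨ deg-++ x Pf (x ∷ U) ⟩
        deg x Pf + deg x (x ∷ U)                       ≡⟨ cong (deg x Pf +_) (deg-no U ~-irr) ⟩
        deg x Pf + deg x U                             ≡⟨ cong (deg x Pf +_) (sym (deg-↭ x T.split)) ⟩
        deg x Pf + deg x (y ∷ T.xs ++ T.rest)          ≡⟨ cong (deg x Pf +_) (deg-++ x (y ∷ T.xs) T.rest) ⟩
        deg x Pf + (deg x (y ∷ T.xs) + deg x T.rest)   ≡⟨ cong (λ k → deg x Pf + (k + deg x T.rest))
                                                          (trans (seg-deg σ x∉) (cong₂ _+_ (same-refl x) (same-refl x))) ⟩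
        deg x Pf + (2 + deg x T.rest)                  ∎)))))
        where open ≡-Reasoning
      own : ∀ {c} → x ~ c → c ∈ y ∷ T.xs
      own {c} x~c = sort (inside (here refl) x~c)
        where
        sort′ : c ∈ (y ∷ T.xs) ++ T.rest → c ∈ y ∷ T.xs
        sort′ c∈ with ∈-++⁻ (y ∷ T.xs) c∈
        ... | inj₁ h = h
        ... | inj₂ h = contradiction x~c (deg-0 T.rest no-more h)
        sort : c ∈ x ∷ U → c ∈ y ∷ T.xs
        sort (here eq) = contradiction (subst (x ~_) eq x~c) ~-irr
        sort (there h) = sort′ (∈-resp-↭ (↭-sym T.split) h)
      rest-closed : Closed [] T.rest
      rest-closed z∈ z~w with T.closed z∈ z~w
      ... | inj₁ w∈          = inj₁ w∈
      ... | inj₂ (here refl) = contradiction (~-sym z~w) (deg-0 T.rest no-more z∈)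
      rest⊆U : ∀ {z} → z ∈ T.rest → z ∈ U
      rest⊆U z∈ = ∈-resp-↭ T.split (∈-++⁺ʳ (y ∷ T.xs) z∈)
      IH = cycle-decomposition k (Pf ++ x ∷ y ∷ T.xs) T.rest
        (ℕ.≤-pred (ℕ.≤-trans (s≤s (ℕ.≤-trans (length-rest T.rest) (ℕ.≤-reflexive (↭-length T.split)))) len))
        (↭-trans perm (↭-trans (++⁺ˡ Pf (prep x (↭-sym T.split))) (↭-reflexive (sym (++-assoc Pf (x ∷ y ∷ T.xs) T.rest)))))
        (All.tabulate λ z∈ → All.lookup ds (rest⊆U z∈)) rest-closed
        where
        length-rest : ∀ R → length R ≤ length ((y ∷ T.xs) ++ R)
        length-rest R = ℕ.≤-trans (ℕ.m≤n+m (length R) (length (y ∷ T.xs))) (ℕ.≤-reflexive (sym (L.length-++ (y ∷ T.xs))))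
          where import Data.List.Properties as L

  module _ {u v : V} (u≢v : u ≢ v) where

    record Dumbbell : Set where
      field
        {xs ys zs rest} : List V
        vertices : allFin n ↭ u ∷ v ∷ xs ++ ys ++ zs ++ rest
        segᵤᵤ    : Seg u u xs
        segᵤᵥ    : Seg v u ys
        segᵥᵥ    : Seg v v zs
        direct   : u ~ v → ys ≡ []
        closed   : Closed [] rest

    record Theta : Set where
      field
        {x y}            : V
        {xs ys zs rest} : List V
        vertices : allFin n ↭ u ∷ v ∷ (x ∷ xs) ++ (y ∷ ys) ++ zs ++ rest
        seg₁     : Seg v u (x ∷ xs)
        seg₂     : Seg v u (y ∷ ys)
        seg₃     : Seg v u zs
        direct   : u ~ v → zs ≡ []
        closed   : Closed [] rest

    module _ (du : degree G u ≡ 3) (dv : degree G v ≡ 3) (d2 : ∀ z → z ≢ u → z ≢ v → degree G z ≡ 2) where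

      private
        B : List V
        B = u ∷ v ∷ []

        record State (U : List V) : Set where
          field
            unique : Unique U
            u∉     : u ∉ U
            v∉     : v ∉ U
            closed : Closed B U

        record Extract (U : List V) (a : V) : Set where
          field
            {x}      : V
            {xs rest} : List V
            {end}    : V
            split    : x ∷ xs ++ rest ↭ U
            end∈     : end ≡ u ⊎ end ≡ v
            seg      : Seg end a (x ∷ xs)
            state    : State rest
            deg-u    : deg u U ≡ same a u + same end u + deg u rest
            deg-v    : deg v U ≡ same a v + same end v + deg v rest

        extract : ∀ {U a k} → State U → a ≡ u ⊎ a ≡ v → deg a U ≡ suc k → Extract U a
        extract {U} {a} S a? eq = record
          { split = T.split ; end∈ = end? T.end∈ ; seg = T.seg
          ; state = record { unique = unique-++ʳ (x ∷ T.xs) (Unique-resp-↭ (↭-sym T.split) unique)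
                           ; u∉ = λ h → u∉ (sub h) ; v∉ = λ h → v∉ (sub h) ; closed = T.closed }
          ; deg-u = count u∉ ; deg-v = count v∉ }
          where
          open State S
          nbr = deg-suc U eq
          x = proj₁ nbr
          end∉ : ∀ {b} → b ≡ u ⊎ b ≡ v → b ∉ U
          end∉ (inj₁ refl) = u∉
          end∉ (inj₂ refl) = v∉
          d2U : All (λ z → degree G z ≡ 2) U
          d2U = All.tabulate λ z∈ → d2 _ (∈-∉-≢ z∈ u∉) (∈-∉-≢ z∈ v∉)
          weaken : ∀ {z w} → w ∈ U ⊎ w ∈ B → w ∈ U ⊎ w ∈ B ⊎ (w ≡ a × z ≡ x)
          weaken (inj₁ h) = inj₁ h
          weaken (inj₂ h) = inj₂ (inj₁ h)
          onward = trail (length U) B U ℕ.≤-refl unique d2U (λ { (here refl) → u∉ ; (there (here refl)) → v∉ })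
                     (end∉ a?) (proj₁ (proj₂ nbr)) (~-sym (proj₂ (proj₂ nbr))) (λ z∈ z~w → weaken (closed z∈ z~w))
          module T = Trail onward
          sub : ∀ {z} → z ∈ T.rest → z ∈ U
          sub z∈ = ∈-resp-↭ T.split (∈-++⁺ʳ (x ∷ T.xs) z∈)
          end? : ∀ {e} → e ∈ B → e ≡ u ⊎ e ≡ v
          end? (here h)         = inj₁ h
          end? (there (here h)) = inj₂ h
          count : ∀ {c} → c ∉ U → deg c U ≡ same a c + same T.end c + deg c T.rest
          count {c} c∉ = trans (sym (deg-↭ c T.split)) (trans (deg-++ c (x ∷ T.xs) T.rest)
            (cong (_+ deg c T.rest) (seg-deg T.seg λ c∈ → c∉ (∈-resp-↭ T.split (∈-++⁺ˡ {xs = x ∷ T.xs} c∈)))))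

        uu = same-refl u
        vv = same-refl v
        uv = same-≢ u≢v
        vu : same v u ≡ 0
        vu = same-≢ λ h → u≢v (sym h)

        done : ∀ {U} → State U → deg u U ≡ 0 → deg v U ≡ 0 → Closed [] U
        done {U} S du≡0 dv≡0 z∈ z~w with State.closed S z∈ z~w
        ... | inj₁ w∈                 = inj₁ w∈
        ... | inj₂ (here refl)         = contradiction (~-sym z~w) (deg-0 U du≡0 z∈)
        ... | inj₂ (there (here refl)) = contradiction (~-sym z~w) (deg-0 U dv≡0 z∈)

        module E = Extract

        from-v : ∀ {U k} (S : State U) → deg u U ≡ 0 → deg v U ≡ suc k → ∃ λ (e : Extract U v) →
          E.end e ≡ v × deg u (E.rest e) ≡ 0 × suc k ≡ 2 + deg v (E.rest e)
        from-v S du≡0 dv≡ with extract S (inj₂ refl) dv≡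
        ... | e@record { end∈ = inj₁ refl ; deg-u = deg-u } = contradiction
          (trans (sym du≡0) (trans deg-u (cong (_+ deg u (E.rest e)) (cong₂ _+_ vu uu)))) λ ()
        ... | e@record { end∈ = inj₂ refl ; deg-u = deg-u ; deg-v = deg-v } = e , refl ,
          sym (trans (sym du≡0) (trans deg-u (cong (_+ deg u (E.rest e)) (cong₂ _+_ vu vu)))) ,
          trans (sym dv≡) (trans deg-v (cong (_+ deg v (E.rest e)) (cong₂ _+_ vv vv)))

        from-u : ∀ {U k} (S : State U) → deg u U ≡ suc k → ∃ λ (e : Extract U u) →
          (E.end e ≡ u × suc k ≡ 2 + deg u (E.rest e) × deg v U ≡ deg v (E.rest e)) ⊎
          (E.end e ≡ v × suc k ≡ 1 + deg u (E.rest e) × deg v U ≡ 1 + deg v (E.rest e))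
        from-u S du≡ with extract S (inj₁ refl) du≡
        ... | e@record { end∈ = inj₁ refl ; deg-u = deg-u ; deg-v = deg-v } = e , inj₁ (refl ,
          trans (sym du≡) (trans deg-u (cong (_+ deg u (E.rest e)) (cong₂ _+_ uu uu))) ,
          trans deg-v (cong (_+ deg v (E.rest e)) (cong₂ _+_ uv uv)))
        ... | e@record { end∈ = inj₂ refl ; deg-u = deg-u ; deg-v = deg-v } = e , inj₂ (refl ,
          trans (sym du≡) (trans deg-u (cong (_+ deg u (E.rest e)) (cong₂ _+_ uu vu))) ,
          trans deg-v (cong (_+ deg v (E.rest e)) (cong₂ _+_ uv vv)))

        record Loops (U : List V) : Set where
          field
            {xs zs rest} : List V
            split  : U ↭ xs ++ zs ++ rest
            segᵤᵤ  : Seg u u xs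
            segᵥᵥ  : Seg v v zs
            closed : Closed [] rest

        record Chords (U : List V) : Set where
          field
            {x y} : V
            {xs ys rest} : List V
            split  : U ↭ (x ∷ xs) ++ (y ∷ ys) ++ rest
            seg₁   : Seg v u (x ∷ xs)
            seg₂   : Seg v u (y ∷ ys)
            closed : Closed [] rest

        two-two : ∀ {U} → State U → deg u U ≡ 2 → deg v U ≡ 2 → Loops U ⊎ Chords U
        two-two {U} S du≡2 dv≡2 = first (from-u S du≡2)
          where
          after-loop : (e : Extract U u) → E.end e ≡ u → 2 ≡ 2 + deg u (E.rest e) → deg v U ≡ deg v (E.rest e) → Loops U
          after-loop e refl p q with from-v (E.state e) (sym (ℕ.suc-injective (ℕ.suc-injective p))) (trans (sym q) dv≡2)
          ... | e′ , refl , p′ , q′ = record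
            { split = ↭-trans (↭-sym (E.split e)) (++⁺ˡ (E.x e ∷ E.xs e) (↭-sym (E.split e′)))
            ; segᵤᵤ = E.seg e ; segᵥᵥ = E.seg e′
            ; closed = done (E.state e′) p′ (sym (ℕ.suc-injective (ℕ.suc-injective q′))) }
          after-chord : (e : Extract U u) → E.end e ≡ v → 2 ≡ 1 + deg u (E.rest e) → deg v U ≡ 1 + deg v (E.rest e) → Chords U
          after-chord e refl p q with from-u (E.state e) (sym (ℕ.suc-injective p))
          ... | e′ , inj₁ (_ , () , _)
          ... | e′ , inj₂ (refl , p′ , q′) = record
            { split = ↭-trans (↭-sym (E.split e)) (++⁺ˡ (E.x e ∷ E.xs e) (↭-sym (E.split e′)))
            ; seg₁ = E.seg e ; seg₂ = E.seg e′
            ; closed = done (E.state e′) (sym (ℕ.suc-injective p′))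
                (sym (ℕ.suc-injective (ℕ.suc-injective (trans (sym dv≡2) (trans q (cong suc q′)))))) }
          first : (∃ λ (e : Extract U u) →
            (E.end e ≡ u × 2 ≡ 2 + deg u (E.rest e) × deg v U ≡ deg v (E.rest e)) ⊎
            (E.end e ≡ v × 2 ≡ 1 + deg u (E.rest e) × deg v U ≡ 1 + deg v (E.rest e))) → Loops U ⊎ Chords U
          first (e , inj₁ (h , p , q)) = inj₁ (after-loop e h p q)
          first (e , inj₂ (h , p , q)) = inj₂ (after-chord e h p q)

        start : ∃ λ U → allFin n ↭ u ∷ v ∷ U × State U
        start = U₂ , perm , record
          { unique = unique-tail (unique-tail uq) ; u∉ = λ h → unique-head uq (there h) ; v∉ = unique-head (unique-tail uq)
          ; closed = λ z∈ z~w → sort (∈-resp-↭ perm (∈-allFin _)) }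
          where
          U₁ = proj₁ (pull (∈-allFin u))
          p₁ : allFin n ↭ u ∷ U₁
          p₁ = ↭-sym (proj₂ (pull (∈-allFin u)))
          v∈ : v ∈ U₁
          v∈ with ∈-resp-↭ p₁ (∈-allFin v)
          ... | here eq = contradiction (sym eq) u≢v
          ... | there h = h
          U₂ = proj₁ (pull v∈)
          perm : allFin n ↭ u ∷ v ∷ U₂
          perm = ↭-trans p₁ (prep u (↭-sym (proj₂ (pull v∈))))
          uq = Unique-resp-↭ perm (allFin⁺ n)
          sort : ∀ {w} → w ∈ u ∷ v ∷ U₂ → w ∈ U₂ ⊎ w ∈ B
          sort (here h)          = inj₂ (here h)
          sort (there (here h))  = inj₂ (there (here h))
          sort (there (there h)) = inj₁ h

      classification : Dumbbell ⊎ Theta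
      classification = go start (u ~? v)
        where
        go : (∃ λ U → allFin n ↭ u ∷ v ∷ U × State U) → Dec (u ~ v) → Dumbbell ⊎ Theta
        go (U , perm , S) (yes u~v) = finish (two-two S du≡2 dv≡2)
          where
          du≡2 : deg u U ≡ 2
          du≡2 = ℕ.suc-injective (trans (sym (trans (deg-no (v ∷ U) ~-irr) (deg-yes U u~v))) (trans (sym (deg-↭ u perm)) du))
          dv≡2 : deg v U ≡ 2
          dv≡2 = ℕ.suc-injective (trans (sym (trans (deg-yes (v ∷ U) (~-sym u~v)) (cong suc (deg-no U ~-irr)))) (trans (sym (deg-↭ v perm)) dv))
          finish : Loops U ⊎ Chords U → Dumbbell ⊎ Theta
          finish (inj₁ L) = inj₁ record { vertices = ↭-trans perm (prep u (prep v L.split)) ; segᵤᵤ = L.segᵤᵤ ; segᵤᵥ = [] u~v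
                                        ; segᵥᵥ = L.segᵥᵥ ; direct = λ _ → refl ; closed = L.closed }
            where module L = Loops L
          finish (inj₂ C) = inj₂ record { vertices = ↭-trans perm (prep u (prep v C.split)) ; seg₁ = C.seg₁ ; seg₂ = C.seg₂
                                        ; seg₃ = [] u~v ; direct = λ _ → refl ; closed = C.closed }
            where module C = Chords C
        go (U , perm , S) (no u≁v) = first (from-u S du≡3)
          where
          du≡3 : deg u U ≡ 3
          du≡3 = trans (sym (trans (deg-no (v ∷ U) ~-irr) (deg-no U u≁v))) (trans (sym (deg-↭ u perm)) du)
          dv≡3 : deg v U ≡ 3
          dv≡3 = trans (sym (trans (deg-no (v ∷ U) (λ h → u≁v (~-sym h))) (deg-no U ~-irr))) (trans (sym (deg-↭ v perm)) dv)
          loop-first : (e : Extract U u) → E.end e ≡ u → 3 ≡ 2 + deg u (E.rest e) → deg v U ≡ deg v (E.rest e) → Dumbbell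
          loop-first e refl p q with from-u (E.state e) (sym (ℕ.suc-injective (ℕ.suc-injective p)))
          ... | e′ , inj₁ (_ , () , _)
          ... | e′ , inj₂ (refl , p′ , q′)
            with from-v (E.state e′) (sym (ℕ.suc-injective p′)) (sym (ℕ.suc-injective (trans (sym dv≡3) (trans q q′))))
          ...   | e″ , refl , p″ , q″ = record
            { vertices = ↭-trans perm (prep u (prep v (↭-trans (↭-sym (E.split e)) (++⁺ˡ (E.x e ∷ E.xs e)
                (↭-trans (↭-sym (E.split e′)) (++⁺ˡ (E.x e′ ∷ E.xs e′) (↭-sym (E.split e″))))))))
            ; segᵤᵤ = E.seg e ; segᵤᵥ = E.seg e′ ; segᵥᵥ = E.seg e″ ; direct = λ h → contradiction h u≁v
            ; closed = done (E.state e″) p″ (sym (ℕ.suc-injective (ℕ.suc-injective q″))) }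
          chord-first : (e : Extract U u) → E.end e ≡ v → 3 ≡ 1 + deg u (E.rest e) → deg v U ≡ 1 + deg v (E.rest e) → Dumbbell ⊎ Theta
          chord-first e refl p q with two-two (E.state e) (sym (ℕ.suc-injective p)) (sym (ℕ.suc-injective (trans (sym dv≡3) q)))
          ... | inj₁ L = inj₁ record
            { vertices = ↭-trans perm (prep u (prep v (↭-trans (↭-sym (E.split e)) (↭-trans (++⁺ˡ (E.x e ∷ E.xs e) L.split)
                (shifts (E.x e ∷ E.xs e) L.xs)))))
            ; segᵤᵤ = L.segᵤᵤ ; segᵤᵥ = E.seg e ; segᵥᵥ = L.segᵥᵥ ; direct = λ h → contradiction h u≁v ; closed = L.closed }
            where module L = Loops L
          ... | inj₂ C = inj₂ record
            { vertices = ↭-trans perm (prep u (prep v (↭-trans (↭-sym (E.split e)) (↭-trans (++⁺ˡ (E.x e ∷ E.xs e) C.split)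
                (↭-trans (shifts (E.x e ∷ E.xs e) (C.x ∷ C.xs)) (++⁺ˡ (C.x ∷ C.xs) (shifts (E.x e ∷ E.xs e) (C.y ∷ C.ys))))))))
            ; seg₁ = C.seg₁ ; seg₂ = C.seg₂ ; seg₃ = E.seg e ; direct = λ h → contradiction h u≁v ; closed = C.closed }
            where module C = Chords C
          first : (∃ λ (e : Extract U u) →
            (E.end e ≡ u × 3 ≡ 2 + deg u (E.rest e) × deg v U ≡ deg v (E.rest e)) ⊎
            (E.end e ≡ v × 3 ≡ 1 + deg u (E.rest e) × deg v U ≡ 1 + deg v (E.rest e))) → Dumbbell ⊎ Theta
          first (e , inj₁ (h , p , q)) = inj₁ (loop-first e h p q)
          first (e , inj₂ (h , p , q)) = chord-first e h p q

module WalkPermanent {n} (G : Graph n) where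

  open import Defs using (degree; diag; A; D; Q; I; Matrix)
  open import Algebra.Structures using (IsCommutativeRing; IsCommutativeSemiring)
  open import Data.Fin.Base using (Fin)
  open import Data.Fin.Properties using (_≟_)
  open import Data.Integer.Base as ℤ using (ℤ; 0ℤ; 1ℤ; +_; -[1+_]; _+_; _*_; _-_; -_; _^_)
  open import Data.List.Base using (List; []; _∷_; _++_; map; length)
  import Data.List.Properties as L
  open import Data.List.Membership.Propositional.Properties using (∈-++⁺ʳ)
  open import Data.List.Relation.Binary.Permutation.Propositional using (_↭_; ↭-sym; ↭-trans; prep; swap; refl)
  open import Data.List.Relation.Binary.Permutation.Propositional.Properties using (shift; ++-comm; ++-identityʳ)
  open import Data.List.Relation.Unary.All as All using (All; []; _∷_)
  open import Data.List.Relation.Unary.Unique.Propositional using (Unique)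
  open import Data.Nat.Base using (ℕ; zero; suc)
  open Walks G
  open Classification G
  open ShapeFunctions using (W; x₀; y₀; dumbbell; θ; cycles)
  open Graph G

  ℤ-isCSR : IsCommutativeSemiring _≡_ _+_ _*_ 0ℤ 1ℤ
  ℤ-isCSR = IsCommutativeRing.isCommutativeSemiring ℤ.+-*-isCommutativeRing

  open ListPermanent ℤ-isCSR using (perm)

  diag-≡ : ∀ {n} (a : Fin n → ℤ) i → diag a i i ≡ a i
  diag-≡ a i with i ≟ i
  ... | yes _  = refl
  ... | no i≢i = contradiction refl i≢i

  diag-≢ : ∀ {n} (a : Fin n → ℤ) {i j} → i ≢ j → diag a i j ≡ 0ℤ
  diag-≢ a {i} {j} i≢j with i ≟ j
  ... | yes eq = contradiction eq i≢j
  ... | no _   = refl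

  A-adj : ∀ {i j} → i ~ j → A G i j ≡ 1ℤ
  A-adj {i} {j} i~j with i ~? j
  ... | yes _  = refl
  ... | no i≁j = contradiction i~j i≁j

  A-nonadj : ∀ {i j} → ¬ i ~ j → A G i j ≡ 0ℤ
  A-nonadj {i} {j} i≁j with i ~? j
  ... | yes i~j = contradiction i~j i≁j
  ... | no _    = refl

  -- The substitution x = 2 + s - 1/s, multiplied by -s to clear the denominator.
  M : ℤ → Matrix ℤ n
  M s i j = (1ℤ - + 2 * s - s * s) * I i j - - s * Q G i j

  private
    M-diag-shape : ∀ s k → (1ℤ - + 2 * s - s * s) * 1ℤ - - s * (k + 0ℤ) ≡ (1ℤ - + 2 * s - s * s) + s * k
    M-diag-shape = solve-∀

  M-diag : ∀ s i → M s i i ≡ (1ℤ - + 2 * s - s * s) + s * + degree G i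
  M-diag s i = trans (cong₂ (λ x y → (1ℤ - + 2 * s - s * s) * x - - s * y) (diag-≡ (λ _ → 1ℤ) i)
    (cong₂ _+_ (diag-≡ (λ i → + degree G i) i) (A-nonadj ~-irr))) (M-diag-shape s (+ degree G i))

  private
    M-off-shape : ∀ s a → (1ℤ - + 2 * s - s * s) * 0ℤ - - s * (0ℤ + a) ≡ s * a
    M-off-shape = solve-∀

  M-off : ∀ s {i j} → i ≢ j → M s i j ≡ s * A G i j
  M-off s {i} {j} i≢j = trans (cong₂ (λ x y → (1ℤ - + 2 * s - s * s) * x - - s * (y + A G i j)) (diag-≢ (λ _ → 1ℤ) i≢j)
    (diag-≢ (λ i → + degree G i) i≢j)) (M-off-shape s (A G i j))

  A-sym : ∀ i j → A G i j ≡ A G j i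
  A-sym i j = go (i ~? j)
    where
    go : Dec (i ~ j) → A G i j ≡ A G j i
    go (yes h) = trans (A-adj h) (sym (A-adj (~-sym h)))
    go (no h)  = trans (A-nonadj h) (sym (A-nonadj λ h′ → h (~-sym h′)))

  M-sym : ∀ s i j → M s i j ≡ M s j i
  M-sym s i j = go (i ≟ j)
    where
    go : Dec (i ≡ j) → M s i j ≡ M s j i
    go (yes refl) = refl
    go (no i≢j)   = trans (M-off s i≢j) (trans (cong (s *_) (A-sym i j)) (sym (M-off s (λ h → i≢j (sym h)))))

  M-adj : ∀ s {i j} → i ~ j → M s i j ≡ s
  M-adj s {i} {j} i~j = trans (M-off s (λ { refl → ~-irr i~j })) (trans (cong (s *_) (A-adj i~j)) (ℤ.*-identityʳ s))

  M-nonadj : ∀ s {i j} → i ≢ j → ¬ i ~ j → M s i j ≡ 0ℤ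
  M-nonadj s i≢j i≁j = trans (M-off s i≢j) (trans (cong (s *_) (A-nonadj i≁j)) (ℤ.*-zeroʳ s))

  private
    M-two-shape : ∀ s → (1ℤ - + 2 * s - s * s) + s * + 2 ≡ 1ℤ - s * s
    M-two-shape = solve-∀

  M-two : ∀ s {i} → degree G i ≡ 2 → M s i i ≡ 1ℤ - s * s
  M-two s {i} eq = trans (M-diag s i) (trans (cong (λ k → (1ℤ - + 2 * s - s * s) + s * + k) eq) (M-two-shape s))

  private
    M-three-shape : ∀ s → (1ℤ - + 2 * s - s * s) + s * + 3 ≡ 1ℤ + s - s * s
    M-three-shape = solve-∀

  M-three : ∀ s {i} → degree G i ≡ 3 → M s i i ≡ 1ℤ + s - s * s
  M-three s {i} eq = trans (M-diag s i) (trans (cong (λ k → (1ℤ - + 2 * s - s * s) + s * + k) eq) (M-three-shape s))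

  total-length : List (V × List V) → List ℕ
  total-length = map (λ (x , xs) → suc (length xs))

  private
    left-shape₂ : ∀ c a b D → c * (a * D + b * 1ℤ) ≡ c * a * D + c * b
    left-shape₂ = solve-∀

    loops-value-final : ∀ s A B E t r →
      (1ℤ - A) * ((1ℤ - B) * ((1ℤ - E) * ((1ℤ + s - s * s) * (1ℤ + s - s * s)) + + 2 * ((E - - (s * s)) * (1ℤ + s - s * s)) + (s * s * (s * s) - E)) + (+ 2 * (B - - (s * s)) + + 2 * ((1ℤ + s * s) * r)) * ((1ℤ - E) * (1ℤ + s - s * s) + (E - - (s * s))))
      + (+ 2 * (A - - (s * s)) + + 2 * ((1ℤ + s * s) * t)) * ((1ℤ - B) * ((1ℤ - E) * (1ℤ + s - s * s) + (E - - (s * s))) + (+ 2 * (B - - (s * s)) + + 2 * ((1ℤ + s * s) * r)) * (1ℤ - E)) ≡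
      (1ℤ + s + + 2 * (s * s) + + 2 * ((1ℤ + s * s) * t) + A * (1ℤ - s)) * (1ℤ + s + + 2 * (s * s) + + 2 * ((1ℤ + s * s) * r) + B * (1ℤ - s))
      - E * ((s + s * s + + 2 * ((1ℤ + s * s) * t) + A * (+ 2 - s + s * s)) * (s + s * s + + 2 * ((1ℤ + s * s) * r) + B * (+ 2 - s + s * s)))
    loops-value-final = solve-∀

    both₂-shape : ∀ c a b g t p q r z m n → c * c * (a * p + b * (q + r) + g * z + t * (m + n)) ≡
      c * a * (c * p) + c * b * (c * q + c * r) + c * g * (c * z) + c * c * (t * (m + n))
    both₂-shape = solve-∀

    one-end-shape : ∀ c a b p q → c * c * (a * p + b * q) ≡ c * a * (c * p) + c * b * (c * q)
    one-end-shape = solve-∀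

    none₂-shape : ∀ c a p → c * c * (a * p) ≡ c * a * (c * p)
    none₂-shape = solve-∀

    cross₂-shape : ∀ c a t p q → c * c * (a * p + t * q) ≡ c * (c * a * p + t * (c * q))
    cross₂-shape = solve-∀

    middle-eq₁ : ∀ s → (1ℤ + s * s) * ((1ℤ + s - s * s) * (1ℤ + s - s * s) + s * (s * 1ℤ)) ≡
      (1ℤ - - (s * s) * 1ℤ) * ((1ℤ + s - s * s) * (1ℤ + s - s * s)) + + 2 * ((- (s * s) * 1ℤ - - (s * s)) * (1ℤ + s - s * s)) + (s * s * (s * s) - - (s * s) * 1ℤ)
    middle-eq₁ = solve-∀

    middle-eq₂ : ∀ s → (1ℤ + s * s) * (1ℤ + s - s * s) ≡ (1ℤ - - (s * s) * 1ℤ) * (1ℤ + s - s * s) + (- (s * s) * 1ℤ - - (s * s))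
    middle-eq₂ = solve-∀

    middle-eq₃ : ∀ s → (1ℤ + s * s) * 1ℤ ≡ 1ℤ - - (s * s) * 1ℤ
    middle-eq₃ = solve-∀

    middle-shape₁ : ∀ c a b g t D → c * (a * (D * D + 0ℤ * (0ℤ * 1ℤ)) + b * (D + D) + g * 1ℤ + t * (0ℤ + 0ℤ)) ≡ c * a * (D * D) + + 2 * (c * b * D) + c * g
    middle-shape₁ = solve-∀

    middle-shape₃ : ∀ a t → a * 0ℤ + t * 1ℤ ≡ t
    middle-shape₃ = solve-∀

    loops-value-spread : ∀ c a z a′ z′ p q r t → c * (c * c) * (a * (a′ * p + z′ * q) + z * (a′ * r + z′ * t)) ≡
      c * a * (c * a′ * (c * p) + c * z′ * (c * q)) + c * z * (c * a′ * (c * r) + c * z′ * (c * t))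
    loops-value-spread = solve-∀

    chords-value-spread₁ : ∀ c a b g t p q r z m → c * (c * c) * (a * p + b * (q + r) + g * z + t * (m + m)) ≡
      c * a * (c * c * p) + c * b * (c * c * q + c * c * r) + c * g * (c * c * z) + c * t * (+ 2 * (c * c * m))
    chords-value-spread₁ = solve-∀

    chords-value-final : ∀ s A B C t r q →
      (1ℤ - A) * ((1ℤ - B) * ((1ℤ - C) * ((1ℤ + s - s * s) * (1ℤ + s - s * s)) + + 2 * ((C - - (s * s)) * (1ℤ + s - s * s)) + (s * s * (s * s) - C))
          + (B - - (s * s)) * (((1ℤ - C) * (1ℤ + s - s * s) + (C - - (s * s))) + ((1ℤ - C) * (1ℤ + s - s * s) + (C - - (s * s))))
          + (s * s * (s * s) - B) * (1ℤ - C) + (1ℤ + s * s) * (1ℤ + s * s) * (r * (q + q)))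
      + (A - - (s * s)) * (((1ℤ - B) * ((1ℤ - C) * (1ℤ + s - s * s) + (C - - (s * s))) + (B - - (s * s)) * (1ℤ - C))
          + ((1ℤ - B) * ((1ℤ - C) * (1ℤ + s - s * s) + (C - - (s * s))) + (B - - (s * s)) * (1ℤ - C)))
      + (s * s * (s * s) - A) * ((1ℤ - B) * (1ℤ - C))
      + (1ℤ + s * s) * t * (+ 2 * ((1ℤ + s * s) * ((1ℤ - B) * q + r * (1ℤ - C)))) ≡
      (1ℤ + s + + 2 * (s * s)) * (1ℤ + s + + 2 * (s * s)) - (s + s * s) * (s + s * s) * (A + B + C) + (1ℤ - s) * (1ℤ - s) * (A * B + A * C + B * C)
      - (+ 2 - s + s * s) * (+ 2 - s + s * s) * (A * B * C)
      + + 2 * ((1ℤ + s * s) * (1ℤ + s * s) * (t * r * (1ℤ - C) + t * q * (1ℤ - B) + r * q * (1ℤ - A)))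
    chords-value-final = solve-∀

    α-closed-eq : ∀ s → (1ℤ + s * s) * (1ℤ - s * s) ≡ 1ℤ - - (s * s) * (- (s * s) * 1ℤ)
    α-closed-eq = solve-∀

    α-closed-eq₁ : ∀ c d a b → c * (d * a + b) ≡ d * (c * a) + c * b
    α-closed-eq₁ = solve-∀

    α-closed-eq₂ : ∀ s w → (1ℤ - s * s) * (1ℤ - w) + (w - - (s * s)) ≡ 1ℤ - - (s * s) * w
    α-closed-eq₂ = solve-∀

    β-closed-eq : ∀ s → (1ℤ + s * s) * (s * s) ≡ - (s * s) * (- (s * s) * 1ℤ) - - (s * s)
    β-closed-eq = solve-∀

    β-closed-eq₁ : ∀ c s a → c * (s * (s * a)) ≡ s * s * (c * a)
    β-closed-eq₁ = solve-∀

    β-closed-eq₂ : ∀ s w → s * s * (1ℤ - w) ≡ - (s * s) * w - - (s * s)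
    β-closed-eq₂ = solve-∀

    γ-closed-eq : ∀ s → (1ℤ + s * s) * 0ℤ ≡ s * s * (s * s) - - (s * s) * (- (s * s) * 1ℤ)
    γ-closed-eq = solve-∀

    γ-closed-eq₁ : ∀ c s a → c * (s * (s * a)) ≡ s * s * (c * a)
    γ-closed-eq₁ = solve-∀

    γ-closed-eq₂ : ∀ s w → s * s * (w - - (s * s)) ≡ s * s * (s * s) - - (s * s) * w
    γ-closed-eq₂ = solve-∀

    ζ-closed-eq : ∀ c b t → c * (b + b + (t + t)) ≡ + 2 * (c * b) + + 2 * (c * t)
    ζ-closed-eq = solve-∀

    cycle-factor-eq₁ : ∀ c d a z → c * (d * a + z) ≡ d * (c * a) + c * z
    cycle-factor-eq₁ = solve-∀

    cycle-factor-eq₂ : ∀ s w t → (1ℤ - s * s) * (1ℤ - w) + (+ 2 * (w - - (s * s)) + + 2 * ((1ℤ + s * s) * t)) ≡ (1ℤ + s * s) * (1ℤ + + 2 * t + w)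
    cycle-factor-eq₂ = solve-∀

    loops-cong : ∀ {a z a′ z′ p q r t b y b′ y′ p′ q′ r′ t′ : ℤ} → a ≡ b → z ≡ y → a′ ≡ b′ → z′ ≡ y′ → p ≡ p′ → q ≡ q′ → r ≡ r′ → t ≡ t′ →
      a * (a′ * p + z′ * q) + z * (a′ * r + z′ * t) ≡ b * (b′ * p′ + y′ * q′) + y * (b′ * r′ + y′ * t′)
    loops-cong refl refl refl refl refl refl refl refl = refl

    cong₃ : ∀ (f : ℤ → ℤ → ℤ → ℤ) {x x′ y y′ z z′} → x ≡ x′ → y ≡ y′ → z ≡ z′ → f x y z ≡ f x′ y′ z′
    cong₃ f refl refl refl = refl

  module At (s : ℤ) where

    open ChainExpansion ℤ-isCSR (1ℤ - s * s) s (M s) (M-sym s)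
    open ListPermanent.Symmetric ℤ-isCSR (M s) (M-sym s)

    private
      P = perm (M s)

    ⊥-from : ∀ {x O} → (∀ {c} → c ∈ O → x ≢ c × ¬ x ~ c) → x ⊥ O
    ⊥-from h = All.tabulate λ c∈ → M-nonadj s (proj₁ (h c∈)) (proj₂ (h c∈))

    nbr2-⊥ : ∀ {x a b O} → Nbr2 x a b → (∀ {c} → c ∈ O → x ≢ c × a ≢ c × b ≢ c) → x ⊥ O
    nbr2-⊥ h away = ⊥-from λ c∈ → proj₁ (away c∈) , λ x~c → neither (away c∈) (Nbr2.only h x~c)
      where
      neither : ∀ {x a b c} → x ≢ c × a ≢ c × b ≢ c → c ≡ a ⊎ c ≡ b → _
      neither (_ , a≢c , _) (inj₁ eq) = a≢c (sym eq)
      neither (_ , _ , b≢c) (inj₂ eq) = b≢c (sym eq)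

    seg⇒Chain : ∀ {b a x xs O} → Seg b a (x ∷ xs) → Unique (a ∷ b ∷ x ∷ xs ++ O) → Chain b a (x ∷ xs) O O
    seg⇒Chain {b} {a} {x} {[]} {O} (h ∷ _) u =
      chain-end (M-two s (Nbr2⇒degree≡2 h)) (M-adj s (Nbr2.x~a h)) (M-adj s (Nbr2.x~b h)) z z
      where
      z : x ⊥ O
      z = nbr2-⊥ h λ c∈ → (λ { refl → unique-head (unique-tail (unique-tail u)) c∈ }) ,
            (λ { refl → unique-head u (there (there c∈)) }) , (λ { refl → unique-head (unique-tail u) (there c∈) })
    seg⇒Chain {b} {a} {x} {y ∷ xs} {O} (h ∷ σ) u =
      chain-cons (M-two s (Nbr2⇒degree≡2 h)) (M-adj s (Nbr2.x~a h)) x≁b z z (seg⇒Chain σ (Unique-resp-↭ reorder u))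
      where
      reorder : a ∷ b ∷ x ∷ (y ∷ xs) ++ O ↭ x ∷ b ∷ (y ∷ xs) ++ a ∷ O
      reorder = ↭-trans (↭-sym (shift a (b ∷ x ∷ y ∷ xs) O)) (swap b x refl)
      b≢x : b ≢ x
      b≢x refl = unique-head (unique-tail u) (here refl)
      x≁b : M s x b ≡ 0ℤ
      x≁b = M-nonadj s (λ h → b≢x (sym h)) λ x~b → neither (Nbr2.only h x~b)
        where
        neither : b ≡ a ⊎ b ≡ y → _
        neither (inj₁ refl) = unique-head u (here refl)
        neither (inj₂ refl) = unique-head (unique-tail u) (there (here refl))
      z : x ⊥ O
      z = nbr2-⊥ h λ c∈ → (λ { refl → unique-head (unique-tail (unique-tail u)) (there (∈-++⁺ʳ xs c∈)) }) ,
            (λ { refl → unique-head u (there (there (there (∈-++⁺ʳ xs c∈)))) }) ,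
            (λ { refl → unique-head (unique-tail (unique-tail (unique-tail u))) (∈-++⁺ʳ xs c∈) })

    seg⇒Loop : ∀ {u xs O} → Seg u u xs → Unique (u ∷ xs ++ O) → Loop u xs O
    seg⇒Loop ([] u~u) uq = contradiction u~u ~-irr
    seg⇒Loop {xs = x ∷ []} (h ∷ _) uq = contradiction refl (Nbr2.a≢b h)
    seg⇒Loop {u} {x ∷ y ∷ xs} {O} (h ∷ σ) uq = loop (M-two s (Nbr2⇒degree≡2 h)) (M-adj s (Nbr2.x~a h))
      (nbr2-⊥ h λ c∈ → (λ { refl → unique-head (unique-tail uq) (there (∈-++⁺ʳ xs c∈)) }) ,
        (λ { refl → unique-head uq (there (there (∈-++⁺ʳ xs c∈))) }) ,
        (λ { refl → unique-head (unique-tail (unique-tail uq)) (∈-++⁺ʳ xs c∈) }))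
      (seg⇒Chain σ (Unique-resp-↭ (swap u x refl) uq))

    c = 1ℤ + s * s
    w = - (s * s)

    α-closed : ∀ k → c * α k ≡ 1ℤ - W (suc (suc k)) s
    β-closed : ∀ k → c * β k ≡ W (suc (suc k)) s - w
    α-closed zero = α-closed-eq s
    α-closed (suc k) = trans (α-closed-eq₁ c (1ℤ - s * s) (α k) (β k)) (trans (cong₂ (λ x y → (1ℤ - s * s) * x + y) (α-closed k) (β-closed k)) (α-closed-eq₂ s (W (suc (suc k)) s)))
    β-closed zero = β-closed-eq s
    β-closed (suc k) = trans (β-closed-eq₁ c s (α k)) (trans (cong (λ x → s * s * x) (α-closed k)) (β-closed-eq₂ s (W (suc (suc k)) s)))

    γ-closed : ∀ k → c * γ k ≡ s * s * (s * s) - W (suc (suc k)) s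
    γ-closed zero = γ-closed-eq s
    γ-closed (suc k) = trans (γ-closed-eq₁ c s (β k)) (trans (cong (λ x → s * s * x) (β-closed k)) (γ-closed-eq₂ s (W (suc (suc k)) s)))

    τ-closed : ∀ k → τ k ≡ s ^ suc (suc k)
    τ-closed zero    = cong (s *_) (sym (ℤ.*-identityʳ s))
    τ-closed (suc k) = cong (s *_) (τ-closed k)

    ζ-closed : ∀ k → c * ζ k ≡ + 2 * (W (suc (suc k)) s - w) + + 2 * (c * s ^ suc (suc k))
    ζ-closed k = trans (ζ-closed-eq c (β k) (τ k)) (cong₂ (λ x y → + 2 * x + + 2 * (c * y)) (β-closed k) (τ-closed k))

    c≢0 : ∀ {x y} → c * x ≡ c * y → x ≡ y
    c≢0 {x} {y} eq = ℤ.*-cancelˡ-≡ c x y ⦃ nz s ⦄ eq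
      where
      nz : ∀ s → ℤ.NonZero (1ℤ + s * s)
      nz (+ zero)    = _
      nz (+ suc k)   = _
      nz -[1+ k ]    = _

    cycle-factor : ∀ k → (1ℤ - s * s) * α k + ζ k ≡ 1ℤ + + 2 * s ^ suc (suc k) + W (suc (suc k)) s
    cycle-factor k = c≢0 (trans (cycle-factor-eq₁ c (1ℤ - s * s) (α k) (ζ k)) (trans (cong₂ (λ x y → (1ℤ - s * s) * x + y) (α-closed k) (ζ-closed k))
      (cycle-factor-eq₂ s (W (suc (suc k)) s) (s ^ suc (suc k)))))

    perm-cycles : ∀ cs {O} → All Cycle cs → Unique (flat cs ++ O) →
      P (flat cs ++ O) (flat cs ++ O) ≡ cycles (total-length cs) s * P O O
    perm-cycles []              {O} []              uq = sym (ℤ.*-identityˡ (P O O))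
    perm-cycles ((x , xs) ∷ cs) {O} ((σ , dx , own) ∷ cyc) uq with seg-nonempty σ
    ... | y , ys , refl = begin
      P (x ∷ (xs ++ flat cs) ++ O) (x ∷ (xs ++ flat cs) ++ O)
        ≡⟨ cong₂ P assoc assoc ⟩
      P (x ∷ xs ++ O′) (x ∷ xs ++ O′)
        ≡⟨ perm-cycle (M-two s dx) x⊥ (seg⇒Loop σ uq′) ⟩
      ((1ℤ - s * s) * α (length ys) + ζ (length ys)) * P O′ O′
        ≡⟨ cong₂ _*_ (cycle-factor (length ys)) (perm-cycles cs cyc (unique-++ʳ (x ∷ xs) uq′)) ⟩
      (1ℤ + + 2 * s ^ suc (length xs) + W (suc (length xs)) s) * (cycles (total-length cs) s * P O O)
        ≡⟨ ℤ.*-assoc (1ℤ + + 2 * s ^ suc (length xs) + W (suc (length xs)) s) (cycles (total-length cs) s) (P O O) ⟨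
      cycles (total-length ((x , xs) ∷ cs)) s * P O O ∎
      where
      open ≡-Reasoning
      O′ = flat cs ++ O
      assoc : x ∷ (xs ++ flat cs) ++ O ≡ x ∷ xs ++ O′
      assoc = cong (x ∷_) (L.++-assoc xs (flat cs) O)
      uq′ : Unique (x ∷ xs ++ O′)
      uq′ = subst Unique assoc uq
      x⊥ : x ⊥ O′
      x⊥ = ⊥-from λ c∈ → (λ { refl → unique-head uq′ (∈-++⁺ʳ xs c∈) }) ,
             λ x~c → unique-++-disjoint xs (unique-tail uq′) (own x~c) c∈

    -- The permanent of the part of the graph spanned by a u-v walk zs, its interior together
    -- with u and v, one of them, or none of them.
    module Ends {u v : V} (du : degree G u ≡ 3) (dv : degree G v ≡ 3) where

      Dg = 1ℤ + s - s * s

      record Middle (ys : List V) : Set where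
        e = suc (length ys)
        field
          both  : c * P (u ∷ v ∷ ys) (u ∷ v ∷ ys) ≡ (1ℤ - W e s) * (Dg * Dg) + + 2 * ((W e s - w) * Dg) + (s * s * (s * s) - W e s)
          left  : c * P (u ∷ ys) (u ∷ ys) ≡ (1ℤ - W e s) * Dg + (W e s - w)
          right : c * P (v ∷ ys) (v ∷ ys) ≡ (1ℤ - W e s) * Dg + (W e s - w)
          none  : c * P ys ys ≡ 1ℤ - W e s
          cross : P (u ∷ ys) (v ∷ ys) ≡ s ^ e

      private
        P[] : P [] [] ≡ 1ℤ
        P[] = ListPermanent.perm-[] ℤ-isCSR (M s)
        single : ∀ {x} → degree G x ≡ 3 → P (x ∷ []) (x ∷ []) ≡ Dg
        single {x} dx = trans (perm-row₁ {x = x} [] x []) (trans (cong₂ _*_ (M-three s dx) P[]) (ℤ.*-identityʳ Dg))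
        off : P (u ∷ []) (v ∷ []) ≡ M s u v
        off = trans (perm-row₁ {x = u} [] v []) (trans (cong (M s u v *_) P[]) (ℤ.*-identityʳ (M s u v)))
        pair : P (u ∷ v ∷ []) (u ∷ v ∷ []) ≡ Dg * Dg + M s u v * (M s u v * 1ℤ)
        pair = trans (perm-leaf {u} v {[]} {[]} [] []) (cong₂ _+_ (cong₂ _*_ (M-three s du) (single dv)) (cong (λ z → M s u v * (M s u v * z)) P[]))

      middle : ∀ {ys} → u ≢ v → Seg v u ys → (u ~ v → ys ≡ []) → Unique (u ∷ v ∷ ys) → Middle ys
      middle {[]} u≢v ([] u~v) direct uq = record
        { both  = trans (cong (c *_) (trans pair (cong (λ m → Dg * Dg + m * (m * 1ℤ)) m≡s))) (middle-eq₁ s)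
        ; left  = trans (cong (c *_) (single du)) (middle-eq₂ s)
        ; right = trans (cong (c *_) (single dv)) (middle-eq₂ s)
        ; none  = trans (cong (c *_) P[]) (middle-eq₃ s)
        ; cross = trans off (trans m≡s (sym (ℤ.*-identityʳ s))) }
        where
        m≡s : M s u v ≡ s
        m≡s = M-adj s u~v
      middle {y ∷ ys} u≢v σ direct uq = record
        { both  = trans (cong (c *_) (trans (cong₂ P (sym nil₂) (sym nil₂)) (trans (perm-chain-ab-ab ch) (cong-both pair (single du) (single dv) P[] off (trans (perm-transpose (v ∷ []) (u ∷ [])) off)))))
            (trans (middle-shape₁ c (α k) (β k) (γ k) (τ k) Dg) (cong-three (α-closed k) (β-closed k) (γ-closed k)))
        ; left  = trans (cong (c *_) (trans (cong₂ P (sym nil₁) (sym nil₁)) (trans (perm-chain-a-a ch) (cong₂ (λ x y → α k * x + β k * y) (single du) P[])))) left-shape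
        ; right = trans (cong (c *_) (trans (cong₂ P (sym nil₁) (sym nil₁)) (trans (perm-chain-b-b ch) (cong₂ (λ x y → α k * x + β k * y) (single dv) P[])))) left-shape
        ; none  = trans (cong (c *_) (trans (cong₂ P (sym nil₀) (sym nil₀)) (trans (perm-chain-∅-∅ ch) (trans (cong (α k *_) P[]) (ℤ.*-identityʳ (α k)))))) (α-closed k)
        ; cross = trans (cong₂ P (sym nil₁) (sym nil₁)) (trans (perm-chain-a-b ch) (trans (cong₂ (λ x y → α k * x + τ k * y) (trans off m≡0) P[])
            (trans (middle-shape₃ (α k) (τ k)) (τ-closed k)))) }
        where
        k = length ys
        e = suc (suc k)
        u≁v : ¬ u ~ v
        u≁v u~v with () ← direct u~v
        m≡0 : M s u v ≡ 0ℤ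
        m≡0 = M-nonadj s u≢v u≁v
        nil₀ : (y ∷ ys) ++ [] ≡ y ∷ ys
        nil₀ = L.++-identityʳ (y ∷ ys)
        nil₁ : ∀ {x} → x ∷ (y ∷ ys) ++ [] ≡ x ∷ y ∷ ys
        nil₁ {x} = cong (x ∷_) nil₀
        nil₂ : u ∷ v ∷ (y ∷ ys) ++ [] ≡ u ∷ v ∷ y ∷ ys
        nil₂ = cong (u ∷_) nil₁
        ch : Chain v u (y ∷ ys) [] []
        ch = seg⇒Chain σ (subst Unique (sym nil₂) uq)
        cong-both : ∀ {p q r t x z} → p ≡ Dg * Dg + M s u v * (M s u v * 1ℤ) → q ≡ Dg → r ≡ Dg → t ≡ 1ℤ → x ≡ M s u v → z ≡ M s u v →
          α k * p + β k * (q + r) + γ k * t + τ k * (x + z) ≡ α k * (Dg * Dg + 0ℤ * (0ℤ * 1ℤ)) + β k * (Dg + Dg) + γ k * 1ℤ + τ k * (0ℤ + 0ℤ)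
        cong-both refl refl refl refl refl refl = cong (λ m → α k * (Dg * Dg + m * (m * 1ℤ)) + β k * (Dg + Dg) + γ k * 1ℤ + τ k * (m + m)) m≡0
        cong-three : ∀ {a b g a′ b′ g′} → a ≡ a′ → b ≡ b′ → g ≡ g′ → a * (Dg * Dg) + + 2 * (b * Dg) + g ≡ a′ * (Dg * Dg) + + 2 * (b′ * Dg) + g′
        cong-three refl refl refl = refl
        left-shape : c * (α k * Dg + β k * 1ℤ) ≡ (1ℤ - W e s) * Dg + (W e s - w)
        left-shape = trans (left-shape₂ c (α k) (β k) Dg) (cong₂ (λ x y → x * Dg + y) (α-closed k) (β-closed k))

      loops-value : ∀ {xs ys zs} → u ≢ v → Seg u u xs → Seg v u ys → Seg v v zs → (u ~ v → ys ≡ []) →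
        Unique (u ∷ v ∷ xs ++ ys ++ zs) → let O = u ∷ v ∷ xs ++ ys ++ zs in
        c * (c * c) * P O O ≡ dumbbell (suc (length xs)) (suc (length zs)) (suc (length ys)) s
      loops-value {xs} {ys} {zs} u≢v σ μ ρ direct uq with seg-nonempty σ | seg-nonempty ρ
      ... | x , xs′ , refl | z , zs′ , refl = begin
        c * (c * c) * P O O
          ≡⟨ cong (c * (c * c) *_) (trans (perm-↭ p₁ p₁) (trans (perm-loop-u-u (seg⇒Loop σ (Unique-resp-↭ p₁ uq)))
               (cong₂ (λ m n → αx * m + ζx * n)
                 (trans (perm-↭ p₂ p₂) (trans (perm-loop-u-u loop₂) (cong (λ m → αz * m + ζz * P (u ∷ ys) (u ∷ ys)) (perm-↭ (swap v u refl) (swap v u refl)))))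
                 (trans (perm-↭ p₃ p₃) (perm-loop-u-u loop₃))))) ⟩
        c * (c * c) * (αx * (αz * P (u ∷ v ∷ ys) (u ∷ v ∷ ys) + ζz * P (u ∷ ys) (u ∷ ys)) + ζx * (αz * P (v ∷ ys) (v ∷ ys) + ζz * P ys ys))
          ≡⟨ loops-value-spread c αx ζx αz ζz (P (u ∷ v ∷ ys) (u ∷ v ∷ ys)) (P (u ∷ ys) (u ∷ ys)) (P (v ∷ ys) (v ∷ ys)) (P ys ys) ⟩
        c * αx * (c * αz * (c * P (u ∷ v ∷ ys) (u ∷ v ∷ ys)) + c * ζz * (c * P (u ∷ ys) (u ∷ ys)))
          + c * ζx * (c * αz * (c * P (v ∷ ys) (v ∷ ys)) + c * ζz * (c * P ys ys))
          ≡⟨ loops-cong (α-closed (length xs′)) (ζ-closed (length xs′)) (α-closed (length zs′)) (ζ-closed (length zs′)) Mi.both Mi.left Mi.right Mi.none ⟩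
        _ ≡⟨ final s (W (suc (suc (length xs′))) s) (W (suc (suc (length zs′))) s) (W (suc (length ys)) s)
                    (s ^ suc (suc (length xs′))) (s ^ suc (suc (length zs′))) ⟩
        dumbbell (suc (length xs)) (suc (length zs)) (suc (length ys)) s ∎
        where
        open ≡-Reasoning
        O = u ∷ v ∷ xs ++ ys ++ zs
        αx = α (length xs′)
        ζx = ζ (length xs′)
        αz = α (length zs′)
        ζz = ζ (length zs′)
        p₁ : O ↭ u ∷ xs ++ v ∷ ys ++ zs
        p₁ = prep u (↭-sym (shift v xs (ys ++ zs)))
        p₂ : u ∷ v ∷ ys ++ zs ↭ v ∷ zs ++ u ∷ ys
        p₂ = ↭-trans (swap u v (++-comm ys zs)) (prep v (↭-sym (shift u zs ys)))
        p₃ : v ∷ ys ++ zs ↭ v ∷ zs ++ ys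
        p₃ = prep v (++-comm ys zs)
        uq₁ : Unique (u ∷ v ∷ ys ++ zs)
        uq₁ = unique-++ʳ xs (Unique-resp-↭ (↭-trans (prep u (swap v x refl)) (shift-front)) uq)
          where
          shift-front : u ∷ x ∷ v ∷ xs′ ++ ys ++ zs ↭ (x ∷ xs′) ++ u ∷ v ∷ ys ++ zs
          shift-front = ↭-trans (prep u (prep x (↭-sym (shift v xs′ (ys ++ zs))))) (↭-sym (shift u (x ∷ xs′) (v ∷ ys ++ zs)))
        loop₂ : Loop v zs (u ∷ ys)
        loop₂ = seg⇒Loop ρ (Unique-resp-↭ p₂ uq₁)
        loop₃ : Loop v zs ys
        loop₃ = seg⇒Loop ρ (Unique-resp-↭ p₃ (unique-tail uq₁))
        module Mi = Middle (middle u≢v μ direct (unique-++ʳ zs (Unique-resp-↭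
          (↭-trans (prep u (prep v (++-comm ys zs))) (↭-trans (prep u (↭-sym (shift v zs ys))) (↭-sym (shift u zs (v ∷ ys))))) uq₁)))
        final : ∀ s A B E t r → let w = - (s * s); c = 1ℤ + s * s; D = 1ℤ + s - s * s in
          (1ℤ - A) * ((1ℤ - B) * ((1ℤ - E) * (D * D) + + 2 * ((E - w) * D) + (s * s * (s * s) - E)) + (+ 2 * (B - w) + + 2 * (c * r)) * ((1ℤ - E) * D + (E - w)))
          + (+ 2 * (A - w) + + 2 * (c * t)) * ((1ℤ - B) * ((1ℤ - E) * D + (E - w)) + (+ 2 * (B - w) + + 2 * (c * r)) * (1ℤ - E)) ≡
          (1ℤ + s + + 2 * (s * s) + + 2 * (c * t) + A * (1ℤ - s)) * (1ℤ + s + + 2 * (s * s) + + 2 * (c * r) + B * (1ℤ - s))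
          - E * ((s + s * s + + 2 * (c * t) + A * (+ 2 - s + s * s)) * (s + s * s + + 2 * (c * r) + B * (+ 2 - s + s * s)))
        final = loops-value-final

      chords-value : ∀ {x xs y ys zs} → u ≢ v → Seg v u (x ∷ xs) → Seg v u (y ∷ ys) → Seg v u zs → (u ~ v → zs ≡ []) →
        Unique (u ∷ v ∷ (x ∷ xs) ++ (y ∷ ys) ++ zs) → let O = u ∷ v ∷ (x ∷ xs) ++ (y ∷ ys) ++ zs in
        c * (c * c) * P O O ≡ θ (suc (suc (length xs))) (suc (suc (length ys))) (suc (length zs)) s
      chords-value {x} {xs} {y} {ys} {zs} u≢v σ ρ μ direct uq = begin
        c * (c * c) * P (u ∷ v ∷ (x ∷ xs) ++ O₁) (u ∷ v ∷ (x ∷ xs) ++ O₁)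
          ≡⟨ cong (c * (c * c) *_) (trans (perm-chain-ab-ab ch₁) (cong (λ z → α₁ * P (u ∷ v ∷ O₁) (u ∷ v ∷ O₁) + β₁ * (P (u ∷ O₁) (u ∷ O₁) + P (v ∷ O₁) (v ∷ O₁))
               + γ₁ * P O₁ O₁ + τ₁ * (P (u ∷ O₁) (v ∷ O₁) + z)) (perm-transpose (v ∷ O₁) (u ∷ O₁)))) ⟩
        c * (c * c) * (α₁ * P (u ∷ v ∷ O₁) (u ∷ v ∷ O₁) + β₁ * (P (u ∷ O₁) (u ∷ O₁) + P (v ∷ O₁) (v ∷ O₁))
               + γ₁ * P O₁ O₁ + τ₁ * (P (u ∷ O₁) (v ∷ O₁) + P (u ∷ O₁) (v ∷ O₁)))
          ≡⟨ chords-value-spread₁ c α₁ β₁ γ₁ τ₁ (P (u ∷ v ∷ O₁) (u ∷ v ∷ O₁)) (P (u ∷ O₁) (u ∷ O₁)) (P (v ∷ O₁) (v ∷ O₁)) (P O₁ O₁) (P (u ∷ O₁) (v ∷ O₁)) ⟩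
        c * α₁ * (c * c * P (u ∷ v ∷ O₁) (u ∷ v ∷ O₁)) + c * β₁ * (c * c * P (u ∷ O₁) (u ∷ O₁) + c * c * P (v ∷ O₁) (v ∷ O₁))
               + c * γ₁ * (c * c * P O₁ O₁) + c * τ₁ * (+ 2 * (c * c * P (u ∷ O₁) (v ∷ O₁)))
          ≡⟨ close (α-closed k₁) (β-closed k₁) (γ-closed k₁) (τ-closed k₁) both₂ left₂ right₂ none₂ cross₂ ⟩
        _ ≡⟨ chords-value-final s (W (suc (suc k₁)) s) (W (suc (suc k₂)) s) (W (suc (length zs)) s) (s ^ suc (suc k₁)) (s ^ suc (suc k₂)) (s ^ suc (length zs)) ⟩
        θ′ (W (suc (suc k₁)) s) (W (suc (suc k₂)) s) (W (suc (length zs)) s) (s ^ suc (suc k₁) * s ^ suc (suc k₂))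
           (s ^ suc (suc k₁) * s ^ suc (length zs)) (s ^ suc (suc k₂) * s ^ suc (length zs))
          ≡⟨ cong₃ (θ′ (W (suc (suc k₁)) s) (W (suc (suc k₂)) s) (W (suc (length zs)) s))
               (ℤ.^-distribˡ-+-* s (suc (suc k₁)) (suc (suc k₂))) (ℤ.^-distribˡ-+-* s (suc (suc k₁)) (suc (length zs)))
               (ℤ.^-distribˡ-+-* s (suc (suc k₂)) (suc (length zs))) ⟨
        θ (suc (suc k₁)) (suc (suc k₂)) (suc (length zs)) s ∎
        where
        open ≡-Reasoning
        O₁ = (y ∷ ys) ++ zs
        k₁ = length xs
        k₂ = length ys
        α₁ = α k₁
        β₁ = β k₁
        γ₁ = γ k₁
        τ₁ = τ k₁
        ch₁ : Chain v u (x ∷ xs) O₁ O₁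
        ch₁ = seg⇒Chain σ uq
        uq₁ : Unique (u ∷ v ∷ O₁)
        uq₁ = unique-++ʳ (x ∷ xs) (Unique-resp-↭ (↭-trans (prep u (↭-sym (shift v (x ∷ xs) O₁))) (↭-sym (shift u (x ∷ xs) (v ∷ O₁)))) uq)
        ch₂ : Chain v u (y ∷ ys) zs zs
        ch₂ = seg⇒Chain ρ uq₁
        module Mi = Middle (middle u≢v μ direct (unique-++ʳ (y ∷ ys)
          (Unique-resp-↭ (↭-trans (prep u (↭-sym (shift v (y ∷ ys) zs))) (↭-sym (shift u (y ∷ ys) (v ∷ zs)))) uq₁)))
        A₂ = 1ℤ - W (suc (suc k₂)) s
        B₂ = W (suc (suc k₂)) s - w
        G₂ = s * s * (s * s) - W (suc (suc k₂)) s
        C = W (suc (length zs)) s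
        both₂ : c * c * P (u ∷ v ∷ O₁) (u ∷ v ∷ O₁) ≡
          A₂ * ((1ℤ - C) * (Dg * Dg) + + 2 * ((C - w) * Dg) + (s * s * (s * s) - C)) + B₂ * (((1ℤ - C) * Dg + (C - w)) + ((1ℤ - C) * Dg + (C - w)))
          + G₂ * (1ℤ - C) + c * c * (s ^ suc (suc k₂) * (s ^ suc (length zs) + s ^ suc (length zs)))
        both₂ = trans (cong (c * c *_) (perm-chain-ab-ab ch₂))
          (trans (both₂-shape c (α k₂) (β k₂) (γ k₂) (τ k₂) (P (u ∷ v ∷ zs) (u ∷ v ∷ zs)) (P (u ∷ zs) (u ∷ zs)) (P (v ∷ zs) (v ∷ zs)) (P zs zs) (P (u ∷ zs) (v ∷ zs)) (P (v ∷ zs) (u ∷ zs)))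
            (close′ (α-closed k₂) (β-closed k₂) (γ-closed k₂) (τ-closed k₂) Mi.both Mi.left Mi.right Mi.none Mi.cross (trans (perm-transpose (v ∷ zs) (u ∷ zs)) Mi.cross)))
          where
          close′ : ∀ {a b g t p q r z m n a′ b′ g′ t′ p′ q′ r′ z′ m′ n′} → a ≡ a′ → b ≡ b′ → g ≡ g′ → t ≡ t′ → p ≡ p′ → q ≡ q′ → r ≡ r′ → z ≡ z′ → m ≡ m′ → n ≡ n′ →
            a * p + b * (q + r) + g * z + c * c * (t * (m + n)) ≡ a′ * p′ + b′ * (q′ + r′) + g′ * z′ + c * c * (t′ * (m′ + n′))
          close′ refl refl refl refl refl refl refl refl refl refl = refl
        one-end : ∀ {p q} → c * p ≡ (1ℤ - C) * Dg + (C - w) → c * q ≡ 1ℤ - C →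
          c * c * (α k₂ * p + β k₂ * q) ≡ A₂ * ((1ℤ - C) * Dg + (C - w)) + B₂ * (1ℤ - C)
        one-end {p} {q} e f = trans (one-end-shape c (α k₂) (β k₂) p q)
          (cong₂ _+_ (cong₂ _*_ (α-closed k₂) e) (cong₂ _*_ (β-closed k₂) f))
        left₂ : c * c * P (u ∷ O₁) (u ∷ O₁) ≡ A₂ * ((1ℤ - C) * Dg + (C - w)) + B₂ * (1ℤ - C)
        left₂ = trans (cong (c * c *_) (perm-chain-a-a ch₂)) (one-end Mi.left Mi.none)
        right₂ : c * c * P (v ∷ O₁) (v ∷ O₁) ≡ A₂ * ((1ℤ - C) * Dg + (C - w)) + B₂ * (1ℤ - C)
        right₂ = trans (cong (c * c *_) (perm-chain-b-b ch₂)) (one-end Mi.right Mi.none)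
        none₂ : c * c * P O₁ O₁ ≡ A₂ * (1ℤ - C)
        none₂ = trans (cong (c * c *_) (perm-chain-∅-∅ ch₂)) (trans (none₂-shape c (α k₂) (P zs zs)) (cong₂ _*_ (α-closed k₂) Mi.none))
        cross₂ : c * c * P (u ∷ O₁) (v ∷ O₁) ≡ c * (A₂ * s ^ suc (length zs) + s ^ suc (suc k₂) * (1ℤ - C))
        cross₂ = trans (cong (c * c *_) (perm-chain-a-b ch₂)) (trans (cross₂-shape c (α k₂) (τ k₂) (P (u ∷ zs) (v ∷ zs)) (P zs zs))
          (cong (c *_) (cong₂ _+_ (cong₂ _*_ (α-closed k₂) Mi.cross) (cong₂ _*_ (τ-closed k₂) Mi.none))))
        close : ∀ {a b g t p q r z m a′ b′ g′ t′ p′ q′ r′ z′ m′} → a ≡ a′ → b ≡ b′ → g ≡ g′ → t ≡ t′ → p ≡ p′ → q ≡ q′ → r ≡ r′ → z ≡ z′ → m ≡ m′ →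
          a * p + b * (q + r) + g * z + c * t * (+ 2 * m) ≡ a′ * p′ + b′ * (q′ + r′) + g′ * z′ + c * t′ * (+ 2 * m′)
        close refl refl refl refl refl refl refl refl refl = refl
        θ′ : ℤ → ℤ → ℤ → ℤ → ℤ → ℤ → ℤ
        θ′ A B C ab ac bc = x₀ s * x₀ s - y₀ s * y₀ s * (A + B + C) + (1ℤ - s) * (1ℤ - s) * (A * B + A * C + B * C)
          - (+ 2 - s + s * s) * (+ 2 - s + s * s) * (A * B * C)
          + + 2 * ((1ℤ + s * s) * (1ℤ + s * s) * (ab * (1ℤ - C) + ac * (1ℤ - B) + bc * (1ℤ - A)))

module ShapeValues {n} (G : Graph n) where

  open import Defs using (degree)
  open import Data.Integer.Base as ℤ using (ℤ; 1ℤ; _+_; _*_)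
  open import Data.List.Base using (List; []; _∷_; _++_; length; allFin; reverse; _ʳ++_)
  import Data.List.Properties as L
  open import Data.List.Membership.Propositional.Properties using (∈-++⁺ˡ; ∈-++⁺ʳ; ∈-++⁻; ∈-allFin)
  open import Data.List.Relation.Binary.Permutation.Propositional using (_↭_; ↭-sym; ↭-trans; prep; swap; refl; ↭-reflexive)
  open import Data.List.Relation.Binary.Permutation.Propositional.Properties using (shift; shifts; ++⁺ˡ; ++⁺ʳ; ++-comm; ∈-resp-↭; ↭-length; ↭-reverse)
  open import Data.List.Relation.Unary.All as All using (All; []; _∷_)
  open import Data.List.Relation.Unary.Unique.Propositional using (Unique)
  open import Data.List.Relation.Unary.Unique.Propositional.Properties using (allFin⁺)
  open import Data.Nat.Base as ℕ using (ℕ; suc; z≤n; s≤s; _≤_)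
  open import Data.Nat.ListAction using (sum)
  open Walks G
  open Classification G
  open WalkPermanent G
  open ShapeFunctions using (dumbbell; θ; cycles)
  open Graph G

  open ListPermanent ℤ-isCSR using (perm)

  seg-length : ∀ {a xs} → Seg a a xs → 2 ≤ length xs
  seg-length ([] a~a)                 = contradiction a~a ~-irr
  seg-length (h ∷ [] _)               = contradiction refl (Nbr2.a≢b h)
  seg-length {xs = _ ∷ _ ∷ _} (_ ∷ _) = s≤s (s≤s z≤n)

  Nbr2-swap : ∀ {x a b} → Nbr2 x a b → Nbr2 x b a
  Nbr2-swap (nbr2 a≢b x~a x~b only) = nbr2 (λ eq → a≢b (sym eq)) x~b x~a λ h → Sum.swap (only h)

  seg-reverse : ∀ {a b xs} → Seg b a xs → Seg a b (reverse xs)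
  seg-reverse ([] a~b) = [] (~-sym a~b)
  seg-reverse {a} {b} {x ∷ xs} (h ∷ σ) = go xs [] σ ([] (Nbr2.x~a h)) h
    where
    go : ∀ {x} xs ys → Seg b x xs → Seg a x ys → Nbr2 x (next ys a) (next xs b) → Seg a b (xs ʳ++ x ∷ ys)
    go []       ys _       ρ h = Nbr2-swap h ∷ ρ
    go (y ∷ xs) ys (k ∷ σ) ρ h = go xs _ σ (Nbr2-swap h ∷ ρ) k

  length-flat : ∀ cs → length (flat cs) ≡ sum (total-length cs)
  length-flat []              = refl
  length-flat ((x , xs) ∷ cs) = cong suc (trans (L.length-++ xs) (cong (length xs ℕ.+_) (length-flat cs)))

  cycle-lengths : ∀ {cs} → All Cycle cs → All (3 ≤_) (total-length cs)
  cycle-lengths []              = []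
  cycle-lengths ((σ , _) ∷ cyc) = s≤s (seg-length σ) ∷ cycle-lengths cyc

  record Split (O rest : List V) : Set where
    field
      ks     : List ℕ
      3≤ks   : All (3 ≤_) ks
      value  : ∀ s → perm (M s) (allFin n) (allFin n) ≡ cycles ks s * perm (M s) O O
      size   : length O ℕ.+ sum ks ≡ n
      empty  : ks ≡ [] → rest ≡ []
      full   : rest ≡ [] → ks ≡ []

  split-cycles : ∀ O rest → allFin n ↭ O ++ rest → All (λ z → degree G z ≡ 2) rest → Closed [] rest → Split O rest
  split-cycles O rest vertices d2 closed = from (cycle-decomposition _ (λ eq → eq) (length rest) O rest ℕ.≤-refl vertices d2 closed)
    where
    from : (∃ λ cs → rest ↭ flat cs × All Cycle cs) → Split O rest
    from (cs , p , cyc) = record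
      { ks    = total-length cs
      ; 3≤ks  = cycle-lengths cyc
      ; value = λ s → trans (ListPermanent.Symmetric.perm-↭ ℤ-isCSR (M s) (M-sym s) q q) (At.perm-cycles s cs cyc (Unique-resp-↭ q (allFin⁺ n)))
      ; size  = trans (cong (length O ℕ.+_) (trans (sym (length-flat cs)) (sym (↭-length p))))
                  (trans (sym (L.length-++ O)) (trans (sym (↭-length vertices)) (L.length-tabulate {n = n} (λ i → i))))
      ; empty = none cs p
      ; full  = all cs p
      }
      where
      q : allFin n ↭ flat cs ++ O
      q = ↭-trans vertices (↭-trans (++⁺ˡ O p) (++-comm O (flat cs)))
      all : ∀ {R} cs → R ↭ flat cs → R ≡ [] → total-length cs ≡ []
      all []      p eq   = refl
      all (_ ∷ _) p refl = contradiction (↭-length p) λ ()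
      none : ∀ cs → rest ↭ flat cs → total-length cs ≡ [] → rest ≡ []
      none [] p _ = empty-list rest (↭-length p)
        where
        empty-list : ∀ (l : List V) → length l ≡ 0 → l ≡ []
        empty-list [] _ = refl

  private
    dumbbell-value-shape : ∀ x y z k → suc x ℕ.+ suc z ℕ.+ suc y ℕ.+ k ≡ suc (suc (suc (x ℕ.+ (y ℕ.+ z) ℕ.+ k)))
    dumbbell-value-shape = ℕ-solve-∀

    theta-value-shape : ∀ x y z k → suc (suc x) ℕ.+ suc (suc y) ℕ.+ suc z ℕ.+ k ≡ suc (suc (suc (suc x ℕ.+ (suc y ℕ.+ z) ℕ.+ k)))
    theta-value-shape = ℕ-solve-∀

  module _ {u v : V} (u≢v : u ≢ v) where

    private
      rest-2 : (∀ z → z ≢ u → z ≢ v → degree G z ≡ 2) → ∀ {O rest} → allFin n ↭ (u ∷ v ∷ O) ++ rest → All (λ z → degree G z ≡ 2) rest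
      rest-2 d2 {O} p = All.tabulate λ z∈ → d2 _ (λ { refl → off (here refl) z∈ }) (λ { refl → off (there (here refl)) z∈ })
        where
        off = unique-++-disjoint (u ∷ v ∷ O) (Unique-resp-↭ p (allFin⁺ n))

      front : ∀ {O rest} → allFin n ↭ O ++ rest → Unique O
      front {O} {rest} p = unique-++ʳ rest (Unique-resp-↭ (↭-trans p (++-comm O rest)) (allFin⁺ n))

      cong-length : ∀ (xs ys zs : List V) → length (xs ++ ys ++ zs) ≡ length xs ℕ.+ (length ys ℕ.+ length zs)
      cong-length xs ys zs = trans (L.length-++ xs) (cong (length xs ℕ.+_) (L.length-++ ys))

      assoc₃ : ∀ (xs ys zs ws : List V) → u ∷ v ∷ xs ++ ys ++ zs ++ ws ≡ (u ∷ v ∷ xs ++ ys ++ zs) ++ ws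
      assoc₃ xs ys zs ws = cong (λ l → u ∷ v ∷ l) (trans (cong (xs ++_) (sym (L.++-assoc ys zs ws))) (sym (L.++-assoc xs (ys ++ zs) ws)))

      into : ∀ c p d k → p ≡ k * d → c * p ≡ (c * d) * k
      into c p d k eq = trans (cong (c *_) (trans eq (ℤ.*-comm k d))) (sym (ℤ.*-assoc c d k))

    module _ (du : degree G u ≡ 3) (dv : degree G v ≡ 3) (d2 : ∀ z → z ≢ u → z ≢ v → degree G z ≡ 2) where

      record DumbbellValue (D : Dumbbell u≢v) : Set where
        open Dumbbell D
        field
          ks    : List ℕ
          3≤ks  : All (3 ≤_) ks
          value : ∀ s → let c = 1ℤ + s * s in c * (c * c) * perm (M s) (allFin n) (allFin n) ≡
                    dumbbell (suc (length xs)) (suc (length zs)) (suc (length ys)) s * cycles ks s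
          size  : suc (length xs) ℕ.+ suc (length zs) ℕ.+ suc (length ys) ℕ.+ sum ks ≡ suc n
          empty : ks ≡ [] → rest ≡ []
          full  : rest ≡ [] → ks ≡ []

      dumbbell-value : ∀ D → DumbbellValue D
      dumbbell-value D = record
        { ks = ks ; 3≤ks = 3≤ks ; empty = empty ; full = full
        ; value = λ s → trans (into (let c = 1ℤ + s * s in c * (c * c)) _ (perm (M s) O O) (cycles ks s) (value s))
                    (cong (_* cycles ks s) (At.Ends.loops-value s du dv u≢v segᵤᵤ segᵤᵥ segᵥᵥ direct (front vertices′)))
        ; size  = trans (trans (dumbbell-value-shape (length xs) (length ys) (length zs) (sum ks))
                    (cong (λ l → suc (suc (suc (l ℕ.+ sum ks)))) (sym (cong-length xs ys zs)))) (cong suc size) }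
        where
        open Dumbbell D
        O = u ∷ v ∷ xs ++ ys ++ zs
        vertices′ : allFin n ↭ O ++ rest
        vertices′ = ↭-trans vertices (↭-reflexive (assoc₃ xs ys zs rest))
        open Split (split-cycles O rest vertices′ (rest-2 d2 vertices′) closed)

      record ThetaValue (T : Theta u≢v) : Set where
        open Theta T
        field
          ks    : List ℕ
          3≤ks  : All (3 ≤_) ks
          value : ∀ s → let c = 1ℤ + s * s in c * (c * c) * perm (M s) (allFin n) (allFin n) ≡
                    θ (suc (suc (length xs))) (suc (suc (length ys))) (suc (length zs)) s * cycles ks s
          size  : suc (suc (length xs)) ℕ.+ suc (suc (length ys)) ℕ.+ suc (length zs) ℕ.+ sum ks ≡ suc n

      theta-value : ∀ T → ThetaValue T
      theta-value T = record
        { ks = ks ; 3≤ks = 3≤ks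
        ; value = λ s → trans (into (let c = 1ℤ + s * s in c * (c * c)) _ (perm (M s) O O) (cycles ks s) (value s))
                    (cong (_* cycles ks s) (At.Ends.chords-value s du dv u≢v seg₁ seg₂ seg₃ direct (front vertices′)))
        ; size  = trans (trans (theta-value-shape (length xs) (length ys) (length zs) (sum ks))
                    (cong (λ l → suc (suc (suc (l ℕ.+ sum ks)))) (sym (cong-length (x ∷ xs) (y ∷ ys) zs)))) (cong suc size) }
        where
        open Theta T
        O = u ∷ v ∷ (x ∷ xs) ++ (y ∷ ys) ++ zs
        vertices′ : allFin n ↭ O ++ rest
        vertices′ = ↭-trans vertices (↭-reflexive (assoc₃ (x ∷ xs) (y ∷ ys) zs rest))
        open Split (split-cycles O rest vertices′ (rest-2 d2 vertices′) closed)

    flip : Dumbbell u≢v → Dumbbell (λ eq → u≢v (sym eq))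
    flip D = record
      { xs = zs ; ys = reverse ys ; zs = xs ; rest = rest
      ; vertices = ↭-trans vertices (swap u v (↭-trans (exchange xs ys zs rest) (++⁺ˡ zs (++⁺ʳ (xs ++ rest) (↭-sym (↭-reverse ys))))))
      ; segᵤᵤ = segᵥᵥ ; segᵤᵥ = seg-reverse segᵤᵥ ; segᵥᵥ = segᵤᵤ
      ; direct = λ v~u → cong reverse (direct (~-sym v~u)) ; closed = closed }
      where
      open Dumbbell D
      exchange : ∀ (xs ys zs ws : List V) → xs ++ ys ++ zs ++ ws ↭ zs ++ ys ++ xs ++ ws
      exchange xs ys zs ws = ↭-trans (++⁺ˡ xs (shifts ys zs)) (↭-trans (shifts xs zs) (++⁺ˡ zs (shifts xs ys)))

    module Degrees (D : Dumbbell u≢v) (rest≡[] : Dumbbell.rest D ≡ []) where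
      open Dumbbell D

      list : allFin n ↭ u ∷ v ∷ xs ++ ys ++ zs
      list = ↭-trans vertices (↭-reflexive (cong (λ l → u ∷ v ∷ xs ++ ys ++ l) (trans (cong (zs ++_) rest≡[]) (L.++-identityʳ zs))))

      private
        uq : Unique (u ∷ v ∷ xs ++ ys ++ zs)
        uq = Unique-resp-↭ list (allFin⁺ n)

        u∉ : u ∉ xs ++ ys ++ zs
        u∉ h = unique-head uq (there h)

        v∉ : v ∉ xs ++ ys ++ zs
        v∉ = unique-head (unique-tail uq)

        loop-deg : ∀ {z w xs} → Seg w w xs → z ∉ xs → deg z xs ≡ same w z ℕ.+ same w z
        loop-deg ([] w~w)    z∉ = contradiction w~w ~-irr
        loop-deg σ@(_ ∷ _) z∉ = seg-deg σ z∉

        path-deg : ∀ {ys} → Seg v u ys → (u ~ v → ys ≡ []) → u ∉ ys → v ∉ ys →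
                   deg u (v ∷ ys) ≡ 1 × deg v (u ∷ ys) ≡ 1
        path-deg ([] u~v) _ _ _ = deg-yes [] u~v , deg-yes [] (~-sym u~v)
        path-deg {ys} σ@(_ ∷ _) direct u∉ v∉ =
          trans (deg-no ys u≁v) (trans (seg-deg σ u∉) (cong₂ ℕ._+_ (same-refl u) (same-≢ λ eq → u≢v (sym eq)))) ,
          trans (deg-no ys (λ h → u≁v (~-sym h))) (trans (seg-deg σ v∉) (cong₂ ℕ._+_ (same-≢ u≢v) (same-refl v)))
          where
          u≁v : ¬ u ~ v
          u≁v h with () ← direct h

        paths = path-deg segᵤᵥ direct (λ h → u∉ (∈-++⁺ʳ xs (∈-++⁺ˡ h))) (λ h → v∉ (∈-++⁺ʳ xs (∈-++⁺ˡ h)))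

        total : ∀ {a b} z → z ∉ xs → z ∉ zs → deg z (a ∷ b ∷ ys) ≡ 1 → allFin n ↭ a ∷ b ∷ xs ++ ys ++ zs →
                (same u z ℕ.+ same u z) ℕ.+ (same v z ℕ.+ same v z) ≡ 2 → degree G z ≡ 3
        total {a} {b} z z∉ z∉′ one p two = begin
          deg z (allFin n)                              ≡⟨ deg-↭ z (↭-trans p (↭-trans (prep a (↭-sym (shift b xs (ys ++ zs)))) (↭-sym (shift a xs (b ∷ ys ++ zs))))) ⟩
          deg z (xs ++ (a ∷ b ∷ ys) ++ zs)              ≡⟨ trans (deg-++ z xs _) (cong (deg z xs ℕ.+_) (deg-++ z (a ∷ b ∷ ys) zs)) ⟩
          deg z xs ℕ.+ (deg z (a ∷ b ∷ ys) ℕ.+ deg z zs) ≡⟨ cong (λ k → deg z xs ℕ.+ (k ℕ.+ deg z zs)) one ⟩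
          deg z xs ℕ.+ suc (deg z zs)                   ≡⟨ ℕ.+-suc (deg z xs) (deg z zs) ⟩
          suc (deg z xs ℕ.+ deg z zs)                   ≡⟨ cong suc (trans (cong₂ ℕ._+_ (loop-deg segᵤᵤ z∉) (loop-deg segᵥᵥ z∉′)) two) ⟩
          3                                             ∎
          where open ≡-Reasoning

      degree-u : degree G u ≡ 3
      degree-u = total u (λ h → u∉ (∈-++⁺ˡ h)) (λ h → u∉ (∈-++⁺ʳ xs (∈-++⁺ʳ ys h))) (trans (deg-no (v ∷ ys) ~-irr) (proj₁ paths)) list
        (cong₂ (λ x y → x ℕ.+ x ℕ.+ (y ℕ.+ y)) (same-refl u) (same-≢ {v} {u} λ eq → u≢v (sym eq)))

      degree-v : degree G v ≡ 3
      degree-v = total v (λ h → v∉ (∈-++⁺ˡ h)) (λ h → v∉ (∈-++⁺ʳ xs (∈-++⁺ʳ ys h))) (trans (deg-no (u ∷ ys) ~-irr) (proj₂ paths))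
        (↭-trans list (swap u v refl)) (cong₂ (λ x y → x ℕ.+ x ℕ.+ (y ℕ.+ y)) (same-≢ u≢v) (same-refl v))

      degree-other : ∀ z → z ≢ u → z ≢ v → degree G z ≡ 2
      degree-other z z≢u z≢v with ∈-resp-↭ list (∈-allFin z)
      ... | here eq          = contradiction eq z≢u
      ... | there (here eq)  = contradiction eq z≢v
      ... | there (there z∈) with ∈-++⁻ xs z∈
      ...   | inj₁ z∈xs = All.lookup (seg-degree segᵤᵤ) z∈xs
      ...   | inj₂ z∈′ with ∈-++⁻ ys z∈′
      ...     | inj₁ z∈ys = All.lookup (seg-degree segᵤᵥ) z∈ys
      ...     | inj₂ z∈zs = All.lookup (seg-degree segᵥᵥ) z∈zs

module DegreeMoments {n} (G : Graph n) where

  open import Defs using (degree; A)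
  open import Data.Integer.Base as ℤ using (ℤ; 0ℤ; 1ℤ; +_; -[1+_]; _+_; _*_; _-_; -_; _^_)
  open import Data.List.Base using (List; []; _∷_; _++_; length; allFin)
  open import Data.List.Membership.Propositional.Properties using (∈-allFin)
  open import Data.List.Relation.Binary.Permutation.Propositional using (_↭_; ↭-sym; ↭-trans; prep; swap; refl) renaming (trans to ↭-step)
  open import Data.List.Relation.Binary.Permutation.Propositional.Properties using (∈-resp-↭; shift)
  open import Data.List.Relation.Unary.All as All using (All; []; _∷_)
  open import Data.List.Relation.Unary.Unique.Propositional using (Unique)
  open import Data.List.Relation.Unary.AllPairs using ([]; _∷_)
  open import Data.List.Relation.Unary.Unique.Propositional.Properties using (allFin⁺)
  open import Data.Nat.Base as ℕ using (ℕ; zero; suc; z≤n; _≤_)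
  open import Data.Vec.Base using (Vec; []; _∷_)
  open Walks G
  open WalkPermanent G
  open Windows
  open Graph G

  open ListPermanent ℤ-isCSR using (perm; perm-∷; Σpick)

  private
    P : ℤ → List V → List V → ℤ
    P s = perm (M s)

  Σ : (V → ℤ) → List V → ℤ
  Σ f []       = 0ℤ
  Σ f (x ∷ xs) = f x + Σ f xs

  private
    Σ-↭-shape : ∀ a b c → a + (b + c) ≡ b + (a + c)
    Σ-↭-shape = solve-∀

  Σ-↭ : ∀ (f : V → ℤ) {xs ys} → xs ↭ ys → Σ f xs ≡ Σ f ys
  Σ-↭ f refl = refl
  Σ-↭ f (prep x p) = cong (λ t → f x + t) (Σ-↭ f p)
  Σ-↭ f {x ∷ y ∷ xs} {_ ∷ _ ∷ ys} (swap x y p) = trans (cong (λ t → f x + (f y + t)) (Σ-↭ f p)) (Σ-↭-shape (f x) (f y) (Σ f ys))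
  Σ-↭ f (↭-step p q) = trans (Σ-↭ f p) (Σ-↭ f q)

  private
    Win-Σpick-zero-term : ∀ t s → 0ℤ ≡ t * (0ℤ + s * 0ℤ)
    Win-Σpick-zero-term = solve-∀

  Win-Σpick : ∀ {k} (f : V → List V → ℤ → ℤ) (g : V → ℤ) xs → (∀ c ds → c ∷ ds ↭ xs → Win k (g c ∷ []) (f c ds)) →
    Win k (Σ g xs ∷ []) (λ s → Σpick (λ c ds → f c ds s) xs)
  Win-Σpick {k} f g [] h = win λ s → 0ℤ , Win-Σpick-zero-term (s ^ k) s
  Win-Σpick f g (x ∷ xs) h = h x xs refl ⊞ Win-Σpick (λ d ds → f d (x ∷ ds)) g xs λ c ds p → h c (x ∷ ds) (↭-trans (swap c x refl) (prep x p))

  private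
    Win-s*-shape : ∀ s z → s * z ≡ 1ℤ * (0ℤ + s * z)
    Win-s*-shape = solve-∀

  Win-s* : ∀ (g : ℤ → ℤ) → Win 0 (0ℤ ∷ []) (λ s → s * g s)
  Win-s* g = win λ s → g s , Win-s*-shape s (g s)

  Win-shift : ∀ {k w} {cs : Vec ℤ w} {f : ℤ → ℤ} → Win k cs f → Win (suc k) cs (λ s → s * f s)
  Win-shift {k} {cs = cs} {f} (win h) = win λ s → proj₁ (h s) ,
    trans (cong (s *_) (proj₂ (h s))) (sym (ℤ.*-assoc s (s ^ k) (eval cs s (proj₁ (h s)))))

  δ′ : V → ℤ
  δ′ x = + degree G x - + 2

  private
    step-shape : ∀ s d z r → (1ℤ + d * s - s * s) * (1ℤ * (1ℤ + s * z)) + s * r ≡ 1ℤ * (1ℤ + s * (z + (d - s) * (1ℤ + s * z) + r))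
    step-shape = solve-∀

    M-δ-shape : ∀ s k → (1ℤ - + 2 * s - s * s) + s * k ≡ 1ℤ + (k - + 2) * s - s * s
    M-δ-shape = solve-∀

    diagonal-shape : ∀ s → 1ℤ ≡ 1ℤ * (1ℤ + s * 0ℤ)
    diagonal-shape = solve-∀

    transposed-[a]≡ : ∀ a → a * 1ℤ + 0ℤ ≡ a
    transposed-[a]≡ = solve-∀

    Σ-0 : ∀ xs → Σ (λ _ → 0ℤ) xs ≡ 0ℤ
    Σ-0 []       = refl
    Σ-0 (x ∷ xs) = trans (ℤ.+-identityˡ _) (Σ-0 xs)

    M-δ : ∀ s x → M s x x ≡ 1ℤ + δ′ x * s - s * s
    M-δ s x = trans (M-diag s x) (M-δ-shape s (+ degree G x))

    off-diagonal : ∀ c rs cs → c ∉ cs → Win 0 (0ℤ ∷ []) (λ s → P s (c ∷ rs) cs)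
    off-diagonal c rs cs c∉ = win-ext (λ s → sym (perm-∷ (M s) c rs cs)) (win-cs (cong (_∷ []) (Σ-0 cs))
      (Win-Σpick (λ d ds s → M s c d * P s rs ds) (λ _ → 0ℤ) cs λ d ds p →
        win-ext (λ s → trans (sym (ℤ.*-assoc s (A G c d) (P s rs ds))) (cong (_* P s rs ds) (sym (M-off s λ { refl → c∉ (∈-resp-↭ p (here refl)) }))))
          (Win-s* (λ s → A G c d * P s rs ds))))

    diagonal : ∀ xs → Unique xs → Win 0 (1ℤ ∷ []) (λ s → P s xs xs)
    diagonal [] _ = win λ s → 0ℤ , trans (ListPermanent.perm-[] ℤ-isCSR (M s)) (diagonal-shape s)
    diagonal (x ∷ xs) uq@(x∉ ∷ u) = win-ext (λ s → trans
        (cong₂ (λ t r → r * P s xs xs + t) (sym (tail-term s)) (sym (M-δ s x))) (sym (perm-∷ (M s) x xs (x ∷ xs))))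
      (step (diagonal xs u))
      where
      rest : ℤ → ℤ
      rest s = Σpick (λ c ds → A G x c * P s xs (x ∷ ds)) xs
      tail-term : ∀ s → Σpick (λ c ds → M s x c * P s xs (x ∷ ds)) xs ≡ s * rest s
      tail-term s = trans (go xs (λ ds → P s xs (x ∷ ds)) x∉) (sym (ListPermanent.*-Σpick ℤ-isCSR s (λ c ds → A G x c * P s xs (x ∷ ds)) xs))
        where
        go : ∀ ys (h : List V → ℤ) → All (x ≢_) ys → Σpick (λ c ds → M s x c * h ds) ys ≡ Σpick (λ c ds → s * (A G x c * h ds)) ys
        go []       h []         = refl
        go (y ∷ ys) h (x≢y ∷ zs) = cong₂ _+_ (trans (cong (_* h ys) (M-off s x≢y)) (ℤ.*-assoc s (A G x y) (h ys))) (go ys (λ ds → h (y ∷ ds)) zs)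
      step : Win 0 (1ℤ ∷ []) (λ s → P s xs xs) → Win 0 (1ℤ ∷ []) (λ s → (1ℤ + δ′ x * s - s * s) * P s xs xs + s * rest s)
      step (win h) = win λ s → let z , eq = h s in
        z + (δ′ x - s) * (1ℤ + s * z) + rest s , trans (cong (λ p → (1ℤ + δ′ x * s - s * s) * p + s * rest s) eq) (step-shape s (δ′ x) z (rest s))

    A² : ∀ x y → A G x y * A G x y ≡ A G x y
    A² x y = go (x ~? y)
      where
      go : Dec (x ~ y) → A G x y * A G x y ≡ A G x y
      go (yes h) rewrite A-adj h    = refl
      go (no h)  rewrite A-nonadj h = refl

    transposed : ∀ x xs c ds → Unique (x ∷ xs) → c ∷ ds ↭ xs → Win 1 (A G x c ∷ []) (λ s → P s xs (x ∷ ds))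
    transposed x xs c ds uq p = win-ext (λ s → sym (shape s)) (win-cs (cong (_∷ []) (transposed-[a]≡ (A G x c)))
        (win-ext (λ s → trans (sym (ℤ.*-assoc s (A G x c) (P s ds ds))) (cong (_* P s ds ds) (sym (M-off s x≢c)))) (Win-shift (A G x c ⊡ diagonal ds (unique-tail uq′)))
         ⊞ win-cs (cong (_∷ []) (Σ-0 ds)) (Win-Σpick (λ d es s → M s x d * P s ds (c ∷ es)) (λ _ → 0ℤ) ds λ d es q →
             win-ext (λ s → trans (cong (λ t → s * (A G x d * t)) (ListPermanent.Symmetric.perm-transpose ℤ-isCSR (M s) (M-sym s) (c ∷ es) ds))
                 (trans (sym (ℤ.*-assoc s (A G x d) (P s ds (c ∷ es)))) (cong (_* P s ds (c ∷ es)) (sym (M-off s (x≢ (∈-resp-↭ q (here refl))))))))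
               (Win-shift (win-cs (cong (_∷ []) (ℤ.*-zeroʳ (A G x d))) (A G x d ⊡ off-diagonal c es ds (unique-head uq′)))))))
      where
      uq′ : Unique (c ∷ ds)
      uq′ = Unique-resp-↭ (↭-sym p) (unique-tail uq)
      x≢ : ∀ {d} → d ∈ ds → x ≢ d
      x≢ d∈ refl = unique-head uq (∈-resp-↭ p (there d∈))
      x≢c : x ≢ c
      x≢c refl = unique-head uq (∈-resp-↭ p (here refl))
      shape : ∀ s → P s xs (x ∷ ds) ≡ M s x c * P s ds ds + Σpick (λ d es → M s x d * P s ds (c ∷ es)) ds
      shape s = trans (ListPermanent.Symmetric.perm-transpose ℤ-isCSR (M s) (M-sym s) xs (x ∷ ds)) (trans (ListPermanent.perm-↭ʳ ℤ-isCSR (M s) (x ∷ ds) (↭-sym p))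
        (perm-∷ (M s) x ds (c ∷ ds)))

  e₂ : List V → ℤ
  e₂ []       = 0ℤ
  e₂ (x ∷ xs) = e₂ xs + δ′ x * Σ δ′ xs - 1ℤ + Σ (A G x) xs

  private
    second-order-shape : ∀ s d S e a z y → (1ℤ + d * s - s * s) * (1ℤ * (1ℤ + s * (S + s * (e + s * z)))) + s * (s * 1ℤ) * (a + s * y) ≡
      1ℤ * (1ℤ + s * (d + S + s * (e + d * S - 1ℤ + a + s * (z + d * (e + s * z) - (S + s * (e + s * z)) + y))))
    second-order-shape = solve-∀

    second-order-shape₁ : ∀ s → 1ℤ ≡ 1ℤ * (1ℤ + s * (0ℤ + s * (0ℤ + s * 0ℤ)))
    second-order-shape₁ = solve-∀

  second-order : ∀ xs → Unique xs → Win 0 (1ℤ ∷ Σ δ′ xs ∷ e₂ xs ∷ []) (λ s → P s xs xs)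
  second-order [] _ = win λ s → 0ℤ , trans (ListPermanent.perm-[] ℤ-isCSR (M s)) (second-order-shape₁ s)
  second-order (x ∷ xs) uq@(x∉ ∷ u) = win-ext (λ s → trans (cong (_+ rest s) (cong (_* P s xs xs) (sym (M-δ s x)))) (sym (perm-∷ (M s) x xs (x ∷ xs))))
    (combine (second-order xs u) (win-cs (cong (_∷ []) (Σ-cong xs)) (Win-Σpick (λ c ds s → M s x c * P s xs (x ∷ ds)) (λ c → A G x c * A G x c) xs
      λ c ds p → win-ext (λ s → trans (sym (ℤ.*-assoc s (A G x c) (P s xs (x ∷ ds)))) (cong (_* P s xs (x ∷ ds)) (sym (M-off s λ { refl → unique-head uq (∈-resp-↭ p (here refl)) }))))
        (Win-shift (A G x c ⊡ transposed x xs c ds uq p)))))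
    where
    rest : ℤ → ℤ
    rest s = Σpick (λ c ds → M s x c * P s xs (x ∷ ds)) xs
    Σ-cong : ∀ ys → Σ (λ c → A G x c * A G x c) ys ≡ Σ (A G x) ys
    Σ-cong []       = refl
    Σ-cong (y ∷ ys) = cong₂ _+_ (A² x y) (Σ-cong ys)
    combine : ∀ {S e a : ℤ} → Win 0 (1ℤ ∷ S ∷ e ∷ []) (λ s → P s xs xs) → Win 2 (a ∷ []) rest →
      Win 0 (1ℤ ∷ δ′ x + S ∷ e + δ′ x * S - 1ℤ + a ∷ []) (λ s → (1ℤ + δ′ x * s - s * s) * P s xs xs + rest s)
    combine {S} {e} {a} (win h) (win k) = win λ s → let z , p = h s; y , q = k s in
      z + δ′ x * (e + s * z) - (S + s * (e + s * z)) + y , trans (cong₂ (λ t r → (1ℤ + δ′ x * s - s * s) * t + r) p q) (second-order-shape s (δ′ x) S e a z y)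

  private
    Σ²-col-shape : ∀ a b c d → a + b + (c + d) ≡ a + c + (b + d)
    Σ²-col-shape = solve-∀

    e₂-closed-shape₁ : ∀ e d S a → + 2 * (e + d * S - 1ℤ + a) ≡ + 2 * e + + 2 * (d * S - 1ℤ + a)
    e₂-closed-shape₁ = solve-∀

    e₂-closed-shape₂ : ∀ d S Q l t a → S * S - Q - + 2 * l + t + + 2 * (d * S - 1ℤ + a) ≡
      (d + S) * (d + S) - (d * d + Q) - + 2 * (1ℤ + l) + (0ℤ + a + (a + t))
    e₂-closed-shape₂ = solve-∀

    Σ²-all-shape : ∀ k S l → k + (S + + 2 * l) ≡ k - + 2 + S + + 2 * (1ℤ + l)
    Σ²-all-shape = solve-∀

    Σ² : List V → List V → ℤ
    Σ² xs ys = Σ (λ x → Σ (A G x) ys) xs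

    Σ²-col : ∀ y xs ys → Σ² xs (y ∷ ys) ≡ Σ (A G y) xs + Σ² xs ys
    Σ²-col y []       ys = refl
    Σ²-col y (x ∷ xs) ys = trans (cong₂ (λ a t → a + Σ (A G x) ys + t) (A-sym x y) (Σ²-col y xs ys)) (Σ²-col-shape (A G y x) (Σ (A G x) ys) (Σ (A G y) xs) (Σ² xs ys))

    e₂-closed : ∀ xs → + 2 * e₂ xs ≡ Σ δ′ xs * Σ δ′ xs - Σ (λ x → δ′ x * δ′ x) xs - + 2 * Σ (λ _ → 1ℤ) xs + Σ² xs xs
    e₂-closed []       = refl
    e₂-closed (x ∷ xs) = trans (e₂-closed-shape₁ (e₂ xs) (δ′ x) (Σ δ′ xs) (Σ (A G x) xs))
      (trans (cong (λ t → t + + 2 * (δ′ x * Σ δ′ xs - 1ℤ + Σ (A G x) xs)) (e₂-closed xs))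
      (trans (e₂-closed-shape₂ (δ′ x) (Σ δ′ xs) (Σ (λ x → δ′ x * δ′ x) xs) (Σ (λ _ → 1ℤ) xs) (Σ² xs xs) (Σ (A G x) xs))
        (cong (λ t → (δ′ x + Σ δ′ xs) * (δ′ x + Σ δ′ xs) - (δ′ x * δ′ x + Σ (λ x → δ′ x * δ′ x) xs) - + 2 * (1ℤ + Σ (λ _ → 1ℤ) xs) + t)
          (sym (cong₂ (λ a t → a + Σ (A G x) xs + t) (A-nonadj ~-irr) (Σ²-col x xs xs))))))

    Σ-A : ∀ x ys → Σ (A G x) ys ≡ + deg x ys
    Σ-A x []       = refl
    Σ-A x (y ∷ ys) = go (x ~? y)
      where
      go : Dec (x ~ y) → A G x y + Σ (A G x) ys ≡ + deg x (y ∷ ys)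
      go (yes h) = trans (cong₂ _+_ (A-adj h) (Σ-A x ys)) (cong +_ (sym (deg-yes ys h)))
      go (no h)  = trans (cong₂ _+_ (A-nonadj h) (Σ-A x ys)) (trans (ℤ.+-identityˡ _) (cong +_ (sym (deg-no ys h))))

    Σ²-all : ∀ xs → Σ² xs (allFin n) ≡ Σ δ′ xs + + 2 * Σ (λ _ → 1ℤ) xs
    Σ²-all []       = refl
    Σ²-all (x ∷ xs) = trans (cong₂ _+_ (Σ-A x (allFin n)) (Σ²-all xs)) (Σ²-all-shape (+ degree G x) (Σ δ′ xs) (Σ (λ _ → 1ℤ) xs))

  S₁ S₂ : ℤ
  S₁ = Σ δ′ (allFin n)
  S₂ = Σ (λ x → δ′ x * δ′ x) (allFin n)

  private
    degree-window-shape : ∀ a b l S → a - b - + 2 * l + (S + + 2 * l) ≡ a - b + S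
    degree-window-shape = solve-∀

  degree-window : ∃ λ e → + 2 * e ≡ S₁ * S₁ - S₂ + S₁ × Win 0 (1ℤ ∷ S₁ ∷ e ∷ []) (λ s → P s (allFin n) (allFin n))
  degree-window = e₂ (allFin n) ,
    trans (e₂-closed (allFin n)) (trans (cong (λ t → S₁ * S₁ - S₂ - + 2 * Σ (λ _ → 1ℤ) (allFin n) + t) (Σ²-all (allFin n)))
      (degree-window-shape (S₁ * S₁) S₂ (Σ (λ _ → 1ℤ) (allFin n)) S₁)) ,
    second-order (allFin n) (allFin⁺ n)

  Dumbbell-degrees : Set
  Dumbbell-degrees = ∃₂ λ u v → u ≢ v × degree G u ≡ 3 × degree G v ≡ 3 × (∀ z → z ≢ u → z ≢ v → degree G z ≡ 2)

  private
    from-δ-shape : ∀ d → d ≡ + 2 + (d - + 2)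
    from-δ-shape = solve-∀

    NonNeg-pred-shape : ∀ k → k * (1ℤ + k) ≡ (1ℤ + k) * (1ℤ + k) - (1ℤ + k)
    NonNeg-pred-shape = solve-∀

    zero-or-one-shape : ∀ i → i * (i - 1ℤ) ≡ i * i - i
    zero-or-one-shape = solve-∀

    from-δ : ∀ {x} k → δ′ x ≡ + k → degree G x ≡ 2 ℕ.+ k
    from-δ {x} k eq = ℤ.+-injective (trans (from-δ-shape (+ degree G x)) (cong (λ t → + 2 + t) eq))

    NonNeg-pred : ∀ i → 0ℤ ℤ.≤ i * i - i
    NonNeg-pred (+ zero)  = ℤ.+≤+ z≤n
    NonNeg-pred (+ suc k) = subst (0ℤ ℤ.≤_) (trans (ℤ.pos-* k (suc k)) (NonNeg-pred-shape (+ k))) (ℤ.+≤+ z≤n)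
    NonNeg-pred -[1+ k ]  = ℤ.+≤+ z≤n

    Σ-nonneg : ∀ {f} → (∀ x → 0ℤ ℤ.≤ f x) → ∀ xs → 0ℤ ℤ.≤ Σ f xs
    Σ-nonneg h []       = ℤ.≤-refl
    Σ-nonneg h (x ∷ xs) = ℤ.+-mono-≤ (h x) (Σ-nonneg h xs)

    Σ≡0⇒All≡0 : ∀ {f} → (∀ x → 0ℤ ℤ.≤ f x) → ∀ xs → Σ f xs ≡ 0ℤ → All (λ x → f x ≡ 0ℤ) xs
    Σ≡0⇒All≡0 h []       eq = []
    Σ≡0⇒All≡0 {f} h (x ∷ xs) eq = fx≡0 ∷ Σ≡0⇒All≡0 h xs (trans (sym (trans (cong (λ t → t + Σ f xs) fx≡0) (ℤ.+-identityˡ _))) eq)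
      where
      fx≡0 : f x ≡ 0ℤ
      fx≡0 = ℤ.≤-antisym (subst₂ ℤ._≤_ (ℤ.+-identityʳ (f x)) eq (ℤ.+-monoʳ-≤ (f x) (Σ-nonneg h xs))) (h x)

    zero-or-one : ∀ i → i * i - i ≡ 0ℤ → i ≡ 0ℤ ⊎ i ≡ 1ℤ
    zero-or-one i eq = Sum.map₂ (λ e → ℤ.i-j≡0⇒i≡j i 1ℤ e) (ℤ.i*j≡0⇒i≡0∨j≡0 i (trans (zero-or-one-shape i) eq))

    record Sorted (xs : List V) : Set where
      field
        {ones zeros} : List V
        split        : xs ↭ ones ++ zeros
        ones-1       : All (λ x → δ′ x ≡ 1ℤ) ones
        zeros-0      : All (λ x → δ′ x ≡ 0ℤ) zeros
        count-1      : Σ δ′ xs ≡ + length ones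

    sorted : ∀ xs → All (λ x → δ′ x ≡ 0ℤ ⊎ δ′ x ≡ 1ℤ) xs → Sorted xs
    sorted []       []       = record { ones = [] ; zeros = [] ; split = refl ; ones-1 = [] ; zeros-0 = [] ; count-1 = refl }
    sorted (x ∷ xs) (h ∷ hs) = add h
      where
      open Sorted (sorted xs hs)
      add : δ′ x ≡ 0ℤ ⊎ δ′ x ≡ 1ℤ → Sorted (x ∷ xs)
      add (inj₁ eq) = record { split = ↭-trans (prep x split) (↭-sym (shift x ones zeros)) ; ones-1 = ones-1 ; zeros-0 = eq ∷ zeros-0
                             ; count-1 = trans (cong₂ _+_ eq count-1) (ℤ.+-identityˡ _) }
      add (inj₂ eq) = record { split = prep x split ; ones-1 = eq ∷ ones-1 ; zeros-0 = zeros-0 ; count-1 = cong₂ _+_ eq count-1 }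

    dumbbell-degrees-shape : ∀ a b c d → a - b + (c - d) ≡ a + c - (b + d)
    dumbbell-degrees-shape = solve-∀

  dumbbell-degrees : S₁ ≡ + 2 → S₂ ≡ + 2 → Dumbbell-degrees
  dumbbell-degrees e₁ e₂ = from (sorted (allFin n) (All.map (λ {x} → zero-or-one (δ′ x))
      (Σ≡0⇒All≡0 (λ x → NonNeg-pred (δ′ x)) (allFin n) (trans (Σ-- (allFin n)) (cong₂ _-_ e₂ e₁)))))
    where
    Σ-- : ∀ xs → Σ (λ x → δ′ x * δ′ x - δ′ x) xs ≡ Σ (λ x → δ′ x * δ′ x) xs - Σ δ′ xs
    Σ-- []       = refl
    Σ-- (x ∷ xs) = trans (cong (λ t → δ′ x * δ′ x - δ′ x + t) (Σ-- xs)) (dumbbell-degrees-shape (δ′ x * δ′ x) (δ′ x) (Σ (λ x → δ′ x * δ′ x) xs) (Σ δ′ xs))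
    from : Sorted (allFin n) → Dumbbell-degrees
    from S = two ones split ones-1 (ℤ.+-injective (trans (sym count-1) e₁))
      where
      open Sorted S
      two : ∀ l → allFin n ↭ l ++ zeros → All (λ x → δ′ x ≡ 1ℤ) l → length l ≡ 2 → Dumbbell-degrees
      two (u ∷ v ∷ []) p ls refl = u , v , (λ { refl → unique-head uq (here refl) }) , at (here refl) , at (there (here refl)) , other
        where
        uq : Unique (u ∷ v ∷ zeros)
        uq = Unique-resp-↭ p (allFin⁺ n)
        at : ∀ {z} → z ∈ u ∷ v ∷ [] → degree G z ≡ 3
        at z∈ = from-δ 1 (All.lookup ls z∈)
        other : ∀ z → z ≢ u → z ≢ v → degree G z ≡ 2
        other z z≢u z≢v with ∈-resp-↭ p (∈-allFin z)
        ... | here eq          = contradiction eq z≢u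
        ... | there (here eq)  = contradiction eq z≢v
        ... | there (there z∈) = from-δ 0 (All.lookup zeros-0 z∈)

  private
    dumbbell-degrees⇒-shape : ∀ k → + 2 + k - + 2 ≡ k
    dumbbell-degrees⇒-shape = solve-∀

  dumbbell-degrees⇒ : Dumbbell-degrees → S₁ ≡ + 2 × S₂ ≡ + 2
  dumbbell-degrees⇒ (u , v , u≢v , du , dv , d2) = total δ′ (δ≡ u 1 du) (δ≡ v 1 dv) (λ x eq → δ≡ x 0 eq) ,
      total (λ x → δ′ x * δ′ x) (square (δ≡ u 1 du)) (square (δ≡ v 1 dv)) (λ x eq → square (δ≡ x 0 eq))
    where
    square : ∀ {i j : ℤ} → i ≡ j → i * i ≡ j * j
    square refl = refl
    δ≡ : ∀ x k → degree G x ≡ 2 ℕ.+ k → δ′ x ≡ + k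
    δ≡ x k eq = trans (cong (λ d → + d - + 2) eq) (dumbbell-degrees⇒-shape (+ k))
    order : ∃ λ zs → u ∷ v ∷ zs ↭ allFin n
    order = from (pull (∈-allFin u))
      where
      from : (∃ λ us → u ∷ us ↭ allFin n) → ∃ λ zs → u ∷ v ∷ zs ↭ allFin n
      from (us , p) with ∈-resp-↭ (↭-sym p) (∈-allFin v)
      ... | here eq = contradiction (sym eq) u≢v
      ... | there h = proj₁ (pull h) , ↭-trans (prep u (proj₂ (pull h))) p
    zs = proj₁ order
    uq : Unique (u ∷ v ∷ zs)
    uq = Unique-resp-↭ (↭-sym (proj₂ order)) (allFin⁺ n)
    total : ∀ (f : V → ℤ) → f u ≡ 1ℤ → f v ≡ 1ℤ → (∀ x → degree G x ≡ 2 → f x ≡ 0ℤ) → Σ f (allFin n) ≡ + 2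
    total f fu fv f0 = trans (sym (Σ-↭ f (proj₂ order))) (cong₂ _+_ fu (cong₂ _+_ fv (vanish zs λ h → f0 _ (d2 _
        (λ { refl → unique-head uq (there h) }) (λ { refl → unique-head (unique-tail uq) h })))))
      where
      vanish : ∀ xs → (∀ {x} → x ∈ xs → f x ≡ 0ℤ) → Σ f xs ≡ 0ℤ
      vanish []       h = refl
      vanish (x ∷ xs) h = cong₂ _+_ (h (here refl)) (vanish xs λ z∈ → h (there z∈))

module Isomorphism where

  open import Defs using (_≅_)
  open import Data.Fin.Base using (Fin)
  open import Data.Fin.Permutation using (permutation)
  open import Data.Fin.Properties using (_≟_)
  open import Data.List.Base using (List; []; _∷_; _++_; map; length; allFin)
  import Data.List.Properties as L
  open import Data.List.Membership.Propositional.Properties using (∈-++⁺ˡ; ∈-++⁺ʳ; ∈-++⁻; ∈-allFin; ∈-map⁺)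
  open import Data.List.Relation.Binary.Permutation.Propositional using (_↭_)
  open import Data.List.Relation.Binary.Permutation.Propositional.Properties using (∈-resp-↭)
  open import Data.List.Relation.Unary.All as All using (All; []; _∷_)
  import Data.List.Relation.Unary.All.Properties as All
  open import Data.List.Relation.Unary.Unique.Propositional using (Unique)
  open import Data.List.Relation.Unary.AllPairs using ([]; _∷_)
  open import Data.List.Relation.Unary.Unique.Propositional.Properties using (allFin⁺)
  open import Data.Nat.Base as ℕ using (ℕ; suc)
  open import Function.Bundles using (mk⇔)

  module _ {V : Set} where

    pairs : V → List V → V → List (V × V)
    pairs a []       b = (a , b) ∷ []
    pairs a (x ∷ xs) b = (a , x) ∷ pairs x xs b

    Joined : List (V × V) → V → V → Set
    Joined E x y = (x , y) ∈ E ⊎ (y , x) ∈ E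

  both : ∀ {V W : Set} → (V → W) → V × V → W × W
  both f (x , y) = f x , f y

  pairs-map : ∀ {V W : Set} (f : V → W) a xs b → map (both f) (pairs a xs b) ≡ pairs (f a) (map f xs) (f b)
  pairs-map f a []       b = refl
  pairs-map f a (x ∷ xs) b = cong (_ ∷_) (pairs-map f x xs b)

  module Edges {n} (G : Graph n) {u v : Fin n} (u≢v : u ≢ v) where
    open Graph G
    open Walks G
    open Classification G
    open ShapeValues G

    seg⇒edges : ∀ {b a xs} → Seg b a xs → All (λ (x , y) → x ~ y) (pairs a xs b)
    seg⇒edges ([] a~b) = a~b ∷ []
    seg⇒edges (h ∷ σ)  = ~-sym (Nbr2.x~a h) ∷ seg⇒edges σ

    first-pair : ∀ {x} xs {b} → (x , next xs b) ∈ pairs x xs b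
    first-pair []      = here refl
    first-pair (_ ∷ _) = here refl

    interior : ∀ {b a xs x y} → Seg b a xs → x ∈ xs → x ~ y → Joined (pairs a xs b) x y
    interior {xs = _ ∷ xs} (h ∷ σ) (here refl) x~y with Nbr2.only h x~y
    ... | inj₁ refl = inj₂ (here refl)
    ... | inj₂ refl = inj₁ (there (first-pair xs))
    interior (h ∷ σ) (there x∈) x~y = Sum.map there there (interior σ x∈ x~y)

    module _ (D : Dumbbell u≢v) (rest≡[] : Dumbbell.rest D ≡ []) where
      open Dumbbell D
      open Degrees u≢v D rest≡[] using (list)

      edges : List (Fin n × Fin n)
      edges = pairs u xs u ++ pairs u ys v ++ pairs v zs v

      joined⇒~ : ∀ {x y} → Joined edges x y → x ~ y
      joined⇒~ = Sum.[ at , (λ h → ~-sym (at h)) ]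
        where
        at : ∀ {x y} → (x , y) ∈ edges → x ~ y
        at = All.lookup (All.++⁺ (seg⇒edges segᵤᵤ) (All.++⁺ (seg⇒edges segᵤᵥ) (seg⇒edges segᵥᵥ)))

      private
        inside : ∀ {x y} → x ∈ xs ++ ys ++ zs → x ~ y → Joined edges x y
        inside x∈ x~y with ∈-++⁻ xs x∈
        ... | inj₁ h = Sum.map ∈-++⁺ˡ ∈-++⁺ˡ (interior segᵤᵤ h x~y)
        ... | inj₂ h with ∈-++⁻ ys h
        ...   | inj₁ h′ = Sum.map (λ k → ∈-++⁺ʳ (pairs u xs u) (∈-++⁺ˡ k)) (λ k → ∈-++⁺ʳ (pairs u xs u) (∈-++⁺ˡ k)) (interior segᵤᵥ h′ x~y)
        ...   | inj₂ h′ = Sum.map up up (interior segᵥᵥ h′ x~y)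
          where
          up : ∀ {e} → e ∈ pairs v zs v → e ∈ edges
          up k = ∈-++⁺ʳ (pairs u xs u) (∈-++⁺ʳ (pairs u ys v) k)

        bridge : u ~ v → (u , v) ∈ edges
        bridge u~v = ∈-++⁺ʳ (pairs u xs u) (∈-++⁺ˡ (subst (λ l → (u , v) ∈ pairs u l v) (sym (direct u~v)) (here refl)))

        position : ∀ x → x ≡ u ⊎ x ≡ v ⊎ x ∈ xs ++ ys ++ zs
        position x with ∈-resp-↭ list (∈-allFin x)
        ... | here eq         = inj₁ eq
        ... | there (here eq) = inj₂ (inj₁ eq)
        ... | there (there h) = inj₂ (inj₂ h)

      ~⇒joined : ∀ {x y} → x ~ y → Joined edges x y
      ~⇒joined {x} {y} x~y with position x | position y
      ... | inj₂ (inj₂ x∈)   | _                = inside x∈ x~y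
      ... | inj₁ _           | inj₂ (inj₂ y∈)   = Sum.swap (inside y∈ (~-sym x~y))
      ... | inj₂ (inj₁ _)    | inj₂ (inj₂ y∈)   = Sum.swap (inside y∈ (~-sym x~y))
      ... | inj₁ refl        | inj₁ refl        = contradiction x~y ~-irr
      ... | inj₂ (inj₁ refl) | inj₂ (inj₁ refl) = contradiction x~y ~-irr
      ... | inj₁ refl        | inj₂ (inj₁ refl) = inj₁ (bridge x~y)
      ... | inj₂ (inj₁ refl) | inj₁ refl        = inj₂ (bridge (~-sym x~y))

  module _ {m : ℕ} {W : Set} where

    -- Junk value w outside the first list.
    assoc : List (Fin m) → List W → W → Fin m → W
    assoc []       _        w x = w
    assoc (_ ∷ _)  []       w x = w
    assoc (y ∷ ys) (z ∷ zs) w x with x ≟ y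
    ... | yes _ = z
    ... | no _  = assoc ys zs w x

    map-assoc : ∀ ys zs w → Unique ys → length ys ≡ length zs → map (assoc ys zs w) ys ≡ zs
    map-assoc []       []       w _         _  = refl
    map-assoc (y ∷ ys) (z ∷ zs) w (y∉ ∷ uq) eq = cong₂ _∷_ head (trans (tail ys y∉) (map-assoc ys zs w uq (ℕ.suc-injective eq)))
      where
      head : assoc (y ∷ ys) (z ∷ zs) w y ≡ z
      head with y ≟ y
      ... | yes _  = refl
      ... | no y≢y = contradiction refl y≢y
      other : ∀ x → y ≢ x → assoc (y ∷ ys) (z ∷ zs) w x ≡ assoc ys zs w x
      other x y≢x with x ≟ y
      ... | yes eq = contradiction (sym eq) y≢x
      ... | no _   = refl
      tail : ∀ xs → All (y ≢_) xs → map (assoc (y ∷ ys) (z ∷ zs) w) xs ≡ map (assoc ys zs w) xs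
      tail []       []       = refl
      tail (x ∷ xs) (h ∷ hs) = cong₂ _∷_ (other x h) (tail xs hs)

  map-fixed : ∀ {V : Set} (h : V → V) xs → map h xs ≡ xs → ∀ {x} → x ∈ xs → h x ≡ x
  map-fixed h (x ∷ xs) eq (here refl) = L.∷-injectiveˡ eq
  map-fixed h (x ∷ xs) eq (there x∈)  = map-fixed h xs (L.∷-injectiveʳ eq) x∈

  ++-split : ∀ {V : Set} (xs xs′ : List V) {ys ys′} → length xs ≡ length xs′ → xs ++ ys ≡ xs′ ++ ys′ → xs ≡ xs′ × ys ≡ ys′
  ++-split []       []         _ eq = refl , eq
  ++-split (x ∷ xs) (x′ ∷ xs′) l eq with p , q ← ++-split xs xs′ (ℕ.suc-injective l) (L.∷-injectiveʳ eq) =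
    cong₂ _∷_ (L.∷-injectiveˡ eq) p , q

  module _ {m n : ℕ} {G : Graph m} {H : Graph n} {u v : Fin m} {u′ v′ : Fin n} {u≢v : u ≢ v} {u′≢v′ : u′ ≢ v′} where
    private
      module G = Graph G
      module H = Graph H
    open Classification.Dumbbell using (xs; ys; zs; rest)

    dumbbell-map : (D : Classification.Dumbbell G u≢v) (D′ : Classification.Dumbbell H u′≢v′) (e : rest D ≡ []) (e′ : rest D′ ≡ []) →
      length (xs D) ≡ length (xs D′) → length (ys D) ≡ length (ys D′) →
      ∀ f → map f (u ∷ v ∷ xs D ++ ys D ++ zs D) ≡ u′ ∷ v′ ∷ xs D′ ++ ys D′ ++ zs D′ → ∀ {x y} → x G.~ y → f x H.~ f y
    dumbbell-map D D′ e e′ lx ly f eq x~y = joined⇒~ D′ e′ (Sum.map image image (EG.~⇒joined D e x~y))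
      where
      module D = Classification.Dumbbell D
      module D′ = Classification.Dumbbell D′
      module EG = Edges G u≢v
      open Edges H u′≢v′ using (joined⇒~; edges)
      fu : f u ≡ u′
      fu = L.∷-injectiveˡ eq
      fv : f v ≡ v′
      fv = L.∷-injectiveˡ (L.∷-injectiveʳ eq)
      tails : map f (D.xs ++ D.ys ++ D.zs) ≡ D′.xs ++ D′.ys ++ D′.zs
      tails = L.∷-injectiveʳ (L.∷-injectiveʳ eq)
      s₁ = ++-split (map f D.xs) D′.xs (trans (L.length-map f D.xs) lx) (trans (sym (L.map-++ f D.xs (D.ys ++ D.zs))) tails)
      s₂ = ++-split (map f D.ys) D′.ys (trans (L.length-map f D.ys) ly) (trans (sym (L.map-++ f D.ys D.zs)) (proj₂ s₁))
      walk : ∀ {a b a′ b′ xs xs′} → f a ≡ a′ → f b ≡ b′ → map f xs ≡ xs′ → map (both f) (pairs a xs b) ≡ pairs a′ xs′ b′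
      walk {a} {b} {xs = xs} refl refl refl = pairs-map f a xs b
      images : map (both f) (EG.edges D e) ≡ edges D′ e′
      images = trans (L.map-++ (both f) (pairs u D.xs u) _) (cong₂ _++_ (walk fu fu (proj₁ s₁))
        (trans (L.map-++ (both f) (pairs u D.ys v) _) (cong₂ _++_ (walk fu fv (proj₁ s₂)) (walk fv fv (proj₂ s₂)))))
      image : ∀ {x y} → (x , y) ∈ EG.edges D e → (f x , f y) ∈ edges D′ e′
      image h = subst (_ ∈_) images (∈-map⁺ (both f) h)

  module _ {m n : ℕ} {G : Graph m} {H : Graph n} {u v : Fin m} {u′ v′ : Fin n} {u≢v : u ≢ v} {u′≢v′ : u′ ≢ v′} where
    private
      module G = Graph G
      module H = Graph H
    open Classification.Dumbbell using (xs; ys; zs; rest)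

    dumbbell-≅ : (D : Classification.Dumbbell G u≢v) (D′ : Classification.Dumbbell H u′≢v′) (e : rest D ≡ []) (e′ : rest D′ ≡ []) →
      length (xs D) ≡ length (xs D′) → length (ys D) ≡ length (ys D′) → length (zs D) ≡ length (zs D′) → G ≅ H
    dumbbell-≅ D D′ e e′ lx ly lz = permutation f g (inverse map-g map-f complete′) (inverse map-f map-g complete) ,
      λ i j → mk⇔ (dumbbell-map D D′ e e′ lx ly f map-f)
        λ h → subst₂ G._~_ (inverse map-f map-g complete i) (inverse map-f map-g complete j) (dumbbell-map D′ D e′ e (sym lx) (sym ly) g map-g h)
      where
      module D = Classification.Dumbbell D
      module D′ = Classification.Dumbbell D′
      L₁ = u ∷ v ∷ D.xs ++ D.ys ++ D.zs
      L₂ = u′ ∷ v′ ∷ D′.xs ++ D′.ys ++ D′.zs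
      lengths : length L₁ ≡ length L₂
      lengths = cong (λ k → suc (suc k)) (trans (L.length-++ D.xs) (trans (cong₂ ℕ._+_ lx (trans (L.length-++ D.ys)
        (trans (cong₂ ℕ._+_ ly lz) (sym (L.length-++ D′.ys))))) (sym (L.length-++ D′.xs))))
      list₁ : allFin m ↭ L₁
      list₁ = ShapeValues.Degrees.list G u≢v D e
      list₂ : allFin n ↭ L₂
      list₂ = ShapeValues.Degrees.list H u′≢v′ D′ e′
      f : Fin m → Fin n
      f = assoc L₁ L₂ u′
      g : Fin n → Fin m
      g = assoc L₂ L₁ u
      map-f : map f L₁ ≡ L₂
      map-f = map-assoc L₁ L₂ u′ (Walks.Unique-resp-↭ G list₁ (allFin⁺ m)) lengths
      map-g : map g L₂ ≡ L₁
      map-g = map-assoc L₂ L₁ u (Walks.Unique-resp-↭ H list₂ (allFin⁺ n)) (sym lengths)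
      complete : ∀ x → x ∈ L₁
      complete x = ∈-resp-↭ list₁ (∈-allFin x)
      complete′ : ∀ x → x ∈ L₂
      complete′ x = ∈-resp-↭ list₂ (∈-allFin x)
      inverse : ∀ {V W : Set} {f : V → W} {g : W → V} {l l′} → map f l ≡ l′ → map g l′ ≡ l → (∀ x → x ∈ l) → ∀ x → g (f x) ≡ x
      inverse {f = f} {g} {l} p q c x = map-fixed (λ z → g (f z)) l (trans (L.map-∘ l) (trans (cong (map g) p) q)) (c x)

module DumbbellGraph where

  open import Defs
  open import Data.Fin.Base as Fin using (Fin; zero; suc; toℕ; fromℕ; fromℕ<; inject₁; splitAt; _↑ˡ_; _↑ʳ_)
  import Data.Fin.Properties as Fin
  open import Data.List.Base using (List; []; _∷_; _++_; map; allFin; tabulate)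
  import Data.List.Properties as L
  open import Data.List.Membership.Propositional.Properties using (∈-++⁺ˡ; ∈-++⁺ʳ; ∈-allFin; ∈-map⁺; ∈-map⁻; ∈-tabulate⁺; ∈-tabulate⁻)
  open import Data.List.Relation.Binary.Permutation.Propositional using (_↭_; ↭-trans; prep; swap; refl; ↭-reflexive)
  open import Data.List.Relation.Binary.Permutation.Propositional.Properties using (map⁺; ++⁺; ++⁺ˡ; ++⁺ʳ; shift)
  open import Data.List.Relation.Unary.All using ([]; _∷_)
  open import Data.List.Relation.Unary.Unique.Propositional using (Unique)
  open import Data.List.Relation.Unary.AllPairs using ([]; _∷_)
  import Data.List.Relation.Unary.Unique.Propositional.Properties as Unique
  open import Data.Nat.Base as ℕ using (ℕ; zero; suc; z≤n; s≤s; _≤_; _<_; _+_)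
  open import Function.Base using (_∘_; id)

  -- The vertex i of a path or cycle, with zero in place of every i out of range.
  vertex : ∀ {n} → ℕ → Fin (suc n)
  vertex {n} i with i ℕ.<? suc n
  ... | yes i<n = fromℕ< i<n
  ... | no _    = zero

  toℕ-vertex : ∀ {n i} → i ≤ n → toℕ (vertex {n} i) ≡ i
  toℕ-vertex {n} {i} i≤n with i ℕ.<? suc n
  ... | yes i<n = Fin.toℕ-fromℕ< i<n
  ... | no i≮n  = contradiction (s≤s i≤n) i≮n

  vertex-toℕ : ∀ {n} (i : Fin (suc n)) → vertex (toℕ i) ≡ i
  vertex-toℕ i = Fin.toℕ-injective (toℕ-vertex (ℕ.≤-pred (Fin.toℕ<n i)))

  vertex-end : ∀ {n} → vertex {n} (suc n) ≡ zero
  vertex-end {n} with suc n ℕ.<? suc n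
  ... | yes n<n = contradiction n<n (ℕ.<-irrefl refl)
  ... | no _    = refl

  seg-tabulate : ∀ {n} (G : Graph n) m (f : ℕ → Fin n) →
    (∀ i → i < m → Walks.Nbr2 G (f (suc i)) (f i) (f (suc (suc i)))) → Graph._~_ G (f m) (f (suc m)) →
    Walks.Seg G (f (suc m)) (f 0) (tabulate {n = m} (f ∘ suc ∘ toℕ))
  seg-tabulate G zero          f h e = Walks.[] e
  seg-tabulate G (suc zero)    f h e = h 0 (s≤s z≤n) Walks.∷ Walks.[] e
  seg-tabulate G (suc (suc m)) f h e = h 0 (s≤s z≤n) Walks.∷ seg-tabulate G (suc m) (f ∘ suc) (λ i i<m → h (suc i) (s≤s i<m)) e

  module _ (k : ℕ) where
    private
      m p : ℕ
      m = suc (suc k)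
      p = suc m
      at : ℕ → Fin p
      at = vertex
      open Graph (C p)

      C-nbr2 : ∀ i → i < m → Walks.Nbr2 (C p) (at (suc i)) (at i) (at (suc (suc i)))
      C-nbr2 i i<m = from (ℕ.m≤n⇒m<n∨m≡n i<m)
        where
        tᵢ : toℕ (at i) ≡ i
        tᵢ = toℕ-vertex (ℕ.<⇒≤ i<m)
        tₛ : toℕ (at (suc i)) ≡ suc i
        tₛ = toℕ-vertex i<m
        x~a : at (suc i) ~ at i
        x~a = (λ eq → ℕ.1+n≢n (trans (sym tₛ) (trans (cong toℕ eq) tᵢ))) , inj₂ (inj₁ (trans tₛ (cong suc (sym tᵢ))))
        pred-case : ∀ {y b} → toℕ (at (suc i)) ≡ suc (toℕ y) → y ≡ at i ⊎ y ≡ b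
        pred-case eq = inj₁ (Fin.toℕ-injective (trans (ℕ.suc-injective (trans (sym eq) tₛ)) (sym tᵢ)))
        from : suc i < m ⊎ suc i ≡ m → Walks.Nbr2 (C p) (at (suc i)) (at i) (at (suc (suc i)))
        from (inj₁ i+1<m) = Walks.nbr2 (λ eq → ℕ.m≢1+n+m i {1} (trans (sym tᵢ) (trans (cong toℕ eq) t₂))) x~a
            ((λ eq → ℕ.1+n≢n (sym (trans (sym tₛ) (trans (cong toℕ eq) t₂)))) , inj₁ (inj₁ (trans t₂ (cong suc (sym tₛ)))))
            λ { (_ , inj₁ (inj₁ eq)) → inj₂ (Fin.toℕ-injective (trans eq (trans (cong suc tₛ) (sym t₂))))
              ; (_ , inj₁ (inj₂ (_ , eq))) → contradiction (trans (sym tₛ) (ℕ.suc-injective eq)) (ℕ.<⇒≢ i+1<m)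
              ; (_ , inj₂ (inj₁ eq)) → pred-case eq
              ; (_ , inj₂ (inj₂ (eq , _))) → contradiction (trans (sym tₛ) eq) λ () }
          where
          t₂ : toℕ (at (suc (suc i))) ≡ suc (suc i)
          t₂ = toℕ-vertex i+1<m
        from (inj₂ eqₘ) = Walks.nbr2 (λ eq → i≢0 (trans (sym tᵢ) (trans (cong toℕ eq) (cong toℕ at-end)))) x~a
            ((λ eq → ℕ.1+n≢0 (trans (sym tₛ) (trans (cong toℕ eq) (cong toℕ at-end)))) , inj₁ (inj₂ (cong toℕ at-end , cong suc (trans tₛ eqₘ))))
            λ { {y} (_ , inj₁ (inj₁ eq)) → contradiction (subst (_< p) (trans eq (cong suc (trans tₛ eqₘ))) (Fin.toℕ<n y)) (ℕ.<-irrefl refl)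
              ; (_ , inj₁ (inj₂ (eq , _))) → inj₂ (trans (Fin.toℕ-injective eq) (sym at-end))
              ; (_ , inj₂ (inj₁ eq)) → pred-case eq
              ; (_ , inj₂ (inj₂ (eq , _))) → contradiction (trans (sym tₛ) eq) λ () }
          where
          at-end : at (suc (suc i)) ≡ zero
          at-end = trans (cong at (cong suc eqₘ)) vertex-end
          i≢0 : i ≢ 0
          i≢0 eq = contradiction (trans (cong suc (sym eq)) eqₘ) λ ()

    cycle-seg : Walks.Seg (C p) zero zero (tabulate suc)
    cycle-seg = subst₂ (λ e l → Walks.Seg (C p) e zero l) vertex-end
      (L.tabulate-cong {n = m} (λ i → vertex-toℕ (suc i)))
      (seg-tabulate (C p) m at C-nbr2 (last-edge , inj₁ (inj₂ (cong toℕ (vertex-end {m}) , cong suc (toℕ-vertex {m} ℕ.≤-refl)))))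
      where
      last-edge : at m ≢ at (suc m)
      last-edge eq with () ← trans (sym (toℕ-vertex {m} ℕ.≤-refl)) (trans (cong toℕ eq) (cong toℕ (vertex-end {m})))

  module _ (k : ℕ) where
    private
      m r : ℕ
      m = suc k
      r = suc m
      at : ℕ → Fin r
      at = vertex
      open Graph (P r)

      P-nbr2 : ∀ i → i < k → Walks.Nbr2 (P r) (at (suc i)) (at i) (at (suc (suc i)))
      P-nbr2 i i<k = Walks.nbr2 (λ eq → ℕ.m≢1+n+m i {1} (trans (sym tᵢ) (trans (cong toℕ eq) t₂)))
          ((λ eq → ℕ.1+n≢n (trans (sym tₛ) (trans (cong toℕ eq) tᵢ))) , inj₂ (trans tₛ (cong suc (sym tᵢ))))
          ((λ eq → ℕ.1+n≢n (sym (trans (sym tₛ) (trans (cong toℕ eq) t₂)))) , inj₁ (trans t₂ (cong suc (sym tₛ))))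
          λ { (_ , inj₁ eq) → inj₂ (Fin.toℕ-injective (trans eq (trans (cong suc tₛ) (sym t₂))))
            ; (_ , inj₂ eq) → inj₁ (Fin.toℕ-injective (trans (ℕ.suc-injective (trans (sym eq) tₛ)) (sym tᵢ))) }
        where
        tᵢ : toℕ (at i) ≡ i
        tᵢ = toℕ-vertex (ℕ.≤-trans (ℕ.<⇒≤ i<k) (ℕ.n≤1+n k))
        tₛ : toℕ (at (suc i)) ≡ suc i
        tₛ = toℕ-vertex (ℕ.≤-trans i<k (ℕ.n≤1+n k))
        t₂ : toℕ (at (suc (suc i))) ≡ suc (suc i)
        t₂ = toℕ-vertex (s≤s i<k)

    path-interior : List (Fin r)
    path-interior = tabulate {n = k} (suc ∘ inject₁)

    path-seg : Walks.Seg (P r) (fromℕ m) zero path-interior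
    path-seg = subst₂ (λ e l → Walks.Seg (P r) e zero l) (Fin.toℕ-injective (trans (toℕ-vertex {m} ℕ.≤-refl) (sym (Fin.toℕ-fromℕ m))))
      (L.tabulate-cong {n = k} (λ i → trans (cong (λ j → at (suc j)) (sym (Fin.toℕ-inject₁ i))) (vertex-toℕ (suc (inject₁ i)))))
      (seg-tabulate (P r) k at P-nbr2 (ends , inj₁ (trans (toℕ-vertex {m} ℕ.≤-refl) (cong suc (sym (toℕ-vertex {m} (ℕ.n≤1+n k)))))))
      where
      ends : at k ≢ at m
      ends eq = ℕ.1+n≢n (trans (sym (toℕ-vertex {m} ℕ.≤-refl)) (trans (cong toℕ (sym eq)) (toℕ-vertex {m} (ℕ.n≤1+n k))))

  module Identify {m n} (G : Graph m) (u : Fin m) (K : Graph (suc n)) where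

    private
      J = identify G u K
      module G = Graph G
      module K = Graph K
      module J = Graph J

    ι₁ : Fin m → Fin (m + n)
    ι₁ i = i ↑ˡ n

    ι₂ : Fin (suc n) → Fin (m + n)
    ι₂ zero    = ι₁ u
    ι₂ (suc k) = m ↑ʳ k

    data View : Fin (m + n) → Set where
      left  : ∀ i → View (ι₁ i)
      right : ∀ k → View (ι₂ (suc k))

    view : ∀ x → View x
    view x = go (splitAt m x) refl
      where
      go : ∀ z → splitAt m x ≡ z → View x
      go (inj₁ i) eq = subst View (Fin.splitAt⁻¹-↑ˡ eq) (left i)
      go (inj₂ k) eq = subst View (Fin.splitAt⁻¹-↑ʳ eq) (right k)

    ι₁-~ : ∀ {x y} → x G.~ y → ι₁ x J.~ ι₁ y
    ι₁-~ {x} {y} h rewrite Fin.splitAt-↑ˡ m x n | Fin.splitAt-↑ˡ m y n = h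

    ι₁-~⁻ : ∀ {x y} → ι₁ x J.~ ι₁ y → x G.~ y
    ι₁-~⁻ {x} {y} h rewrite Fin.splitAt-↑ˡ m x n | Fin.splitAt-↑ˡ m y n = h

    cross-~⁻ : ∀ {x k} → ι₁ x J.~ ι₂ (suc k) → x ≡ u × zero K.~ suc k
    cross-~⁻ {x} {k} h rewrite Fin.splitAt-↑ˡ m x n | Fin.splitAt-↑ʳ m n k = h

    private
      cross-~ : ∀ {k} → zero K.~ suc k → ι₁ u J.~ ι₂ (suc k)
      cross-~ {k} h rewrite Fin.splitAt-↑ˡ m u n | Fin.splitAt-↑ʳ m n k = refl , h

      right-~ : ∀ {k l} → suc k K.~ suc l → ι₂ (suc k) J.~ ι₂ (suc l)
      right-~ {k} {l} h rewrite Fin.splitAt-↑ʳ m n k | Fin.splitAt-↑ʳ m n l = h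

      right-~⁻ : ∀ {k l} → ι₂ (suc k) J.~ ι₂ (suc l) → suc k K.~ suc l
      right-~⁻ {k} {l} h rewrite Fin.splitAt-↑ʳ m n k | Fin.splitAt-↑ʳ m n l = h

    ι₂-~ : ∀ {x y} → x K.~ y → ι₂ x J.~ ι₂ y
    ι₂-~ {zero}  {zero}  h = contradiction h K.~-irr
    ι₂-~ {zero}  {suc _} h = cross-~ h
    ι₂-~ {suc _} {zero}  h = J.~-sym (cross-~ (K.~-sym h))
    ι₂-~ {suc _} {suc _} h = right-~ h

    ι₁-injective : ∀ {x y} → ι₁ x ≡ ι₁ y → x ≡ y
    ι₁-injective = Fin.↑ˡ-injective n _ _

    ι₁≢ι₂ : ∀ {x k} → ι₁ x ≢ ι₂ (suc k)
    ι₁≢ι₂ {x} {k} eq with () ← trans (sym (Fin.splitAt-↑ˡ m x n)) (trans (cong (splitAt m) eq) (Fin.splitAt-↑ʳ m n k))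

    ι₂-injective : ∀ {x y} → ι₂ x ≡ ι₂ y → x ≡ y
    ι₂-injective {zero}  {zero}  eq = refl
    ι₂-injective {zero}  {suc _} eq = contradiction eq ι₁≢ι₂
    ι₂-injective {suc _} {zero}  eq = contradiction (sym eq) ι₁≢ι₂
    ι₂-injective {suc _} {suc _} eq = cong suc (Fin.↑ʳ-injective m _ _ eq)

    ι₁-seg : ∀ {b a xs} → u ∉ xs → Walks.Seg G b a xs → Walks.Seg J (ι₁ b) (ι₁ a) (map ι₁ xs)
    ι₁-seg u∉ (Walks.[] h) = Walks.[] (ι₁-~ h)
    ι₁-seg {b} {a} {x ∷ xs} u∉ (Walks.nbr2 a≢c x~a x~c only Walks.∷ σ) =
      subst (Walks.Nbr2 J (ι₁ x) (ι₁ a)) (next-map xs) (Walks.nbr2 (λ eq → a≢c (ι₁-injective eq)) (ι₁-~ x~a) (ι₁-~ x~c) λ {y} h → only′ (view y) h)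
        Walks.∷ ι₁-seg (λ h → u∉ (there h)) σ
      where
      next-map : ∀ xs → ι₁ (Walks.next G xs b) ≡ Walks.next J (map ι₁ xs) (ι₁ b)
      next-map []      = refl
      next-map (_ ∷ _) = refl
      only′ : ∀ {y} → View y → ι₁ x J.~ y → y ≡ ι₁ a ⊎ y ≡ ι₁ (Walks.next G xs b)
      only′ (left i)  h = Sum.map (cong ι₁) (cong ι₁) (only (ι₁-~⁻ h))
      only′ (right k) h = contradiction (here (sym (proj₁ (cross-~⁻ h)))) u∉

    ι₂-seg : ∀ {b a xs} → zero ∉ xs → Walks.Seg K b a xs → Walks.Seg J (ι₂ b) (ι₂ a) (map ι₂ xs)
    ι₂-seg 0∉ (Walks.[] h) = Walks.[] (ι₂-~ h)
    ι₂-seg {xs = zero ∷ xs} 0∉ (_ Walks.∷ _) = contradiction (here refl) 0∉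
    ι₂-seg {b} {a} {suc x ∷ xs} 0∉ (Walks.nbr2 a≢c x~a x~c only Walks.∷ σ) =
      subst (Walks.Nbr2 J (ι₂ (suc x)) (ι₂ a)) (next-map xs) (Walks.nbr2 (λ eq → a≢c (ι₂-injective eq)) (ι₂-~ x~a) (ι₂-~ x~c) λ {y} h → only′ (view y) h)
        Walks.∷ ι₂-seg (λ h → 0∉ (there h)) σ
      where
      next-map : ∀ xs → ι₂ (Walks.next K xs b) ≡ Walks.next J (map ι₂ xs) (ι₂ b)
      next-map []      = refl
      next-map (_ ∷ _) = refl
      only′ : ∀ {y} → View y → ι₂ (suc x) J.~ y → y ≡ ι₂ a ⊎ y ≡ ι₂ (Walks.next K xs b)
      only′ (left i)  h = subst (λ i → ι₁ i ≡ _ ⊎ ι₁ i ≡ _) (sym (proj₁ e)) (Sum.map (cong ι₂) (cong ι₂) (only (K.~-sym (proj₂ e))))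
        where
        e : i ≡ u × zero K.~ suc x
        e = cross-~⁻ (J.~-sym h)
      only′ (right k) h = Sum.map (cong ι₂) (cong ι₂) (only (right-~⁻ h))

    vertices : allFin (m + n) ↭ map ι₁ (allFin m) ++ map ι₂ (tabulate suc)
    vertices = Walks.unique-set-↭ J (Unique.allFin⁺ (m + n))
      (Unique.++⁺ (Unique.map⁺ ι₁-injective (Unique.allFin⁺ m)) (Unique.map⁺ ι₂-injective (Unique.tabulate⁺ Fin.suc-injective))
        λ (z∈ , z∈′) → disjoint (∈-map⁻ ι₁ z∈) (∈-map⁻ ι₂ z∈′))
      (λ {z} _ → in-list (view z)) (λ _ → ∈-allFin _)
      where
      disjoint : ∀ {z} → (∃ λ x → x ∈ allFin m × z ≡ ι₁ x) → ¬ (∃ λ y → y ∈ tabulate suc × z ≡ ι₂ y)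
      disjoint (x , _ , refl) (y , y∈ , eq) with k , refl ← ∈-tabulate⁻ y∈ = ι₁≢ι₂ eq
      in-list : ∀ {z} → View z → z ∈ map ι₁ (allFin m) ++ map ι₂ (tabulate suc)
      in-list (left i)  = ∈-++⁺ˡ (∈-map⁺ ι₁ (∈-allFin i))
      in-list (right k) = ∈-++⁺ʳ (map ι₁ (allFin m)) (∈-map⁺ ι₂ (∈-tabulate⁺ k))

  record IsDumbbell {n} (G : Graph n) : Set where
    field
      {u v}    : Fin n
      u≢v      : u ≢ v
      dumbbell : Classification.Dumbbell G u≢v
      rest≡[]  : Classification.Dumbbell.rest dumbbell ≡ []

  tabulate-last : ∀ {A : Set} n (f : Fin (suc n) → A) → tabulate f ↭ f (fromℕ n) ∷ tabulate (f ∘ inject₁)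
  tabulate-last zero    f = refl
  tabulate-last (suc n) f = ↭-trans (prep (f zero) (tabulate-last n (f ∘ suc))) (swap _ _ refl)

  d-isDumbbell : ∀ p q r (p≥3 : 3 ≤ p) (q≥3 : 3 ≤ q) (r≥2 : 2 ≤ r) → IsDumbbell (d p q r p≥3 q≥3 r≥2)
  d-isDumbbell (suc (suc (suc k))) (suc (suc (suc l))) (suc (suc r′)) (s≤s (s≤s (s≤s _))) (s≤s (s≤s (s≤s _))) (s≤s (s≤s _)) = record
    { u≢v = u≢v
    ; dumbbell = record
      { xs = xs ; ys = ys ; zs = zs ; rest = []
      ; vertices = vertices
      ; segᵤᵤ = I₂.ι₁-seg (λ h → last∉xs (∈-map⁻ I₁.ι₁ h)) (I₁.ι₁-seg {xs = tabulate suc} (zero∉ id) (cycle-seg k))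
      ; segᵤᵥ = I₂.ι₁-seg (λ h → last∉ys (∈-map⁻ I₁.ι₂ h)) (I₁.ι₂-seg {xs = path-interior r′} (zero∉ inject₁) (path-seg r′))
      ; segᵥᵥ = I₂.ι₂-seg {xs = tabulate suc} (zero∉ id) (cycle-seg l)
      ; direct = λ h → cong (λ l → map I₂.ι₁ (map I₁.ι₂ l)) (direct r′ (proj₂ (I₁.cross-~⁻ {zero} {fromℕ r′} (I₂.ι₁-~⁻ {I₁.ι₁ zero} {last} h))))
      ; closed = λ () }
    ; rest≡[] = refl }
    where
    p = suc (suc (suc k))
    module I₁ = Identify (C p) zero (P (suc (suc r′)))
    last = I₁.ι₂ (fromℕ (suc r′))
    module I₂ = Identify (identify (C p) zero (P (suc (suc r′)))) last (C (suc (suc (suc l))))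
    u = I₂.ι₁ (I₁.ι₁ zero)
    v = I₂.ι₁ last
    xs = map I₂.ι₁ (map I₁.ι₁ (tabulate suc))
    ys = map I₂.ι₁ (map I₁.ι₂ (path-interior r′))
    zs = map I₂.ι₂ (tabulate suc)
    u≢v : u ≢ v
    u≢v eq = I₁.ι₁≢ι₂ (I₂.ι₁-injective eq)
    zero∉ : ∀ {m n} (f : Fin n → Fin m) → Fin.zero ∉ tabulate (λ i → Fin.suc (f i))
    zero∉ f h with () ← proj₂ (∈-tabulate⁻ {f = λ i → Fin.suc (f i)} h)
    last∉xs : ¬ (∃ λ x → x ∈ tabulate suc × last ≡ I₁.ι₁ x)
    last∉xs (_ , _ , eq) = I₁.ι₁≢ι₂ (sym eq)
    last∉ys : ¬ (∃ λ y → y ∈ path-interior r′ × last ≡ I₁.ι₂ y)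
    last∉ys (y , y∈ , eq) with i , refl ← ∈-tabulate⁻ {f = λ i → Fin.suc (inject₁ i)} y∈ = Fin.fromℕ≢inject₁ (Fin.suc-injective (I₁.ι₂-injective eq))
    direct : ∀ r′ → Graph._~_ (P (suc (suc r′))) zero (fromℕ (suc r′)) → path-interior r′ ≡ []
    direct zero     _              = refl
    direct (suc r′) (_ , inj₁ ())
    direct (suc r′) (_ , inj₂ ())
    vertices : allFin _ ↭ u ∷ v ∷ xs ++ ys ++ zs ++ []
    vertices = ↭-trans I₂.vertices (↭-trans (++⁺ʳ zs (↭-trans (map⁺ I₂.ι₁ (↭-trans I₁.vertices
        (++⁺ˡ (map I₁.ι₁ (allFin p)) (map⁺ I₁.ι₂ (tabulate-last r′ suc)))))
        (↭-reflexive (L.map-++ I₂.ι₁ (map I₁.ι₁ (allFin p)) (last ∷ map I₁.ι₂ (path-interior r′))))))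
      (↭-trans (prep u (↭-trans (↭-reflexive (L.++-assoc xs (v ∷ ys) zs)) (shift v xs (ys ++ zs))))
        (↭-reflexive (cong (λ l → u ∷ v ∷ xs ++ ys ++ l) (sym (L.++-identityʳ zs))))))

open import Defs using (Graph; _≅_; degree; Q; π; _≈ₚ_; coeff; d)
open import Data.Empty using (⊥; ⊥-elim)
open import Data.Fin.Base using (Fin)
open import Data.Integer.Base as ℤ using (ℤ; 0ℤ; 1ℤ; +_; _+_; _*_; _-_; -_; _^_)
import Data.Integer.Properties as ℤ
open import Data.Integer.Tactic.RingSolver using (solve-∀)
open import Data.List.Base using ([]; length; allFin)
open import Data.List.Relation.Unary.All using (All; [])
open import Data.Nat.Base as ℕ using (ℕ; suc; z≤n; s≤s; _≤_)
open import Data.Nat.ListAction using (sum)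
import Data.Nat.Properties as ℕ
open import Data.Nat.Tactic.RingSolver renaming (solve-∀ to ℕ-solve-∀)
open import Data.Vec.Base using ([])
import Data.Vec.Relation.Unary.All as V
open import Relation.Binary.PropositionalEquality
open import Relation.Binary.Definitions using (tri<; tri≈; tri>)
open HomogeneousEvaluation using (homEval; homEval-≈; homEval-π; length-π; coeff-long; coeff-homEval; ℤ-raw)
open Windows using (win; win-zero; _⊞_; _⊡_)
open ShapeFunctions using (dumbbell; θ; cycles; W)
open DumbbellGraph using (IsDumbbell; d-isDumbbell)

private
  solve-S₂-shape : ∀ Q → Q ≡ + 6 - (+ 2 * + 2 - Q + + 2)
  solve-S₂-shape = solve-∀

  difference-cancel : ∀ x → x + - 1ℤ * x ≡ 0ℤ
  difference-cancel = solve-∀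

  agree-shape : ∀ a b → a - b ≡ a + - 1ℤ * b
  agree-shape = solve-∀

  F-zero-shape : ∀ y → 1ℤ * (1ℤ + 0ℤ * y) ≡ 1ℤ
  F-zero-shape = solve-∀

  F : ∀ {n} → Graph n → ℤ → ℤ
  F {n} G s = ListPermanent.perm (WalkPermanent.ℤ-isCSR G) (WalkPermanent.M G s) (allFin n) (allFin n)

  homEval≡F : ∀ {n} (G : Graph n) s → homEval (1ℤ - + 2 * s - s * s) (- s) n (π (Q G)) ≡ F G s
  homEval≡F {n} G s = trans (homEval-π (Q G) (1ℤ - + 2 * s - s * s) (- s)) (PermanentOfList.per≡perm ℤ-raw (WalkPermanent.ℤ-isCSR G) (WalkPermanent.M G s))

  F-zero : ∀ {n} (G : Graph n) → F G 0ℤ ≡ 1ℤ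
  F-zero G with e , _ , win h ← DegreeMoments.degree-window G = trans (proj₂ (h 0ℤ)) (F-zero-shape (DegreeMoments.S₁ G + 0ℤ * (e + 0ℤ * proj₁ (h 0ℤ))))

  leading : ∀ {n} (G : Graph n) → coeff (π (Q G)) n ≡ 1ℤ
  leading {n} G = trans (sym (coeff-homEval n (π (Q G)))) (trans (homEval≡F G 0ℤ) (F-zero G))

  same-order : ∀ {m n} (H : Graph m) (G : Graph n) → π (Q H) ≈ₚ π (Q G) → m ≡ n
  same-order {m} {n} H G eq with ℕ.<-cmp m n
  ... | tri≈ _ m≡n _ = m≡n
  ... | tri< m<n _ _ = contradiction (trans (sym (leading G)) (trans (sym (eq n)) (coeff-long (π (Q H)) (ℕ.≤-trans (length-π (Q H)) m<n)))) λ ()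
  ... | tri> _ _ n<m = contradiction (trans (sym (leading H)) (trans (eq m) (coeff-long (π (Q G)) (ℕ.≤-trans (length-π (Q G)) n<m)))) λ ()

  same-values : ∀ {n} (H G : Graph n) → π (Q H) ≈ₚ π (Q G) → ∀ s → F H s ≡ F G s
  same-values {n} H G eq s = trans (sym (homEval≡F H s))
    (trans (homEval-≈ (1ℤ - + 2 * s - s * s) (- s) n {π (Q H)} {π (Q G)} eq) (homEval≡F G s))

  same-degrees : ∀ {n} (H G : Graph n) → (∀ s → F H s ≡ F G s) → DegreeMoments.S₁ G ≡ + 2 × DegreeMoments.S₂ G ≡ + 2 → DegreeMoments.S₁ H ≡ + 2 × DegreeMoments.S₂ H ≡ + 2
  same-degrees H G eq (g₁ , g₂) = h₁ , h₂
    where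
    wH = DegreeMoments.degree-window H
    wG = DegreeMoments.degree-window G
    difference = win-zero (λ s → trans (cong (λ t → F H s + - 1ℤ * t) (sym (eq s))) (difference-cancel (F H s)))
      (proj₂ (proj₂ wH) ⊞ (- 1ℤ ⊡ proj₂ (proj₂ wG)))
    agree : ∀ {a b} → a + - 1ℤ * b ≡ 0ℤ → a ≡ b
    agree {a} {b} e = ℤ.i-j≡0⇒i≡j a b (trans (agree-shape a b) e)
    s₁ : DegreeMoments.S₁ H ≡ DegreeMoments.S₁ G
    s₁ = agree (V.head (V.tail difference))
    e₂ : proj₁ wH ≡ proj₁ wG
    e₂ = agree (V.head (V.tail (V.tail difference)))
    h₁ : DegreeMoments.S₁ H ≡ + 2
    h₁ = trans s₁ g₁
    h₂ : DegreeMoments.S₂ H ≡ + 2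
    h₂ = trans (solve-S₂ (DegreeMoments.S₁ H) (DegreeMoments.S₂ H) (proj₁ wH) h₁ (proj₁ (proj₂ wH)))
      (trans (cong (λ e → + 6 - + 2 * e) e₂) (trans (sym (solve-S₂ (DegreeMoments.S₁ G) (DegreeMoments.S₂ G) (proj₁ wG) g₁ (proj₁ (proj₂ wG)))) g₂))
      where
      solve-S₂ : ∀ S Q e → S ≡ + 2 → + 2 * e ≡ S * S - Q + S → Q ≡ + 6 - + 2 * e
      solve-S₂ S Q e refl eq = trans (solve-S₂-shape Q) (cong (λ t → + 6 - t) (sym eq))

  θ-swap₁₂-shape : ∀ x y z t C A B D p q r →
    x - y * (A + B + D) + z * (A * B + A * D + B * D) - t * (A * B * D) + + 2 * (C * (p * (1ℤ - D) + q * (1ℤ - B) + r * (1ℤ - A))) ≡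
    x - y * (B + A + D) + z * (B * A + B * D + A * D) - t * (B * A * D) + + 2 * (C * (p * (1ℤ - D) + r * (1ℤ - A) + q * (1ℤ - B)))
  θ-swap₁₂-shape = solve-∀

θ-swap₁₂ : ∀ a b c s → θ a b c s ≡ θ b a c s
θ-swap₁₂ a b c s = trans (cong (λ t → rest + + 2 * (C * (t * (1ℤ - W c s) + s ^ (a ℕ.+ c) * (1ℤ - W b s) + s ^ (b ℕ.+ c) * (1ℤ - W a s))))
    (cong (s ^_) (ℕ.+-comm a b)))
  (θ-swap₁₂-shape (x₀ s * x₀ s) (y₀ s * y₀ s) ((1ℤ - s) * (1ℤ - s)) ((+ 2 - s + s * s) * (+ 2 - s + s * s)) C
    (W a s) (W b s) (W c s) (s ^ (b ℕ.+ a)) (s ^ (a ℕ.+ c)) (s ^ (b ℕ.+ c)))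
  where
  open ShapeFunctions using (x₀; y₀)
  C = (1ℤ + s * s) * (1ℤ + s * s)
  rest = x₀ s * x₀ s - y₀ s * y₀ s * (W a s + W b s + W c s)
    + (1ℤ - s) * (1ℤ - s) * (W a s * W b s + W a s * W c s + W b s * W c s)
    - (+ 2 - s + s * s) * (+ 2 - s + s * s) * (W a s * W b s * W c s)

private
  θ-swap₂₃-shape : ∀ x y z t C A B D p q r →
    x - y * (A + B + D) + z * (A * B + A * D + B * D) - t * (A * B * D) + + 2 * (C * (p * (1ℤ - D) + q * (1ℤ - B) + r * (1ℤ - A))) ≡
    x - y * (A + D + B) + z * (A * D + A * B + D * B) - t * (A * D * B) + + 2 * (C * (q * (1ℤ - B) + p * (1ℤ - D) + r * (1ℤ - A)))
  θ-swap₂₃-shape = solve-∀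

θ-swap₂₃ : ∀ a b c s → θ a b c s ≡ θ a c b s
θ-swap₂₃ a b c s = trans (cong (λ t → rest + + 2 * (C * (s ^ (a ℕ.+ b) * (1ℤ - W c s) + s ^ (a ℕ.+ c) * (1ℤ - W b s) + t * (1ℤ - W a s))))
    (cong (s ^_) (ℕ.+-comm b c)))
  (θ-swap₂₃-shape (x₀ s * x₀ s) (y₀ s * y₀ s) ((1ℤ - s) * (1ℤ - s)) ((+ 2 - s + s * s) * (+ 2 - s + s * s)) C
    (W a s) (W b s) (W c s) (s ^ (a ℕ.+ b)) (s ^ (a ℕ.+ c)) (s ^ (c ℕ.+ b)))
  where
  open ShapeFunctions using (x₀; y₀)
  C = (1ℤ + s * s) * (1ℤ + s * s)
  rest = x₀ s * x₀ s - y₀ s * y₀ s * (W a s + W b s + W c s)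
    + (1ℤ - s) * (1ℤ - s) * (W a s * W b s + W a s * W c s + W b s * W c s)
    - (+ 2 - s + s * s) * (+ 2 - s + s * s) * (W a s * W b s * W c s)

private
  unordered-theta-impossible-shape : ∀ a c b → a ℕ.+ c ℕ.+ b ≡ a ℕ.+ b ℕ.+ c
  unordered-theta-impossible-shape = ℕ-solve-∀

-- θ a b c is symmetric, so the lengths may be assumed to increase.
unordered-theta-impossible : ∀ {p q e a b c ks} → 3 ≤ p → p ≤ q → 1 ≤ e → 1 ≤ a → 1 ≤ b → 1 ≤ c → 3 ≤ a ℕ.+ b → 3 ≤ a ℕ.+ c → 3 ≤ b ℕ.+ c →
  All (3 ≤_) ks → (∀ s → dumbbell p q e s ≡ θ a b c s * cycles ks s) → a ℕ.+ b ℕ.+ c ℕ.+ sum ks ≡ p ℕ.+ q ℕ.+ e → ⊥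
unordered-theta-impossible {p} {q} {e} {a₀} {b₀} {c₀} {ks} 3≤p p≤q 1≤e 1≤a 1≤b 1≤c ab ac bc 3≤ks = bubble₁ {a₀} {b₀} {c₀} 1≤a 1≤b 1≤c ab ac bc
  where
  T : ℕ → ℕ → ℕ → Set
  T a b c = (∀ s → dumbbell p q e s ≡ θ a b c s * cycles ks s) → a ℕ.+ b ℕ.+ c ℕ.+ sum ks ≡ p ℕ.+ q ℕ.+ e → ⊥
  swap₁₂ : ∀ {a b c} → T b a c → T a b c
  swap₁₂ {a} {b} {c} t H eq = t (λ s → trans (H s) (cong (_* cycles ks s) (θ-swap₁₂ a b c s))) (trans (cong (λ n → n ℕ.+ c ℕ.+ sum ks) (ℕ.+-comm b a)) eq)
  swap₂₃ : ∀ {a b c} → T a c b → T a b c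
  swap₂₃ {a} {b} {c} t H eq = t (λ s → trans (H s) (cong (_* cycles ks s) (θ-swap₂₃ a b c s))) (trans (cong (ℕ._+ sum ks) (unordered-theta-impossible-shape a c b)) eq)
  comm : ∀ {a b} → 3 ≤ a ℕ.+ b → 3 ≤ b ℕ.+ a
  comm {a} {b} = subst (3 ≤_) (ℕ.+-comm a b)
  sorted : ∀ {a b c} → 1 ≤ a → 3 ≤ a ℕ.+ b → a ≤ b → b ≤ c → T a b c
  sorted {a} {b} {c} 1≤a ab a≤b b≤c = ThetaComparison.theta-impossible {p} {q} {e} {a} {b} {c} {ks} 3≤p p≤q 1≤e 1≤a a≤b b≤c ab 3≤ks
  bubble₃ : ∀ {a b c} → 1 ≤ a → 1 ≤ b → 3 ≤ a ℕ.+ b → a ≤ c → b ≤ c → T a b c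
  bubble₃ {a} {b} {c} 1≤a 1≤b ab a≤c b≤c with ℕ.≤-total a b
  ... | inj₁ a≤b = sorted {a} {b} {c} 1≤a ab a≤b b≤c
  ... | inj₂ b≤a = swap₁₂ {a} {b} {c} (sorted {b} {a} {c} 1≤b (comm {a} ab) b≤a a≤c)
  bubble₂ : ∀ {a b c} → 1 ≤ a → 1 ≤ b → 1 ≤ c → 3 ≤ a ℕ.+ b → 3 ≤ a ℕ.+ c → a ≤ b → T a b c
  bubble₂ {a} {b} {c} 1≤a 1≤b 1≤c ab ac a≤b with ℕ.≤-total b c
  ... | inj₁ b≤c = bubble₃ {a} {b} {c} 1≤a 1≤b ab (ℕ.≤-trans a≤b b≤c) b≤c
  ... | inj₂ c≤b = swap₂₃ {a} {b} {c} (bubble₃ {a} {c} {b} 1≤a 1≤c ac a≤b c≤b)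
  bubble₁ : ∀ {a b c} → 1 ≤ a → 1 ≤ b → 1 ≤ c → 3 ≤ a ℕ.+ b → 3 ≤ a ℕ.+ c → 3 ≤ b ℕ.+ c → T a b c
  bubble₁ {a} {b} {c} 1≤a 1≤b 1≤c ab ac bc with ℕ.≤-total a b
  ... | inj₁ a≤b = bubble₂ {a} {b} {c} 1≤a 1≤b 1≤c ab ac a≤b
  ... | inj₂ b≤a = swap₁₂ {a} {b} {c} (bubble₂ {b} {a} {c} 1≤b 1≤a 1≤c (comm {a} ab) bc b≤a)

record Branching {n} (G : Graph n) (u v : Fin n) : Set where
  field
    u≢v          : u ≢ v
    degree-u     : degree G u ≡ 3
    degree-v     : degree G v ≡ 3
    degree-other : ∀ z → z ≢ u → z ≢ v → degree G z ≡ 2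

record Oriented {n} (G : Graph n) : Set where
  field
    {u v}     : Fin n
    branching : Branching G u v
  open Branching branching public
  field
    structure : Classification.Dumbbell G u≢v
  open Classification.Dumbbell structure public
  field
    ordered   : length xs ≤ length zs
  value : ShapeValues.DumbbellValue G u≢v degree-u degree-v degree-other structure
  value = ShapeValues.dumbbell-value G u≢v degree-u degree-v degree-other structure

orient : ∀ {n} {G : Graph n} {u v} (B : Branching G u v) (D : Classification.Dumbbell G (Branching.u≢v B)) →
         ∃ λ (O : Oriented G) → Oriented.rest O ≡ Classification.Dumbbell.rest D
orient {G = G} B D = from (ℕ.≤-total (length D.xs) (length D.zs))
  where
  module D = Classification.Dumbbell D
  module B = Branching B
  from : length D.xs ≤ length D.zs ⊎ length D.zs ≤ length D.xs → ∃ λ (O : Oriented G) → Oriented.rest O ≡ D.rest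
  from (inj₁ le) = record { branching = B ; structure = D ; ordered = le } , refl
  from (inj₂ le) = record
    { branching = record { u≢v = λ eq → B.u≢v (sym eq) ; degree-u = B.degree-v ; degree-v = B.degree-u
                         ; degree-other = λ z z≢v z≢u → B.degree-other z z≢u z≢v }
    ; structure = ShapeValues.flip G B.u≢v D ; ordered = le } , refl

dumbbell-determined : ∀ {n} (H G : Graph n) → IsDumbbell G → (∀ s → F H s ≡ F G s) → H ≅ G
dumbbell-determined {n} H G isD eq = from (DegreeMoments.dumbbell-degrees H (proj₁ degrees) (proj₂ degrees))
  where
  module D₀ = IsDumbbell isD
  module Deg = ShapeValues.Degrees G D₀.u≢v D₀.dumbbell D₀.rest≡[]
  oriented = orient (record { u≢v = D₀.u≢v ; degree-u = Deg.degree-u ; degree-v = Deg.degree-v ; degree-other = Deg.degree-other }) D₀.dumbbell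
  module O = Oriented (proj₁ oriented)
  no-rest : O.rest ≡ []
  no-rest = trans (proj₂ oriented) D₀.rest≡[]
  degrees : DegreeMoments.S₁ H ≡ + 2 × DegreeMoments.S₂ H ≡ + 2
  degrees = same-degrees H G eq (DegreeMoments.dumbbell-degrees⇒ G (D₀.u , D₀.v , D₀.u≢v , Deg.degree-u , Deg.degree-v , Deg.degree-other))
  module VG = ShapeValues.DumbbellValue O.value
  p = suc (length O.xs)
  q = suc (length O.zs)
  e = suc (length O.ys)
  3≤p : 3 ≤ p
  3≤p = s≤s (ShapeValues.seg-length G O.segᵤᵤ)
  p≤q : p ≤ q
  p≤q = s≤s O.ordered
  value-G : ∀ s → let c = 1ℤ + s * s in c * (c * c) * F G s ≡ dumbbell p q e s
  value-G s = trans (VG.value s) (trans (cong (λ l → dumbbell p q e s * cycles l s) (VG.full no-rest)) (ℤ.*-identityʳ (dumbbell p q e s)))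
  size-G : p ℕ.+ q ℕ.+ e ≡ suc n
  size-G = trans (sym (ℕ.+-identityʳ (p ℕ.+ q ℕ.+ e))) (trans (cong (λ l → p ℕ.+ q ℕ.+ e ℕ.+ sum l) (sym (VG.full no-rest))) VG.size)
  value-H : ∀ {f : ℤ → ℤ} → (∀ s → let c = 1ℤ + s * s in c * (c * c) * F H s ≡ f s) → ∀ s → dumbbell p q e s ≡ f s
  value-H h s = trans (sym (value-G s)) (trans (cong (λ t → let c = 1ℤ + s * s in c * (c * c) * t) (sym (eq s))) (h s))
  from : DegreeMoments.Dumbbell-degrees H → H ≅ G
  from (u , v , u≢v , du , dv , d2) = compare (Classification.classification H u≢v du dv d2)
    where
    from-dumbbell : Classification.Dumbbell H u≢v → H ≅ G
    from-dumbbell D = Isomorphism.dumbbell-≅ O′.structure O.structure (VH.empty (proj₁ unique)) no-rest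
        (ℕ.suc-injective (sym (proj₁ (proj₂ unique)))) (ℕ.suc-injective (sym (proj₂ (proj₂ (proj₂ unique))))) (ℕ.suc-injective (sym (proj₁ (proj₂ (proj₂ unique)))))
      where
      oriented′ = orient (record { u≢v = u≢v ; degree-u = du ; degree-v = dv ; degree-other = d2 }) D
      module O′ = Oriented (proj₁ oriented′)
      module VH = ShapeValues.DumbbellValue O′.value
      unique = DumbbellComparison.dumbbell-unique {p} {q} {e} {suc (length O′.xs)} {suc (length O′.zs)} {suc (length O′.ys)} {VH.ks} 3≤p p≤q (s≤s z≤n) (s≤s (ShapeValues.seg-length H O′.segᵤᵤ)) (s≤s O′.ordered) (s≤s z≤n) VH.3≤ks
        (value-H {λ s → dumbbell (suc (length O′.xs)) (suc (length O′.zs)) (suc (length O′.ys)) s * cycles VH.ks s} VH.value) (trans size-G (sym VH.size))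
    from-theta : Classification.Theta H u≢v → H ≅ G
    from-theta T = ⊥-elim (unordered-theta-impossible {p} {q} {e} {2 ℕ.+ length T.xs} {2 ℕ.+ length T.ys} {suc (length T.zs)} {VT.ks} 3≤p p≤q (s≤s z≤n) (s≤s z≤n) (s≤s z≤n) (s≤s z≤n)
        (large (length T.xs) (suc (length T.ys))) (large (length T.xs) (length T.zs)) (large (length T.ys) (length T.zs)) VT.3≤ks
        (value-H {λ s → θ (2 ℕ.+ length T.xs) (2 ℕ.+ length T.ys) (suc (length T.zs)) s * cycles VT.ks s} VT.value) (trans VT.size (sym size-G)))
      where
      module T = Classification.Theta T
      module VT = ShapeValues.ThetaValue (ShapeValues.theta-value H u≢v du dv d2 T)
      large : ∀ i j → 3 ≤ 2 ℕ.+ i ℕ.+ suc j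
      large i j = s≤s (s≤s (ℕ.≤-trans (s≤s z≤n) (ℕ.m≤n+m (suc j) i)))
    compare : Classification.Dumbbell H u≢v ⊎ Classification.Theta H u≢v → H ≅ G
    compare (inj₁ D) = from-dumbbell D
    compare (inj₂ T) = from-theta T

theorem1p3 : ∀ (p q r : ℕ) (p≥3 : 3 ≤ p) (q≥3 : 3 ≤ q) (r≥2 : 2 ≤ r) →
    ∀ (m : ℕ) (H : Graph m) →
    π (Q H) ≈ₚ π (Q (d p q r p≥3 q≥3 r≥2)) →
    H ≅ d p q r p≥3 q≥3 r≥2
theorem1p3 p q r p≥3 q≥3 r≥2 m H eq = determined (same-order H G eq) H eq
  where
  G = d p q r p≥3 q≥3 r≥2
  determined : ∀ {m} → m ≡ p ℕ.+ ℕ.pred r ℕ.+ ℕ.pred q → (H : Graph m) → π (Q H) ≈ₚ π (Q G) → H ≅ G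
  determined refl H eq = dumbbell-determined H G (d-isDumbbell p q r p≥3 q≥3 r≥2) (same-values H G eq)
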